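{- Let $\mathcal{M}$ be a loopless oriented matroid of rank $r\ge0$ on $E$, $\chi$ a chirotope of $\mathcal{M}$, $P$ a tope of $\mathcal{M}$, and $R$ a unital commutative ring. Define $\Omega(P,\chi):=\sum_{B\in\Delta}({}_P\chi)(B)\,e_B\in\mathrm{OS}^r_R(\mathrm{M})$ for a triangulation $\Delta$ of ${}_P\mathcal{M}$. Then $\Omega(P,\chi)$ does not depend on the choice of triangulation of ${}_P\mathcal{M}$, and it satisfies the characterizing recursion: (i) if $r=0$, then $\Omega(P,\chi)=\chi(\emptyset)\cdot1\in\mathrm{OS}^0_R(\mathrm{M})$; (ii) if $r>0$, then for every atom $a$ of $\mathrm{M}$, $\operatorname{Res}_a\Omega(P,\chi)=\Omega(P/a,\chi/^Pa)$ if $a\in\partial P$, and $\operatorname{Res}_a\Omega(P,\chi)=0$ if $a\notin\partial P$.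
   Context: Oriented matroid conventions are those of Björner–Las Vergnas–Sturmfels–White–Ziegler; $\mathrm{M}$ is the underlying matroid, atoms are rank one flats, $X^-=\{i:X(i)=-\}$. Orlik–Solomon algebra: $\mathrm{OS}^\bullet_R(\mathrm{M})=\bigwedge^\bullet R^{\mathfrak{A}}/\langle \partial e_S : S\subseteq\mathfrak{A}\text{ dependent}\rangle$ ($\mathfrak{A}$ the atoms, $S$ dependent if its rank is less than $|S|$), where $e_S=e_{s_1}\wedge\cdots\wedge e_{s_k}$ and $\partial e_S=\sum_{i=0}^{k-1}(-1)^i e_{S\setminus s_{k-i}}$; for elements of $E$, $e_{(i_1,\dots,i_k)}$ uses the atoms containing the $i_j$, and each basis $B$ is ordered arbitrarily (the product ${}_P\chi(B)e_B$ is independent of ordering). $\operatorname{Res}_a:\mathrm{OS}^\bullet_R(\mathrm{M})\to\mathrm{OS}^{\bullet-1}_R(\mathrm{M}/a)$ sends $e_{(i_1,\dots,i_{k-1},a)}\mapsto e_{(i_1,\dots,i_{k-1})}$ (read in $\mathrm{M}/a$) and $e_I\mapsto0$ if $a\notin I$. Triangulation (Santos): a nonempty collection $\Delta$ of bases such that for any $B,B'\in\Delta$ no signed circuit $C$ has $C^+\subseteq B$, $C^-\subseteq B'$, and for every $B\in\Delta$, $b\in B$, either $B\setminus b$ lies in the zero set of a positive cocircuit or $B\setminus b\subset B'$ for some other $B'\in\Delta$. For a tope $P$, ${}_P\mathcal{M}$ is the reorientation with chirotope ${}_P\chi(B)=(-1)^{|B\cap P^-|}\chi(B)$. An atom $a$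 is a facet of $P$ ($a\in\partial P$) if the sign vector $P_a$ with $P_a(i)=P(i)$ for $i\notin a$, $P_a(i)=0$ for $i\in a$ is a covector; then $P/a:=P|_{E\setminus a}$ is a tope of $\mathcal{M}/a$ and $(\chi/^Pa)(I):=P(i)\chi(I,i)$ (any $i\in a$) is a chirotope of $\mathcal{M}/a$. -}

module Defs where

open import Level using (_⊔_)
open import Data.Nat using (ℕ; zero; suc)
open import Data.Fin using (Fin)
open import Data.Fin.Properties using (any?)
open import Data.Fin.Subset using (Subset; _∈_; _∉_; _⊆_; _∪_; _─_; ⁅_⁆; ∣_∣; ⋃)
  renaming (⊥ to ∅)
open import Data.Fin.Subset.Properties using (anySubset?; _⊆?_; _∈?_)
open import Data.Vec using (Vec; []; _∷_; lookup; _[_]≔_; _∷ʳ_; toList; tabulate)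
import Data.Vec.Properties as VecP
open import Data.Bool using (Bool; true; false; _∧_; not; if_then_else_)
open import Data.Bool.Properties using () renaming (_≟_ to _≟B_)
open import Data.List using (List; []; _∷_; _++_; map; concatMap; length; foldr)
import Data.List.Properties as ListP
open import Data.List.Relation.Unary.All using (All)
import Data.List.Relation.Unary.Any as Any
open import Data.List.Relation.Unary.Unique.Propositional using (Unique)
open import Data.List.Relation.Unary.AllPairs using (AllPairs)
open import Data.List.Membership.Propositional using () renaming (_∈_ to _∈ₗ_)
open import Data.Maybe using (Maybe; just; nothing)
open import Data.Product using (Σ; ∃; _×_; _,_)
open import Data.Sum using (_⊎_)
open import Data.Unit using (⊤)
open import Data.Empty using (⊥)
open import Relation.Nullary using (¬_; Dec; yes; no)
open import Relation.Nullary.Decidable using (⌊_⌋; map′; _×-dec_; ¬?)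
open import Relation.Binary.PropositionalEquality using (_≡_; _≢_; refl)
open import Relation.Binary.Definitions using (DecidableEquality)
open import Algebra.Bundles using (CommutativeRing)

-- Signs and sign vectors.  Ground sets are subsets E of Fin N.

data Sign : Set where
  pos neg zer : Sign

negₛ : Sign → Sign
negₛ pos = neg
negₛ neg = pos
negₛ zer = zer

infixl 7 _*ₛ_
_*ₛ_ : Sign → Sign → Sign
zer *ₛ _ = zer
pos *ₛ s = s
neg *ₛ s = negₛ s

_≟ₛ_ : DecidableEquality Sign
pos ≟ₛ pos = yes refl
pos ≟ₛ neg = no λ ()
pos ≟ₛ zer = no λ ()
neg ≟ₛ pos = no λ ()
neg ≟ₛ neg = yes refl
neg ≟ₛ zer = no λ ()
zer ≟ₛ pos = no λ ()
zer ≟ₛ neg = no λ ()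
zer ≟ₛ zer = yes refl

parity : ℕ → Sign
parity zero = pos
parity (suc k) = negₛ (parity k)

SignVec : ℕ → Set
SignVec N = Fin N → Sign

-- a map E^r → {-1,0,1} (extended by 0 outside E)
Chi : ℕ → ℕ → Set
Chi N r = Vec (Fin N) r → Sign

img : ∀ {N k} → Vec (Fin N) k → Subset N
img [] = ∅
img (x ∷ xs) = ⁅ x ⁆ ∪ img xs

_≟S_ : ∀ {N} → DecidableEquality (Subset N)
_≟S_ = VecP.≡-dec _≟B_

-- Chirotopes (Björner–Las Vergnas–Sturmfels–White–Ziegler, Def. 3.5.3)

swapAt : ∀ {A : Set} {r} → Vec A r → Fin r → Fin r → Vec A r
swapAt x i j = (x [ i ]≔ lookup x j) [ j ]≔ lookup x i

GP : ∀ {N} (r : ℕ) → Chi N r → Set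
GP zero χ = ⊤
GP {N} (suc r) χ = ∀ (x₁ : Fin N) (xs : Vec (Fin N) r) (y : Vec (Fin N) (suc r)) →
  (∀ i → χ (lookup y i ∷ xs) *ₛ χ (y [ i ]≔ x₁) ≢ neg) →
  χ (x₁ ∷ xs) *ₛ χ y ≢ neg

record IsChirotope {N} (E : Subset N) (r : ℕ) (χ : Chi N r) : Set where
  field
    support     : ∀ x → χ x ≢ zer → ∀ k → lookup x k ∈ E
    nonzero     : ∃ λ x → χ x ≢ zer
    alternating : ∀ x i j → i ≢ j → χ (swapAt x i j) ≡ negₛ (χ x)
    exchange    : GP r χ

Indep : ∀ {N r} → Chi N r → Subset N → Set
Indep χ I = ∃ λ x → χ x ≢ zer × I ⊆ img x

RankGe : ∀ {N r} → Chi N r → Subset N → ℕ → Set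
RankGe χ X k = ∃ λ I → Indep χ I × I ⊆ X × ∣ I ∣ ≡ k

Loopless : ∀ {N r} → Subset N → Chi N r → Set
Loopless E χ = ∀ e → e ∈ E → Indep χ ⁅ e ⁆

IsAtom : ∀ {N r} → Subset N → Chi N r → Subset N → Set
IsAtom E χ a = a ⊆ E × RankGe χ a 1 × ¬ RankGe χ a 2 ×
  (∀ e → e ∈ E → e ∉ a → RankGe χ (a ∪ ⁅ e ⁆) 2)

∃Vec? : ∀ {N} k {P : Vec (Fin N) k → Set} → (∀ v → Dec (P v)) → Dec (∃ P)
∃Vec? zero {P} P? with P? []
... | yes p = yes ([] , p)
... | no ¬p = no λ { ([] , p) → ¬p p }
∃Vec? (suc k) {P} P? =
  map′ (λ { (i , xs , p) → (i ∷ xs) , p }) (λ { ((i ∷ xs) , p) → i , xs , p })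
       (any? λ i → ∃Vec? k (λ xs → P? (i ∷ xs)))

Indep? : ∀ {N r} (χ : Chi N r) I → Dec (Indep χ I)
Indep? {r = r} χ I = ∃Vec? r (λ x → ¬? (χ x ≟ₛ zer) ×-dec (I ⊆? img x))

RankGe? : ∀ {N r} (χ : Chi N r) X k → Dec (RankGe χ X k)
RankGe? χ X k = anySubset? (λ I → Indep? χ I ×-dec ((I ⊆? X) ×-dec (∣ I ∣ Data.Nat.≟ k)))

-- { j ∈ E : rank (S ∪ {j}) ≤ 1 }, i.e. the closure of a rank one set S
atomSpan : ∀ {N r} → Subset N → Chi N r → Subset N → Subset N
atomSpan E χ S = tabulate λ j → ⌊ j ∈? E ⌋ ∧ not ⌊ RankGe? χ (S ∪ ⁅ j ⁆) 2 ⌋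

atomOf : ∀ {N r} → Subset N → Chi N r → Fin N → Subset N
atomOf E χ i = atomSpan E χ ⁅ i ⁆

IsCocircuit : ∀ {N} (r : ℕ) → Chi N r → SignVec N → Set
IsCocircuit zero χ Y = ⊥
IsCocircuit {N} (suc r) χ Y = Σ (Vec (Fin N) r) λ x → Σ Sign λ s →
  s ≢ zer × (∃ λ e → χ (x ∷ʳ e) ≢ zer) × (∀ e → Y e ≡ s *ₛ χ (x ∷ʳ e))

zeroV : ∀ {N} → SignVec N
zeroV _ = zer

compose : ∀ {N} → SignVec N → SignVec N → SignVec N
compose X Y e with X e
... | zer = Y e
... | s = s

IsCovector : ∀ {N r} → Chi N r → SignVec N → Set
IsCovector {N} {r} χ X = ∃ λ (Ys : List (SignVec N)) →
  All (IsCocircuit r χ) Ys × (∀ e → X e ≡ foldr compose zeroV Ys e)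

_≼_ : ∀ {N} → SignVec N → SignVec N → Set
X ≼ Y = ∀ e → X e ≢ zer → Y e ≡ X e

IsTope : ∀ {N r} → Chi N r → SignVec N → Set
IsTope χ P = IsCovector χ P × (∀ X → IsCovector χ X → P ≼ X → ∀ e → X e ≡ P e)

Orthogonal : ∀ {N} → SignVec N → SignVec N → Set
Orthogonal X Y = (∀ e → X e *ₛ Y e ≡ zer) ⊎
  ((∃ λ e → X e *ₛ Y e ≡ pos) × (∃ λ f → X f *ₛ Y f ≡ neg))

IsVector : ∀ {N r} → Subset N → Chi N r → SignVec N → Set
IsVector E χ V = (∀ e → V e ≢ zer → e ∈ E) × (∀ X → IsCovector χ X → Orthogonal V X)

IsCircuit : ∀ {N r} → Subset N → Chi N r → SignVec N → Set
IsCircuit E χ C = IsVector E χ C × (∃ λ e → C e ≢ zer) ×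
  (∀ D → IsVector E χ D → (∃ λ e → D e ≢ zer) →
     (∀ e → D e ≢ zer → C e ≢ zer) → ∀ e → C e ≢ zer → D e ≢ zer)

negIf : Sign → Sign
negIf neg = neg
negIf _ = pos

flips : ∀ {N k} → SignVec N → Vec (Fin N) k → Sign
flips P [] = pos
flips P (e ∷ xs) = negIf (P e) *ₛ flips P xs

-- _Pχ (B) = (-1)^{|B ∩ P⁻|} χ(B)
reorient : ∀ {N r} → SignVec N → Chi N r → Chi N r
reorient P χ x = flips P x *ₛ χ x

-- P_a (zero on a);  restricted to E ∖ a this is P/a
zeroOn : ∀ {N} → Subset N → SignVec N → SignVec N
zeroOn a P e = if ⌊ e ∈? a ⌋ then zer else P e

IsFacet : ∀ {N r} → Chi N r → SignVec N → Subset N → Set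
IsFacet χ P a = IsCovector χ (zeroOn a P)

-- chirotope of M/a:  I ↦ χ(I, i)  for i ∈ a
contr : ∀ {N r} → Chi N (suc r) → Fin N → Chi N r
contr χ i I = χ (I ∷ʳ i)

-- χ/^P a : I ↦ P(i) χ(I, i)  for i ∈ a
contrP : ∀ {N r} → SignVec N → Chi N (suc r) → Fin N → Chi N r
contrP P χ i I = P i *ₛ χ (I ∷ʳ i)

-- Triangulations (Santos)

record IsTriangulation {N} (E : Subset N) (r : ℕ) (ψ : Chi N r)
                       (Δ : List (Vec (Fin N) r)) : Set where
  field
    nonempty  : Δ ≢ []
    bases     : All (λ B → ψ B ≢ zer) Δ
    distinct  : AllPairs (λ B B' → img B ≢ img B') Δ
    noCircuit : ∀ B B' → B ∈ₗ Δ → B' ∈ₗ Δ → ∀ C → IsCircuit E ψ C →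
                ¬ ((∀ e → C e ≡ pos → e ∈ img B) × (∀ e → C e ≡ neg → e ∈ img B'))
    facets    : ∀ B → B ∈ₗ Δ → ∀ (j : Fin r) →
                (∃ λ Y → IsCocircuit r ψ Y × (∀ e → Y e ≢ neg) ×
                         (∀ k → k ≢ j → Y (lookup B k) ≡ zer))
                ⊎ (∃ λ B' → B' ∈ₗ Δ × img B' ≢ img B ×
                         (∀ k → k ≢ j → lookup B k ∈ img B'))

-- Orlik–Solomon algebra, as formal R-combinations of words in atoms
-- (elements of the tensor algebra) modulo a two-sided ideal.

Word : ℕ → Set
Word N = List (Subset N)

module _ {c ℓ} (R : CommutativeRing c ℓ) where
  open CommutativeRing R using (Carrier; _≈_; _+_; _*_; -_; 0#; 1#)

  FS : ℕ → Set c
  FS N = List (Carrier × Word N)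

  signR : Sign → Carrier
  signR pos = 1#
  signR neg = - 1#
  signR zer = 0#

  coeff : ∀ {N} → Word N → FS N → Carrier
  coeff w [] = 0#
  coeff w ((d , u) ∷ f) = if ⌊ ListP.≡-dec _≟S_ u w ⌋ then d + coeff w f else coeff w f

  _≈F_ : ∀ {N} → FS N → FS N → Set ℓ
  f ≈F g = ∀ w → coeff w f ≈ coeff w g

  scaleFS : ∀ {N} → Carrier → FS N → FS N
  scaleFS k f = map (λ { (d , u) → (k * d , u) }) f

  sandwich : ∀ {N} → Word N → FS N → Word N → FS N
  sandwich u g v = map (λ { (d , w) → (d , u ++ w ++ v) }) g

  -- ∂ e_S = Σ_{i=0}^{k-1} (-1)^i e_{S ∖ s_{k-i}}
  ∂ : ∀ {N} → Word N → FS N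
  ∂ [] = []
  ∂ (s ∷ w) = (signR (parity (length w)) , w) ∷ map (λ { (d , u) → (d , s ∷ u) }) (∂ w)

  data OSGen {N r} (E : Subset N) (χ : Chi N r) : FS N → Set c where
    sq   : ∀ a → IsAtom E χ a → OSGen E χ ((1# , a ∷ a ∷ []) ∷ [])
    anti : ∀ a b → IsAtom E χ a → IsAtom E χ b →
           OSGen E χ ((1# , a ∷ b ∷ []) ∷ (1# , b ∷ a ∷ []) ∷ [])
    dep  : ∀ S → All (IsAtom E χ) S → Unique S → ¬ RankGe χ (⋃ S) (length S) →
           OSGen E χ (∂ S)

  data InIdeal {N r} (E : Subset N) (χ : Chi N r) : FS N → Set (c ⊔ ℓ) where
    nil  : InIdeal E χ []
    step : ∀ k u g v f → OSGen E χ g → InIdeal E χ f →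
           InIdeal E χ (scaleFS k (sandwich u g v) ++ f)
    resp : ∀ f g → f ≈F g → InIdeal E χ f → InIdeal E χ g

  OSEq : ∀ {N r} (E : Subset N) (χ : Chi N r) → FS N → FS N → Set (c ⊔ ℓ)
  OSEq E χ f g = InIdeal E χ (f ++ scaleFS (- 1#) g)

  Omega : ∀ {N r} → Subset N → Chi N r → SignVec N → List (Vec (Fin N) r) → FS N
  Omega E χ P Δ = map (λ B → (signR (reorient P χ B) , map (atomOf E χ) (toList B))) Δ

  -- Res_a on words: move the (unique) occurrence of a to the end and drop it
  resWord : ∀ {N} → Subset N → Word N → Maybe (Sign × Word N)
  resWord a [] = nothing
  resWord a (b ∷ w) with b ≟S a
  ... | yes _ = if ⌊ Any.any? (_≟S a) w ⌋ then nothing else just (parity (length w) , w)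
  ... | no _ with resWord a w
  ...   | nothing = nothing
  ...   | just (s , w') = just (s , b ∷ w')

  -- Res_a : OS(M) → OS(M/a); M/a given by ground set E' = E ∖ a and chirotope χ'.
  -- Remaining atoms b are read in M/a as their closure there.
  Res : ∀ {N r'} (E' : Subset N) (χ' : Chi N r') → Subset N → FS N → FS N
  Res E' χ' a f = concatMap step' f
    where
    step' : _ → FS _
    step' (d , w) with resWord a w
    ... | nothing = []
    ... | just (s , w') = (signR s * d , map (atomSpan E' χ') w') ∷ []

  Recursion : ∀ {N} (E : Subset N) (r : ℕ) (χ : Chi N r) (P : SignVec N) → Set (c ⊔ ℓ)
  Recursion E zero χ P =
    ∀ Δ → IsTriangulation E zero (reorient P χ) Δ →
      OSEq E χ (Omega E χ P Δ) ((signR (χ []) , []) ∷ [])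
  Recursion E (suc r) χ P =
    ∀ a → IsAtom E χ a →
    ∀ Δ → IsTriangulation E (suc r) (reorient P χ) Δ →
    ∀ i → i ∈ a →
      (IsFacet χ P a →
         ∀ Δ' → IsTriangulation (E ─ a) r (reorient (zeroOn a P) (contrP P χ i)) Δ' →
           OSEq (E ─ a) (contrP P χ i)
                (Res (E ─ a) (contrP P χ i) a (Omega E χ P Δ))
                (Omega (E ─ a) (contrP P χ i) (zeroOn a P) Δ'))
      × (¬ IsFacet χ P a →
           OSEq (E ─ a) (contr χ i) (Res (E ─ a) (contr χ i) a (Omega E χ P Δ)) [])

{-# OPTIONS --safe #-}
module Submission where

-- A chirotope is used through signed basis exchange (the axiom `ex`).  For a triangulation Δ of an
-- acyclic ν and an element a, e_B = Σ_j e_{B[j]≔a} in the Orlik–Solomon algebra, because ∂ e_{a ∪ B} = 0; two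
-- bases of Δ sharing an interior facet contribute opposite terms, so Σ ν(B) e_B becomes a sum over boundary
-- facets.  Those in a given facet hyperplane triangulate the restriction to it, whence the sum does not depend
-- on Δ, by induction on the rank.  That every facet hyperplane and every extreme element is met by Δ is a volume
-- argument: a flag of extreme faces yields a functional on r-tuples that is nonnegative on positive bases.
-- Triangulations exist by pushing (a generic lexicographic height).  Finally Res_a turns Σ ν(B) e_B into the
-- form of the link of a, which triangulates the contraction; if a is not a facet, some w is in no positive
-- cocircuit of the contraction, and the boundary sum with apex w is empty.

open import Defs
open import Level using (_⊔_)
open import Data.Nat using (ℕ; zero; suc)
import Data.Nat as Nat
import Data.Nat.Properties as NatP
open import Data.Fin using (Fin; zero; suc; toℕ; punchIn; punchOut)
import Data.Fin as Fin
import Data.Fin.Properties as FinP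
open import Data.Fin.Properties using (_≟_; any?; all?; pigeonhole)
open import Data.Fin.Induction using (spo-noetherian; spo-wellFounded)
open import Data.Nat.Induction using (<-wellFounded)
open import Data.Fin.Subset using (Subset; _∈_; _∉_; _⊆_; _∪_; _─_; ⁅_⁆; ∣_∣; ⋃)
open import Data.Fin.Subset.Properties as SubP using (_∈?_)
open import Data.Vec using (Vec; []; _∷_; lookup; _[_]≔_; _∷ʳ_; toList; tabulate; removeAt)
import Data.Vec as Vec
import Data.Vec.Properties as VecP
open import Data.Bool using (true; false; if_then_else_; _∧_; not)
open import Data.List using (List; []; _∷_; _++_; length; filter; allFin; cartesianProduct; concatMap)
import Data.List as List
import Data.List.Properties as ListP
open import Data.List.Relation.Unary.All using (All; []; _∷_)
import Data.List.Relation.Unary.All as All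
import Data.List.Relation.Unary.All.Properties as AllP
open import Data.List.Relation.Unary.Any using (here; there)
import Data.List.Relation.Unary.Any as Any
open import Data.List.Relation.Unary.AllPairs using (AllPairs; []; _∷_)
import Data.List.Relation.Unary.AllPairs as AllPairs
open import Data.List.Relation.Unary.Unique.Propositional using (Unique)
import Data.List.Relation.Unary.Unique.Propositional.Properties as UniqueP
open import Data.List.Membership.Propositional using (find) renaming (_∈_ to _∈ₗ_)
import Data.List.Membership.Propositional.Properties as MemP
open import Data.Maybe using (just; nothing)
open import Data.Product using (Σ; ∃; _×_; _,_; proj₁; proj₂)
open import Data.Sum using (_⊎_; inj₁; inj₂)
import Data.Sum as Sum
open import Data.Unit using (tt)
open import Data.Empty using (⊥; ⊥-elim)
open import Function using (_∘_; id; flip)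
open import Induction.WellFounded using (Acc; acc)
open import Relation.Nullary using (¬_; Dec; yes; no)
open import Relation.Nullary.Decidable using (⌊_⌋; map′; _×-dec_; _→-dec_; _⊎-dec_; ¬?; True; toWitness; decidable-stable)
open import Relation.Binary.Structures using (IsStrictPartialOrder)
open import Relation.Binary.Definitions using (tri<; tri≈; tri>)
open import Relation.Binary.PropositionalEquality
  using (_≡_; _≢_; refl; sym; trans; cong; cong₂; subst; isEquivalence; module ≡-Reasoning)
open import Data.Integer using (ℤ; 0ℤ; 1ℤ) renaming (+_ to ⁺_)
import Data.Integer as ℤ
import Data.Integer.Properties as ℤP
open import Algebra.Bundles using (CommutativeRing; AbelianGroup)

-- A realization would supply determinants as volumes; a chirotope carries only signs, and signs do
-- not add. The substitute is a function on tuples, with values in an abelian group, that alternates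
-- and satisfies a cone identity for the chosen apex; its sum over a triangulation becomes a sum
-- over boundary facets. Orlik-Solomon monomials are one such function. The other is integer-valued:
-- elements are retracted onto the entries of a single tuple, and the cone identity holds for lack
-- of room. Adapted to the simplices, it shows that an extreme element sees a boundary facet;
-- adapted to the cones over the visible facets, it shows that a simplex uses that element up to
-- parallelism. Without this covering, one of two triangulations might miss a facet hyperplane and
-- the induction would compare a form with an empty sum. Links and restrictions keep the index set,
-- loops taking the place of deleted elements, and nonemptiness of a triangulation is carried apart
-- from its other axioms.

variable
  N n r : ℕ

-- Arithmetic of signs

allSigns? : {P : Sign → Set} → (∀ s → Dec (P s)) → Dec (∀ s → P s)
allSigns? P? = map′ (λ { (p , q , z) → λ { pos → p ; neg → q ; zer → z } })
                    (λ f → f pos , f neg , f zer)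
                    (P? pos ×-dec (P? neg ×-dec P? zer))

-- An identity among finitely many signs is proved by evaluating its decision procedure on all
-- cases; the final `tt` in each use certifies that the answer is yes.
decide : {A : Set} (A? : Dec A) → True A? → A
decide A? = toWitness {a? = A?}

*ₛ-assoc : ∀ a b c → (a *ₛ b) *ₛ c ≡ a *ₛ (b *ₛ c)
*ₛ-assoc = decide (allSigns? λ a → allSigns? λ b → allSigns? λ c → _ ≟ₛ _) tt

*ₛ-comm : ∀ a b → a *ₛ b ≡ b *ₛ a
*ₛ-comm = decide (allSigns? λ a → allSigns? λ b → _ ≟ₛ _) tt

*ₛ-zeroʳ : ∀ a → a *ₛ zer ≡ zer
*ₛ-zeroʳ = decide (allSigns? λ a → _ ≟ₛ _) tt

*ₛ-posʳ : ∀ a → a *ₛ pos ≡ a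
*ₛ-posʳ = decide (allSigns? λ a → _ ≟ₛ _) tt

*ₛ-negʳ : ∀ a → a *ₛ neg ≡ negₛ a
*ₛ-negʳ = decide (allSigns? λ a → _ ≟ₛ _) tt

negₛ-invol : ∀ a → negₛ (negₛ a) ≡ a
negₛ-invol = decide (allSigns? λ a → _ ≟ₛ _) tt

negₛ-*ˡ : ∀ a b → negₛ a *ₛ b ≡ negₛ (a *ₛ b)
negₛ-*ˡ = decide (allSigns? λ a → allSigns? λ b → _ ≟ₛ _) tt

negₛ-*ʳ : ∀ a b → a *ₛ negₛ b ≡ negₛ (a *ₛ b)
negₛ-*ʳ = decide (allSigns? λ a → allSigns? λ b → _ ≟ₛ _) tt

negₛ-fix : ∀ a → a ≡ negₛ a → a ≡ zer
negₛ-fix = decide (allSigns? λ a → (_ ≟ₛ _) →-dec (_ ≟ₛ _)) tt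

negₛ≢zer : ∀ a → a ≢ zer → negₛ a ≢ zer
negₛ≢zer = decide (allSigns? λ a → ¬? (_ ≟ₛ _) →-dec ¬? (_ ≟ₛ _)) tt

*ₛ-nonzero : ∀ a b → a ≢ zer → b ≢ zer → a *ₛ b ≢ zer
*ₛ-nonzero = decide (allSigns? λ a → allSigns? λ b →
  ¬? (_ ≟ₛ _) →-dec (¬? (_ ≟ₛ _) →-dec ¬? (_ ≟ₛ _))) tt

*ₛ-nonzeroˡ : ∀ a b → a *ₛ b ≢ zer → a ≢ zer
*ₛ-nonzeroˡ = decide (allSigns? λ a → allSigns? λ b → ¬? (_ ≟ₛ _) →-dec ¬? (_ ≟ₛ _)) tt

*ₛ-nonzeroʳ : ∀ a b → a *ₛ b ≢ zer → b ≢ zer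
*ₛ-nonzeroʳ = decide (allSigns? λ a → allSigns? λ b → ¬? (_ ≟ₛ _) →-dec ¬? (_ ≟ₛ _)) tt

*ₛ-exchange : ∀ a b c → a *ₛ (b *ₛ c) ≡ b *ₛ (a *ₛ c)
*ₛ-exchange = decide (allSigns? λ a → allSigns? λ b → allSigns? λ c → _ ≟ₛ _) tt

*ₛ-cancel₂ : ∀ s a b → s ≢ zer → (s *ₛ a) *ₛ (s *ₛ b) ≡ a *ₛ b
*ₛ-cancel₂ = decide (allSigns? λ s → allSigns? λ a → allSigns? λ b → ¬? (_ ≟ₛ _) →-dec (_ ≟ₛ _)) tt

*ₛ-square : ∀ a → a ≢ zer → a *ₛ a ≡ pos
*ₛ-square = decide (allSigns? λ a → ¬? (_ ≟ₛ _) →-dec (_ ≟ₛ _)) tt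

*ₛ-cancel : ∀ a b → a ≢ zer → a *ₛ (a *ₛ b) ≡ b
*ₛ-cancel = decide (allSigns? λ a → allSigns? λ b → ¬? (_ ≟ₛ _) →-dec (_ ≟ₛ _)) tt

*ₛ-pos⇒≡ : ∀ a b → a *ₛ b ≡ pos → a ≡ b
*ₛ-pos⇒≡ = decide (allSigns? λ a → allSigns? λ b → (_ ≟ₛ _) →-dec (_ ≟ₛ _)) tt

*ₛ-neg⇒≡ : ∀ a b → a *ₛ b ≡ neg → a ≡ negₛ b
*ₛ-neg⇒≡ = decide (allSigns? λ a → allSigns? λ b → (_ ≟ₛ _) →-dec (_ ≟ₛ _)) tt

≡neg⇒≢zer : ∀ {a} → a ≡ neg → a ≢ zer
≡neg⇒≢zer refl ()

≡pos⇒≢zer : ∀ {a} → a ≡ pos → a ≢ zer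
≡pos⇒≢zer refl ()

pos≢neg : ∀ {a} → a ≡ pos → a ≢ neg
pos≢neg refl ()

≢zer∧≢neg⇒pos : ∀ a → a ≢ zer → a ≢ neg → a ≡ pos
≢zer∧≢neg⇒pos = decide (allSigns? λ a → ¬? (_ ≟ₛ _) →-dec (¬? (_ ≟ₛ _) →-dec (_ ≟ₛ _))) tt

≢zer∧≢pos⇒neg : ∀ a → a ≢ zer → a ≢ pos → a ≡ neg
≢zer∧≢pos⇒neg = decide (allSigns? λ a → ¬? (_ ≟ₛ _) →-dec (¬? (_ ≟ₛ _) →-dec (_ ≟ₛ _))) tt

¬≢zer⇒≡ : ∀ {a} → ¬ (a ≢ zer) → a ≡ zer
¬≢zer⇒≡ {a} = decidable-stable (a ≟ₛ zer)

*ₛ-zeroˡ′ : ∀ {a} b → a ≡ zer → a *ₛ b ≡ zer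
*ₛ-zeroˡ′ b refl = refl

*ₛ-zeroʳ′ : ∀ a {b} → b ≡ zer → a *ₛ b ≡ zer
*ₛ-zeroʳ′ a refl = *ₛ-zeroʳ a

parity≢zer : ∀ k → parity k ≢ zer
parity≢zer zero ()
parity≢zer (suc k) = negₛ≢zer (parity k) (parity≢zer k)

-- Vectors up to signed permutation

-- The sign is an index and not computed: for tuples with repeated entries it is not a function of
-- the two tuples. A tuple with a repetition is related to itself with both signs, which is what
-- forces alternating functions to vanish there.
data Perm {A : Set} : ∀ {n} → Sign → Vec A n → Vec A n → Set where
  reflᵖ  : ∀ {n} {x : Vec A n} → Perm pos x x
  swapᵖ  : ∀ {n} a b (x : Vec A n) → Perm neg (a ∷ b ∷ x) (b ∷ a ∷ x)
  prepᵖ  : ∀ {n s} a {x y : Vec A n} → Perm s x y → Perm s (a ∷ x) (a ∷ y)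
  transᵖ : ∀ {n s t} {x y z : Vec A n} → Perm s x y → Perm t y z → Perm (s *ₛ t) x z

module _ {A : Set} where

  Mem : A → Vec A n → Set
  Mem e x = ∃ λ k → lookup x k ≡ e

  Inj : Vec A n → Set
  Inj x = ∀ i j → lookup x i ≡ lookup x j → i ≡ j

  Sub : ∀ {m} → Vec A n → Vec A m → Set
  Sub x y = ∀ k → Mem (lookup x k) y

  Sub-Mem : ∀ {m} {x : Vec A n} {y : Vec A m} → Sub x y → ∀ {e} → Mem e x → Mem e y
  Sub-Mem sub (k , refl) = sub k

  Perm-nonzero : ∀ {s} {x y : Vec A n} → Perm s x y → s ≢ zer
  Perm-nonzero reflᵖ ()
  Perm-nonzero (swapᵖ _ _ _) ()
  Perm-nonzero (prepᵖ _ p) = Perm-nonzero p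
  Perm-nonzero (transᵖ {s = s} {t} p q) = *ₛ-nonzero s t (Perm-nonzero p) (Perm-nonzero q)

  Perm-sym : ∀ {s} {x y : Vec A n} → Perm s x y → Perm s y x
  Perm-sym reflᵖ = reflᵖ
  Perm-sym (swapᵖ a b x) = swapᵖ b a x
  Perm-sym (prepᵖ a p) = prepᵖ a (Perm-sym p)
  Perm-sym (transᵖ {s = s} {t} p q) =
    subst (λ u → Perm u _ _) (*ₛ-comm t s) (transᵖ (Perm-sym q) (Perm-sym p))

  Perm-Mem : ∀ {s} {x y : Vec A n} → Perm s x y → ∀ {e} → Mem e x → Mem e y
  Perm-Mem reflᵖ m = m
  Perm-Mem (swapᵖ a b x) (zero , eq) = suc zero , eq
  Perm-Mem (swapᵖ a b x) (suc zero , eq) = zero , eq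
  Perm-Mem (swapᵖ a b x) (suc (suc k) , eq) = suc (suc k) , eq
  Perm-Mem (prepᵖ a p) (zero , eq) = zero , eq
  Perm-Mem (prepᵖ a p) (suc k , eq) = let l , eq' = Perm-Mem p (k , eq) in suc l , eq'
  Perm-Mem (transᵖ p q) m = Perm-Mem q (Perm-Mem p m)

  bring : (x : Vec A (suc n)) (i : Fin (suc n)) → Perm (parity (toℕ i)) x (lookup x i ∷ removeAt x i)
  bring (a ∷ x) zero = reflᵖ
  bring (a ∷ b ∷ x) (suc i) =
    subst (λ s → Perm s (a ∷ b ∷ x) (lookup (b ∷ x) i ∷ a ∷ removeAt (b ∷ x) i)) (*ₛ-negʳ (parity (toℕ i)))
      (transᵖ (prepᵖ a (bring (b ∷ x) i)) (swapᵖ a _ _))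

  rotate : ∀ e (x : Vec A n) → Perm (parity n) (e ∷ x) (x ∷ʳ e)
  rotate e [] = reflᵖ
  rotate e (a ∷ x) = transᵖ (swapᵖ e a x) (prepᵖ a (rotate e x))

  lookup-removeAt : (x : Vec A (suc n)) (i : Fin (suc n)) (k : Fin n) →
    lookup (removeAt x i) k ≡ lookup x (punchIn i k)
  lookup-removeAt (a ∷ x) zero k = refl
  lookup-removeAt (a ∷ b ∷ x) (suc i) zero = refl
  lookup-removeAt (a ∷ b ∷ x) (suc i) (suc k) = lookup-removeAt (b ∷ x) i k

  Mem-removeAt : (x : Vec A (suc n)) {i l : Fin (suc n)} → i ≢ l → Mem (lookup x l) (removeAt x i)
  Mem-removeAt x i≢l = punchOut i≢l , VecP.removeAt-punchOut x i≢l

  Mem-update : (x : Vec A n) (i : Fin n) {e : A} → Mem e (x [ i ]≔ e)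
  Mem-update x i = i , VecP.lookup∘update i x _

  Mem-update′ : (x : Vec A n) {i k : Fin n} {e : A} → k ≢ i → Mem (lookup x k) (x [ i ]≔ e)
  Mem-update′ x k≢i = _ , VecP.lookup∘update′ k≢i x _

  Mem-update⁻ : (x : Vec A n) (i : Fin n) {e f : A} → Mem f (x [ i ]≔ e) → f ≡ e ⊎ (∃ λ k → k ≢ i × lookup x k ≡ f)
  Mem-update⁻ x i {e} (k , eq) with k ≟ i
  ... | yes refl = inj₁ (trans (sym eq) (VecP.lookup∘update k x e))
  ... | no k≢i = inj₂ (k , k≢i , trans (sym (VecP.lookup∘update′ k≢i x e)) eq)

  vec-ext : {x y : Vec A n} → (∀ k → lookup x k ≡ lookup y k) → x ≡ y
  vec-ext {x = []} {[]} _ = refl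
  vec-ext {x = a ∷ x} {b ∷ y} h = cong₂ _∷_ (h zero) (vec-ext (h ∘ suc))

  Inj-∷⁻ : ∀ {a} {x : Vec A n} → Inj (a ∷ x) → Inj x
  Inj-∷⁻ inj i j eq = FinP.suc-injective (inj (suc i) (suc j) eq)

  -- Both tuples have the same length, so the repetition-free `x` leaves no room for further entries
  -- of `y`; hence bases can be compared as sets through `Sub` alone.
  Sub⇒Perm : (x y : Vec A n) → Inj x → Sub x y → ∃ λ s → Perm s x y
  Sub⇒Perm [] [] _ _ = pos , reflᵖ
  Sub⇒Perm {suc n} (a ∷ x) y inj sub with sub zero
  ... | l , refl = _ , transᵖ (prepᵖ a (proj₂ ih)) (Perm-sym (bring y l))
    where
    sub' : Sub x (removeAt y l)
    sub' k with sub (suc k)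
    ... | m , eq with l ≟ m
    ...   | yes refl = ⊥-elim (FinP.0≢1+n (inj zero (suc k) eq))
    ...   | no l≢m = subst (λ e → Mem e (removeAt y l)) eq (Mem-removeAt y l≢m)
    ih = Sub⇒Perm x (removeAt y l) (Inj-∷⁻ {a = a} inj) sub'

  Perm⇒Sub : ∀ {s} {x y : Vec A n} → Perm s x y → Sub x y
  Perm⇒Sub p k = Perm-Mem p (k , refl)

  swapAt-same : (x : Vec A n) {i j : Fin n} → lookup x i ≡ lookup x j → swapAt x i j ≡ x
  swapAt-same x {i} {j} eq = trans (cong₂ (λ a b → (x [ i ]≔ a) [ j ]≔ b) (sym eq) eq)
    (trans (cong (_[ j ]≔ lookup x j) (VecP.[]≔-lookup x i)) (VecP.[]≔-lookup x j))

Perm-map : {A B : Set} (f : A → B) → ∀ {n s} {x y : Vec A n} → Perm s x y → Perm s (Vec.map f x) (Vec.map f y)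
Perm-map f reflᵖ = reflᵖ
Perm-map f (swapᵖ a b x) = swapᵖ (f a) (f b) (Vec.map f x)
Perm-map f (prepᵖ a p) = prepᵖ (f a) (Perm-map f p)
Perm-map f (transᵖ p q) = transᵖ (Perm-map f p) (Perm-map f q)

put : Fin N → Fin N → Fin N → Fin N
put a b c with c ≟ a
... | yes _ = b
... | no _ = c

put-yes : (a b : Fin N) → put a b a ≡ b
put-yes a b with a ≟ a
... | yes _ = refl
... | no a≢a = ⊥-elim (a≢a refl)

put-no : {a b c : Fin N} → c ≢ a → put a b c ≡ c
put-no {a = a} {b} {c} c≢a with c ≟ a
... | yes c≡a = ⊥-elim (c≢a c≡a)
... | no _ = refl

-- Expresses the replacement of one entry as a relabelling of all entries, so that a permutation
-- between two tuples can be carried along a replacement in both.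
map-put : (x : Vec (Fin N) n) → Inj x → ∀ i {a} b → lookup x i ≡ a → Vec.map (put a b) x ≡ x [ i ]≔ b
map-put x inj i b refl = vec-ext λ k → trans (VecP.lookup-map k (put (lookup x i) b) x) (go k)
  where
  go : ∀ k → put (lookup x i) b (lookup x k) ≡ lookup (x [ i ]≔ b) k
  go k with k ≟ i
  ... | yes refl = trans (put-yes (lookup x i) b) (sym (VecP.lookup∘update i x b))
  ... | no k≢i = trans (put-no (k≢i ∘ inj k i)) (sym (VecP.lookup∘update′ k≢i x b))

Mem? : (e : Fin N) (x : Vec (Fin N) n) → Dec (Mem e x)
Mem? e x = any? λ k → lookup x k ≟ e

Mem⇒∈img : {e : Fin N} (x : Vec (Fin N) n) → Mem e x → e ∈ img x
Mem⇒∈img (a ∷ x) (zero , refl) = SubP.x∈p∪q⁺ (inj₁ (SubP.x∈⁅x⁆ a))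
Mem⇒∈img (a ∷ x) (suc k , eq) = SubP.x∈p∪q⁺ (inj₂ (Mem⇒∈img x (k , eq)))

∈img⇒Mem : {e : Fin N} (x : Vec (Fin N) n) → e ∈ img x → Mem e x
∈img⇒Mem [] e∈ = ⊥-elim (SubP.∉⊥ e∈)
∈img⇒Mem (a ∷ x) e∈ with SubP.x∈p∪q⁻ ⁅ a ⁆ (img x) e∈
... | inj₁ p = zero , sym (SubP.x∈⁅y⁆⇒x≡y a p)
... | inj₂ p = let k , eq = ∈img⇒Mem x p in suc k , eq

img-cong : (x y : Vec (Fin N) n) → Sub x y → Sub y x → img x ≡ img y
img-cong x y p q = SubP.⊆-antisym
  (λ e∈ → Mem⇒∈img y (Sub-Mem {x = x} {y} p (∈img⇒Mem x e∈)))
  (λ e∈ → Mem⇒∈img x (Sub-Mem {x = y} {x} q (∈img⇒Mem y e∈)))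

img≡⇒Sub : (x y : Vec (Fin N) n) → img x ≡ img y → Sub x y
img≡⇒Sub x y eq k = ∈img⇒Mem y (subst (_ ∈_) eq (Mem⇒∈img x (k , refl)))

-- Chirotopes through signed basis exchange

Perm-swapAt₀ : {A : Set} (a : A) (x : Vec A n) (j : Fin n) → Perm neg (a ∷ x) (lookup x j ∷ (x [ j ]≔ a))
Perm-swapAt₀ a (b ∷ x) zero = swapᵖ a b x
Perm-swapAt₀ a (b ∷ x) (suc j) =
  transᵖ (transᵖ (swapᵖ a b x) (prepᵖ b (Perm-swapAt₀ a x j))) (swapᵖ b (lookup x j) (x [ j ]≔ a))

Perm-swapAt : {A : Set} (x : Vec A n) {i j : Fin n} → i ≢ j → Perm neg x (swapAt x i j)
Perm-swapAt (a ∷ x) {zero} {zero} i≢j = ⊥-elim (i≢j refl)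
Perm-swapAt (a ∷ x) {zero} {suc j} _ = Perm-swapAt₀ a x j
Perm-swapAt (a ∷ x) {suc i} {zero} _ = Perm-swapAt₀ a x i
Perm-swapAt (a ∷ x) {suc i} {suc j} i≢j = prepᵖ a (Perm-swapAt x (i≢j ∘ cong suc))

update-exchange : {A : Set} (y : Vec A n) {i k : Fin n} (a : A) → k ≢ i →
  swapAt (y [ k ]≔ a) i k ≡ (y [ i ]≔ a) [ k ]≔ lookup y i
update-exchange y {i} {k} a k≢i = begin
  ((y [ k ]≔ a) [ i ]≔ lookup (y [ k ]≔ a) k) [ k ]≔ lookup (y [ k ]≔ a) i
    ≡⟨ cong₂ (λ b c → ((y [ k ]≔ a) [ i ]≔ b) [ k ]≔ c)
         (VecP.lookup∘update k y a) (VecP.lookup∘update′ (k≢i ∘ sym) y a) ⟩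
  ((y [ k ]≔ a) [ i ]≔ a) [ k ]≔ lookup y i
    ≡⟨ cong (_[ k ]≔ lookup y i) (VecP.[]≔-commutes y k i k≢i) ⟩
  ((y [ i ]≔ a) [ k ]≔ a) [ k ]≔ lookup y i
    ≡⟨ VecP.[]≔-idempotent (y [ i ]≔ a) k ⟩
  (y [ i ]≔ a) [ k ]≔ lookup y i ∎
  where open ≡-Reasoning

-- Exchange is stated for both signs of the product and for every place `j`. Neither a ground set
-- nor a nonzero value is demanded, so contractions, restrictions to hyperplanes and reorientations
-- are again of this kind.
record OM {N r} (ν : Chi N r) : Set where
  field
    alt : ∀ {s} {x y} → Perm s x y → ν x ≡ s *ₛ ν y
    ex  : ∀ x y j → ν x *ₛ ν y ≢ zer →
          ∃ λ i → ν (x [ j ]≔ lookup y i) *ₛ ν (y [ i ]≔ lookup x j) ≡ ν x *ₛ ν y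
open OM public

Alternating : Chi N r → Set
Alternating χ = ∀ x i j → i ≢ j → χ (swapAt x i j) ≡ negₛ (χ x)

Alternating⇒alt : (χ : Chi N r) → Alternating χ → ∀ {s} {x y} → Perm s x y → χ x ≡ s *ₛ χ y
Alternating⇒alt χ _ reflᵖ = refl
Alternating⇒alt χ h (swapᵖ a b x) = h (b ∷ a ∷ x) zero (suc zero) λ ()
Alternating⇒alt χ h (prepᵖ a p) =
  Alternating⇒alt (λ x → χ (a ∷ x)) (λ x i j i≢j → h (a ∷ x) (suc i) (suc j) (i≢j ∘ FinP.suc-injective)) p
Alternating⇒alt χ h (transᵖ {s = s} {t} p q) =
  trans (Alternating⇒alt χ h p)
    (trans (cong (s *ₛ_) (Alternating⇒alt χ h q)) (sym (*ₛ-assoc s t _)))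

module GrassmannPlücker {χ : Chi N (suc r)} (h : Alternating χ) (gp : GP (suc r) χ) where

  private
    alt₀ : ∀ {s} {x y} → Perm s x y → χ x ≡ s *ₛ χ y
    alt₀ = Alternating⇒alt χ h

    neg⇒pos : ∀ a b d → b ≡ negₛ d → a *ₛ b ≡ neg → a *ₛ d ≡ pos
    neg⇒pos = decide (allSigns? λ a → allSigns? λ b → allSigns? λ d →
      (_ ≟ₛ _) →-dec ((_ ≟ₛ _) →-dec (_ ≟ₛ _))) tt

  ex₀-neg : ∀ x₁ xs y → χ (x₁ ∷ xs) *ₛ χ y ≡ neg →
    ∃ λ i → χ (lookup y i ∷ xs) *ₛ χ (y [ i ]≔ x₁) ≡ neg
  ex₀-neg x₁ xs y eq with any? (λ i → (χ (lookup y i ∷ xs) *ₛ χ (y [ i ]≔ x₁)) ≟ₛ neg)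
  ... | yes p = p
  ... | no ¬p = ⊥-elim (gp x₁ xs y (λ i q → ¬p (i , q)) eq)

  -- The Grassmann-Plücker axiom speaks of negative products only. Swapping the first two entries of
  -- `y` makes a positive product negative, and the index found is carried back through the swap.
  -- With a single entry there is nothing to swap and commutativity suffices.
  ex₀-pos : ∀ x₁ xs y → χ (x₁ ∷ xs) *ₛ χ y ≡ pos →
    ∃ λ i → χ (lookup y i ∷ xs) *ₛ χ (y [ i ]≔ x₁) ≡ pos
  ex₀-pos x₁ [] (y₀ ∷ []) eq = zero , trans (*ₛ-comm (χ (y₀ ∷ [])) _) eq
  ex₀-pos x₁ xs@(_ ∷ _) (y₀ ∷ y₁ ∷ ys) eq
    with ex₀-neg x₁ xs (y₁ ∷ y₀ ∷ ys)
           (trans (cong (χ (x₁ ∷ xs) *ₛ_) (alt₀ (swapᵖ y₁ y₀ ys)))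
             (trans (negₛ-*ʳ (χ (x₁ ∷ xs)) _) (cong negₛ eq)))
  ... | zero , p = suc zero ,
    neg⇒pos (χ (y₁ ∷ xs)) _ _ (alt₀ (swapᵖ x₁ y₀ ys)) p
  ... | suc zero , p = zero ,
    neg⇒pos (χ (y₀ ∷ xs)) _ _ (alt₀ (swapᵖ y₁ x₁ ys)) p
  ... | suc (suc i) , p = suc (suc i) ,
    neg⇒pos (χ (lookup ys i ∷ xs)) _ _ (alt₀ (swapᵖ y₁ y₀ (ys [ i ]≔ x₁))) p

  ex₀ : ∀ x₁ xs y → χ (x₁ ∷ xs) *ₛ χ y ≢ zer →
    ∃ λ i → χ (lookup y i ∷ xs) *ₛ χ (y [ i ]≔ x₁) ≡ χ (x₁ ∷ xs) *ₛ χ y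
  ex₀ x₁ xs y nz with χ (x₁ ∷ xs) *ₛ χ y in eq
  ... | pos = ex₀-pos x₁ xs y eq
  ... | neg = ex₀-neg x₁ xs y eq
  ... | zer = ⊥-elim (nz refl)

  ex′ : ∀ x y j → χ x *ₛ χ y ≢ zer →
    ∃ λ i → χ (x [ j ]≔ lookup y i) *ₛ χ (y [ i ]≔ lookup x j) ≡ χ x *ₛ χ y
  ex′ (a ∷ x) y zero nz = ex₀ a x y nz
  ex′ (a ∷ x) y (suc j) nz = proj₁ found , (begin
      χ (a ∷ (x [ j ]≔ lookup y i)) *ₛ χ (y [ i ]≔ lookup x j)
        ≡⟨ cong (_*ₛ χ (y [ i ]≔ lookup x j)) (moved (lookup y i)) ⟩
      negₛ (χ (lookup y i ∷ (x [ j ]≔ a))) *ₛ χ (y [ i ]≔ lookup x j)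
        ≡⟨ negₛ-*ˡ (χ (lookup y i ∷ (x [ j ]≔ a))) _ ⟩
      negₛ (χ (lookup y i ∷ (x [ j ]≔ a)) *ₛ χ (y [ i ]≔ lookup x j))
        ≡⟨ cong negₛ (proj₂ found) ⟩
      negₛ (χ (lookup x j ∷ (x [ j ]≔ a)) *ₛ χ y)
        ≡⟨ sym (negₛ-*ˡ (χ (lookup x j ∷ (x [ j ]≔ a))) _) ⟩
      negₛ (χ (lookup x j ∷ (x [ j ]≔ a))) *ₛ χ y
        ≡⟨ cong (_*ₛ χ y) (sym (alt₀ (Perm-swapAt₀ a x j))) ⟩
      χ (a ∷ x) *ₛ χ y ∎)
    where
    open ≡-Reasoning
    moved : ∀ e → χ (a ∷ (x [ j ]≔ e)) ≡ negₛ (χ (e ∷ (x [ j ]≔ a)))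
    moved e = trans (alt₀ (Perm-swapAt₀ a (x [ j ]≔ e) j))
      (cong (λ z → negₛ (χ z)) (cong₂ _∷_ (VecP.lookup∘update j x e) (VecP.[]≔-idempotent x j)))
    found = ex₀ (lookup x j) (x [ j ]≔ a) y λ eq → nz (begin
      χ (a ∷ x) *ₛ χ y ≡⟨ cong (_*ₛ χ y) (alt₀ (Perm-swapAt₀ a x j)) ⟩
      negₛ (χ (lookup x j ∷ (x [ j ]≔ a))) *ₛ χ y ≡⟨ negₛ-*ˡ (χ (lookup x j ∷ (x [ j ]≔ a))) _ ⟩
      negₛ (χ (lookup x j ∷ (x [ j ]≔ a)) *ₛ χ y) ≡⟨ cong negₛ eq ⟩
      zer ∎)
    i = proj₁ found

IsChirotope⇒OM : ∀ {N} {E : Subset N} {r} {χ : Chi N r} → IsChirotope E r χ → OM χ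
IsChirotope⇒OM {χ = χ} c .alt = Alternating⇒alt χ (IsChirotope.alternating c)
IsChirotope⇒OM {r = suc r} c .ex =
  GrassmannPlücker.ex′ (IsChirotope.alternating c) (IsChirotope.exchange c)

-- Contraction, loops and parallel elements

con : Chi N (suc r) → Fin N → Chi N r
con ν v x = ν (v ∷ x)

NonLoop : Chi N r → Fin N → Set
NonLoop ν e = ∃ λ z → ∃ λ j → ν (z [ j ]≔ e) ≢ zer

NonLoop? : (ν : Chi N r) (e : Fin N) → Dec (NonLoop ν e)
NonLoop? {r = r} ν e = ∃Vec? r λ z → any? λ j → ¬? (ν (z [ j ]≔ e) ≟ₛ zer)

-- Loops of `ν` count as parallel to every `v`, and in rank one all elements are parallel; where
-- proper parallelism matters, `NonLoop` is assumed in addition.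
Par : Chi N (suc r) → Fin N → Fin N → Set
Par ν v w = ¬ NonLoop (con ν v) w

Par? : (ν : Chi N (suc r)) (v w : Fin N) → Dec (Par ν v w)
Par? ν v w = ¬? (NonLoop? (con ν v) w)

Mem⇒NonLoop : (ν : Chi N r) {x : Vec (Fin N) r} → ν x ≢ zer → ∀ {e} → Mem e x → NonLoop ν e
Mem⇒NonLoop ν {x} nz (j , refl) = x , j , λ eq → nz (trans (cong ν (sym (VecP.[]≔-lookup x j))) eq)

module _ {N r} {ν : Chi N r} (om : OM ν) where

  alt-swap : ∀ x {i j} → i ≢ j → ν (swapAt x i j) ≡ negₛ (ν x)
  alt-swap x i≢j = alt om (Perm-sym (Perm-swapAt x i≢j))

  repeated⇒zer : ∀ x {i j} → i ≢ j → lookup x i ≡ lookup x j → ν x ≡ zer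
  repeated⇒zer x i≢j eq = negₛ-fix (ν x) (trans (sym (cong ν (swapAt-same x eq))) (alt-swap x i≢j))

  nonzero⇒Inj : ∀ {x} → ν x ≢ zer → Inj x
  nonzero⇒Inj {x} nz i j eq with i ≟ j
  ... | yes i≡j = i≡j
  ... | no i≢j = ⊥-elim (nz (repeated⇒zer x i≢j eq))

  alt-exchange : ∀ y {i k} a → k ≢ i → ν ((y [ i ]≔ a) [ k ]≔ lookup y i) ≡ negₛ (ν (y [ k ]≔ a))
  alt-exchange y a k≢i = trans (cong ν (sym (update-exchange y a k≢i))) (alt-swap (y [ _ ]≔ a) (k≢i ∘ sym))

  Perm-basis : ∀ {s x y} → Perm s x y → ν x ≢ zer → ν y ≢ zer
  Perm-basis {s} {y = y} p nz = *ₛ-nonzeroʳ s (ν y) (nz ∘ trans (alt om p))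

  Sub-basis : ∀ {x y} → Inj x → Sub x y → ν y ≢ zer → ν x ≢ zer
  Sub-basis {x} {y} inj sub = Perm-basis (Perm-sym (proj₂ (Sub⇒Perm x y inj sub)))

  update-same : ∀ x j {e} → e ≡ lookup x j → ν (x [ j ]≔ e) ≡ ν x
  update-same x j refl = cong ν (VecP.[]≔-lookup x j)

  update-other : ∀ x {j k e} → k ≢ j → e ≡ lookup x k → ν (x [ j ]≔ e) ≡ zer
  update-other x {j} {k} {e} k≢j refl =
    repeated⇒zer (x [ j ]≔ e) k≢j (trans (VecP.lookup∘update′ k≢j x e) (sym (VecP.lookup∘update j x e)))

  -- The entries of `B` other than `B_j` span a hyperplane, and a cocircuit vanishing on them is
  -- determined up to sign; the product form avoids division. Exchange at `j₀` can only select place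
  -- `j`, since any other choice produces a vanishing factor. It is applied from the left side and,
  -- should that be zero, from the right.
  cocircuit-unique : ∀ {B} → ν B ≢ zer → ∀ z j₀ j → (∀ k → k ≢ j → ν (z [ j₀ ]≔ lookup B k) ≡ zer) →
    ∀ e → ν (z [ j₀ ]≔ e) *ₛ ν B ≡ ν (z [ j₀ ]≔ lookup B j) *ₛ ν (B [ j ]≔ e)
  cocircuit-unique {B} _ z j₀ j vanish e with (ν (z [ j₀ ]≔ e) *ₛ ν B) ≟ₛ zer
  ... | no nz = sym (exchanged B vanish e nz)
    where
    exchanged : ∀ B → (∀ k → k ≢ j → ν (z [ j₀ ]≔ lookup B k) ≡ zer) →
      ∀ e → ν (z [ j₀ ]≔ e) *ₛ ν B ≢ zer →
      ν (z [ j₀ ]≔ lookup B j) *ₛ ν (B [ j ]≔ e) ≡ ν (z [ j₀ ]≔ e) *ₛ ν B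
    exchanged B vanish e nz with ex om (z [ j₀ ]≔ e) B j₀ nz
    ... | i , eq with i ≟ j
    ...   | yes refl = trans (cong₂ (λ u v → ν u *ₛ ν (B [ i ]≔ v))
                               (sym (VecP.[]≔-idempotent z j₀)) (sym (VecP.lookup∘update j₀ z e))) eq
    ...   | no i≢j = ⊥-elim (nz (trans (sym eq) (*ₛ-zeroˡ′ (ν (B [ i ]≔ lookup (z [ j₀ ]≔ e) j₀))
                       (trans (cong ν (VecP.[]≔-idempotent z j₀)) (vanish i i≢j)))))
  ... | yes z₁ with (ν (z [ j₀ ]≔ lookup B j) *ₛ ν (B [ j ]≔ e)) ≟ₛ zer
  ...   | yes z₂ = trans z₁ (sym z₂)
  ...   | no nz with ex om (z [ j₀ ]≔ lookup B j) (B [ j ]≔ e) j₀ nz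
  ...     | i , eq with i ≟ j
  ...       | yes refl = trans (cong₂ (λ u v → ν u *ₛ ν v)
      (trans (cong (z [ j₀ ]≔_) (sym (VecP.lookup∘update i B e))) (sym (VecP.[]≔-idempotent z j₀)))
      (sym (trans (VecP.[]≔-idempotent B i)
        (trans (cong (B [ i ]≔_) (VecP.lookup∘update j₀ z _)) (VecP.[]≔-lookup B i))))) eq
  ...       | no i≢j = ⊥-elim (nz (trans (sym eq) (*ₛ-zeroˡ′ (ν ((B [ j ]≔ e) [ i ]≔ lookup (z [ j₀ ]≔ lookup B j) j₀))
      (trans (cong ν (VecP.[]≔-idempotent z j₀))
        (trans (cong (λ f → ν (z [ j₀ ]≔ f)) (VecP.lookup∘update′ i≢j B e)) (vanish i i≢j))))))

con-OM : {ν : Chi N (suc r)} → OM ν → ∀ v → OM (con ν v)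
con-OM om v .alt p = alt om (prepᵖ v p)
con-OM {ν = ν} om v .ex x y j nz with ex om (v ∷ x) (v ∷ y) (suc j) nz
... | zero , eq = ⊥-elim (nz (trans (sym eq) (*ₛ-zeroˡ′ (ν ((v ∷ y) [ zero ]≔ lookup (v ∷ x) (suc j)))
      (repeated⇒zer om (v ∷ (x [ j ]≔ v)) {zero} {suc j} (λ ()) (sym (VecP.lookup∘update j x v))))))
... | suc i , eq = i , eq

module _ {N r} {ν : Chi N (suc r)} (om : OM ν) where

  Par-refl : ∀ v → Par ν v v
  Par-refl v (z , j , nz) =
    nz (repeated⇒zer om (v ∷ (z [ j ]≔ v)) {zero} {suc j} (λ ()) (sym (VecP.lookup∘update j z v)))

  Par⇒zer : ∀ {v w} → Par ν v w → ∀ x {i k} → i ≢ k → lookup x i ≡ w → lookup x k ≡ v → ν x ≡ zer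
  Par⇒zer par x {i} {k} i≢k refl refl = ¬≢zer⇒≡ λ nz →
    par (Mem⇒NonLoop (con ν (lookup x k)) (Perm-basis om (bring x k) nz) (Mem-removeAt x (i≢k ∘ sym)))

  Par-sym : ∀ {v w} → Par ν v w → Par ν w v
  Par-sym {v} {w} par (z , j , nz) =
    nz (Par⇒zer par (w ∷ (z [ j ]≔ v)) {zero} {suc j} (λ ()) refl (VecP.lookup∘update j z v))

  -- The sign is read off from one basis `y` through `v`: putting `w` in the place of `v` leaves a
  -- basis, and putting `w` elsewhere makes the parallel `v` and `w` occur together. Exchange with
  -- `y` therefore relates every tuple through `w` to one through `v` by the same factor.
  Par-sign : ∀ {v w} → NonLoop ν v → NonLoop ν w → Par ν v w →
    ∃ λ σ → σ ≢ zer × (∀ z j → ν (z [ j ]≔ w) ≡ σ *ₛ ν (z [ j ]≔ v))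
  Par-sign {v} {w} (y₀ , k , nzv) (z₀ , j₀ , nzw) par = ν y *ₛ ν (y [ k ]≔ w) , *ₛ-nonzero (ν y) _ nzv nzy' , law
    where
    y = y₀ [ k ]≔ v
    yk : lookup y k ≡ v
    yk = VecP.lookup∘update k y₀ v
    vanish : ∀ i → i ≢ k → ν (y [ i ]≔ w) ≡ zer
    vanish i i≢k = Par⇒zer par (y [ i ]≔ w) i≢k (VecP.lookup∘update i y w)
      (trans (VecP.lookup∘update′ (i≢k ∘ sym) y w) yk)
    nzy' : ν (y [ k ]≔ w) ≢ zer
    nzy' eq with ex om (z₀ [ j₀ ]≔ w) y j₀ (*ₛ-nonzero _ (ν y) nzw nzv)
    ... | i , eq' = *ₛ-nonzero _ (ν y) nzw nzv (trans (sym eq') (*ₛ-zeroʳ′ (ν ((z₀ [ j₀ ]≔ w) [ j₀ ]≔ lookup y i)) van))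
      where
      van : ν (y [ i ]≔ lookup (z₀ [ j₀ ]≔ w) j₀) ≡ zer
      van = trans (cong (λ e → ν (y [ i ]≔ e)) (VecP.lookup∘update j₀ z₀ w)) (go (i ≟ k))
        where
        go : Dec (i ≡ k) → ν (y [ i ]≔ w) ≡ zer
        go (yes refl) = eq
        go (no i≢k) = vanish i i≢k
    law : ∀ z j → ν (z [ j ]≔ w) ≡ (ν y *ₛ ν (y [ k ]≔ w)) *ₛ ν (z [ j ]≔ v)
    law z j = begin
      ν (z [ j ]≔ w) ≡⟨ sym (*ₛ-cancel (ν y) _ nzv) ⟩
      ν y *ₛ (ν y *ₛ ν (z [ j ]≔ w)) ≡⟨ cong (ν y *ₛ_) (*ₛ-comm (ν y) _) ⟩
      ν y *ₛ (ν (z [ j ]≔ w) *ₛ ν y) ≡⟨ cong (ν y *ₛ_) hyper ⟩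
      ν y *ₛ (ν (z [ j ]≔ v) *ₛ ν (y [ k ]≔ w)) ≡⟨ cong (ν y *ₛ_) (*ₛ-comm (ν (z [ j ]≔ v)) _) ⟩
      ν y *ₛ (ν (y [ k ]≔ w) *ₛ ν (z [ j ]≔ v)) ≡⟨ sym (*ₛ-assoc (ν y) _ _) ⟩
      (ν y *ₛ ν (y [ k ]≔ w)) *ₛ ν (z [ j ]≔ v) ∎
      where
      open ≡-Reasoning
      hyper : ν (z [ j ]≔ w) *ₛ ν y ≡ ν (z [ j ]≔ v) *ₛ ν (y [ k ]≔ w)
      hyper with (ν (z [ j ]≔ w) *ₛ ν y) ≟ₛ zer
      ... | no nz with ex om (z [ j ]≔ w) y j nz
      ...   | i , eq with i ≟ k
      ...     | yes refl = trans (sym eq) (cong₂ _*ₛ_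
                  (cong ν (trans (VecP.[]≔-idempotent z j) (cong (z [ j ]≔_) yk)))
                  (cong (λ e → ν (y [ i ]≔ e)) (VecP.lookup∘update j z w)))
      ...     | no i≢k = ⊥-elim (nz (trans (sym eq) (*ₛ-zeroʳ′ (ν ((z [ j ]≔ w) [ j ]≔ lookup y i))
                  (trans (cong (λ e → ν (y [ i ]≔ e)) (VecP.lookup∘update j z w)) (vanish i i≢k)))))
      hyper | yes z₁ with (ν (z [ j ]≔ v) *ₛ ν (y [ k ]≔ w)) ≟ₛ zer
      ... | yes z₂ = trans z₁ (sym z₂)
      ... | no nz with ex om (z [ j ]≔ v) (y [ k ]≔ w) j nz
      ...   | i , eq with i ≟ k
      ...     | yes refl = trans (cong₂ _*ₛ_
                  (cong ν (trans (cong (z [ j ]≔_) (sym (VecP.lookup∘update i y w))) (sym (VecP.[]≔-idempotent z j))))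
                  (cong ν (sym (trans (VecP.[]≔-idempotent y i) (trans (cong (y [ i ]≔_)
                    (trans (VecP.lookup∘update j z v) (sym yk))) (VecP.[]≔-lookup y i)))))) eq
      ...     | no i≢k = ⊥-elim (nz (trans (sym eq) (*ₛ-zeroʳ′ (ν ((z [ j ]≔ v) [ j ]≔ lookup (y [ k ]≔ w) i))
                  (Par⇒zer par ((y [ k ]≔ w) [ i ]≔ lookup (z [ j ]≔ v) j) {k} {i} (i≢k ∘ sym)
                    (trans (VecP.lookup∘update′ (i≢k ∘ sym) (y [ k ]≔ w) _) (VecP.lookup∘update k y w))
                    (trans (VecP.lookup∘update i (y [ k ]≔ w) _) (VecP.lookup∘update j z v))))))

-- The circuit supported on a basis y and an element x, listed over {x} ∪ y

el : Vec (Fin N) r → Fin N → Fin (suc r) → Fin N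
el y x zero = x
el y x (suc i) = lookup y i

sg : Chi N r → Vec (Fin N) r → Fin N → Fin (suc r) → Sign
sg ν y x zero = ν y
sg ν y x (suc i) = negₛ (ν (y [ i ]≔ x))

module _ {N r} {ν : Chi N r} (om : OM ν) (y : Vec (Fin N) r) (x : Fin N) (z : Vec (Fin N) r) (j : Fin r) where

  private
    p : Fin (suc r) → Sign
    p k = sg ν y x k *ₛ ν (z [ j ]≔ el y x k)

    zj : ∀ e f → (z [ j ]≔ e) [ j ]≔ f ≡ z [ j ]≔ f
    zj e f = VecP.[]≔-idempotent z j

    flip* : ∀ a b → negₛ a *ₛ b ≡ negₛ (b *ₛ a)
    flip* = decide (allSigns? λ a → allSigns? λ b → _ ≟ₛ _) tt

  -- Signed exchange read as orthogonality of circuit and cocircuit: the exchanged product belongs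
  -- to another element of the circuit, up to the minus sign built into `sg` or the transposition of
  -- two places of `y`.
  circuit-orthogonal : ∀ k → p k ≢ zer → ∃ λ l → p l ≡ negₛ (p k)
  circuit-orthogonal zero nz with ex om (z [ j ]≔ x) y j (nz ∘ trans (*ₛ-comm (ν y) _))
  ... | i , eq = suc i , (begin
    negₛ (ν (y [ i ]≔ x)) *ₛ ν (z [ j ]≔ lookup y i) ≡⟨ flip* (ν (y [ i ]≔ x)) _ ⟩
    negₛ (ν (z [ j ]≔ lookup y i) *ₛ ν (y [ i ]≔ x))
      ≡⟨ cong negₛ (cong₂ (λ u e → ν u *ₛ ν (y [ i ]≔ e)) (sym (zj x _)) (sym (VecP.lookup∘update j z x))) ⟩
    negₛ (ν ((z [ j ]≔ x) [ j ]≔ lookup y i) *ₛ ν (y [ i ]≔ lookup (z [ j ]≔ x) j)) ≡⟨ cong negₛ eq ⟩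
    negₛ (ν (z [ j ]≔ x) *ₛ ν y) ≡⟨ cong negₛ (*ₛ-comm (ν (z [ j ]≔ x)) _) ⟩
    negₛ (ν y *ₛ ν (z [ j ]≔ x)) ∎)
    where open ≡-Reasoning
  circuit-orthogonal (suc i) nz
    with ex om (z [ j ]≔ lookup y i) (y [ i ]≔ x) j
      (nz ∘ λ eq → trans (flip* (ν (y [ i ]≔ x)) _) (cong negₛ eq))
  ... | m , eq with m ≟ i
  ...   | yes refl = zero , (begin
    ν y *ₛ ν (z [ j ]≔ x) ≡⟨ *ₛ-comm (ν y) _ ⟩
    ν (z [ j ]≔ x) *ₛ ν y ≡⟨ cong₂ (λ u v → ν u *ₛ ν v)
       (trans (cong (z [ j ]≔_) (sym (VecP.lookup∘update m y x))) (sym (zj (lookup y m) _)))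
       (sym (trans (VecP.[]≔-idempotent y m) (trans (cong (y [ m ]≔_) (VecP.lookup∘update j z _)) (VecP.[]≔-lookup y m)))) ⟩
    ν ((z [ j ]≔ lookup y m) [ j ]≔ lookup (y [ m ]≔ x) m) *ₛ ν ((y [ m ]≔ x) [ m ]≔ lookup (z [ j ]≔ lookup y m) j)
      ≡⟨ eq ⟩
    ν (z [ j ]≔ lookup y m) *ₛ ν (y [ m ]≔ x) ≡⟨ sym (trans (cong negₛ (flip* (ν (y [ m ]≔ x)) _)) (negₛ-invol _)) ⟩
    negₛ (negₛ (ν (y [ m ]≔ x)) *ₛ ν (z [ j ]≔ lookup y m)) ∎)
    where open ≡-Reasoning
  ...   | no m≢i = suc m , (begin
    negₛ (ν (y [ m ]≔ x)) *ₛ ν (z [ j ]≔ lookup y m) ≡⟨ *ₛ-comm (negₛ (ν (y [ m ]≔ x))) _ ⟩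
    ν (z [ j ]≔ lookup y m) *ₛ negₛ (ν (y [ m ]≔ x)) ≡⟨ cong₂ (λ u s → ν u *ₛ s)
       (trans (cong (z [ j ]≔_) (sym (VecP.lookup∘update′ m≢i y x))) (sym (zj (lookup y i) _)))
       (trans (sym (alt-exchange om y x m≢i)) (cong (λ e → ν ((y [ i ]≔ x) [ m ]≔ e)) (sym (VecP.lookup∘update j z _)))) ⟩
    ν ((z [ j ]≔ lookup y i) [ j ]≔ lookup (y [ i ]≔ x) m) *ₛ ν ((y [ i ]≔ x) [ m ]≔ lookup (z [ j ]≔ lookup y i) j)
      ≡⟨ eq ⟩
    ν (z [ j ]≔ lookup y i) *ₛ ν (y [ i ]≔ x) ≡⟨ sym (trans (cong negₛ (flip* (ν (y [ i ]≔ x)) _)) (negₛ-invol _)) ⟩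
    negₛ (negₛ (ν (y [ i ]≔ x)) *ₛ ν (z [ j ]≔ lookup y i)) ∎)
    where open ≡-Reasoning

  circuit-not-one-signed : ∀ σ τ → (∀ k → (σ *ₛ sg ν y x k) *ₛ (τ *ₛ ν (z [ j ]≔ el y x k)) ≢ neg) →
    ∀ k → (σ *ₛ sg ν y x k) *ₛ (τ *ₛ ν (z [ j ]≔ el y x k)) ≢ pos
  circuit-not-one-signed σ τ h k eq = h l (begin
      (σ *ₛ sg ν y x l) *ₛ (τ *ₛ ν (z [ j ]≔ el y x l)) ≡⟨ regroup σ (sg ν y x l) τ _ ⟩
      (σ *ₛ τ) *ₛ p l ≡⟨ cong ((σ *ₛ τ) *ₛ_) pl ⟩
      (σ *ₛ τ) *ₛ negₛ (p k) ≡⟨ negₛ-*ʳ (σ *ₛ τ) (p k) ⟩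
      negₛ ((σ *ₛ τ) *ₛ p k) ≡⟨ cong negₛ (sym (regroup σ (sg ν y x k) τ _)) ⟩
      negₛ ((σ *ₛ sg ν y x k) *ₛ (τ *ₛ ν (z [ j ]≔ el y x k))) ≡⟨ cong negₛ eq ⟩
      neg ∎)
    where
    open ≡-Reasoning
    regroup : ∀ a b c d → (a *ₛ b) *ₛ (c *ₛ d) ≡ (a *ₛ c) *ₛ (b *ₛ d)
    regroup = decide (allSigns? λ a → allSigns? λ b → allSigns? λ c → allSigns? λ d → _ ≟ₛ _) tt
    nz : p k ≢ zer
    nz = *ₛ-nonzeroʳ (σ *ₛ τ) (p k) (≡pos⇒≢zer (trans (sym (regroup σ (sg ν y x k) τ _)) eq))
    l = proj₁ (circuit-orthogonal k nz)
    pl = proj₂ (circuit-orthogonal k nz)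

-- The Farkas lemma and extreme elements

module _ {N r} (ν : Chi N r) (w : Fin N) (L : List (Fin N)) where

  PosCoc : Set
  PosCoc = ∃ λ z → ∃ λ j → ∃ λ σ →
    (σ *ₛ ν (z [ j ]≔ w) ≡ pos) × (∀ l → l ∈ₗ L → σ *ₛ ν (z [ j ]≔ l) ≢ neg)

  PosCirc : Set
  PosCirc = ∃ λ y → ∃ λ x → ∃ λ σ → ν y ≢ zer ×
    (∃ λ k → el y x k ≡ w × σ *ₛ sg ν y x k ≡ pos) ×
    (∀ k → σ *ₛ sg ν y x k ≡ zer ⊎ (σ *ₛ sg ν y x k ≡ pos × (el y x k ≡ w ⊎ el y x k ∈ₗ L)))

Acyc : Chi N r → List (Fin N) → Set
Acyc ν L = ∀ w → w ∈ₗ L → PosCoc ν w L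

-- Off the parallel class of `v`, the list stays acyclic after contracting `v`; for an acyclic list
-- this is what being a vertex means.
Extreme : Chi N (suc r) → Fin N → List (Fin N) → Set
Extreme ν v L = ∀ w → w ∈ₗ L → Par ν v w ⊎ PosCoc (con ν v) w L

PosCoc-NonLoop : (ν : Chi N r) {w : Fin N} {L : List (Fin N)} → PosCoc ν w L → NonLoop ν w
PosCoc-NonLoop ν {w} (z , j , σ , eq , _) = z , j , *ₛ-nonzeroʳ σ _ (≡pos⇒≢zer eq)

con-basis : {ν : Chi N (suc r)} → OM ν → ∀ {v} → NonLoop ν v → ∃ λ y → con ν v y ≢ zer
con-basis {ν = ν} om {v} (z , j , nz) = removeAt (z [ j ]≔ v) j ,
  Perm-basis om (subst (λ e → Perm (parity (toℕ j)) (z [ j ]≔ v) (e ∷ removeAt (z [ j ]≔ v) j))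
    (VecP.lookup∘update j z v) (bring (z [ j ]≔ v) j)) nz

con-vanish : {ν : Chi N (suc r)} → OM ν → ∀ u z (j : Fin r) → ν (u ∷ (z [ j ]≔ u)) ≡ zer
con-vanish om u z j = repeated⇒zer om (u ∷ (z [ j ]≔ u)) {zero} {suc j} (λ ()) (sym (VecP.lookup∘update j z u))

Par-vanish : {ν : Chi N (suc r)} {v w : Fin N} → Par ν v w → ∀ z j → ν (v ∷ (z [ j ]≔ w)) ≡ zer
Par-vanish par z j = ¬≢zer⇒≡ λ nz → par (z , j , nz)

PosCoc-con-∷ : {ν : Chi N (suc r)} → OM ν → ∀ {u w L} → PosCoc (con ν u) w L → PosCoc (con ν u) w (u ∷ L)
PosCoc-con-∷ om {u} (z , j , σ , p , q) = z , j , σ , p ,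
  λ { l (here refl) eq → ≡neg⇒≢zer eq (*ₛ-zeroʳ′ σ (con-vanish om u z j)) ; l (there l∈) → q l l∈ }

pos*≢neg : ∀ a b → a ≡ pos → b ≢ neg → a *ₛ b ≢ neg
pos*≢neg .pos b refl h = h

zer*≢neg : ∀ a b → a ≡ zer → a *ₛ b ≢ neg
zer*≢neg .zer b refl ()

*zer≢neg : ∀ a b → b ≡ zer → a *ₛ b ≢ neg
*zer≢neg a .zer refl eq = ≡neg⇒≢zer eq (*ₛ-zeroʳ a)

nonneg-orthogonal : {ν : Chi N r} → OM ν → ∀ y x σ z j τ →
  (∀ k → σ *ₛ sg ν y x k ≡ zer ⊎ (σ *ₛ sg ν y x k ≡ pos × τ *ₛ ν (z [ j ]≔ el y x k) ≢ neg)) →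
  ∀ k → σ *ₛ sg ν y x k ≡ pos → τ *ₛ ν (z [ j ]≔ el y x k) ≢ pos
nonneg-orthogonal om y x σ z j τ h k p q =
  circuit-not-one-signed om y x z j σ τ (λ l → ok l (h l)) k (cong₂ _*ₛ_ p q)
  where
  ok : ∀ l → _ → _
  ok l (inj₁ a) = zer*≢neg _ _ a
  ok l (inj₂ (a , b)) = pos*≢neg _ _ a b

nonneg : ∀ a → a ≢ neg → a ≡ zer ⊎ a ≡ pos
nonneg zer _ = inj₁ refl
nonneg pos _ = inj₂ refl
nonneg neg h = ⊥-elim (h refl)

-- Induction on `L`. If the cocircuit found for `L` is negative at the new element `u`, then `u` is
-- contracted. A cocircuit of the contraction vanishes at `u` and can be kept. A circuit of the
-- contraction lifts to one of `ν` with an uncontrolled entry at `u`; orthogonality to the old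
-- cocircuit, negative at `u`, excludes a negative entry there.
farkas : ∀ {N r} (ν : Chi N r) → OM ν → (∃ λ y → ν y ≢ zer) → ∀ w L → PosCoc ν w L ⊎ PosCirc ν w L
farkas ν om (y , nzy) w [] with NonLoop? ν w
... | yes (z , j , nz) = inj₁ (z , j , ν (z [ j ]≔ w) , *ₛ-square _ nz , λ _ ())
... | no loop = inj₂ (y , w , ν y , nzy , (zero , refl , *ₛ-square _ nzy) , λ
  { zero → inj₂ (*ₛ-square _ nzy , inj₁ refl)
  ; (suc i) → inj₁ (*ₛ-zeroʳ′ (ν y) (cong negₛ (¬≢zer⇒≡ λ nz → loop (y , i , nz)))) })
farkas {N} {r} ν om basis w (u ∷ L) with farkas ν om basis w L
... | inj₂ (y , x , σ , nz , k , h) = inj₂ (y , x , σ , nz , k , λ k → weaken (h k))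
  where
  weaken : ∀ {A B : Set} {e} → A ⊎ (B × (e ≡ w ⊎ e ∈ₗ L)) → A ⊎ (B × (e ≡ w ⊎ e ∈ₗ (u ∷ L)))
  weaken (inj₁ a) = inj₁ a
  weaken (inj₂ (b , inj₁ c)) = inj₂ (b , inj₁ c)
  weaken (inj₂ (b , inj₂ c)) = inj₂ (b , inj₂ (there c))
... | inj₁ (z , j , τ , p , q) with (τ *ₛ ν (z [ j ]≔ u)) ≟ₛ neg
...   | no ok = inj₁ (z , j , τ , p , λ { l (here refl) → ok ; l (there l∈) → q l l∈ })
farkas {N} {suc r} ν om basis w (u ∷ L) | inj₁ (z , j , τ , p , q) | yes bad
  with farkas (con ν u) (con-OM om u) (con-basis om (z , j , *ₛ-nonzeroʳ τ _ (≡neg⇒≢zer bad))) w L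
... | inj₁ Y with PosCoc-con-∷ om Y
...   | z' , j' , σ' , p' , q' = inj₁ (u ∷ z' , suc j' , σ' , p' , q')
farkas {N} {suc r} ν om basis w (u ∷ L) | inj₁ (z , j , τ , p , q) | yes bad
  | inj₂ (y , x , σ , nz , (k₀ , el≡ , sg≡) , h) = inj₂ (u ∷ y , x , σ , nz , found k₀ el≡ sg≡ , signs)
  where
  c : Fin (suc (suc r)) → Sign
  c k = σ *ₛ sg ν (u ∷ y) x k
  Y : Fin N → Sign
  Y e = τ *ₛ ν (z [ j ]≔ e)
  found : ∀ k₀ → el y x k₀ ≡ w → σ *ₛ sg (con ν u) y x k₀ ≡ pos → ∃ λ k → el (u ∷ y) x k ≡ w × c k ≡ pos
  found zero a b = zero , a , b
  found (suc i) a b = suc (suc i) , a , b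
  Y≢neg : ∀ {e} → e ≡ w ⊎ e ∈ₗ L → Y e ≢ neg
  Y≢neg (inj₁ refl) = pos≢neg p
  Y≢neg (inj₂ e∈) = q _ e∈
  prod : ∀ k → c (suc zero) ≡ neg → c k *ₛ Y (el (u ∷ y) x k) ≢ neg
  prod (suc zero) cu = pos≢neg (cong₂ _*ₛ_ cu bad)
  prod zero cu with h zero
  ... | inj₁ a = zer*≢neg _ _ a
  ... | inj₂ (a , b) = pos*≢neg _ _ a (Y≢neg b)
  prod (suc (suc i)) cu with h (suc i)
  ... | inj₁ a = zer*≢neg _ _ a
  ... | inj₂ (a , b) = pos*≢neg _ _ a (Y≢neg b)
  lift : ∀ {A B : Set} {e} → A ⊎ (B × (e ≡ w ⊎ e ∈ₗ L)) → A ⊎ (B × (e ≡ w ⊎ e ∈ₗ (u ∷ L)))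
  lift (inj₁ a) = inj₁ a
  lift (inj₂ (b , inj₁ c)) = inj₂ (b , inj₁ c)
  lift (inj₂ (b , inj₂ c)) = inj₂ (b , inj₂ (there c))
  signs : ∀ k → c k ≡ zer ⊎ (c k ≡ pos × (el (u ∷ y) x k ≡ w ⊎ el (u ∷ y) x k ∈ₗ (u ∷ L)))
  signs zero = lift (h zero)
  signs (suc (suc i)) = lift (h (suc i))
  signs (suc zero) = Sum.map₂ (_, inj₂ (here refl)) (nonneg (c (suc zero)) (λ cu →
      circuit-not-one-signed om (u ∷ y) x z j σ τ (λ k → prod k cu) (suc zero) (cong₂ _*ₛ_ cu bad)))

scan : {A : Set} {P Q : A → Set} (L : List A) → (∀ w → w ∈ₗ L → P w ⊎ Q w) →
  (∃ λ w → w ∈ₗ L × P w) ⊎ (∀ w → w ∈ₗ L → Q w)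
scan [] h = inj₂ λ _ ()
scan (a ∷ L) h with h a (here refl)
... | inj₁ p = inj₁ (a , here refl , p)
... | inj₂ q with scan L (λ w w∈ → h w (there w∈))
...   | inj₁ (w , w∈ , p) = inj₁ (w , there w∈ , p)
...   | inj₂ f = inj₂ λ { w (here refl) → q ; w (there w∈) → f w w∈ }

module _ {N r} {ν : Chi N (suc r)} (om : OM ν) where

  -- If the extreme element v of L is no longer extreme after adding u, some cocircuit Y
  -- vanishing at v separates u from L, and then Y and acyclicity show that u is extreme.
  private
    exchange-extreme : ∀ u L → Acyc ν (u ∷ L) → ∀ v w → w ∈ₗ L →
      ((z , j , σ , _) : PosCoc (con ν v) w L) → σ *ₛ ν (v ∷ (z [ j ]≔ u)) ≡ neg → Extreme ν u (u ∷ L)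
    exchange-extreme u L acyc v w w∈ _ _ _ (here refl) = inj₁ (Par-refl om u)
    exchange-extreme u L acyc v w w∈ (z , j , τ , p , q) bad w₂ (there w₂∈) with NonLoop? (con ν u) w₂
    ... | no par = inj₁ par
    ... | yes nl with farkas (con ν u) (con-OM om u)
                        (con-basis om (PosCoc-NonLoop ν (acyc u (here refl)))) w₂ L
    ...   | inj₁ Y = inj₂ (PosCoc-con-∷ om Y)
    ...   | inj₂ (y , x , σ , nz , (k₀ , el≡ , sg≡) , h) = ⊥-elim contradiction
      where
      c : Fin (suc (suc r)) → Sign
      c k = σ *ₛ sg ν (u ∷ y) x k
      in-L : ∀ {e} → e ≡ w₂ ⊎ e ∈ₗ L → e ∈ₗ L
      in-L (inj₁ refl) = w₂∈
      in-L (inj₂ e∈) = e∈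
      X = acyc w₂ (there w₂∈)
      zX = proj₁ X
      jX = proj₁ (proj₂ X)
      σX = proj₁ (proj₂ (proj₂ X))
      pX = proj₁ (proj₂ (proj₂ (proj₂ X)))
      qX = proj₂ (proj₂ (proj₂ (proj₂ X)))
      found : ∀ k₀ → el y x k₀ ≡ w₂ → σ *ₛ sg (con ν u) y x k₀ ≡ pos →
              ∃ λ k → el (u ∷ y) x k ≡ w₂ × c k ≡ pos
      found zero a b = zero , a , b
      found (suc i) a b = suc (suc i) , a , b
      -- Were the entry at `u` not negative, the lifted circuit would be nonnegative on `u ∷ L` and
      -- positive at `w₂`, against the cocircuit `X` supplied by acyclicity.
      cu≡neg : c (suc zero) ≡ neg
      cu≡neg with c (suc zero) ≟ₛ neg
      ... | yes e = e
      ... | no cu≢neg = ⊥-elim (nonneg-orthogonal om (u ∷ y) x σ zX jX σX signs k a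
                (subst (λ e → σX *ₛ ν (zX [ jX ]≔ e) ≡ pos) (sym b) pX))
        where
        k = proj₁ (found k₀ el≡ sg≡)
        b = proj₁ (proj₂ (found k₀ el≡ sg≡))
        a = proj₂ (proj₂ (found k₀ el≡ sg≡))
        lift : ∀ {A B : Set} {e} → A ⊎ (B × (e ≡ w₂ ⊎ e ∈ₗ L)) → A ⊎ (B × σX *ₛ ν (zX [ jX ]≔ e) ≢ neg)
        lift (inj₁ a) = inj₁ a
        lift (inj₂ (b , e)) = inj₂ (b , qX _ (there (in-L e)))
        signs : ∀ k → c k ≡ zer ⊎ (c k ≡ pos × σX *ₛ ν (zX [ jX ]≔ el (u ∷ y) x k) ≢ neg)
        signs zero = lift (h zero)
        signs (suc (suc i)) = lift (h (suc i))
        signs (suc zero) = Sum.map₂ (_, qX u (here refl)) (nonneg (c (suc zero)) cu≢neg)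
      Y : Fin N → Sign
      Y e = τ *ₛ ν (v ∷ (z [ j ]≔ e))
      prod : ∀ k → c k *ₛ Y (el (u ∷ y) x k) ≢ neg
      prod (suc zero) = pos≢neg (cong₂ _*ₛ_ cu≡neg bad)
      prod zero with h zero
      ... | inj₁ a = zer*≢neg _ _ a
      ... | inj₂ (a , b) = pos*≢neg _ _ a (q _ (in-L b))
      prod (suc (suc i)) with h (suc i)
      ... | inj₁ a = zer*≢neg _ _ a
      ... | inj₂ (a , b) = pos*≢neg _ _ a (q _ (in-L b))
      contradiction : ⊥
      contradiction = circuit-not-one-signed om (u ∷ y) x (v ∷ z) (suc j) σ τ prod (suc zero) (cong₂ _*ₛ_ cu≡neg bad)

    -- Only the new element `u` still needs a cocircuit, and by `farkas` the obstruction is a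
    -- nonnegative circuit of the contraction through `u`. An entry in `L` not parallel to `v` is
    -- refuted by the cocircuit for that entry, which is nonnegative at `u` too. If only `u` and
    -- elements parallel to `v` are left, any cocircuit of the contraction not vanishing at `u`
    -- refutes the circuit.
    keep-extreme : ∀ u L v → NonLoop ν v →
      (∀ w → w ∈ₗ L → Par ν v w ⊎ PosCoc (con ν v) w (u ∷ L)) → Extreme ν v (u ∷ L)
    keep-extreme u L v nlv good w (there w∈) = good w w∈
    keep-extreme u L v nlv good w (here refl) with NonLoop? (con ν v) w
    ... | no par = inj₁ par
    ... | yes (z₀ , j₀ , nz₀) with farkas (con ν v) (con-OM om v) (con-basis om nlv) w L
    ...   | inj₁ (z , j , σ , p , q) = inj₂ (z , j , σ , p ,
              λ { l (here refl) → pos≢neg p ; l (there l∈) → q l l∈ })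
    ...   | inj₂ (y , x , σ , nz , (k₀ , el≡ , sg≡) , h) = ⊥-elim
      (nonneg-orthogonal (con-OM om v) y x σ z₀ j₀ (ν (v ∷ (z₀ [ j₀ ]≔ w))) signs k₀ sg≡
        (trans (cong (λ e → ν (v ∷ (z₀ [ j₀ ]≔ w)) *ₛ ν (v ∷ (z₀ [ j₀ ]≔ e))) el≡) (*ₛ-square _ nz₀)))
      where
      Y₀ : Fin N → Sign
      Y₀ e = ν (v ∷ (z₀ [ j₀ ]≔ w)) *ₛ ν (v ∷ (z₀ [ j₀ ]≔ e))
      bound : ∀ {e} → e ≡ w ⊎ e ∈ₗ L → e ∈ₗ (w ∷ L)
      bound (inj₁ refl) = here refl
      bound (inj₂ e∈) = there e∈
      signs : ∀ k → σ *ₛ sg (con ν v) y x k ≡ zer ⊎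
                    (σ *ₛ sg (con ν v) y x k ≡ pos × Y₀ (el y x k) ≢ neg)
      signs k with h k
      ... | inj₁ a = inj₁ a
      ... | inj₂ (a , inj₁ e≡) = inj₂ (a , pos≢neg (trans (cong Y₀ e≡) (*ₛ-square _ nz₀)))
      ... | inj₂ (a , inj₂ e∈) with good _ e∈
      ...   | inj₁ par = inj₂ (a , λ eq → ≡neg⇒≢zer eq (*ₛ-zeroʳ′ (ν (v ∷ (z₀ [ j₀ ]≔ w))) (Par-vanish {ν = ν} {v} {el y x k} par z₀ j₀)))
      ...   | inj₂ (z , j , τ , p , q) =
        ⊥-elim (nonneg-orthogonal (con-OM om v) y x σ z j τ (λ l → bounded (h l)) k a p)
        where
        bounded : ∀ {A B : Set} {e} → A ⊎ (B × (e ≡ w ⊎ e ∈ₗ L)) → A ⊎ (B × τ *ₛ ν (v ∷ (z [ j ]≔ e)) ≢ neg)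
        bounded (inj₁ a) = inj₁ a
        bounded (inj₂ (b , e)) = inj₂ (b , q _ (bound e))

  extreme-exists : ∀ u L → Acyc ν (u ∷ L) → ∃ λ v → v ∈ₗ (u ∷ L) × Extreme ν v (u ∷ L)
  extreme-exists u [] acyc = u , here refl , λ { w (here refl) → inj₁ (Par-refl om u) }
  extreme-exists u L@(u' ∷ L') acyc = conclude (scan L check)
    where
    ih = extreme-exists u' L' (λ w w∈ →
      let z , j , σ , p , q = acyc w (there w∈) in z , j , σ , p , λ l l∈ → q l (there l∈))
    v = proj₁ ih
    v∈ = proj₁ (proj₂ ih)
    Bad Good : Fin N → Set
    Bad w = Σ (PosCoc (con ν v) w L) λ { (z , j , σ , _) → σ *ₛ ν (v ∷ (z [ j ]≔ u)) ≡ neg }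
    Good w = Par ν v w ⊎ PosCoc (con ν v) w (u ∷ L)
    check : ∀ w → w ∈ₗ L → Bad w ⊎ Good w
    check w w∈ with proj₂ (proj₂ ih) w w∈
    ... | inj₁ par = inj₂ (inj₁ par)
    ... | inj₂ (z , j , σ , p , q) with (σ *ₛ ν (v ∷ (z [ j ]≔ u))) ≟ₛ neg
    ...   | yes bad = inj₁ ((z , j , σ , p , q) , bad)
    ...   | no ok = inj₂ (inj₂ (z , j , σ , p , λ { l (here refl) → ok ; l (there l∈) → q l l∈ }))
    conclude : (∃ λ w → w ∈ₗ L × Bad w) ⊎ (∀ w → w ∈ₗ L → Good w) → _
    conclude (inj₁ (w , w∈ , Y , bad)) = u , here refl , exchange-extreme u L acyc v w w∈ Y bad
    conclude (inj₂ good) = v , there v∈ , keep-extreme u L v (PosCoc-NonLoop ν (acyc v (there v∈))) good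

-- Positive functionals from flags of extreme faces

PosCoc-weaken : (ν : Chi N r) {w : Fin N} {L L' : List (Fin N)} → (∀ {l} → l ∈ₗ L' → l ∈ₗ L) →
  PosCoc ν w L → PosCoc ν w L'
PosCoc-weaken ν sub (z , j , σ , p , q) = z , j , σ , p , λ l l∈ → q l (sub l∈)

-- With opposite signs, the cocircuit positive at `v` would be negative at `w`. Acyclicity thus
-- makes parallel non-loops interchangeable in every tuple.
Par-pos : {ν : Chi N (suc r)} → OM ν → ∀ {v w L} → PosCoc ν v L → w ∈ₗ L → NonLoop ν w → Par ν v w →
  ∀ z j → ν (z [ j ]≔ w) ≡ ν (z [ j ]≔ v)
Par-pos {ν = ν} om {v} {w} Y@(z₀ , j₀ , σ , p , q) w∈ nlw par z j
  with Par-sign om (PosCoc-NonLoop ν Y) nlw par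
... | zer , nz , _ = ⊥-elim (nz refl)
... | pos , _ , law = law z j
... | neg , _ , law = ⊥-elim (q w w∈ (trans (cong (σ *ₛ_) (law z₀ j₀))
        (trans (negₛ-*ʳ σ (ν (z₀ [ j₀ ]≔ v))) (cong negₛ p))))

items : List (Vec (Fin N) r) → List (Vec (Fin N) r × Fin r)
items {r = r} Δ = cartesianProduct Δ (allFin r)

∈-items : {Δ : List (Vec (Fin N) r)} {B : Vec (Fin N) r} → B ∈ₗ Δ → ∀ j → (B , j) ∈ₗ items Δ
∈-items B∈ j = MemP.∈-cartesianProduct⁺ B∈ (MemP.∈-allFin j)

∈-items⁻ : (Δ : List (Vec (Fin N) r)) {p : Vec (Fin N) r × Fin r} → p ∈ₗ items Δ → proj₁ p ∈ₗ Δ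
∈-items⁻ {r = r} Δ p∈ = proj₁ (MemP.∈-cartesianProduct⁻ Δ (allFin r) p∈)

face : Vec (Fin N) (suc r) × Fin (suc r) → Vec (Fin N) r
face (B , j) = removeAt B j

module _ {N r} {P : Vec (Fin N) (suc r) × Fin (suc r) → Set} (P? : ∀ p → Dec (P p)) (Δ : List (Vec (Fin N) (suc r))) where

  -- Serves three purposes, according to `P`: the entry removed is parallel to an extreme element,
  -- or equal to a fixed element (links), or the only one outside a facet hyperplane.
  faces : List (Vec (Fin N) r)
  faces = List.map face (filter P? (items Δ))

  ∈-faces : ∀ {B} → B ∈ₗ Δ → ∀ j → P (B , j) → removeAt B j ∈ₗ faces
  ∈-faces B∈ j p = MemP.∈-map⁺ face (MemP.∈-filter⁺ P? (∈-items B∈ j) p)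

  ∈-faces⁻ : ∀ {F} → F ∈ₗ faces → ∃ λ B → ∃ λ j → B ∈ₗ Δ × P (B , j) × F ≡ removeAt B j
  ∈-faces⁻ F∈ with MemP.∈-map⁻ face F∈
  ... | (B , j) , p∈ , eq with MemP.∈-filter⁻ P? {xs = items Δ} p∈
  ...   | p∈' , p = B , j , ∈-items⁻ Δ p∈' , p , eq

els : List (Vec (Fin N) r) → List (Fin N)
els 𝓕 = concatMap toList 𝓕

Mem⇒∈toList : {A : Set} {e : A} (x : Vec A n) → Mem e x → e ∈ₗ toList x
Mem⇒∈toList (a ∷ x) (zero , refl) = here refl
Mem⇒∈toList (a ∷ x) (suc k , eq) = there (Mem⇒∈toList x (k , eq))

∈toList⇒Mem : {A : Set} {e : A} (x : Vec A n) → e ∈ₗ toList x → Mem e x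
∈toList⇒Mem (a ∷ x) (here refl) = zero , refl
∈toList⇒Mem (a ∷ x) (there e∈) = let k , eq = ∈toList⇒Mem x e∈ in suc k , eq

∈-els : {𝓕 : List (Vec (Fin N) r)} {B : Vec (Fin N) r} {e : Fin N} → B ∈ₗ 𝓕 → Mem e B → e ∈ₗ els 𝓕
∈-els {B = B} (here refl) m = MemP.∈-++⁺ˡ (Mem⇒∈toList B m)
∈-els {𝓕 = C ∷ 𝓕} (there B∈) m = MemP.∈-++⁺ʳ (toList C) (∈-els B∈ m)

∈-els⁻ : (𝓕 : List (Vec (Fin N) r)) {e : Fin N} → e ∈ₗ els 𝓕 → ∃ λ B → B ∈ₗ 𝓕 × Mem e B
∈-els⁻ (B ∷ 𝓕) e∈ with MemP.∈-++⁻ (toList B) e∈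
... | inj₁ p = B , here refl , ∈toList⇒Mem B p
... | inj₂ p = let C , C∈ , m = ∈-els⁻ 𝓕 p in C , there C∈ , m

-- τ retracts the non-loops onto a basis adapted to a flag of flats, so x ↦ ν (map τ x) is
-- the sign of the permutation by which x is adapted to the flag.
record Retraction {N r} (ν : Chi N r) (𝓕 : List (Vec (Fin N) r)) : Set where
  field
    τ        : Fin N → Fin N
    target   : Vec (Fin N) r
    onto     : ∀ e → NonLoop ν e → Mem (τ e) target
    reflects : ∀ x → (∀ k → NonLoop ν (lookup x k)) → ν (Vec.map τ x) ≢ zer → ν x ≢ zer
    nonneg*  : ∀ B → B ∈ₗ 𝓕 → ν B *ₛ ν (Vec.map τ B) ≢ neg
    positive : ∃ λ B → B ∈ₗ 𝓕 × ν B *ₛ ν (Vec.map τ B) ≡ pos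
open Retraction public

pigeon : ∀ {m n} (x : Vec (Fin N) m) (v : Vec (Fin N) n) → n Nat.< m → (∀ k → Mem (lookup x k) v) →
  ∃ λ i → ∃ λ j → i ≢ j × lookup x i ≡ lookup x j
pigeon x v n<m h with pigeonhole n<m (proj₁ ∘ h)
... | i , j , i<j , eq = i , j , FinP.<⇒≢ i<j ,
  trans (sym (proj₂ (h i))) (trans (cong (lookup v) eq) (proj₂ (h j)))

module RetractionStep {N r} {ν : Chi N (suc r)} (om : OM ν) (𝓕 : List (Vec (Fin N) (suc r)))
  (bases : ∀ B → B ∈ₗ 𝓕 → ν B ≢ zer) (acyc : Acyc ν (els 𝓕))
  (v : Fin N) (v∈ : v ∈ₗ els 𝓕) (extreme : Extreme ν v (els 𝓕)) where

  private
    nlv : NonLoop ν v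
    nlv = PosCoc-NonLoop ν (acyc v v∈)

  P? : (p : Vec (Fin N) (suc r) × Fin (suc r)) → Dec (Par ν v (lookup (proj₁ p) (proj₂ p)))
  P? (B , j) = Par? ν v (lookup B j)

  𝓕′ : List (Vec (Fin N) r)
  𝓕′ = faces P? 𝓕

  parallel : ∀ B → B ∈ₗ 𝓕 → ∀ j → Par ν v (lookup B j) → ∀ F → ν (lookup B j ∷ F) ≡ ν (v ∷ F)
  parallel B B∈ j par F = Par-pos om (acyc v v∈) (∈-els B∈ (j , refl))
    (Mem⇒NonLoop ν (bases B B∈) (j , refl)) par (v ∷ F) zero

  bases′ : ∀ F → F ∈ₗ 𝓕′ → con ν v F ≢ zer
  bases′ F F∈ eq with ∈-faces⁻ P? 𝓕 F∈
  ... | B , j , B∈ , par , refl = Perm-basis om (bring B j) (bases B B∈) (trans (parallel B B∈ j par F) eq)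

  nonempty′ : ∃ λ F → F ∈ₗ 𝓕′
  nonempty′ with ∈-els⁻ 𝓕 v∈
  ... | B , B∈ , j , eq = removeAt B j , ∈-faces P? 𝓕 B∈ j (subst (Par ν v) (sym eq) (Par-refl om v))

  els⊆ : ∀ {e} → e ∈ₗ els 𝓕′ → e ∈ₗ els 𝓕
  els⊆ e∈ with ∈-els⁻ 𝓕′ e∈
  ... | F , F∈ , k , eq with ∈-faces⁻ P? 𝓕 F∈
  ...   | B , j , B∈ , _ , refl = ∈-els B∈ (punchIn j k , trans (sym (lookup-removeAt B j k)) eq)

  acyc′ : Acyc (con ν v) (els 𝓕′)
  acyc′ e e∈ with extreme e (els⊆ e∈)
  ... | inj₂ Y = PosCoc-weaken (con ν v) els⊆ Y
  ... | inj₁ par with ∈-els⁻ 𝓕′ e∈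
  ...   | F , F∈ , m = ⊥-elim (par (Mem⇒NonLoop (con ν v) (bases′ F F∈) m))

  module _ (R : Retraction (con ν v) 𝓕′) where

    -- The parallel class of the extreme element goes to `v`; everything else is still a non-loop of
    -- the contraction and is retracted there.
    τ₁ : Fin N → Fin N
    τ₁ e with Par? ν v e
    ... | yes _ = v
    ... | no _ = τ R e

    τ₁-par : ∀ {e} → Par ν v e → τ₁ e ≡ v
    τ₁-par {e} par with Par? ν v e
    ... | yes _ = refl
    ... | no ¬par = ⊥-elim (¬par par)

    τ₁-nonpar : ∀ {e} → ¬ Par ν v e → τ₁ e ≡ τ R e
    τ₁-nonpar {e} ¬par with Par? ν v e
    ... | yes par = ⊥-elim (¬par par)
    ... | no _ = refl

    ¬par⇒NonLoop : ∀ {e} → ¬ Par ν v e → NonLoop (con ν v) e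
    ¬par⇒NonLoop {e} = decidable-stable (NonLoop? (con ν v) e)

    -- Without an entry parallel to `v`, all `r + 1` entries are sent to the `r` entries of the
    -- target in the contraction, so two images coincide.
    has-parallel : ∀ x → ν (Vec.map τ₁ x) ≢ zer → ∃ λ j → Par ν v (lookup x j)
    has-parallel x nz = decidable-stable (any? (λ j → Par? ν v (lookup x j))) λ none →
      let i , j , i≢j , eq = pigeon (Vec.map τ₁ x) (target R) (NatP.n<1+n r) (mem none) in nz (repeated⇒zer om _ i≢j eq)
      where
      mem : ¬ (∃ λ j → Par ν v (lookup x j)) → ∀ k → Mem (lookup (Vec.map τ₁ x) k) (target R)
      mem none k = subst (λ e → Mem e (target R))
        (sym (trans (VecP.lookup-map k τ₁ x) (τ₁-nonpar λ par → none (k , par))))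
        (onto R (lookup x k) (¬par⇒NonLoop λ par → none (k , par)))

    fronted : ∀ (x : Vec (Fin N) (suc r)) j → Par ν v (lookup x j) →
      Perm (parity (toℕ j)) (Vec.map τ₁ x) (v ∷ Vec.map τ₁ (removeAt x j))
    fronted x j par = subst (λ e → Perm (parity (toℕ j)) (Vec.map τ₁ x) (e ∷ Vec.map τ₁ (removeAt x j)))
      (τ₁-par par) (Perm-map τ₁ (bring x j))

    rest-nonpar : ∀ x j → Par ν v (lookup x j) → ν (Vec.map τ₁ x) ≢ zer → ∀ k → ¬ Par ν v (lookup (removeAt x j) k)
    rest-nonpar x j par nz k par' = Perm-basis om (fronted x j par) nz
      (repeated⇒zer om _ {zero} {suc k} (λ ())
        (sym (trans (VecP.lookup-map k τ₁ (removeAt x j)) (τ₁-par par'))))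

    map-rest : ∀ (F : Vec (Fin N) r) → (∀ k → ¬ Par ν v (lookup F k)) → Vec.map τ₁ F ≡ Vec.map (τ R) F
    map-rest F h = vec-ext λ k → trans (VecP.lookup-map k τ₁ F) (trans (τ₁-nonpar (h k)) (sym (VecP.lookup-map k (τ R) F)))

    -- Moving the entry parallel to `v` to the front costs the same sign in `B` and in its image, so
    -- it cancels from the product.
    step-sign : ∀ B → B ∈ₗ 𝓕 → ∀ j → Par ν v (lookup B j) → (∀ k → ¬ Par ν v (lookup (removeAt B j) k)) →
      ν B *ₛ ν (Vec.map τ₁ B) ≡ con ν v (removeAt B j) *ₛ con ν v (Vec.map (τ R) (removeAt B j))
    step-sign B B∈ j par nonpar = begin
      ν B *ₛ ν (Vec.map τ₁ B) ≡⟨ cong₂ _*ₛ_ (alt om (bring B j)) (alt om (fronted B j par)) ⟩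
      (s *ₛ ν (lookup B j ∷ F)) *ₛ (s *ₛ ν (v ∷ Vec.map τ₁ F)) ≡⟨ *ₛ-cancel₂ s _ _ (parity≢zer (toℕ j)) ⟩
      ν (lookup B j ∷ F) *ₛ ν (v ∷ Vec.map τ₁ F)
        ≡⟨ cong₂ (λ a G → a *ₛ ν (v ∷ G)) (parallel B B∈ j par F) (map-rest F nonpar) ⟩
      ν (v ∷ F) *ₛ ν (v ∷ Vec.map (τ R) F) ∎
      where
      open ≡-Reasoning
      s = parity (toℕ j)
      F = removeAt B j

    extend : Retraction ν 𝓕
    extend .τ = τ₁
    extend .target = v ∷ target R
    extend .onto e nl with Par? ν v e
    ... | yes _ = zero , refl
    ... | no ¬par = let k , eq = onto R e (¬par⇒NonLoop ¬par) in suc k , eq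
    extend .reflects x nl nz =
      let j , par = has-parallel x nz
          σ , σnz , law = Par-sign om nlv (nl j) par
      in Perm-basis om (Perm-sym (bring x j)) λ eq →
        reflects R (removeAt x j) (λ k → ¬par⇒NonLoop (rest-nonpar x j par nz k))
          (λ eq' → Perm-basis om (fronted x j par) nz
            (trans (cong (λ G → ν (v ∷ G)) (map-rest _ (rest-nonpar x j par nz))) eq'))
          (¬≢zer⇒≡ λ nz' → *ₛ-nonzero σ _ σnz nz' (trans (sym (law (v ∷ removeAt x j) zero)) eq))
    extend .nonneg* B B∈ eq =
      let nz = *ₛ-nonzeroʳ (ν B) _ (≡neg⇒≢zer eq)
          j , par = has-parallel B nz
      in nonneg* R (removeAt B j) (∈-faces P? 𝓕 B∈ j par) (trans (sym (step-sign B B∈ j par (rest-nonpar B j par nz))) eq)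
    extend .positive =
      let F , F∈ , eq = positive R
          B , j , B∈ , par , F≡ = ∈-faces⁻ P? 𝓕 F∈
      in B , B∈ , trans (step-sign B B∈ j par λ k par' → par' (Mem⇒NonLoop (con ν v) (bases′ F F∈) (k , cong (λ G → lookup G k) F≡)))
           (subst (λ G → con ν v G *ₛ con ν v (Vec.map (τ R) G) ≡ pos) F≡ eq)

retraction : ∀ {r} {ν : Chi N r} → OM ν → (𝓕 : List (Vec (Fin N) r)) → (∀ B → B ∈ₗ 𝓕 → ν B ≢ zer) →
  (∃ λ B → B ∈ₗ 𝓕) → Acyc ν (els 𝓕) → Retraction ν 𝓕
retraction {r = zero} om 𝓕 bases ([] , B∈) acyc = record
  { τ = id ; target = [] ; onto = λ { e (_ , () , _) } ; reflects = λ { [] _ nz → nz }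
  ; nonneg* = λ { [] B∈ eq → pos≢neg (*ₛ-square _ (bases [] B∈)) eq }
  ; positive = [] , B∈ , *ₛ-square _ (bases [] B∈) }
retraction {r = suc r} {ν} om 𝓕 bases (B@(b ∷ _) , B∈) acyc with els 𝓕 in eq
... | [] with () ← subst (b ∈ₗ_) eq (∈-els {B = B} B∈ (zero , refl))
... | u ∷ L with extreme-exists om u L acyc
...   | v , v∈ , extreme = extend (retraction (con-OM om v) 𝓕′ bases′ nonempty′ acyc′)
  where open RetractionStep om 𝓕 bases (subst (Acyc ν) (sym eq) acyc) v (subst (v ∈ₗ_) (sym eq) v∈) (subst (Extreme ν v) (sym eq) extreme)

-- Finite sums in an abelian group, and cancellation of matched terms

module GroupSums {c ℓ} (A : AbelianGroup c ℓ) where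
  open AbelianGroup A renaming (refl to ≈-refl; sym to ≈-sym; trans to ≈-trans)
  open import Relation.Binary.Reasoning.Setoid setoid
  open import Algebra.Properties.AbelianGroup A using (⁻¹-∙-comm)
  open import Algebra.Properties.Group group using (⁻¹-involutive; ε⁻¹≈ε)

  -- Since `zer` acts as zero, degenerate tuples drop out of sums without case distinctions, and the
  -- action remains multiplicative.
  act : Sign → Carrier → Carrier
  act pos a = a
  act neg a = a ⁻¹
  act zer a = ε

  act-cong : ∀ s {a b} → a ≈ b → act s a ≈ act s b
  act-cong pos eq = eq
  act-cong neg eq = ⁻¹-cong eq
  act-cong zer eq = ≈-refl

  act-* : ∀ s t a → act s (act t a) ≈ act (s *ₛ t) a
  act-* pos t a = ≈-refl
  act-* zer t a = ≈-refl
  act-* neg pos a = ≈-refl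
  act-* neg neg a = ⁻¹-involutive a
  act-* neg zer a = ε⁻¹≈ε

  act-ε : ∀ s → act s ε ≈ ε
  act-ε pos = ≈-refl
  act-ε neg = ε⁻¹≈ε
  act-ε zer = ≈-refl

  act-∙ : ∀ s a b → act s (a ∙ b) ≈ act s a ∙ act s b
  act-∙ pos a b = ≈-refl
  act-∙ neg a b = ≈-sym (⁻¹-∙-comm a b)
  act-∙ zer a b = ≈-sym (identityˡ ε)

  act-negₛ : ∀ s a → act s a ∙ act (negₛ s) a ≈ ε
  act-negₛ pos a = inverseʳ a
  act-negₛ neg a = inverseˡ a
  act-negₛ zer a = identityˡ ε

  sumL : {I : Set} → (I → Carrier) → List I → Carrier
  sumL f [] = ε
  sumL f (p ∷ L) = f p ∙ sumL f L

  module _ {I : Set} where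

    sum-cong : ∀ {f g : I → Carrier} L → (∀ p → p ∈ₗ L → f p ≈ g p) → sumL f L ≈ sumL g L
    sum-cong [] h = ≈-refl
    sum-cong (p ∷ L) h = ∙-cong (h p (here refl)) (sum-cong L λ q q∈ → h q (there q∈))

    sum-++ : ∀ (f : I → Carrier) L M → sumL f (L ++ M) ≈ sumL f L ∙ sumL f M
    sum-++ f [] M = ≈-sym (identityˡ _)
    sum-++ f (p ∷ L) M = ≈-trans (∙-congˡ (sum-++ f L M)) (≈-sym (assoc _ _ _))

    sum-ε : ∀ {f : I → Carrier} L → (∀ p → p ∈ₗ L → f p ≈ ε) → sumL f L ≈ ε
    sum-ε [] h = ≈-refl
    sum-ε (p ∷ L) h = ≈-trans (∙-cong (h p (here refl)) (sum-ε L λ q q∈ → h q (there q∈))) (identityˡ ε)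

    sum-act : ∀ s (f : I → Carrier) L → act s (sumL f L) ≈ sumL (act s ∘ f) L
    sum-act s f [] = act-ε s
    sum-act s f (p ∷ L) = ≈-trans (act-∙ s _ _) (∙-congˡ (sum-act s f L))

    sum-map : {J : Set} (f : I → Carrier) (g : J → I) → ∀ L → sumL f (List.map g L) ≈ sumL (f ∘ g) L
    sum-map f g [] = ≈-refl
    sum-map f g (p ∷ L) = ∙-congˡ (sum-map f g L)

    sum-split : {P : I → Set} (P? : ∀ p → Dec (P p)) (f : I → Carrier) → ∀ L →
      sumL f L ≈ sumL f (filter P? L) ∙ sumL f (filter (¬? ∘ P?) L)
    sum-split P? f [] = ≈-sym (identityˡ ε)
    sum-split P? f (p ∷ L) with P? p
    ... | yes _ = ≈-trans (∙-congˡ (sum-split P? f L)) (≈-sym (assoc _ _ _))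
    ... | no _ = ≈-trans (∙-congˡ (≈-trans (sum-split P? f L) (comm _ _)))
                   (≈-trans (≈-sym (assoc _ _ _)) (comm _ _))

    sum-filter : {P : I → Set} (P? : ∀ p → Dec (P p)) (f : I → Carrier) → ∀ L →
      (∀ p → p ∈ₗ L → ¬ P p → f p ≈ ε) → sumL f L ≈ sumL f (filter P? L)
    sum-filter P? f [] h = ≈-refl
    sum-filter P? f (p ∷ L) h with P? p
    ... | yes _ = ∙-congˡ (sum-filter P? f L λ q q∈ → h q (there q∈))
    ... | no ¬p = ≈-trans (∙-cong (h p (here refl) ¬p) (sum-filter P? f L λ q q∈ → h q (there q∈))) (identityˡ _)

    sum-extract : ∀ (f : I → Carrier) L q M → sumL f (L ++ q ∷ M) ≈ f q ∙ sumL f (L ++ M)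
    sum-extract f [] q M = ≈-refl
    sum-extract f (p ∷ L) q M = begin
      f p ∙ sumL f (L ++ q ∷ M) ≈⟨ ∙-congˡ (sum-extract f L q M) ⟩
      f p ∙ (f q ∙ sumL f (L ++ M)) ≈⟨ assoc _ _ _ ⟨
      (f p ∙ f q) ∙ sumL f (L ++ M) ≈⟨ ∙-congʳ (comm _ _) ⟩
      (f q ∙ f p) ∙ sumL f (L ++ M) ≈⟨ assoc _ _ _ ⟩
      f q ∙ (f p ∙ sumL f (L ++ M)) ∎

    ∈-reinsert : ∀ (xs : List I) {ys q t} → t ∈ₗ (xs ++ ys) → t ∈ₗ (xs ++ q ∷ ys)
    ∈-reinsert xs t∈ with MemP.∈-++⁻ xs t∈
    ... | inj₁ a = MemP.∈-++⁺ˡ a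
    ... | inj₂ b = MemP.∈-++⁺ʳ xs (there b)

    ∈-delete : ∀ (xs : List I) {ys q t} → t ≢ q → t ∈ₗ (xs ++ q ∷ ys) → t ∈ₗ (xs ++ ys)
    ∈-delete xs t≢q t∈ with MemP.∈-++⁻ xs t∈
    ... | inj₁ a = MemP.∈-++⁺ˡ a
    ... | inj₂ (here t≡q) = ⊥-elim (t≢q t≡q)
    ... | inj₂ (there b) = MemP.∈-++⁺ʳ xs b

    Unique-remove : ∀ L {q : I} M → Unique (L ++ q ∷ M) → Unique (L ++ M) × (∀ p → p ∈ₗ (L ++ M) → p ≢ q)
    Unique-remove [] M (h ∷ u) = u , λ p p∈ eq → All.lookup h p∈ (sym eq)
    Unique-remove (a ∷ L) {q} M (h ∷ u) with Unique-remove L M u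
    ... | u' , h' = drop h ∷ u' ,
        λ { p (here refl) eq → All.lookup h (MemP.∈-++⁺ʳ L (here refl)) eq ; p (there p∈) → h' p p∈ }
      where
      drop : All (a ≢_) (L ++ q ∷ M) → All (a ≢_) (L ++ M)
      drop h = AllP.++⁺ (AllP.++⁻ˡ L h) (All.tail (AllP.++⁻ʳ L h))

    sum-single : ∀ (f : I → Carrier) L q → Unique L → q ∈ₗ L → (∀ p → p ∈ₗ L → p ≢ q → f p ≈ ε) → sumL f L ≈ f q
    sum-single f L q uniq q∈ h with MemP.∈-∃++ q∈
    ... | xs , ys , refl with Unique-remove xs ys uniq
    ...   | _ , ≢q = ≈-trans (sum-extract f xs q ys)
      (≈-trans (∙-congˡ (sum-ε (xs ++ ys) λ p p∈ → h p (∈-reinsert xs p∈) (≢q p p∈))) (identityʳ _))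

    sum-double : ∀ (f : I → Carrier) L q q' → Unique L → q ∈ₗ L → q' ∈ₗ L → q' ≢ q →
      (∀ p → p ∈ₗ L → p ≢ q → p ≢ q' → f p ≈ ε) → sumL f L ≈ f q ∙ f q'
    sum-double f L q q' uniq q∈ q'∈ q'≢q h with MemP.∈-∃++ q∈
    ... | xs , ys , refl with Unique-remove xs ys uniq
    ...   | uniq' , ≢q = ≈-trans (sum-extract f xs q ys)
      (∙-congˡ (sum-single f (xs ++ ys) q' uniq' (∈-delete xs q'≢q q'∈)
        λ p p∈ → h p (∈-reinsert xs p∈) (≢q p p∈)))

    module _ (f : I → Carrier) (R : I → I → Set) (R-sym : ∀ {p q} → R p q → R q p)
      (R-functional : ∀ {p q q'} → R p q → R p q' → q ≡ q') (R-irrefl : ∀ {p q} → R p q → p ≢ q)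
      (R-cancel : ∀ {p q} → R p q → f p ∙ f q ≈ ε) where

      -- The first term is removed together with its mate; symmetry and functionality of `R` keep
      -- the mates of the remaining terms in the list. The bound `n` is the recursion measure,
      -- because the list also shrinks in its middle.
      sum-cancel : ∀ n L → length L Nat.≤ n → Unique L → (∀ p → p ∈ₗ L → ∃ λ q → q ∈ₗ L × R p q) → sumL f L ≈ ε
      sum-cancel n [] _ _ _ = ≈-refl
      sum-cancel (suc n) (p ∷ L) (Nat.s≤s len) (p∉ ∷ uniq) mate with mate p (here refl)
      ... | q , here refl , Rpq = ⊥-elim (R-irrefl Rpq refl)
      ... | q , there q∈ , Rpq with MemP.∈-∃++ q∈
      ...   | xs , ys , refl with Unique-remove xs ys uniq
      ...     | uniq' , ≢q = begin
        f p ∙ sumL f (xs ++ q ∷ ys) ≈⟨ ∙-congˡ (sum-extract f xs q ys) ⟩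
        f p ∙ (f q ∙ sumL f (xs ++ ys)) ≈⟨ assoc _ _ _ ⟨
        (f p ∙ f q) ∙ sumL f (xs ++ ys) ≈⟨ ∙-cong (R-cancel Rpq)
          (sum-cancel n (xs ++ ys) shorter uniq' mate') ⟩
        ε ∙ ε ≈⟨ identityˡ ε ⟩
        ε ∎
        where
        shorter : length (xs ++ ys) Nat.≤ n
        shorter = NatP.≤-trans (NatP.≤-reflexive (ListP.length-++ xs))
          (NatP.≤-trans (NatP.+-monoʳ-≤ (length xs) (NatP.n≤1+n _))
            (NatP.≤-trans (NatP.≤-reflexive (sym (ListP.length-++ xs))) len))
        mate' : ∀ t → t ∈ₗ (xs ++ ys) → ∃ λ u → u ∈ₗ (xs ++ ys) × R t u
        mate' t t∈ with mate t (there (∈-reinsert xs t∈))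
        ... | u , here refl , Rtu = ⊥-elim (≢q t t∈ (R-functional (R-sym Rtu) Rpq))
        ... | u , there u∈ , Rtu = u , ∈-delete xs u≢q u∈ , Rtu
          where
          u≢q : u ≢ q
          u≢q refl = All.lookup p∉ (∈-reinsert xs t∈) (R-functional (R-sym Rpq) (R-sym Rtu))

  sum-product : {I J : Set} (f : I × J → Carrier) → ∀ L (M : List J) →
    sumL f (cartesianProduct L M) ≈ sumL (λ i → sumL (λ j → f (i , j)) M) L
  sum-product f [] M = ≈-refl
  sum-product f (i ∷ L) M = ≈-trans (sum-++ f (List.map (i ,_) M) _)
    (∙-cong (sum-map-pair M) (sum-product f L M))
    where
    sum-map-pair : ∀ M → sumL f (List.map (i ,_) M) ≈ sumL (λ j → f (i , j)) M
    sum-map-pair [] = ≈-refl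
    sum-map-pair (j ∷ M) = ∙-congˡ (sum-map-pair M)

-- Triangulations and the cancellation of interior facets

Simplex : List (Vec (Fin N) r) → Chi N r → Vec (Fin N) r → Set
Simplex Δ ν x = ν x ≢ zer × ∃ λ B → B ∈ₗ Δ × Sub x B

-- For a basis `x`: all elements lie weakly on the side of `x_j`, so the other entries span a facet
-- hyperplane whose positive cocircuit is the displayed product.
Bd : Chi N r → Vec (Fin N) r × Fin r → Set
Bd ν (x , j) = ∀ e → ν x *ₛ ν (x [ j ]≔ e) ≢ neg

Bd? : (ν : Chi N r) → ∀ p → Dec (Bd ν p)
Bd? ν (x , j) = all? λ e → ¬? (_ ≟ₛ neg)

-- Circuits are presented as fundamental circuits of a basis `y` and a further non-loop `x`; the
-- sign `σ` covers both orientations.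
NoCircuit : Chi N r → List (Vec (Fin N) r) → Set
NoCircuit ν Δ = ∀ B B' → B ∈ₗ Δ → B' ∈ₗ Δ → ∀ y x σ → ν y ≢ zer → ¬ Mem x y → NonLoop ν x → σ ≢ zer →
  (∀ k → σ *ₛ sg ν y x k ≡ pos → Mem (el y x k) B) →
  ¬ (∀ k → σ *ₛ sg ν y x k ≡ neg → Mem (el y x k) B')

-- Facets are phrased through signed exchange, for arbitrary orderings `x` of the simplices; in this
-- form the axioms pass to links and to facet hyperplanes. Nonemptiness is kept apart because a link
-- may be empty.
record Triang {N r} (ν : Chi N r) (Δ : List (Vec (Fin N) r)) : Set where
  field
    bases    : ∀ B → B ∈ₗ Δ → ν B ≢ zer
    unique   : Unique Δ
    distinct : ∀ B B' → B ∈ₗ Δ → B' ∈ₗ Δ → Sub B B' → B ≡ B'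
    nc       : NoCircuit ν Δ
    fac      : ∀ x → Simplex Δ ν x → ∀ j →
               Bd ν (x , j) ⊎ (∃ λ e → Simplex Δ ν (x [ j ]≔ e) × ν x *ₛ ν (x [ j ]≔ e) ≡ neg)
open Triang public

Inj-update : {A : Set} (x : Vec A n) {e : A} → Inj x → ¬ Mem e x → ∀ j → Inj (x [ j ]≔ e)
Inj-update x {e} inj e∉ j a b eq with a ≟ j | b ≟ j
... | yes refl | yes refl = refl
... | yes refl | no b≢j = ⊥-elim (e∉ (b , sym (trans (sym (VecP.lookup∘update a x e))
                            (trans eq (VecP.lookup∘update′ b≢j x e)))))
... | no a≢j | yes refl = ⊥-elim (e∉ (a , trans (sym (VecP.lookup∘update′ a≢j x e))
                            (trans eq (VecP.lookup∘update b x e))))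
... | no a≢j | no b≢j = inj a b (trans (sym (VecP.lookup∘update′ a≢j x e)) (trans eq (VecP.lookup∘update′ b≢j x e)))

module _ {N r} {ν : Chi N r} (om : OM ν) {Δ : List (Vec (Fin N) r)} where

  Simplex-Perm : ∀ {s x y} → Perm s x y → Simplex Δ ν x → Simplex Δ ν y
  Simplex-Perm {x = x} p (nz , B , B∈ , sub) = Perm-basis om p nz , B , B∈ ,
    λ k → Sub-Mem {x = x} {B} sub (Perm-Mem (Perm-sym p) (k , refl))

  Simplex-Sub : ∀ {x} → (S : Simplex Δ ν x) → Sub (proj₁ (proj₂ S)) x
  Simplex-Sub {x} (nz , B , B∈ , sub) =
    Perm⇒Sub (Perm-sym (proj₂ (Sub⇒Perm x B (nonzero⇒Inj om nz) sub)))

module _ {N r} {ν : Chi N r} (om : OM ν) {Δ : List (Vec (Fin N) r)} where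

  -- For two simplices on the same side of a common facet, the fundamental circuit of `e` over `x`
  -- is negative at `x_j`; its positive part then lies in one simplex and its negative part in the
  -- other.
  no-circuit⇒one-sided : NoCircuit ν Δ → ∀ x j e → Simplex Δ ν x → Simplex Δ ν (x [ j ]≔ e) → ν x *ₛ ν (x [ j ]≔ e) ≡ pos → e ≡ lookup x j
  no-circuit⇒one-sided nc′ x j e (nz , B , B∈ , sub) (nz' , B' , B'∈ , sub') same with e ≟ lookup x j
  ... | yes e≡ = e≡
  ... | no e≢ = ⊥-elim (nc′ B' B B'∈ B∈ x e (ν x) nz e∉x (x , j , nz') nz positive' negative)
    where
    e∉x : ¬ Mem e x
    e∉x (k , eq) with k ≟ j
    ... | yes refl = e≢ (sym eq)
    ... | no k≢j = nz' (update-other om x k≢j (sym eq))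
    positive' : ∀ k → ν x *ₛ sg ν x e k ≡ pos → Mem (el x e k) B'
    positive' zero _ = Sub-Mem {x = x [ j ]≔ e} {B'} sub' (Mem-update x j)
    positive' (suc i) eq with i ≟ j
    ... | yes refl = ⊥-elim (pos≢neg eq (trans (negₛ-*ʳ (ν x) _) (cong negₛ same)))
    ... | no i≢j = Sub-Mem {x = x [ j ]≔ e} {B'} sub' (Mem-update′ x i≢j)
    negative : ∀ k → ν x *ₛ sg ν x e k ≡ neg → Mem (el x e k) B
    negative zero eq = ⊥-elim (pos≢neg (*ₛ-square (ν x) nz) eq)
    negative (suc i) _ = sub i

module _ {N r} {ν : Chi N r} (om : OM ν) {Δ : List (Vec (Fin N) r)} (T : Triang ν Δ) where

  ∈⇒Simplex : ∀ {B} → B ∈ₗ Δ → Simplex Δ ν B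
  ∈⇒Simplex {B} B∈ = bases T B B∈ , B , B∈ , λ k → k , refl

  one-sided : ∀ x j e → Simplex Δ ν x → Simplex Δ ν (x [ j ]≔ e) → ν x *ₛ ν (x [ j ]≔ e) ≡ pos → e ≡ lookup x j
  one-sided = no-circuit⇒one-sided om (nc T)

  Adj : Vec (Fin N) r × Fin r → Vec (Fin N) r × Fin r → Set
  Adj (B , j) (B' , j') = B ≢ B' × Sub (B [ j ]≔ lookup B' j') B' × Sub (B' [ j' ]≔ lookup B j) B

  Adj-sym : ∀ {p q} → Adj p q → Adj q p
  Adj-sym (ne , s , t) = ne ∘ sym , t , s

  module _ {B j B' j'} (B∈ : B ∈ₗ Δ) (B'∈ : B' ∈ₗ Δ) (adj : Adj (B , j) (B' , j')) where

    private
      e : Fin N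
      e = lookup B' j'
      x : Vec (Fin N) r
      x = B [ j ]≔ e

    Adj-fresh : ¬ Mem e B
    Adj-fresh m = proj₁ adj (sym (distinct T B' B B'∈ B∈ sub))
      where
      sub : Sub B' B
      sub k with k ≟ j'
      ... | yes refl = m
      ... | no k≢j' = Sub-Mem {x = B' [ j' ]≔ lookup B j} {B} (proj₂ (proj₂ adj)) (Mem-update′ B' k≢j')

    Adj-Perm : ∃ λ s → Perm s x B'
    Adj-Perm = Sub⇒Perm x B' (Inj-update B (nonzero⇒Inj om (bases T B B∈)) Adj-fresh j) (proj₁ (proj₂ adj))

    Adj-Simplex : Simplex Δ ν x
    Adj-Simplex = Perm-basis om (Perm-sym (proj₂ Adj-Perm)) (bases T B' B'∈) , B' , B'∈ , proj₁ (proj₂ adj)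

    Adj-opposite : ν B *ₛ ν x ≡ neg
    Adj-opposite = ≢zer∧≢pos⇒neg _ (*ₛ-nonzero _ _ (bases T B B∈) (proj₁ Adj-Simplex)) λ same →
      Adj-fresh (j , sym (one-sided B j e (∈⇒Simplex B∈) Adj-Simplex same))

    -- The permutation matching two simplices across their common facet also matches the cones from
    -- `a` over that facet, so the values of an alternating function on these cones differ by a
    -- known sign.
    Adj-replace : ∀ a → Perm (proj₁ Adj-Perm) (B [ j ]≔ a) (B' [ j' ]≔ a)
    Adj-replace a = subst₂P (trans (map-put x injx j a (VecP.lookup∘update j B e)) (VecP.[]≔-idempotent B j))
      (map-put B' (nonzero⇒Inj om (bases T B' B'∈)) j' a refl) (Perm-map (put e a) (proj₂ Adj-Perm))
      where
      injx = Inj-update B (nonzero⇒Inj om (bases T B B∈)) Adj-fresh j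
      subst₂P : ∀ {s} {a b c d : Vec (Fin N) r} → a ≡ b → c ≡ d → Perm s a c → Perm s b d
      subst₂P refl refl p = p

  -- Two neighbours across one facet are both opposite to `B`, hence on the same side of the facet,
  -- and `one-sided` identifies their remaining vertices.
  Adj-functional : ∀ {B j B' j' B'' j''} → B ∈ₗ Δ → B' ∈ₗ Δ → B'' ∈ₗ Δ →
    Adj (B , j) (B' , j') → Adj (B , j) (B'' , j'') → (B' , j') ≡ (B'' , j'')
  Adj-functional {B} {j} {B'} {j'} {B''} {j''} B∈ B'∈ B''∈ a a' = same
    where
    e = lookup B' j'
    e' = lookup B'' j''
    x = B [ j ]≔ e
    idem : x [ j ]≔ e' ≡ B [ j ]≔ e'
    idem = VecP.[]≔-idempotent B j
    negneg : ∀ a b c → a *ₛ b ≡ neg → a *ₛ c ≡ neg → b *ₛ c ≡ pos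
    negneg = decide (allSigns? λ a → allSigns? λ b → allSigns? λ c →
      (_ ≟ₛ _) →-dec ((_ ≟ₛ _) →-dec (_ ≟ₛ _))) tt
    e'≡e : e' ≡ e
    e'≡e = trans (one-sided x j e' (Adj-Simplex B∈ B'∈ a)
        (subst (Simplex Δ ν) (sym idem) (Adj-Simplex B∈ B''∈ a'))
        (trans (cong (λ z → ν x *ₛ ν z) idem)
          (negneg (ν B) _ _ (Adj-opposite B∈ B'∈ a) (Adj-opposite B∈ B''∈ a'))))
      (VecP.lookup∘update j B e)
    sub : Sub B' B''
    sub k = Sub-Mem {x = x} {B''} (subst (λ f → Sub (B [ j ]≔ f) B'') e'≡e (proj₁ (proj₂ a')))
      (Perm-Mem (Perm-sym (proj₂ (Adj-Perm B∈ B'∈ a))) (k , refl))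
    same : (B' , j') ≡ (B'' , j'')
    same with distinct T B' B'' B'∈ B''∈ sub
    ... | refl = cong (B' ,_) (nonzero⇒Inj om (bases T B' B'∈) j' j'' (sym e'≡e))

  Adj-exists : ∀ {B j} → B ∈ₗ Δ → ¬ Bd ν (B , j) → ∃ λ B' → ∃ λ j' → B' ∈ₗ Δ × Adj (B , j) (B' , j')
  Adj-exists {B} {j} B∈ ¬bd with fac T B (∈⇒Simplex B∈) j
  ... | inj₁ bd = ⊥-elim (¬bd bd)
  ... | inj₂ (e , S@(nz , B' , B'∈ , sub) , opp) with Sub-Mem {x = B [ j ]≔ e} {B'} sub (Mem-update B j)
  ...   | j' , refl = B' , j' , B'∈ , B≢B' , sub , sub'
    where
    e∉B : ¬ Mem e B
    e∉B (k , eq) with k ≟ j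
    ... | yes refl = pos≢neg (*ₛ-square _ (bases T B B∈)) (trans (cong (ν B *ₛ_) (sym (update-same om B j (sym eq)))) opp)
    ... | no k≢j = nz (update-other om B k≢j (sym eq))
    B≢B' : B ≢ B'
    B≢B' refl = e∉B (j' , refl)
    sub' : Sub (B' [ j' ]≔ lookup B j) B
    sub' k with Mem-update⁻ B' j' (k , refl)
    ... | inj₁ eq = j , sym eq
    ... | inj₂ (m , m≢j' , eq) with Mem-update⁻ B j (Sub-Mem {x = B'} {B [ j ]≔ lookup B' j'} (Simplex-Sub om S) (m , eq))
    ...   | inj₁ eq' = ⊥-elim (m≢j' (nonzero⇒Inj om (bases T B' B'∈) m j' (trans eq eq')))
    ...   | inj₂ (l , _ , eq') = l , eq'

  Adj-Bd : ∀ {B j B' j'} → B ∈ₗ Δ → B' ∈ₗ Δ → Adj (B , j) (B' , j') → ¬ Bd ν (B' , j')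
  Adj-Bd {B} {j} {B'} {j'} B∈ B'∈ a bd = bd (lookup B j) (begin
      ν B' *ₛ ν (B' [ j' ]≔ lookup B j)
        ≡⟨ cong (λ z → ν B' *ₛ z) (trans (sym (trans (cong (s *ₛ_) (alt om (Adj-replace B∈ B'∈ a (lookup B j))))
             (*ₛ-cancel s _ (Perm-nonzero p)))) (cong (λ z → s *ₛ ν z) (VecP.[]≔-lookup B j))) ⟩
      ν B' *ₛ (s *ₛ ν B)
        ≡⟨ cong (_*ₛ (s *ₛ ν B)) (trans (sym (*ₛ-cancel s (ν B') (Perm-nonzero p))) (cong (s *ₛ_) (sym (alt om p)))) ⟩
      (s *ₛ ν x) *ₛ (s *ₛ ν B) ≡⟨ regroup s (ν x) (ν B) (Perm-nonzero p) ⟩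
      ν B *ₛ ν x ≡⟨ Adj-opposite B∈ B'∈ a ⟩
      neg ∎)
    where
    open ≡-Reasoning
    x = B [ j ]≔ lookup B' j'
    s = proj₁ (Adj-Perm B∈ B'∈ a)
    p = proj₂ (Adj-Perm B∈ B'∈ a)
    regroup : ∀ s a b → s ≢ zer → (s *ₛ a) *ₛ (s *ₛ b) ≡ b *ₛ a
    regroup = decide (allSigns? λ s → allSigns? λ a → allSigns? λ b → ¬? (_ ≟ₛ _) →-dec (_ ≟ₛ _)) tt

  module Boundary {c ℓ} (A : AbelianGroup c ℓ) where
    open AbelianGroup A using (Carrier; _≈_; _∙_; ε; setoid; identityʳ; ∙-cong; ∙-congˡ)
      renaming (refl to ≈-refl; sym to ≈-sym; trans to ≈-trans; reflexive to ≈-reflexive)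
    open GroupSums A
    open import Relation.Binary.Reasoning.Setoid setoid

    module _ (W : Vec (Fin N) r → Carrier) (a : Fin N) (nla : NonLoop ν a)
      (W-alt : ∀ {s x y} → (∀ k → NonLoop ν (lookup x k)) → Perm s x y → W x ≈ act s (W y))
      (W-cone : ∀ B → B ∈ₗ Δ → W B ≈ sumL (λ j → W (B [ j ]≔ a)) (allFin r)) where

      term : Vec (Fin N) r × Fin r → Carrier
      term (B , j) = act (ν B) (W (B [ j ]≔ a))

      private
        interior? : ∀ p → Dec (¬ Bd ν p)
        interior? p = ¬? (Bd? ν p)

        L : List (Vec (Fin N) r × Fin r)
        L = filter interior? (items Δ)

        R : Vec (Fin N) r × Fin r → Vec (Fin N) r × Fin r → Set
        R p q = proj₁ p ∈ₗ Δ × proj₁ q ∈ₗ Δ × Adj p q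

        R-cancel : ∀ {p q} → R p q → term p ∙ term q ≈ ε
        R-cancel {B , j} {B' , j'} (B∈ , B'∈ , adj) = begin
          act (ν B) (W (B [ j ]≔ a)) ∙ act (ν B') w
            ≈⟨ ∙-cong (≈-trans (act-cong (ν B) (W-alt nl (Adj-replace B∈ B'∈ adj a))) (act-* (ν B) s w))
                      (≈-reflexive (cong (λ t → act t w) sign)) ⟩
          act (ν B *ₛ s) w ∙ act (negₛ (ν B *ₛ s)) w ≈⟨ act-negₛ (ν B *ₛ s) w ⟩
          ε ∎
          where
          w = W (B' [ j' ]≔ a)
          s = proj₁ (Adj-Perm B∈ B'∈ adj)
          p = proj₂ (Adj-Perm B∈ B'∈ adj)
          nl : ∀ k → NonLoop ν (lookup (B [ j ]≔ a) k)
          nl k with Mem-update⁻ B j {a} (k , refl)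
          ... | inj₁ eq = subst (NonLoop ν) (sym eq) nla
          ... | inj₂ (m , _ , eq) = Mem⇒NonLoop ν (bases T B B∈) (m , eq)
          combine : ∀ b x b' s → s ≢ zer → b *ₛ x ≡ neg → x ≡ s *ₛ b' → b' ≡ negₛ (b *ₛ s)
          combine = decide (allSigns? λ b → allSigns? λ x → allSigns? λ b' → allSigns? λ s →
            ¬? (_ ≟ₛ _) →-dec ((_ ≟ₛ _) →-dec ((_ ≟ₛ _) →-dec (_ ≟ₛ _)))) tt
          sign : ν B' ≡ negₛ (ν B *ₛ s)
          sign = combine (ν B) _ (ν B') s (Perm-nonzero p) (Adj-opposite B∈ B'∈ adj) (alt om p)

        interior-cancels : sumL term L ≈ ε
        interior-cancels = sum-cancel term R
          (λ (p∈ , q∈ , adj) → q∈ , p∈ , Adj-sym adj)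
          (λ (p∈ , q∈ , adj) (_ , q'∈ , adj') → Adj-functional p∈ q∈ q'∈ adj adj')
          (λ (_ , _ , adj) eq → proj₁ adj (cong proj₁ eq))
          R-cancel (length L) L NatP.≤-refl
          (UniqueP.filter⁺ interior? (UniqueP.cartesianProduct⁺ (unique T) (UniqueP.allFin⁺ r)))
          mate
          where
          mate : ∀ p → p ∈ₗ L → ∃ λ q → q ∈ₗ L × R p q
          mate (B , j) p∈ with MemP.∈-filter⁻ interior? {xs = items Δ} p∈
          ... | p∈' , ¬bd with Adj-exists (∈-items⁻ Δ p∈') ¬bd
          ...   | B' , j' , B'∈ , adj = (B' , j') ,
                    MemP.∈-filter⁺ interior? (∈-items B'∈ j') (Adj-Bd (∈-items⁻ Δ p∈') B'∈ adj) ,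
                    ∈-items⁻ Δ p∈' , B'∈ , adj

      -- `W-cone` rewrites a simplex as the sum of the cones from `a` over its facets. An interior
      -- facet occurs twice, with cones equal up to the matching permutation and with opposite
      -- signs. The group is arbitrary so that integers and Orlik-Solomon classes are treated alike.
      boundary-formula : sumL (λ B → act (ν B) (W B)) Δ ≈ sumL term (filter (Bd? ν) (items Δ))
      boundary-formula = begin
        sumL (λ B → act (ν B) (W B)) Δ
          ≈⟨ sum-cong Δ (λ B B∈ → ≈-trans (act-cong (ν B) (W-cone B B∈)) (sum-act (ν B) _ (allFin r))) ⟩
        sumL (λ B → sumL (λ j → term (B , j)) (allFin r)) Δ ≈⟨ sum-product term Δ (allFin r) ⟨
        sumL term (items Δ) ≈⟨ sum-split (Bd? ν) term (items Δ) ⟩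
        sumL term (filter (Bd? ν) (items Δ)) ∙ sumL term L ≈⟨ ∙-congˡ interior-cancels ⟩
        sumL term (filter (Bd? ν) (items Δ)) ∙ ε ≈⟨ identityʳ _ ⟩
        sumL term (filter (Bd? ν) (items Δ)) ∎

-- Covering: extreme elements and facets are met by every triangulation

module ConeIdentity {N r} {ν : Chi N r} (om : OM ν) {c ℓ} (A : AbelianGroup c ℓ) where
  open AbelianGroup A using (Carrier; _≈_; _∙_; ε) renaming (refl to ≈-refl; sym to ≈-sym; trans to ≈-trans; reflexive to ≈-reflexive)
  open GroupSums A

  -- For p ∷ y inside the r-element set of entries of v, some entry repeats; alternation then leaves
  -- either the one term replacing p by itself or two opposite terms.
  cone-identity : ∀ (v y : Vec (Fin N) r) p u → (∀ k → Mem (lookup y k) v) → Mem p v →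
    act (ν y) u ≈ sumL (λ j → act (ν (y [ j ]≔ p)) u) (allFin r)
  cone-identity v y p u y⊆v p∈v with Mem? p y
  ... | yes (j₀ , eq) = ≈-sym (≈-trans
      (sum-single _ (allFin r) j₀ (UniqueP.allFin⁺ r) (MemP.∈-allFin j₀)
        λ j _ j≢j₀ → ≈-reflexive (cong (λ s → act s u) (update-other om y (j≢j₀ ∘ sym) (sym eq))))
      (≈-reflexive (cong (λ s → act s u) (update-same om y j₀ (sym eq)))))
  ... | no p∉y with pigeon (p ∷ y) v (NatP.n<1+n r) (λ { zero → p∈v ; (suc k) → y⊆v k })
  ...   | zero , zero , i≢j , _ = ⊥-elim (i≢j refl)
  ...   | zero , suc j , _ , eq = ⊥-elim (p∉y (j , sym eq))
  ...   | suc i , zero , _ , eq = ⊥-elim (p∉y (i , eq))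
  ...   | suc i , suc j , i≢j′ , eq = ≈-trans (≈-reflexive (cong (λ s → act s u) (repeated⇒zer om y i≢j eq)))
      (≈-sym (≈-trans
        (sum-double _ (allFin r) i j (UniqueP.allFin⁺ r) (MemP.∈-allFin i) (MemP.∈-allFin j) (i≢j ∘ sym)
          λ k _ k≢i k≢j → ≈-reflexive (cong (λ s → act s u) (repeated⇒zer om (y [ k ]≔ p) i≢j
            (trans (VecP.lookup∘update′ (k≢i ∘ sym) y p) (trans eq (sym (VecP.lookup∘update′ (k≢j ∘ sym) y p)))))))
        (≈-trans (≈-reflexive (cong (λ s → act (ν (y [ i ]≔ p)) u ∙ act s u) opposite)) (act-negₛ (ν (y [ i ]≔ p)) u))))
    where
    i≢j : i ≢ j
    i≢j = i≢j′ ∘ cong suc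
    opposite : ν (y [ j ]≔ p) ≡ negₛ (ν (y [ i ]≔ p))
    opposite = trans (cong ν (sym (trans (update-exchange y {j} {i} p i≢j) (trans
        (cong ((y [ j ]≔ p) [ i ]≔_) (trans (sym eq) (sym (VecP.lookup∘update′ i≢j y p))))
        (VecP.[]≔-lookup (y [ j ]≔ p) i)))))
      (alt-swap om (y [ i ]≔ p) (i≢j ∘ sym))

open GroupSums ℤP.+-0-abelianGroup using () renaming (act to actℤ; sumL to sumℤ)

sumℤ-nonneg : {I : Set} (s : I → Sign) (L : List I) → (∀ p → p ∈ₗ L → s p ≢ neg) →
  ∃ λ n → sumℤ (λ p → actℤ (s p) 1ℤ) L ≡ ⁺ n × ((∃ λ p → p ∈ₗ L × s p ≡ pos) → n ≢ 0)
sumℤ-nonneg s [] h = 0 , refl , λ ()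
sumℤ-nonneg s (p ∷ L) h with sumℤ-nonneg s L (λ q q∈ → h q (there q∈)) | s p in eq
... | n , sum≡ , n≢0 | neg = ⊥-elim (h p (here refl) eq)
... | n , sum≡ , n≢0 | pos = suc n , cong (λ k → 1ℤ ℤ.+ k) sum≡ , λ _ ()
... | n , sum≡ , n≢0 | zer = n , trans (cong (λ k → 0ℤ ℤ.+ k) sum≡) (ℤP.+-identityˡ _) ,
    λ { (q , here refl , q≡) → λ _ → ≡pos⇒≢zer q≡ eq ; (q , there q∈ , q≡) → n≢0 (q , q∈ , q≡) }

Acyclic : Chi N r → Set
Acyclic {N} ν = ∀ e → NonLoop ν e → PosCoc ν e (allFin N)

module Covering {N r} {ν : Chi N (suc r)} (om : OM ν) (acyclic : Acyclic ν)
  {Δ : List (Vec (Fin N) (suc r))} (T : Triang ν Δ) (nonempty : ∃ λ B → B ∈ₗ Δ)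
  (v : Fin N) (nlv : NonLoop ν v) (extreme : Extreme ν v (allFin N)) where

  private
    acyc-els : ∀ 𝓕 → (∀ B → B ∈ₗ 𝓕 → ν B ≢ zer) → Acyc ν (els 𝓕)
    acyc-els 𝓕 bases e e∈ with ∈-els⁻ 𝓕 e∈
    ... | B , B∈ , m = PosCoc-weaken ν (λ _ → MemP.∈-allFin _) (acyclic e (Mem⇒NonLoop ν (bases B B∈) m))

    module Balance {𝓕} (R : Retraction ν 𝓕) where
      W : Vec (Fin N) (suc r) → ℤ
      W x = actℤ (ν (Vec.map (τ R) x)) 1ℤ

      open GroupSums ℤP.+-0-abelianGroup using (act-*; sum-cong)

      product-sign : ∀ s x → actℤ s (W x) ≡ actℤ (s *ₛ ν (Vec.map (τ R) x)) 1ℤ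
      product-sign s x = act-* s (ν (Vec.map (τ R) x)) 1ℤ

      left : Vec (Fin N) (suc r) → Sign
      left B = ν B *ₛ ν (Vec.map (τ R) B)
      right : Vec (Fin N) (suc r) × Fin (suc r) → Sign
      right (B , j) = ν B *ₛ ν (Vec.map (τ R) (B [ j ]≔ v))

      -- Takes the part of additivity of volume: the simplices and the cones from `v` over the
      -- boundary facets have the same total value.
      balance : sumℤ (λ B → actℤ (left B) 1ℤ) Δ ≡ sumℤ (λ p → actℤ (right p) 1ℤ) (filter (Bd? ν) (items Δ))
      balance = begin
        sumℤ (λ B → actℤ (left B) 1ℤ) Δ ≡⟨ sum-cong Δ (λ B _ → sym (product-sign (ν B) B)) ⟩
        sumℤ (λ B → actℤ (ν B) (W B)) Δ ≡⟨ Boundary.boundary-formula om T ℤP.+-0-abelianGroup W v nlv W-alt W-cone ⟩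
        sumℤ (λ (B , j) → actℤ (ν B) (W (B [ j ]≔ v))) (filter (Bd? ν) (items Δ))
          ≡⟨ sum-cong (filter (Bd? ν) (items Δ)) (λ (B , j) _ → product-sign (ν B) (B [ j ]≔ v)) ⟩
        sumℤ (λ p → actℤ (right p) 1ℤ) (filter (Bd? ν) (items Δ)) ∎
        where
        open ≡-Reasoning
        W-alt : ∀ {s x y} → (∀ k → NonLoop ν (lookup x k)) → Perm s x y → W x ≡ actℤ s (W y)
        W-alt {s} {x} {y} _ p = trans (cong (λ t → actℤ t 1ℤ) (alt om (Perm-map (τ R) p)))
          (sym (product-sign s y))
        W-cone : ∀ B → B ∈ₗ Δ → W B ≡ sumℤ (λ j → W (B [ j ]≔ v)) (allFin (suc r))
        W-cone B B∈ = trans (ConeIdentity.cone-identity om ℤP.+-0-abelianGroup (target R) (Vec.map (τ R) B) (τ R v) 1ℤ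
            (λ k → subst (λ e → Mem e (target R)) (sym (VecP.lookup-map k (τ R) B))
              (onto R (lookup B k) (Mem⇒NonLoop ν (bases T B B∈) (k , refl))))
            (onto R v nlv))
          (sum-cong (allFin (suc r)) λ j _ → cong (λ x → actℤ (ν x) 1ℤ) (sym (VecP.map-[]≔ (τ R) B j)))

    nonloops : ∀ B → B ∈ₗ Δ → ∀ j k → NonLoop ν (lookup (B [ j ]≔ v) k)
    nonloops B B∈ j k with Mem-update⁻ B j {v} (k , refl)
    ... | inj₁ eq = subst (NonLoop ν) (sym eq) nlv
    ... | inj₂ (m , _ , eq) = Mem⇒NonLoop ν (bases T B B∈) (m , eq)

    -- The retraction is adapted to the simplices, so the left side of the balance is positive;
    -- hence some cone on the right has nonzero value, and `reflects` makes it a basis.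
    visible-facet-from : Retraction ν Δ → ∃ λ p → p ∈ₗ filter (Bd? ν) (items Δ) × ν (proj₁ p [ proj₂ p ]≔ v) ≢ zer
    visible-facet-from R = conclude (scan {P = λ p → right p ≢ zer} {Q = λ p → right p ≡ zer} (filter (Bd? ν) (items Δ)) dichotomy)
      where
      open Balance R
      open GroupSums ℤP.+-0-abelianGroup using (sum-ε)
      dichotomy : ∀ p → p ∈ₗ filter (Bd? ν) (items Δ) → right p ≢ zer ⊎ right p ≡ zer
      dichotomy p _ with right p ≟ₛ zer
      ... | yes eq = inj₂ eq
      ... | no nz = inj₁ nz
      conclude : _ ⊎ _ → _
      conclude (inj₁ ((B , j) , p∈ , nz)) = (B , j) , p∈ ,
        reflects R (B [ j ]≔ v) (nonloops B (∈-items⁻ Δ (proj₁ (MemP.∈-filter⁻ (Bd? ν) {xs = items Δ} p∈))) j)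
          (*ₛ-nonzeroʳ (ν B) _ nz)
      conclude (inj₂ vanish) with sumℤ-nonneg left Δ (nonneg* R)
      ... | n , sum≡ , n≢0 = ⊥-elim (n≢0 (positive R) (ℤP.+-injective (trans (sym sum≡) (trans balance
              (sum-ε (filter (Bd? ν) (items Δ)) λ p p∈ → cong (λ s → actℤ s 1ℤ) (vanish p p∈))))))

    abstract
      visible-facet : ∃ λ p → p ∈ₗ filter (Bd? ν) (items Δ) × ν (proj₁ p [ proj₂ p ]≔ v) ≢ zer
      visible-facet = visible-facet-from (retraction om Δ (bases T) nonempty (acyc-els Δ (bases T)))

    Q : Vec (Fin N) (suc r) × Fin (suc r) → Set
    Q (B , j) = ν (B [ j ]≔ v) ≢ zer
    Q? : ∀ p → Dec (Q p)
    Q? (B , j) = ¬? (ν (B [ j ]≔ v) ≟ₛ zer)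
    boundary visible : List (Vec (Fin N) (suc r) × Fin (suc r))
    boundary = filter (Bd? ν) (items Δ)
    visible = filter Q? boundary
    𝓕 : List (Vec (Fin N) (suc r))
    𝓕 = List.map (λ (B , j) → B [ j ]≔ v) visible
    bases𝓕 : ∀ G → G ∈ₗ 𝓕 → ν G ≢ zer
    bases𝓕 G G∈ with MemP.∈-map⁻ (λ (B , j) → B [ j ]≔ v) G∈
    ... | (B , j) , p∈ , refl = proj₂ (MemP.∈-filter⁻ Q? {xs = boundary} p∈)
    v∈𝓕 : v ∈ₗ els 𝓕
    v∈𝓕 = let (B , j) , p∈ , nz = visible-facet in
      ∈-els (MemP.∈-map⁺ (λ (B , j) → B [ j ]≔ v) (MemP.∈-filter⁺ Q? p∈ nz)) (Mem-update B j)
    extreme𝓕 : Extreme ν v (els 𝓕)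
    extreme𝓕 w w∈ with extreme w (MemP.∈-allFin w)
    ... | inj₁ par = inj₁ par
    ... | inj₂ Y = inj₂ (PosCoc-weaken (con ν v) (λ _ → MemP.∈-allFin _) Y)

  private
   module FromRetraction (R : Retraction ν 𝓕)
     (has-parallel : ∀ x → ν (Vec.map (τ R) x) ≢ zer → ∃ λ j → Par ν v (lookup x j)) where
    open Balance R
    -- Here the retraction is adapted to the cones over the visible facets. A visible boundary facet
    -- gives its simplex and its cone the same sign, so the right side is positive and some simplex
    -- has nonzero value.
    extreme-used : ∃ λ B → B ∈ₗ Δ × ∃ λ j → Par ν v (lookup B j)
    extreme-used = conclude (scan {P = λ B → ∃ λ j → Par ν v (lookup B j)} {Q = λ B → left B ≡ zer} Δ dichotomy)
      where
      open GroupSums ℤP.+-0-abelianGroup using (sum-ε)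
      dichotomy : ∀ B → B ∈ₗ Δ → (∃ λ j → Par ν v (lookup B j)) ⊎ left B ≡ zer
      dichotomy B _ with any? (λ j → Par? ν v (lookup B j))
      ... | yes p = inj₁ p
      ... | no none = inj₂ (*ₛ-zeroʳ′ (ν B) (¬≢zer⇒≡ λ nz → none (has-parallel B nz)))
      visible-same : ∀ B j → Bd ν (B , j) → Q (B , j) → B ∈ₗ Δ → ν B ≡ ν (B [ j ]≔ v)
      visible-same B j bd nz B∈ = *ₛ-pos⇒≡ _ _ (≢zer∧≢neg⇒pos _ (*ₛ-nonzero _ _ (bases T B B∈) nz) (bd v))
      right-nonneg : ∀ p → p ∈ₗ boundary → right p ≢ neg
      right-nonneg (B , j) p∈ with MemP.∈-filter⁻ (Bd? ν) {xs = items Δ} p∈ | Q? (B , j)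
      ... | p∈' , bd | yes nz = λ eq → nonneg* R (B [ j ]≔ v) (MemP.∈-map⁺ (λ (B , j) → B [ j ]≔ v) (MemP.∈-filter⁺ Q? p∈ nz))
              (trans (cong (_*ₛ ν (Vec.map (τ R) (B [ j ]≔ v))) (sym (visible-same B j bd nz (∈-items⁻ Δ p∈')))) eq)
      ... | p∈' , bd | no z = λ eq → z (reflects R (B [ j ]≔ v) (nonloops B (∈-items⁻ Δ p∈') j)
              (*ₛ-nonzeroʳ (ν B) _ (≡neg⇒≢zer eq)))
      right-positive : ∃ λ p → p ∈ₗ boundary × right p ≡ pos
      right-positive with positive R
      ... | G , G∈ , eq with MemP.∈-map⁻ (λ (B , j) → B [ j ]≔ v) G∈
      ...   | (B , j) , p∈ , refl with MemP.∈-filter⁻ Q? {xs = boundary} p∈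
      ...     | p∈' , nz with MemP.∈-filter⁻ (Bd? ν) {xs = items Δ} p∈'
      ...       | p∈'' , bd = (B , j) , p∈' ,
        trans (cong (_*ₛ ν (Vec.map (τ R) (B [ j ]≔ v))) (visible-same B j bd nz (∈-items⁻ Δ p∈''))) eq
      conclude : _ ⊎ _ → _
      conclude (inj₁ (B , B∈ , p)) = B , B∈ , p
      conclude (inj₂ vanish) with sumℤ-nonneg right boundary right-nonneg
      ... | n , sum≡ , n≢0 = ⊥-elim (n≢0 right-positive (ℤP.+-injective (trans (sym sum≡) (trans (sym balance)
              (sum-ε Δ λ B B∈ → cong (λ s → actℤ s 1ℤ) (vanish B B∈))))))

  abstract
    extreme-used : ∃ λ B → B ∈ₗ Δ × ∃ λ j → Par ν v (lookup B j)
    -- The flag starts at `v`, so every tuple of nonzero value has an entry parallel to `v`.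
    extreme-used = FromRetraction.extreme-used (extend R) (has-parallel R)
      where
      open RetractionStep om 𝓕 bases𝓕 (acyc-els 𝓕 bases𝓕) v v∈𝓕 extreme𝓕
      R : Retraction (con ν v) 𝓕′
      R = retraction (con-OM om v) 𝓕′ bases′ nonempty′ acyc′

-- Links, and covering of facets

Unique-map : {A B : Set} (f : A → B) (L : List A) → Unique L →
  (∀ p q → p ∈ₗ L → q ∈ₗ L → f p ≡ f q → p ≡ q) → Unique (List.map f L)
Unique-map f [] [] inj = []
Unique-map f (a ∷ L) (a∉ ∷ u) inj = fresh ∷ Unique-map f L u (λ p q p∈ q∈ → inj p q (there p∈) (there q∈))
  where
  fresh : All (f a ≢_) (List.map f L)
  fresh = All.tabulate λ b∈ eq → let p , p∈ , b≡ = MemP.∈-map⁻ f b∈ in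
    All.lookup a∉ p∈ (inj a p (here refl) (there p∈) (trans eq b≡))

module _ {N r} {P : Vec (Fin N) (suc r) × Fin (suc r) → Set} (P? : ∀ p → Dec (P p)) (Δ : List (Vec (Fin N) (suc r)))
  (uniq : Unique Δ)
  (sep : ∀ {B j B' j'} → B ∈ₗ Δ → B' ∈ₗ Δ → P (B , j) → P (B' , j') → Sub (removeAt B j) (removeAt B' j') → (B , j) ≡ (B' , j')) where

  faces-unique : Unique (faces P? Δ)
  faces-unique = Unique-map face (filter P? (items Δ))
    (UniqueP.filter⁺ P? (UniqueP.cartesianProduct⁺ uniq (UniqueP.allFin⁺ (suc r)))) inj
    where
    inj : ∀ p q → p ∈ₗ filter P? (items Δ) → q ∈ₗ filter P? (items Δ) → face p ≡ face q → p ≡ q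
    inj p q p∈ q∈ eq with MemP.∈-filter⁻ P? {xs = items Δ} p∈ | MemP.∈-filter⁻ P? {xs = items Δ} q∈
    ... | p∈' , Pp | q∈' , Pq = sep (∈-items⁻ Δ p∈') (∈-items⁻ Δ q∈') Pp Pq (λ k → k , cong (λ x → lookup x k) (sym eq))

  faces-distinct : ∀ F F' → F ∈ₗ faces P? Δ → F' ∈ₗ faces P? Δ → Sub F F' → F ≡ F'
  faces-distinct F F' F∈ F'∈ sub with ∈-faces⁻ P? Δ F∈ | ∈-faces⁻ P? Δ F'∈
  ... | B , j , B∈ , p , refl | B' , j' , B'∈ , p' , refl = cong face (sep B∈ B'∈ p p' sub)

Mem-removeAt⁻ : {A : Set} (x : Vec A (suc n)) {i : Fin (suc n)} {e : A} → Mem e (removeAt x i) → Mem e x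
Mem-removeAt⁻ x {i} (k , eq) = punchIn i k , trans (sym (lookup-removeAt x i k)) eq

At : Fin N → Vec (Fin N) r × Fin r → Set
At i (B , j) = lookup B j ≡ i

At? : (i : Fin N) (p : Vec (Fin N) r × Fin r) → Dec (At i p)
At? i (B , j) = lookup B j ≟ i

link : List (Vec (Fin N) (suc r)) → Fin N → List (Vec (Fin N) r)
link Δ i = faces (At? i) Δ

module _ {N r} {ν : Chi N (suc r)} (om : OM ν) {Δ : List (Vec (Fin N) (suc r))} (T : Triang ν Δ) (i : Fin N) where

  private
    Sub-∷ : ∀ {F : Vec (Fin N) r} {B : Vec (Fin N) (suc r)} {j} → lookup B j ≡ i → Sub F (removeAt B j) → Sub (i ∷ F) B
    Sub-∷ eq sub zero = _ , eq
    Sub-∷ {B = B} eq sub (suc k) = Mem-removeAt⁻ B (sub k)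

    Mem-link : ∀ {B : Vec (Fin N) (suc r)} {j e} → lookup B j ≡ i → e ≢ i → Mem e B → Mem e (removeAt B j)
    Mem-link {B} {j} at e≢i (k , refl) = Mem-removeAt B λ { refl → e≢i at }

  link-Simplex : ∀ {x} → Simplex (link Δ i) (con ν i) x → Simplex Δ ν (i ∷ x)
  link-Simplex (nz , F , F∈ , sub) with ∈-faces⁻ (At? i) Δ F∈
  ... | B , j , B∈ , at , refl = nz , B , B∈ , Sub-∷ {B = B} {j} at sub

  link-Simplex⁻ : ∀ {x} → Simplex Δ ν (i ∷ x) → Simplex (link Δ i) (con ν i) x
  link-Simplex⁻ {x} (nz , B , B∈ , sub) with sub zero
  ... | j , at = nz , removeAt B j , ∈-faces (At? i) Δ B∈ j at ,
    λ k → Mem-link {B} {j} at (λ eq → FinP.0≢1+n (nonzero⇒Inj om nz zero (suc k) (sym eq))) (sub (suc k))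

  private
    sep : ∀ {B j B' j'} → B ∈ₗ Δ → B' ∈ₗ Δ → At i (B , j) → At i (B' , j') →
      Sub (removeAt B j) (removeAt B' j') → (B , j) ≡ (B' , j')
    sep {B} {j} {B'} {j'} B∈ B'∈ at at' sub with distinct T B B' B∈ B'∈ sub'
      where
      sub' : Sub B B'
      sub' k with j ≟ k
      ... | yes refl = j' , trans at' (sym at)
      ... | no j≢k = Mem-removeAt⁻ B' (Sub-Mem {x = removeAt B j} {removeAt B' j'} sub (Mem-removeAt B j≢k))
    ... | refl = cong (B ,_) (nonzero⇒Inj om (bases T B B∈) j j' (trans at (sym at')))

  -- A circuit of the contraction becomes one of `ν` once `i` is added to the underlying basis. Its
  -- sign at `i` is uncontrolled but harmless, as `i` lies in every simplex that contributes to the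
  -- link.
  link-Triang : Triang (con ν i) (link Δ i)
  link-Triang .bases F F∈ with ∈-faces⁻ (At? i) Δ F∈
  ... | B , j , B∈ , refl , refl = Perm-basis om (bring B j) (bases T B B∈)
  link-Triang .unique = faces-unique (At? i) Δ (unique T) sep
  link-Triang .distinct = faces-distinct (At? i) Δ (unique T) sep
  link-Triang .nc F F' F∈ F'∈ y x σ nz x∉y nl σnz p q
    with ∈-faces⁻ (At? i) Δ F∈ | ∈-faces⁻ (At? i) Δ F'∈
  ... | B , j , B∈ , at , refl | B' , j' , B'∈ , at' , refl =
    nc T B B' B∈ B'∈ (i ∷ y) x σ nz x∉ (let z , k , h = nl in i ∷ z , suc k , h) σnz p' q'
    where
    x∉ : ¬ Mem x (i ∷ y)
    x∉ (zero , refl) = Par-refl om i nl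
    x∉ (suc k , eq) = x∉y (k , eq)
    p' : ∀ k → σ *ₛ sg ν (i ∷ y) x k ≡ pos → Mem (el (i ∷ y) x k) B
    p' zero eq = Mem-removeAt⁻ B (p zero eq)
    p' (suc zero) eq = j , at
    p' (suc (suc k)) eq = Mem-removeAt⁻ B (p (suc k) eq)
    q' : ∀ k → σ *ₛ sg ν (i ∷ y) x k ≡ neg → Mem (el (i ∷ y) x k) B'
    q' zero eq = Mem-removeAt⁻ B' (q zero eq)
    q' (suc zero) eq = j' , at'
    q' (suc (suc k)) eq = Mem-removeAt⁻ B' (q (suc k) eq)
  link-Triang .fac x S j with fac T (i ∷ x) (link-Simplex S) (suc j)
  ... | inj₁ bd = inj₁ bd
  ... | inj₂ (e , S' , opp) = inj₂ (e , link-Simplex⁻ S' , opp)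

PosCoc-≗ : {ν ν' : Chi N r} → (∀ x → ν x ≡ ν' x) → ∀ {w L} → PosCoc ν w L → PosCoc ν' w L
PosCoc-≗ h (z , j , σ , p , q) = z , j , σ , trans (cong (σ *ₛ_) (sym (h _))) p ,
  λ l l∈ eq → q l l∈ (trans (cong (σ *ₛ_) (h _)) eq)

NonLoop-≗ : {ν ν' : Chi N r} → (∀ x → ν x ≡ ν' x) → ∀ {w} → NonLoop ν w → NonLoop ν' w
NonLoop-≗ h (z , j , nz) = z , j , λ eq → nz (trans (h _) eq)

extreme⇒Acyclic-con : {ν : Chi N (suc r)} {v : Fin N} → Extreme ν v (allFin N) → Acyclic (con ν v)
extreme⇒Acyclic-con extreme e nl with extreme e (MemP.∈-allFin e)
... | inj₁ par = ⊥-elim (par nl)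
... | inj₂ Y = Y

-- The entries of `tuple` away from `place` span the facet hyperplane; the marked element `apex`
-- witnesses that the cocircuit is not zero.
record FacetCocircuit {N r} (ν : Chi N r) : Set where
  field
    tuple : Vec (Fin N) r
    place : Fin r
    sign  : Sign
  value : Fin N → Sign
  value e = sign *ₛ ν (tuple [ place ]≔ e)
  field
    value≢neg : ∀ e → value e ≢ neg
    apex      : Fin N
    value-apex : value apex ≡ pos
open FacetCocircuit public using (value; value≢neg; apex; value-apex)

module _ {N r} {ν : Chi N r} (om : OM ν) (Y : FacetCocircuit ν) where
  open FacetCocircuit Y using (tuple; place; sign)

  value-basis : ∀ {e} → value Y e ≢ zer → ν (tuple [ place ]≔ e) ≢ zer
  value-basis {e} = *ₛ-nonzeroʳ sign _

  value-pos : ∀ {e} → value Y e ≢ zer → value Y e ≡ pos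
  value-pos {e} nz = ≢zer∧≢neg⇒pos _ nz (value≢neg Y e)

  sign≢zer : sign ≢ zer
  sign≢zer = *ₛ-nonzeroˡ sign _ (≡pos⇒≢zer (value-apex Y))

  hyperplane-value : ∀ k → k ≢ place → value Y (lookup tuple k) ≡ zer
  hyperplane-value k k≢ = *ₛ-zeroʳ′ sign (update-other om tuple k≢ refl)

  value-unique : ∀ {B} → ν B ≢ zer → ∀ j → (∀ k → k ≢ j → value Y (lookup B k) ≡ zer) →
    ∀ e → value Y e *ₛ ν B ≡ value Y (lookup B j) *ₛ ν (B [ j ]≔ e)
  value-unique {B} nz j h e = begin
    (sign *ₛ ν (tuple [ place ]≔ e)) *ₛ ν B ≡⟨ *ₛ-assoc sign _ _ ⟩
    sign *ₛ (ν (tuple [ place ]≔ e) *ₛ ν B)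
      ≡⟨ cong (sign *ₛ_) (cocircuit-unique om nz tuple place j (λ k k≢j →
           trans (sym (*ₛ-cancel sign _ sign≢zer)) (*ₛ-zeroʳ′ sign (h k k≢j))) e) ⟩
    sign *ₛ (ν (tuple [ place ]≔ lookup B j) *ₛ ν (B [ j ]≔ e)) ≡⟨ *ₛ-assoc sign _ _ ⟨
    (sign *ₛ ν (tuple [ place ]≔ lookup B j)) *ₛ ν (B [ j ]≔ e) ∎
    where open ≡-Reasoning

  -- A basis cannot lie in the hyperplane, so at an outside position j the value is positive.
  value-outside : ∀ {B} → ν B ≢ zer → ∀ j → (∀ k → k ≢ j → value Y (lookup B k) ≡ zer) → value Y (lookup B j) ≡ pos
  value-outside {B} nz j h = value-pos λ eq → *ₛ-nonzero _ (ν B) (≡pos⇒≢zer (value-apex Y)) nz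
    (trans (value-unique nz j h (apex Y)) (*ₛ-zeroˡ′ (ν (B [ j ]≔ apex Y)) eq))

  hyperplane⇒zer : ∀ x → (∀ k → value Y (lookup x k) ≡ zer) → ν x ≡ zer
  hyperplane⇒zer x h = ¬≢zer⇒≡ λ nz → ≡pos⇒≢zer (value-outside nz place (λ k _ → h k)) (h place)

-- The facet hyperplane H of Y, by its non-loop elements
module FacetHyperplane {N r} {ν : Chi N (suc (suc r))} (om : OM ν) (acyclic : Acyclic ν) (Y : FacetCocircuit ν) where
  open FacetCocircuit Y using (tuple; place; sign)

  InH : Fin N → Set
  InH e = value Y e ≡ zer × NonLoop ν e
  InH? : ∀ e → Dec (InH e)
  InH? e = (value Y e ≟ₛ zer) ×-dec NonLoop? ν e
  H : List (Fin N)
  H = filter InH? (allFin N)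
  ∈H : ∀ {e} → value Y e ≡ zer → NonLoop ν e → e ∈ₗ H
  ∈H {e} h nl = MemP.∈-filter⁺ InH? (MemP.∈-allFin e) (h , nl)
  ∈H⁻ : ∀ {e} → e ∈ₗ H → InH e
  ∈H⁻ e∈ = proj₂ (MemP.∈-filter⁻ InH? {xs = allFin N} e∈)

  D : Vec (Fin N) (suc (suc r))
  D = tuple [ place ]≔ apex Y
  D-basis : ν D ≢ zer
  D-basis = value-basis om Y (≡pos⇒≢zer (value-apex Y))

  H-nonempty : ∃ λ e → e ∈ₗ H
  H-nonempty = lookup tuple k , ∈H (hyperplane-value om Y k k≢) (Mem⇒NonLoop ν D-basis (Mem-update′ tuple k≢))
    where
    k = punchIn place zero
    k≢ = FinP.punchInᵢ≢i place zero

  extreme-in-H : ∃ λ v → v ∈ₗ H × Extreme ν v H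
  extreme-in-H = go H H-nonempty (λ e∈ → proj₂ (∈H⁻ e∈))
    where
    go : ∀ L → (∃ λ e → e ∈ₗ L) → (∀ {e} → e ∈ₗ L → NonLoop ν e) → ∃ λ v → v ∈ₗ L × Extreme ν v L
    go [] (_ , ()) _
    go (u ∷ L) _ nl = extreme-exists om u L λ w w∈ → PosCoc-weaken ν (λ _ → MemP.∈-allFin _) (acyclic w (nl w∈))

  module _ (v : Fin N) (value-v : value Y v ≡ zer) (nlv : NonLoop ν v) (extremeH : Extreme ν v H) where

    -- Vertices of a face are vertices of the whole: a nonnegative circuit of the contraction of `v`
    -- is orthogonal to the nonnegative `Y`, so its support lies in the hyperplane, where
    -- extremality within `H` excludes it.
    extend-extreme : Extreme ν v (allFin N)
    extend-extreme w _ with NonLoop? (con ν v) w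
    ... | no par = inj₁ par
    ... | yes nl with farkas (con ν v) (con-OM om v) (con-basis om (nlv)) w (allFin N)
    ...   | inj₁ Y' = inj₂ Y'
    ...   | inj₂ (y , x , σ , nz , (k₀ , el≡ , sg≡) , h) = ⊥-elim contradiction
      where
      value-el : ∀ k → σ *ₛ sg (con ν v) y x k ≡ pos → value Y (el y x k) ≡ zer
      value-el k eq with value Y (el y x k) ≟ₛ zer
      ... | yes z = z
      ... | no nz' = ⊥-elim (circuit-not-one-signed om (v ∷ y) x tuple place σ sign prod (shift k)
              (trans (cong₂ _*ₛ_ (shift-sg k) (cong (value Y) (shift-el k))) (cong₂ _*ₛ_ eq (value-pos om Y nz'))))
        where
        shift : Fin (suc (suc r)) → Fin (suc (suc (suc r)))
        shift zero = zero
        shift (suc k) = suc (suc k)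
        shift-sg : ∀ k → σ *ₛ sg ν (v ∷ y) x (shift k) ≡ σ *ₛ sg (con ν v) y x k
        shift-sg zero = refl
        shift-sg (suc k) = refl
        shift-el : ∀ k → el (v ∷ y) x (shift k) ≡ el y x k
        shift-el zero = refl
        shift-el (suc k) = refl
        prod : ∀ k → (σ *ₛ sg ν (v ∷ y) x k) *ₛ value Y (el (v ∷ y) x k) ≢ neg
        prod (suc zero) = *zer≢neg (σ *ₛ sg ν (v ∷ y) x (suc zero)) _ value-v
        prod zero with h zero
        ... | inj₁ a = zer*≢neg _ _ a
        ... | inj₂ (a , _) = pos*≢neg _ _ a (value≢neg Y _)
        prod (suc (suc i)) with h (suc i)
        ... | inj₁ a = zer*≢neg _ _ a
        ... | inj₂ (a , _) = pos*≢neg _ _ a (value≢neg Y _)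
      contradiction : ⊥
      contradiction with extremeH w (∈H (subst (λ e → value Y e ≡ zer) el≡ (value-el k₀ sg≡))
                           (let z , j , nz = nl in v ∷ z , suc j , nz))
      ... | inj₁ par = par nl
      ... | inj₂ (z , j , τ , p , q) = nonneg-orthogonal (con-OM om v) y x σ z j τ signs k₀ sg≡
              (trans (cong (λ e → τ *ₛ ν (v ∷ (z [ j ]≔ e))) el≡) p)
        where
        signs : ∀ k → σ *ₛ sg (con ν v) y x k ≡ zer ⊎
          (σ *ₛ sg (con ν v) y x k ≡ pos × τ *ₛ ν (v ∷ (z [ j ]≔ el y x k)) ≢ neg)
        signs k with h k
        ... | inj₁ a = inj₁ a
        ... | inj₂ (a , _) with NonLoop? ν (el y x k)
        ...   | yes nl' = inj₂ (a , q _ (∈H (value-el k a) nl'))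
        ...   | no loop = inj₂ (a , λ eq → ≡neg⇒≢zer eq
                  (*ₛ-zeroʳ′ τ (¬≢zer⇒≡ λ nz → loop (v ∷ z , suc j , nz))))

  module FacetLink (B₀ : Vec (Fin N) (suc (suc r))) (B₀-basis : ν B₀ ≢ zer) (j₀ : Fin (suc (suc r)))
    (i : Fin N) (at : lookup B₀ j₀ ≡ i) (value-i : value Y i ≡ zer) where

    private
      exchanged : ∃ λ m → ν (D [ m ]≔ i) ≢ zer
      exchanged with ex om B₀ D j₀ (*ₛ-nonzero _ _ B₀-basis D-basis)
      ... | m , eq = m , λ z → *ₛ-nonzero _ _ B₀-basis D-basis (trans (sym eq)
            (*ₛ-zeroʳ′ (ν (B₀ [ j₀ ]≔ lookup D m)) (trans (cong (λ e → ν (D [ m ]≔ e)) at) z)))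
      m : Fin (suc (suc r))
      m = proj₁ exchanged
      D′ : Vec (Fin N) (suc (suc r))
      D′ = D [ m ]≔ i
      D′-basis : ν D′ ≢ zer
      D′-basis = proj₂ exchanged
      m≢place : m ≢ place
      m≢place m≡ = D′-basis (trans (cong (λ t → ν (D [ t ]≔ i)) m≡) (trans (cong ν (VecP.[]≔-idempotent tuple place))
        (trans (sym (*ₛ-cancel sign _ (sign≢zer om Y))) (*ₛ-zeroʳ′ sign value-i))))
      F : Vec (Fin N) (suc r)
      F = removeAt D′ m
      place′ : Fin (suc r)
      place′ = punchOut m≢place
      iF-basis : ν (i ∷ F) ≢ zer
      iF-basis = Perm-basis om (subst (λ e → Perm _ D′ (e ∷ F)) (VecP.lookup∘update m D i) (bring D′ m)) D′-basis

      F-place : lookup F place′ ≡ apex Y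
      F-place = trans (VecP.removeAt-punchOut D′ m≢place) (trans (VecP.lookup∘update′ (m≢place ∘ sym) D i)
        (VecP.lookup∘update place tuple _))

      F-InH : ∀ k → k ≢ suc place′ → value Y (lookup (i ∷ F) k) ≡ zer
      F-InH zero _ = value-i
      F-InH (suc l) l≢ = trans (cong (value Y) (trans (lookup-removeAt D′ m l)
          (trans (VecP.lookup∘update′ (FinP.punchInᵢ≢i m l) D i) (VecP.lookup∘update′ pl≢ tuple _))))
          (hyperplane-value om Y (punchIn m l) pl≢)
        where
        pl≢ : punchIn m l ≢ place
        pl≢ eq = l≢ (cong suc (FinP.punchIn-injective m l place′ (trans eq (sym (FinP.punchIn-punchOut m≢place)))))

    abstract
      -- To read `Y` in the contraction of `i`, the basis formed by the apex and hyperplane elements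
      -- is made to contain `i` by an exchange. The new expression vanishes on the same hyperplane
      -- and is normalized at the apex, so uniqueness of the cocircuit identifies the two.
      value-agrees : ∀ e → ν (i ∷ F) *ₛ ν (i ∷ (F [ place′ ]≔ e)) ≡ value Y e
      value-agrees e = trans (cong (ν (i ∷ F) *ₛ_) (sym (trans (value-unique om Y iF-basis (suc place′) F-InH e)
          (cong (_*ₛ ν (i ∷ (F [ place′ ]≔ e))) (trans (cong (value Y) F-place) (value-apex Y))))))
        (trans (cong (ν (i ∷ F) *ₛ_) (*ₛ-comm (value Y e) _)) (*ₛ-cancel _ _ iF-basis))

    Y′ : FacetCocircuit (con ν i)
    Y′ = record { tuple = F ; place = place′ ; sign = ν (i ∷ F)
                ; value≢neg = λ e eq → value≢neg Y e (trans (sym (value-agrees e)) eq)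
                ; apex = apex Y ; value-apex = trans (value-agrees (apex Y)) (value-apex Y) }

unlink-facet : ∀ {N r} {ν : Chi N (suc (suc r))} {i : Fin N} (Y : FacetCocircuit ν) (Y′ : FacetCocircuit (con ν i)) →
  value Y i ≡ zer → (∀ e → value Y′ e ≡ value Y e) → ∀ {Δ : List (Vec (Fin N) (suc (suc r)))} →
  (∃ λ F → F ∈ₗ link Δ i × ∃ λ j → ∀ k → k ≢ j → value Y′ (lookup F k) ≡ zer) →
  ∃ λ B → B ∈ₗ Δ × ∃ λ j → ∀ k → k ≢ j → value Y (lookup B k) ≡ zer
unlink-facet {r = r} {i = i} Y Y′ value-i agrees {Δ} (G , G∈ , k₀ , h) with ∈-faces⁻ (At? i) Δ G∈
... | B , j , B∈ , at , refl = B , B∈ , punchIn j k₀ , h'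
  where
  h' : ∀ k → k ≢ punchIn j k₀ → value Y (lookup B k) ≡ zer
  h' k k≢ with j ≟ k
  ... | yes refl = trans (cong (value Y) at) value-i
  ... | no j≢k = trans (sym (agrees _)) (trans (cong (value Y′) (sym (VecP.removeAt-punchOut B j≢k)))
          (h (punchOut j≢k) λ eq → k≢ (trans (sym (FinP.punchIn-punchOut j≢k)) (cong (punchIn j) eq))))

-- Induction on the rank. The hyperplane contains an extreme element of the whole configuration, and
-- `Δ` uses an element `i` parallel to it; the link of `i` triangulates the contraction, where `Y`
-- is still a facet. In rank one the hyperplane contains no non-loops and every simplex will do.
facet-covered : ∀ {N} r {ν : Chi N (suc r)} → OM ν → Acyclic ν → ∀ {Δ : List (Vec (Fin N) (suc r))} → Triang ν Δ → (∃ λ B → B ∈ₗ Δ) →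
  (Y : FacetCocircuit ν) → ∃ λ B → B ∈ₗ Δ × ∃ λ j → ∀ k → k ≢ j → value Y (lookup B k) ≡ zer
facet-covered zero om acyclic T (B , B∈) Y = B , B∈ , zero , λ { zero k≢ → ⊥-elim (k≢ refl) }
facet-covered {N} (suc r) {ν} om acyclic {Δ} T nonempty Y =
  let v , v∈ , extremeH = FacetHyperplane.extreme-in-H om acyclic Y
      value-v , nlv = FacetHyperplane.∈H⁻ om acyclic Y v∈
      extreme = FacetHyperplane.extend-extreme om acyclic Y v value-v nlv extremeH
      B₀ , B₀∈ , j₀ , par = Covering.extreme-used om acyclic T nonempty v nlv extreme
  in through-link v value-v nlv extreme B₀ B₀∈ j₀ par
  where
  through-link : ∀ v → value Y v ≡ zer → NonLoop ν v → Extreme ν v (allFin N) → ∀ B₀ → B₀ ∈ₗ Δ → ∀ j₀ → Par ν v (lookup B₀ j₀) →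
    ∃ λ B → B ∈ₗ Δ × ∃ λ j → ∀ k → k ≢ j → value Y (lookup B k) ≡ zer
  through-link v value-v nlv extreme B₀ B₀∈ j₀ par = unlink-facet {N} {r} {ν} {i} Y L.Y′ value-i L.value-agrees
      (facet-covered r (con-OM om i) acyclic-i (link-Triang om T i) (removeAt B₀ j₀ , ∈-faces (At? i) Δ B₀∈ j₀ refl) L.Y′)
    where
    i : Fin N
    i = lookup B₀ j₀
    parallel : ∀ z j → ν (z [ j ]≔ i) ≡ ν (z [ j ]≔ v)
    parallel = Par-pos om (acyclic v nlv) (MemP.∈-allFin i) (Mem⇒NonLoop ν (bases T B₀ B₀∈) (j₀ , refl)) par
    value-i : value Y i ≡ zer
    value-i = trans (cong (FacetCocircuit.sign Y *ₛ_) (parallel (FacetCocircuit.tuple Y) (FacetCocircuit.place Y))) value-v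
    acyclic-i : Acyclic (con ν i)
    acyclic-i e nl = PosCoc-≗ {ν = con ν v} {con ν i} (λ x → sym (parallel (i ∷ x) zero))
      (extreme⇒Acyclic-con {ν = ν} {v} extreme e (NonLoop-≗ {ν = con ν i} {con ν v} (λ x → parallel (i ∷ x) zero) nl))
    module L = FacetHyperplane.FacetLink om acyclic Y B₀ (bases T B₀ B₀∈) j₀ i refl value-i

-- Restriction to a facet hyperplane

module Restriction {N r} {ν : Chi N (suc r)} (om : OM ν) (Y : FacetCocircuit ν) where

  OnH : Vec (Fin N) n → Set
  OnH x = ∀ k → value Y (lookup x k) ≡ zer

  OnH? : (x : Vec (Fin N) n) → Dec (OnH x)
  OnH? x = all? λ k → value Y (lookup x k) ≟ₛ zer

  private
    a : Fin N
    a = apex Y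

  -- Restriction to the facet hyperplane: the apex is contracted and all elements outside the
  -- hyperplane become loops, so the rank drops by one and the index set stays.
  res : Chi N r
  res x with OnH? x
  ... | yes _ = ν (a ∷ x)
  ... | no _ = zer

  res-on : ∀ {x} → OnH x → res x ≡ ν (a ∷ x)
  res-on {x} h with OnH? x
  ... | yes _ = refl
  ... | no ¬h = ⊥-elim (¬h h)

  res-off : ∀ {x} → ¬ OnH x → res x ≡ zer
  res-off {x} ¬h with OnH? x
  ... | yes h = ⊥-elim (¬h h)
  ... | no _ = refl

  res-OnH : ∀ {x} → res x ≢ zer → OnH x
  res-OnH {x} nz with OnH? x
  ... | yes h = h
  ... | no _ = ⊥-elim (nz refl)

  res-basis : ∀ {x} → res x ≢ zer → ν (a ∷ x) ≢ zer
  res-basis {x} nz = nz ∘ trans (res-on (res-OnH nz))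

  OnH-Mem : ∀ {m} {x : Vec (Fin N) n} {y : Vec (Fin N) m} → Sub x y → OnH y → OnH x
  OnH-Mem sub h k = let l , eq = sub k in trans (cong (value Y) (sym eq)) (h l)

  OnH-update : ∀ {x : Vec (Fin N) n} {e} j → OnH x → value Y e ≡ zer → OnH (x [ j ]≔ e)
  OnH-update {x = x} j h he k with Mem-update⁻ x j (k , refl)
  ... | inj₁ eq = trans (cong (value Y) eq) he
  ... | inj₂ (l , _ , eq) = trans (cong (value Y) (sym eq)) (h l)

  OnH-∷ : ∀ {e} {x : Vec (Fin N) n} → value Y e ≡ zer → OnH x → OnH (e ∷ x)
  OnH-∷ he h zero = he
  OnH-∷ he h (suc k) = h k

  res-OM : OM res
  res-OM .alt {s} {x} {y} p with OnH? x
  ... | yes h = trans (alt om (prepᵖ a p)) (cong (s *ₛ_) (sym (res-on (OnH-Mem {x = y} {x} (Perm⇒Sub (Perm-sym p)) h))))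
  ... | no ¬h = sym (*ₛ-zeroʳ′ s (res-off λ h → ¬h (OnH-Mem {x = x} {y} (Perm⇒Sub p) h)))
  res-OM .ex x y j nz = i , (begin
      res (x [ j ]≔ lookup y i) *ₛ res (y [ i ]≔ lookup x j)
        ≡⟨ cong₂ _*ₛ_ (res-on (OnH-update {x = x} j hx (hy i))) (res-on (OnH-update {x = y} i hy (hx j))) ⟩
      ν (a ∷ (x [ j ]≔ lookup y i)) *ₛ ν (a ∷ (y [ i ]≔ lookup x j)) ≡⟨ proj₂ found ⟩
      ν (a ∷ x) *ₛ ν (a ∷ y) ≡⟨ cong₂ _*ₛ_ (sym (res-on hx)) (sym (res-on hy)) ⟩
      res x *ₛ res y ∎)
    where
    open ≡-Reasoning
    nzx = *ₛ-nonzeroˡ (res x) _ nz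
    nzy = *ₛ-nonzeroʳ (res x) _ nz
    hx : OnH x
    hx = res-OnH nzx
    hy : OnH y
    hy = res-OnH nzy
    found = ex (con-OM om a) x y j (*ₛ-nonzero _ _ (res-basis nzx) (res-basis nzy))
    i = proj₁ found

  -- By uniqueness of the cocircuit, the sign of a cone over a tuple in the hyperplane depends only
  -- on the side of its apex; so the marked element in `res` may be replaced by the actual vertex of
  -- a simplex.
  same-side : ∀ {x p q} → OnH x → value Y p ≡ pos → value Y q ≡ pos → ν (p ∷ x) ≡ ν (q ∷ x)
  same-side {x} {p} {q} h vp vq with ν (q ∷ x) ≟ₛ zer
  ... | no nz = sym (half h vp vq nz)
    where
    half : ∀ {p q} → OnH x → value Y p ≡ pos → value Y q ≡ pos → ν (q ∷ x) ≢ zer → ν (q ∷ x) ≡ ν (p ∷ x)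
    half {p} {q} h vp vq nz = begin
      ν (q ∷ x) ≡⟨ cong (_*ₛ ν (q ∷ x)) vp ⟨
      value Y p *ₛ ν (q ∷ x) ≡⟨ value-unique om Y nz zero (λ { zero k≢ → ⊥-elim (k≢ refl) ; (suc k) _ → h k }) p ⟩
      value Y q *ₛ ν (p ∷ x) ≡⟨ cong (_*ₛ ν (p ∷ x)) vq ⟩
      ν (p ∷ x) ∎
      where open ≡-Reasoning
  ... | yes zq with ν (p ∷ x) ≟ₛ zer
  ...   | yes zp = trans zp (sym zq)
  ...   | no nz = ⊥-elim (nz (begin
      ν (p ∷ x) ≡⟨ cong (_*ₛ ν (p ∷ x)) vq ⟨
      value Y q *ₛ ν (p ∷ x) ≡⟨ value-unique om Y nz zero (λ { zero k≢ → ⊥-elim (k≢ refl) ; (suc k) _ → h k }) q ⟩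
      value Y p *ₛ ν (q ∷ x) ≡⟨ *ₛ-zeroʳ′ (value Y p) zq ⟩
      zer ∎))
      where open ≡-Reasoning

  InFacet : Vec (Fin N) (suc r) × Fin (suc r) → Set
  InFacet (B , j) = ∀ k → k ≢ j → value Y (lookup B k) ≡ zer

  InFacet? : ∀ p → Dec (InFacet p)
  InFacet? (B , j) = all? λ k → ¬? (k ≟ j) →-dec (value Y (lookup B k) ≟ₛ zer)

  facetΔ : List (Vec (Fin N) (suc r)) → List (Vec (Fin N) r)
  facetΔ = faces InFacet?

  InFacet-OnH : ∀ {B j} → InFacet (B , j) → OnH (removeAt B j)
  InFacet-OnH {B} {j} h k = trans (cong (value Y) (lookup-removeAt B j k)) (h _ (FinP.punchInᵢ≢i j k))

  module _ {Δ : List (Vec (Fin N) (suc r))} (T : Triang ν Δ) where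

    facet-side : ∀ {B j} → B ∈ₗ Δ → InFacet (B , j) → value Y (lookup B j) ≡ pos
    facet-side {B} {j} B∈ h = value-outside om Y (bases T B B∈) j h

    facet-Simplex : ∀ {x} → Simplex (facetΔ Δ) res x → ∃ λ b → value Y b ≡ pos × Simplex Δ ν (b ∷ x)
    facet-Simplex {x} (nz , F , F∈ , sub) with ∈-faces⁻ InFacet? Δ F∈
    ... | B , j , B∈ , h , refl = lookup B j , vb , (λ eq → res-basis nz (trans (same-side (res-OnH nz) (value-apex Y) vb) eq)) ,
        B , B∈ , sub'
      where
      vb = facet-side B∈ h
      sub' : Sub (lookup B j ∷ x) B
      sub' zero = j , refl
      sub' (suc k) = Mem-removeAt⁻ B (sub k)

    facet-Simplex⁻ : ∀ {x p} → value Y p ≡ pos → OnH x → Simplex Δ ν (p ∷ x) → Simplex (facetΔ Δ) res x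
    facet-Simplex⁻ {x} {p} vp h S@(nz , B , B∈ , sub) with sub zero
    ... | j , at = (λ eq → nz (trans (same-side h vp (value-apex Y)) (trans (sym (res-on h)) eq))) ,
        removeAt B j , ∈-faces InFacet? Δ B∈ j inF , sub'
      where
      inj = nonzero⇒Inj om (bases T B B∈)
      inF : InFacet (B , j)
      inF k k≢j with Simplex-Sub om S k
      ... | zero , eq = ⊥-elim (k≢j (inj k j (trans (sym eq) (sym at))))
      ... | suc l , eq = trans (cong (value Y) (sym eq)) (h l)
      sub' : Sub x (removeAt B j)
      sub' k with sub (suc k)
      ... | l , eq = subst (λ e → Mem e (removeAt B j)) eq (Mem-removeAt B {j} {l} λ { refl →
            ≡pos⇒≢zer vp (trans (cong (value Y) (trans (sym at) eq)) (h k)) })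

    private
      sep : ∀ {B j B' j'} → B ∈ₗ Δ → B' ∈ₗ Δ → InFacet (B , j) → InFacet (B' , j') →
        Sub (removeAt B j) (removeAt B' j') → (B , j) ≡ (B' , j')
      sep {B} {j} {B'} {j'} B∈ B'∈ h h' sub = finish (distinct T B B' B∈ B'∈ sub')
        where
        F = removeAt B j
        b = lookup B j
        b' = lookup B' j'
        onF : OnH F
        onF = InFacet-OnH {B} {j} h
        nzF : ν (b ∷ F) ≢ zer
        nzF = Perm-basis om (bring B j) (bases T B B∈)
        same : ν (b ∷ F) ≡ ν (b' ∷ F)
        same = same-side onF (facet-side B∈ h) (facet-side B'∈ h')
        subB : Sub (b ∷ F) B
        subB zero = j , refl
        subB (suc k) = Mem-removeAt⁻ B (k , refl)
        subB' : Sub (b' ∷ F) B'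
        subB' zero = j' , refl
        subB' (suc k) = Mem-removeAt⁻ B' (sub k)
        b'≡b : b' ≡ b
        b'≡b = one-sided om T (b ∷ F) zero b' (nzF , B , B∈ , subB) (nzF ∘ trans same , B' , B'∈ , subB')
          (trans (cong (ν (b ∷ F) *ₛ_) (sym same)) (*ₛ-square _ nzF))
        sub' : Sub B B'
        sub' k with j ≟ k
        ... | yes refl = j' , b'≡b
        ... | no j≢k = Mem-removeAt⁻ B' (Sub-Mem {x = F} {removeAt B' j'} sub (Mem-removeAt B j≢k))
        finish : B ≡ B' → (B , j) ≡ (B' , j')
        finish refl = cong (B ,_) (nonzero⇒Inj om (bases T B B∈) j j' (sym b'≡b))

      -- The rank two contraction at F ∖ F_k: q lies before p when q, p is positively oriented.
      module Ridge (F : Vec (Fin N) r) (onF : OnH F) (k : Fin r) (nzF : ν (a ∷ F) ≢ zer) where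

        ε : Sign
        ε = ν (a ∷ F)

        _⊏_ : Fin N → Fin N → Set
        q ⊏ p = value Y q ≡ pos × value Y p ≡ pos × ν (p ∷ (F [ k ]≔ q)) ≡ ε

        flip-pair : ∀ p q → ν (p ∷ (F [ k ]≔ q)) ≡ negₛ (ν (q ∷ (F [ k ]≔ p)))
        flip-pair p q = trans (alt om (Perm-swapAt₀ p (F [ k ]≔ q) k))
          (cong (λ z → negₛ (ν z)) (cong₂ _∷_ (VecP.lookup∘update k F q) (VecP.[]≔-idempotent F k)))

        ⊏-irrefl : ∀ {p q} → p ≡ q → ¬ (p ⊏ q)
        ⊏-irrefl {p} refl (_ , _ , eq) = nzF (trans (sym eq) (con-vanish om p F k))

        -- A rank two exchange leaves three kinds of candidates: one is the claim, one has the wrong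
        -- sign, and the others repeat an entry.
        ⊏-trans : ∀ {p q t} → p ⊏ q → q ⊏ t → p ⊏ t
        ⊏-trans {p} {q} {t} (vp , vq , pq) (_ , vt , qt)
          with ex om (t ∷ (F [ k ]≔ q)) (p ∷ F) (suc k) (*ₛ-nonzero _ _ (nzF ∘ trans (sym qt)) (nzF ∘ trans (sym (same-side onF vp (value-apex Y)))))
        ... | zero , eq = vp , vt , *ₛ-pos⇒≡ _ ε (trans (cong₂ _*ₛ_
              (cong (λ G → ν (t ∷ G)) (sym (VecP.[]≔-idempotent F k)))
              (sym (trans (cong (λ e → ν (e ∷ F)) (VecP.lookup∘update k F q)) (same-side onF vq (value-apex Y)))))
              (trans eq prod))
          where
          prod : ν (t ∷ (F [ k ]≔ q)) *ₛ ν (p ∷ F) ≡ pos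
          prod = trans (cong₂ _*ₛ_ qt (same-side onF vp (value-apex Y))) (*ₛ-square ε nzF)
        ... | suc m , eq with m ≟ k
        ...   | yes refl = ⊥-elim (pos≢neg prod (trans (sym eq) (trans (cong₂ _*ₛ_ at-t at-p) (trans (negₛ-*ʳ ε ε) (cong negₛ (*ₛ-square ε nzF))))))
          where
          prod : ν (t ∷ (F [ k ]≔ q)) *ₛ ν (p ∷ F) ≡ pos
          prod = trans (cong₂ _*ₛ_ qt (same-side onF vp (value-apex Y))) (*ₛ-square ε nzF)
          at-t : ν (t ∷ ((F [ m ]≔ q) [ m ]≔ lookup F m)) ≡ ε
          at-t = trans (cong (λ G → ν (t ∷ G)) (trans (VecP.[]≔-idempotent F m) (VecP.[]≔-lookup F m)))
            (same-side onF vt (value-apex Y))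
          at-p : ν (p ∷ (F [ m ]≔ lookup (F [ m ]≔ q) m)) ≡ negₛ ε
          at-p = trans (cong (λ e → ν (p ∷ (F [ m ]≔ e))) (VecP.lookup∘update m F q)) (trans (flip-pair p q) (cong negₛ pq))
        ...   | no m≢k = ⊥-elim (*ₛ-nonzero _ _ (nzF ∘ trans (sym qt)) (nzF ∘ trans (sym (same-side onF vp (value-apex Y))))
            (trans (sym eq) (*ₛ-zeroˡ′ _ (trans (cong (λ G → ν (t ∷ G)) (VecP.[]≔-idempotent F k))
              (repeated⇒zer om (t ∷ (F [ k ]≔ lookup F m)) {suc m} {suc k} (m≢k ∘ FinP.suc-injective)
                (trans (VecP.lookup∘update′ m≢k F _) (sym (VecP.lookup∘update k F _))))))))

        ⊏-isStrictPartialOrder : IsStrictPartialOrder _≡_ _⊏_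
        ⊏-isStrictPartialOrder = record { isEquivalence = isEquivalence ; irrefl = ⊏-irrefl ; trans = ⊏-trans
          ; <-resp-≈ = (λ { refl h → h }) , (λ { refl h → h }) }

        -- Walks through the simplices around the ridge `F` without `F_k`. Crossing the facet
        -- opposite to `q` meets the boundary, or an element of the hyperplane, which gives the
        -- wanted neighbour of `F`, or an element `e` outside it. In the last case `e` takes the
        -- part of `p` and `p` that of `q`; as `p ⊏ e`, the walk ends.
        climb : ∀ p → Acc (flip _⊏_) p → ∀ q → value Y p ≡ pos → Simplex Δ ν (p ∷ (F [ k ]≔ q)) →
          ν (p ∷ (F [ k ]≔ q)) ≡ ε →
          Bd res (F , k) ⊎ (∃ λ e → Simplex (facetΔ Δ) res (F [ k ]≔ e) × res F *ₛ res (F [ k ]≔ e) ≡ neg)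
        climb p (acc rec) q vp S eq with fac T (p ∷ (F [ k ]≔ q)) S (suc k)
        ... | inj₁ bd = inj₁ bd'
          where
          bd' : Bd res (F , k)
          bd' e with OnH? (F [ k ]≔ e)
          ... | no ¬on = λ eq' → ≡neg⇒≢zer eq' (*ₛ-zeroʳ (res F))
          ... | yes on = λ eq' → bd e (trans (cong₂ _*ₛ_ (trans eq (sym (res-on onF)))
                (trans (cong (λ G → ν (p ∷ G)) (VecP.[]≔-idempotent F k)) (same-side on vp (value-apex Y)))) eq')
        ... | inj₂ (e , S' , opp) = onward (subst (λ G → Simplex Δ ν (p ∷ G)) (VecP.[]≔-idempotent F k) S')
              (*ₛ-neg⇒≡ _ _ (trans (*ₛ-comm (ν (p ∷ (F [ k ]≔ e))) ε) (trans (sym (cong₂ _*ₛ_ eq (cong (λ G → ν (p ∷ G)) (VecP.[]≔-idempotent F k)))) opp)))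
          where
          onward : Simplex Δ ν (p ∷ (F [ k ]≔ e)) → ν (p ∷ (F [ k ]≔ e)) ≡ negₛ ε → _
          onward S″ eq″ with value Y e ≟ₛ zer
          ... | yes ve = inj₂ (e , facet-Simplex⁻ vp on S″ , trans (cong₂ _*ₛ_ (res-on onF)
                (trans (res-on on) (trans (same-side on (value-apex Y) vp) eq″))) (trans (negₛ-*ʳ ε ε) (cong negₛ (*ₛ-square ε nzF))))
            where
            on : OnH (F [ k ]≔ e)
            on = OnH-update {x = F} k onF ve
          ... | no nz = climb e (rec (vp , ve , turned)) p ve
                (Simplex-Perm om (subst (Perm neg (p ∷ (F [ k ]≔ e))) (cong₂ _∷_ (VecP.lookup∘update k F e) (VecP.[]≔-idempotent F k))
                  (Perm-swapAt₀ p (F [ k ]≔ e) k)) S″) turned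
            where
            ve : value Y e ≡ pos
            ve = value-pos om Y nz
            turned : ν (e ∷ (F [ k ]≔ p)) ≡ ε
            turned = trans (flip-pair e p) (trans (cong negₛ eq″) (negₛ-invol ε))

    facet-Triang : Triang res (facetΔ Δ)
    facet-Triang .bases F F∈ with ∈-faces⁻ InFacet? Δ F∈
    ... | B , j , B∈ , h , refl = λ eq → Perm-basis om (bring B j) (bases T B B∈)
            (trans (same-side on (facet-side B∈ h) (value-apex Y)) (trans (sym (res-on on)) eq))
      where
      on : OnH (removeAt B j)
      on = InFacet-OnH {B} {j} h
    facet-Triang .unique = faces-unique InFacet? Δ (unique T) sep
    facet-Triang .distinct = faces-distinct InFacet? Δ (unique T) sep
    facet-Triang .nc F F' F∈ F'∈ y x σ nz x∉y (z , j , nzx) σnz p q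
      with ∈-faces⁻ InFacet? Δ F∈ | ∈-faces⁻ InFacet? Δ F'∈
    ... | B , b , B∈ , _ , refl | B' , b' , B'∈ , _ , refl =
      nc T B B' B∈ B'∈ (a ∷ y) x σ (res-basis nz) x∉ (a ∷ z , suc j , res-basis nzx) σnz p' q'
      where
      ony : OnH y
      ony = res-OnH nz
      vx : value Y x ≡ zer
      vx = trans (cong (value Y) (sym (VecP.lookup∘update j z x))) (res-OnH nzx j)
      x∉ : ¬ Mem x (a ∷ y)
      x∉ (zero , refl) = ≡pos⇒≢zer (value-apex Y) vx
      x∉ (suc k , eq) = x∉y (k , eq)
      -- The rest of the circuit lies in the hyperplane, which misses the apex, so the entry at the
      -- apex vanishes.
      at-a : σ *ₛ sg ν (a ∷ y) x (suc zero) ≡ zer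
      at-a = *ₛ-zeroʳ′ σ (cong negₛ (hyperplane⇒zer om Y (x ∷ y) (OnH-∷ {x = y} vx ony)))
      agree : ∀ i → res (y [ i ]≔ x) ≡ ν (a ∷ (y [ i ]≔ x))
      agree i = res-on (OnH-update {x = y} i ony vx)
      p' : ∀ k → σ *ₛ sg ν (a ∷ y) x k ≡ pos → Mem (el (a ∷ y) x k) B
      p' zero eq = Mem-removeAt⁻ B (p zero (trans (cong (σ *ₛ_) (res-on ony)) eq))
      p' (suc zero) eq = ⊥-elim (≡pos⇒≢zer eq at-a)
      p' (suc (suc k)) eq = Mem-removeAt⁻ B (p (suc k) (trans (cong (λ s → σ *ₛ negₛ s) (agree k)) eq))
      q' : ∀ k → σ *ₛ sg ν (a ∷ y) x k ≡ neg → Mem (el (a ∷ y) x k) B'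
      q' zero eq = Mem-removeAt⁻ B' (q zero (trans (cong (σ *ₛ_) (res-on ony)) eq))
      q' (suc zero) eq = ⊥-elim (≡neg⇒≢zer eq at-a)
      q' (suc (suc k)) eq = Mem-removeAt⁻ B' (q (suc k) (trans (cong (λ s → σ *ₛ negₛ s) (agree k)) eq))
    facet-Triang .fac x S k with facet-Simplex S
    ... | b , vb , S' = climb b (spo-noetherian ⊏-isStrictPartialOrder b) (lookup x k) vb
            (subst (λ G → Simplex Δ ν (b ∷ G)) (sym (VecP.[]≔-lookup x k)) S')
            (trans (cong (λ G → ν (b ∷ G)) (VecP.[]≔-lookup x k)) (same-side on vb (value-apex Y)))
      where
      on : OnH x
      on = res-OnH (proj₁ S)
      open Ridge x on k (res-basis (proj₁ S))

-- Circuits as sign vectors; triangulations in the sense of Santos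

circ : Chi N r → Vec (Fin N) r → Fin N → SignVec N
circ ν y x e with e ≟ x | Mem? e y
... | yes _ | _ = ν y
... | no _ | yes (i , _) = negₛ (ν (y [ i ]≔ x))
... | no _ | no _ = zer

circ-el : (ν : Chi N r) (y : Vec (Fin N) r) (x : Fin N) → Inj y → ¬ Mem x y → ∀ k → circ ν y x (el y x k) ≡ sg ν y x k
circ-el ν y x inj x∉ zero with x ≟ x | Mem? x y
... | yes _ | _ = refl
... | no x≢x | _ = ⊥-elim (x≢x refl)
circ-el ν y x inj x∉ (suc i) with lookup y i ≟ x | Mem? (lookup y i) y
... | yes eq | _ = ⊥-elim (x∉ (i , eq))
... | no _ | yes (k , eq) = cong (λ k → negₛ (ν (y [ k ]≔ x))) (inj k i eq)
... | no _ | no ∉ = ⊥-elim (∉ (i , refl))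

circ-support : (ν : Chi N r) (y : Vec (Fin N) r) (x e : Fin N) → circ ν y x e ≢ zer → ∃ λ k → el y x k ≡ e
circ-support ν y x e nz with e ≟ x | Mem? e y
... | yes eq | _ = zero , sym eq
... | no _ | yes (i , eq) = suc i , eq
... | no _ | no _ = ⊥-elim (nz refl)

-- Orthogonality with its disjunction removed: exchange yields the opposite term directly.
Balanced : SignVec N → SignVec N → Set
Balanced V X = ∀ e → V e *ₛ X e ≢ zer → ∃ λ f → V f *ₛ X f ≡ negₛ (V e *ₛ X e)

-- Cocircuits alone are tested; composition carries orthogonality over to all covectors.
record Vect {N r} (ν : Chi N r) (V : SignVec N) : Set where
  field
    orthogonal : ∀ z j → Balanced V (λ e → ν (z [ j ]≔ e))
open Vect public

module _ {N r} {ν : Chi N r} (om : OM ν) {y : Vec (Fin N) r} (nz : ν y ≢ zer) {x : Fin N} (x∉ : ¬ Mem x y) where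

  circ-Vect : ∀ σ → Vect ν (λ e → σ *ₛ circ ν y x e)
  circ-Vect σ .orthogonal z j e nze with circ-support ν y x e (*ₛ-nonzeroʳ σ _ (*ₛ-nonzeroˡ (σ *ₛ circ ν y x e) _ nze))
  ... | k , refl with circuit-orthogonal om y x z j k (λ eq → nze (trans (pull k) (*ₛ-zeroʳ′ σ eq)))
    where
    pull : ∀ k → (σ *ₛ circ ν y x (el y x k)) *ₛ ν (z [ j ]≔ el y x k) ≡ σ *ₛ (sg ν y x k *ₛ ν (z [ j ]≔ el y x k))
    pull k = trans (*ₛ-assoc σ _ _) (cong (λ s → σ *ₛ (s *ₛ ν (z [ j ]≔ el y x k))) (circ-el ν y x (nonzero⇒Inj om nz) x∉ k))
  ...   | l , eq = el y x l , trans (pull l) (trans (cong (σ *ₛ_) eq)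
            (trans (negₛ-*ʳ σ _) (cong negₛ (sym (pull k)))))
    where
    pull : ∀ k → (σ *ₛ circ ν y x (el y x k)) *ₛ ν (z [ j ]≔ el y x k) ≡ σ *ₛ (sg ν y x k *ₛ ν (z [ j ]≔ el y x k))
    pull k = trans (*ₛ-assoc σ _ _) (cong (λ s → σ *ₛ (s *ₛ ν (z [ j ]≔ el y x k))) (circ-el ν y x (nonzero⇒Inj om nz) x∉ k))

compose-nonzero : (X Y : SignVec N) (e : Fin N) → X e ≢ zer → compose X Y e ≡ X e
compose-nonzero X Y e nz with X e
... | pos = refl
... | neg = refl
... | zer = ⊥-elim (nz refl)

compose-zero : (X Y : SignVec N) (e : Fin N) → X e ≡ zer → compose X Y e ≡ Y e
compose-zero X Y e eq with X e
compose-zero X Y e refl | .zer = refl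

-- If `V` meets the support of `X`, both signs already occur there and composing with `Y` does not
-- disturb them; otherwise `V` sees only `Y`.
Balanced-compose : {V X Y : SignVec N} → Balanced V X → Balanced V Y → Balanced V (compose X Y)
Balanced-compose {V = V} {X} {Y} bx by e nz with any? (λ f → ¬? ((V f *ₛ X f) ≟ₛ zer))
... | yes (f , nzf) with bx f nzf
...   | f' , eq' = go ((V e *ₛ compose X Y e) ≟ₛ (V f *ₛ X f))
  where
  on : ∀ g → V g *ₛ X g ≢ zer → V g *ₛ compose X Y g ≡ V g *ₛ X g
  on g nzg = cong (V g *ₛ_) (compose-nonzero X Y g (*ₛ-nonzeroʳ (V g) _ nzg))
  other : ∀ a b → a ≢ zer → b ≢ zer → a ≢ b → b ≡ negₛ a
  other = decide (allSigns? λ a → allSigns? λ b → ¬? (_ ≟ₛ _) →-dec (¬? (_ ≟ₛ _) →-dec (¬? (_ ≟ₛ _) →-dec (_ ≟ₛ _)))) tt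
  go : Dec (V e *ₛ compose X Y e ≡ V f *ₛ X f) → ∃ λ g → V g *ₛ compose X Y g ≡ negₛ (V e *ₛ compose X Y e)
  go (yes eq) = f' , trans (on f' λ z → negₛ≢zer _ nzf (trans (sym eq') z)) (trans eq' (cong negₛ (sym eq)))
  go (no ne) = f , trans (on f nzf) (other _ _ nz nzf ne)
Balanced-compose {V = V} {X} {Y} bx by e nz | no none with by e (nz ∘ trans (off e))
  where
  off : ∀ g → V g *ₛ compose X Y g ≡ V g *ₛ Y g
  off g with V g ≟ₛ zer
  ... | yes eq = trans (*ₛ-zeroˡ′ _ eq) (sym (*ₛ-zeroˡ′ (Y g) eq))
  ... | no nzg = cong (V g *ₛ_) (compose-zero X Y g (¬≢zer⇒≡ λ nzx → none (g , *ₛ-nonzero _ _ nzg nzx)))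
... | f , eq = f , trans (off f) (trans eq (cong negₛ (sym (off e))))
  where
  off : ∀ g → V g *ₛ compose X Y g ≡ V g *ₛ Y g
  off g with V g ≟ₛ zer
  ... | yes eq = trans (*ₛ-zeroˡ′ _ eq) (sym (*ₛ-zeroˡ′ (Y g) eq))
  ... | no nzg = cong (V g *ₛ_) (compose-zero X Y g (¬≢zer⇒≡ λ nzx → none (g , *ₛ-nonzero _ _ nzg nzx)))

Balanced-≗ : {V X Y : SignVec N} → (∀ e → X e ≡ Y e) → Balanced V X → Balanced V Y
Balanced-≗ {V = V} h b e nz with b e (nz ∘ trans (cong (V e *ₛ_) (sym (h e))))
... | f , eq = f , trans (cong (V f *ₛ_) (sym (h f))) (trans eq (cong (λ s → negₛ (V e *ₛ s)) (h e)))

Balanced-scale : {V X : SignVec N} (s : Sign) → Balanced V X → Balanced V (λ e → s *ₛ X e)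
Balanced-scale {V = V} {X} s b e nz = f , (begin
    V f *ₛ (s *ₛ X f) ≡⟨ *ₛ-exchange (V f) s (X f) ⟩
    s *ₛ (V f *ₛ X f) ≡⟨ cong (s *ₛ_) (proj₂ found) ⟩
    s *ₛ negₛ (V e *ₛ X e) ≡⟨ negₛ-*ʳ s _ ⟩
    negₛ (s *ₛ (V e *ₛ X e)) ≡⟨ cong negₛ (*ₛ-exchange (V e) s (X e)) ⟨
    negₛ (V e *ₛ (s *ₛ X e)) ∎)
  where
  open ≡-Reasoning
  found = b e λ eq → nz (trans (*ₛ-exchange (V e) s (X e)) (*ₛ-zeroʳ′ s eq))
  f = proj₁ found

snoc-update : {A : Set} (x : Vec A n) (a e : A) → (x ∷ʳ a) [ Fin.fromℕ n ]≔ e ≡ x ∷ʳ e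
snoc-update [] a e = refl
snoc-update (b ∷ x) a e = cong (b ∷_) (snoc-update x a e)

lookup-snoc-last : {A : Set} (x : Vec A n) (a : A) → lookup (x ∷ʳ a) (Fin.fromℕ n) ≡ a
lookup-snoc-last [] a = refl
lookup-snoc-last (b ∷ x) a = lookup-snoc-last x a

removeAt-update : {A : Set} (z : Vec A (suc n)) (j : Fin (suc n)) (e : A) → removeAt (z [ j ]≔ e) j ≡ removeAt z j
removeAt-update z j e = vec-ext λ k → trans (lookup-removeAt (z [ j ]≔ e) j k)
  (trans (VecP.lookup∘update′ (FinP.punchInᵢ≢i j k) z e) (sym (lookup-removeAt z j k)))

update-snoc : {A : Set} (z : Vec A (suc n)) (j : Fin (suc n)) (e : A) →
  Perm (parity (toℕ j) *ₛ parity n) (z [ j ]≔ e) (removeAt z j ∷ʳ e)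
update-snoc {n} z j e = transᵖ
  (subst (λ x → Perm (parity (toℕ j)) (z [ j ]≔ e) x)
    (cong₂ _∷_ (VecP.lookup∘update j z e) (removeAt-update z j e)) (bring (z [ j ]≔ e) j))
  (rotate e (removeAt z j))

cocircuit-update : {ν : Chi N (suc r)} {Y : SignVec N} → IsCocircuit (suc r) ν Y →
  ∃ λ z → ∃ λ s → s ≢ zer × (∃ λ e → ν (z [ Fin.fromℕ r ]≔ e) ≢ zer) × (∀ e → Y e ≡ s *ₛ ν (z [ Fin.fromℕ r ]≔ e))
cocircuit-update {ν = ν} (x , s , s≢ , (e₀ , nz) , Y≡) = x ∷ʳ e₀ , s , s≢ ,
  (e₀ , nz ∘ trans (cong ν (sym (snoc-update x e₀ e₀)))) ,
  λ e → trans (Y≡ e) (cong (λ z → s *ₛ ν z) (sym (snoc-update x e₀ e)))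

update-cocircuit : ∀ {N r} {ν : Chi N (suc r)} → OM ν → ∀ z j s → s ≢ zer → (∃ λ e → ν (z [ j ]≔ e) ≢ zer) →
  IsCocircuit (suc r) ν (λ e → s *ₛ ν (z [ j ]≔ e))
update-cocircuit {r = r} {ν} om z j s s≢ (e₀ , nz) = removeAt z j , s *ₛ t , *ₛ-nonzero _ _ s≢ (Perm-nonzero (update-snoc z j e₀)) ,
  (e₀ , Perm-basis om (update-snoc z j e₀) nz) ,
  λ e → trans (cong (s *ₛ_) (alt om (update-snoc z j e))) (sym (*ₛ-assoc s t _))
  where
  t = parity (toℕ j) *ₛ parity r

covector-Balanced : ∀ {r} {ν : Chi N r} {V X : SignVec N} → Vect ν V → IsCovector ν X → Balanced V X
covector-Balanced {r = r} {ν} {V} {X} vect (Ys , cs , X≡) = Balanced-≗ {V = V} {List.foldr compose zeroV Ys} {X} (λ e → sym (X≡ e)) (all-balanced Ys cs)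
  where
  single : ∀ {r} {ν : Chi _ r} {Y} → Vect ν V → IsCocircuit r ν Y → Balanced V Y
  single {suc r} {ν} {Y} vect c with cocircuit-update {ν = ν} {Y} c
  ... | z , s , _ , _ , Y≡ = Balanced-≗ {V = V} {X = λ e → s *ₛ ν (z [ Fin.fromℕ r ]≔ e)} {Y} (λ e → sym (Y≡ e)) (Balanced-scale {V = V} {λ e → ν (z [ Fin.fromℕ r ]≔ e)} s (orthogonal vect z (Fin.fromℕ r)))
  all-balanced : ∀ Ys → All (IsCocircuit r ν) Ys → Balanced V (List.foldr compose zeroV Ys)
  all-balanced [] _ e nz = ⊥-elim (nz (*ₛ-zeroʳ (V e)))
  all-balanced (Y ∷ Ys) (c ∷ cs) = Balanced-compose {V = V} {Y} {List.foldr compose zeroV Ys} (single {r} {ν} {Y} vect c) (all-balanced Ys cs)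

Balanced⇒Orthogonal : {V X : SignVec N} → Balanced V X → Orthogonal V X
Balanced⇒Orthogonal {V = V} {X} b with any? (λ f → ¬? ((V f *ₛ X f) ≟ₛ zer))
... | no none = inj₁ λ e → ¬≢zer⇒≡ λ nz → none (e , nz)
... | yes (f , nz) with V f *ₛ X f in eq | b f nz
...   | pos | g , eq' = inj₂ ((f , eq) , g , eq')
...   | neg | g , eq' = inj₂ ((g , eq') , f , eq)
...   | zer | _ = ⊥-elim (nz eq)

Orthogonal⇒Balanced : {V X : SignVec N} → Orthogonal V X → Balanced V X
Orthogonal⇒Balanced (inj₁ h) e nz = ⊥-elim (nz (h e))
Orthogonal⇒Balanced {V = V} {X} (inj₂ ((f , p) , g , q)) e nz with V e *ₛ X e
... | pos = g , q
... | neg = f , p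
... | zer = ⊥-elim (nz refl)

cocircuit⇒covector : ∀ {r} {ν : Chi N r} {Y : SignVec N} → IsCocircuit r ν Y → IsCovector ν Y
cocircuit⇒covector {Y = Y} c = Y ∷ [] , c ∷ [] , λ e → sym (single e)
  where
  single : ∀ e → compose Y zeroV e ≡ Y e
  single e with Y e ≟ₛ zer
  ... | yes eq = trans (compose-zero Y zeroV e eq) (sym eq)
  ... | no nz = compose-nonzero Y zeroV e nz

IsVector⇒Vect : {E : Subset N} {ν : Chi N (suc r)} → OM ν → ∀ {V} → IsVector E ν V → Vect ν V
IsVector⇒Vect {ν = ν} om {V} (_ , h) .orthogonal z j e nz = Orthogonal⇒Balanced {V = V} {λ e → ν (z [ j ]≔ e)} (h _ (cocircuit⇒covector {ν = ν}
  (update-cocircuit {ν = ν} om z j pos (λ ()) (e , *ₛ-nonzeroʳ (V e) _ nz)))) e nz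

module _ {N r} {E : Subset N} {ν : Chi N (suc r)} (om : OM ν)
  (support : ∀ x → ν x ≢ zer → ∀ k → lookup x k ∈ E)
  {y : Vec (Fin N) (suc r)} (nz : ν y ≢ zer) {x : Fin N} (x∉ : ¬ Mem x y) (nl : NonLoop ν x) where

  private
    C : Sign → SignVec N
    C σ e = σ *ₛ circ ν y x e

    inE : ∀ k → el y x k ∈ E
    inE zero = let z , j , nzx = nl in subst (_∈ E) (VecP.lookup∘update j z x) (support _ nzx j)
    inE (suc i) = support y nz i

    supported : ∀ {σ e} → C σ e ≢ zer → ∃ λ k → el y x k ≡ e
    supported {σ} {e} nzc = circ-support ν y x e (*ₛ-nonzeroʳ σ _ nzc)

    module Minimal {σ} {D : SignVec N} (vect : Vect ν D) (D⊆C : ∀ e → D e ≢ zer → C σ e ≢ zer) where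

      -- In D ⊥ ν(y[i]≔·) only the entries at x and at y_i survive.
      crossing : ∀ i e → D e *ₛ ν (y [ i ]≔ e) ≢ zer → (D x *ₛ ν (y [ i ]≔ x)) ≢ zer × D (lookup y i) ≢ zer
      crossing i e nze with orthogonal vect y i e nze
      ... | f , eq = both (at e nze) (at f λ z → negₛ≢zer _ nze (trans (sym eq) z))
        where
        at : ∀ g → D g *ₛ ν (y [ i ]≔ g) ≢ zer → g ≡ x ⊎ g ≡ lookup y i
        at g nzg with supported {σ} {g} (D⊆C g (*ₛ-nonzeroˡ (D g) _ nzg))
        ... | zero , refl = inj₁ refl
        ... | suc m , refl with m ≟ i
        ...   | yes refl = inj₂ refl
        ...   | no m≢i = ⊥-elim (nzg (*ₛ-zeroʳ′ (D (lookup y m)) (update-other om y m≢i refl)))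
        distinct-values : e ≢ f
        distinct-values refl = nze (negₛ-fix _ eq)
        both : e ≡ x ⊎ e ≡ lookup y i → f ≡ x ⊎ f ≡ lookup y i → _
        both (inj₁ refl) (inj₁ refl) = ⊥-elim (distinct-values refl)
        both (inj₁ refl) (inj₂ refl) = nze , *ₛ-nonzeroˡ (D f) _ λ z → negₛ≢zer _ nze (trans (sym eq) z)
        both (inj₂ refl) (inj₁ refl) = (λ z → negₛ≢zer _ nze (trans (sym eq) z)) , *ₛ-nonzeroˡ (D e) _ nze
        both (inj₂ refl) (inj₂ refl) = ⊥-elim (distinct-values refl)

      at-x : (∃ λ e → D e ≢ zer) → D x ≢ zer
      at-x (e , nze) with supported {σ} {e} (D⊆C e nze)
      ... | zero , refl = nze
      ... | suc i , refl = *ₛ-nonzeroˡ (D x) _ (proj₁ (crossing i (lookup y i)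
              (*ₛ-nonzero _ _ nze (nz ∘ trans (sym (update-same om y i refl))))))

      minimal : (∃ λ e → D e ≢ zer) → ∀ e → C σ e ≢ zer → D e ≢ zer
      minimal some e nzc with supported {σ} {e} nzc
      ... | zero , refl = at-x some
      ... | suc i , refl = proj₂ (crossing i x (*ₛ-nonzero _ _ (at-x some) λ z →
              *ₛ-nonzeroʳ σ _ nzc (trans (circ-el ν y x (nonzero⇒Inj om nz) x∉ (suc i)) (cong negₛ z))))

  circ-IsCircuit : ∀ σ → σ ≢ zer → IsCircuit E ν (λ e → σ *ₛ circ ν y x e)
  circ-IsCircuit σ σ≢ =
    ( (λ e nzc → let k , eq = supported {σ} {e} nzc in subst (_∈ E) eq (inE k))
    , (λ X cov → Balanced⇒Orthogonal {V = C σ} {X} (covector-Balanced {ν = ν} {C σ} {X} (circ-Vect om nz x∉ σ) cov)))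
    , (x , *ₛ-nonzero _ _ σ≢ (nz ∘ trans (sym (circ-el ν y x (nonzero⇒Inj om nz) x∉ zero))))
    , λ D vec some D⊆C → Minimal.minimal {σ} {D} (IsVector⇒Vect {E = E} {ν} om {D} vec) D⊆C some

AllPairs-lookup : {A : Set} {R : A → A → Set} {L : List A} → AllPairs R L → (∀ {x y} → R x y → R y x) →
  ∀ {x y} → x ∈ₗ L → y ∈ₗ L → x ≢ y → R x y
AllPairs-lookup (h ∷ p) R-sym (here refl) (here refl) ne = ⊥-elim (ne refl)
AllPairs-lookup (h ∷ p) R-sym (here refl) (there y∈) ne = All.lookup h y∈
AllPairs-lookup (h ∷ p) R-sym (there x∈) (here refl) ne = R-sym (All.lookup h x∈)
AllPairs-lookup (h ∷ p) R-sym (there x∈) (there y∈) ne = AllPairs-lookup p R-sym x∈ y∈ ne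

module _ {N r} {E : Subset N} {ν : Chi N (suc r)} (om : OM ν)
  (support : ∀ x → ν x ≢ zer → ∀ k → lookup x k ∈ E)
  {Δ : List (Vec (Fin N) (suc r))} (I : IsTriangulation E (suc r) ν Δ) where

  private
    module I = IsTriangulation I

    bases′ : ∀ B → B ∈ₗ Δ → ν B ≢ zer
    bases′ B B∈ = All.lookup I.bases B∈

    noCircuit′ : NoCircuit ν Δ
    noCircuit′ B B' B∈ B'∈ y x σ nz x∉ nl σ≢ p q = I.noCircuit B B' B∈ B'∈ (λ e → σ *ₛ circ ν y x e)
      (circ-IsCircuit om support nz x∉ nl σ σ≢) (inside {pos} {B} p , inside {neg} {B'} q)
      where
      inside : ∀ {s} {B : Vec (Fin N) (suc r)} → (∀ k → σ *ₛ sg ν y x k ≡ s → Mem (el y x k) B) →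
        {s≢ : True (¬? (s ≟ₛ zer))} → ∀ e → σ *ₛ circ ν y x e ≡ s → e ∈ img B
      inside {s} {B} p {s≢} e eq with circ-support ν y x e (*ₛ-nonzeroʳ σ _ (toWitness s≢ ∘ trans (sym eq)))
      ... | k , refl = Mem⇒∈img B (p k (trans (cong (σ *ₛ_) (sym (circ-el ν y x (nonzero⇒Inj om nz) x∉ k))) eq))

    fac′ : ∀ x → Simplex Δ ν x → ∀ j →
      Bd ν (x , j) ⊎ (∃ λ e → Simplex Δ ν (x [ j ]≔ e) × ν x *ₛ ν (x [ j ]≔ e) ≡ neg)
    fac′ x S@(nz , B , B∈ , sub) j with sub j
    ... | l , at with I.facets B B∈ l
    ...   | inj₁ (Y , coc , nonneg , vanish) = inj₁ bd
      where
      c = cocircuit-update {ν = ν} {Y} coc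
      z = proj₁ c
      s = proj₁ (proj₂ c)
      Y≡ = proj₂ (proj₂ (proj₂ (proj₂ c)))
      vanish-x : ∀ k → k ≢ j → ν (z [ Fin.fromℕ r ]≔ lookup x k) ≡ zer
      vanish-x k k≢j = trans (sym (*ₛ-cancel s _ (proj₁ (proj₂ (proj₂ c))))) (*ₛ-zeroʳ′ s
        (trans (sym (Y≡ _)) (trans (cong Y (sym (proj₂ (sub k)))) (vanish (proj₁ (sub k)) λ eq →
          k≢j (nonzero⇒Inj om nz k j (trans (sym (proj₂ (sub k))) (trans (cong (lookup B) eq) at)))))))
      law : ∀ e → Y e *ₛ ν x ≡ Y (lookup x j) *ₛ ν (x [ j ]≔ e)
      law e = begin
        Y e *ₛ ν x ≡⟨ cong (_*ₛ ν x) (Y≡ e) ⟩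
        (s *ₛ ν (z [ Fin.fromℕ r ]≔ e)) *ₛ ν x ≡⟨ *ₛ-assoc s _ _ ⟩
        s *ₛ (ν (z [ Fin.fromℕ r ]≔ e) *ₛ ν x) ≡⟨ cong (s *ₛ_) (cocircuit-unique om nz z (Fin.fromℕ r) j vanish-x e) ⟩
        s *ₛ (ν (z [ Fin.fromℕ r ]≔ lookup x j) *ₛ ν (x [ j ]≔ e)) ≡⟨ *ₛ-assoc s _ _ ⟨
        (s *ₛ ν (z [ Fin.fromℕ r ]≔ lookup x j)) *ₛ ν (x [ j ]≔ e) ≡⟨ cong (_*ₛ ν (x [ j ]≔ e)) (Y≡ _) ⟨
        Y (lookup x j) *ₛ ν (x [ j ]≔ e) ∎
        where open ≡-Reasoning
      e₁ = proj₁ (proj₁ (proj₂ (proj₂ (proj₂ c))))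
      Y-j : Y (lookup x j) ≡ pos
      Y-j = ≢zer∧≢neg⇒pos _ (λ eq → *ₛ-nonzero (Y e₁) _ (λ z → *ₛ-nonzero s _ (proj₁ (proj₂ (proj₂ c)))
              (proj₂ (proj₁ (proj₂ (proj₂ (proj₂ c))))) (trans (sym (Y≡ e₁)) z)) nz
              (trans (law e₁) (*ₛ-zeroˡ′ _ eq))) (nonneg _)
      bd : Bd ν (x , j)
      bd e eq = nonneg e (trans (sym (trans (cong (ν x *ₛ_) (trans (sym (trans (law e) (cong (_*ₛ ν (x [ j ]≔ e)) Y-j)))
        (*ₛ-comm (Y e) (ν x)))) (*ₛ-cancel _ _ nz))) eq)
    -- The element to exchange in is an entry of `B'` outside `x`; if there were none, the two
    -- simplices would coincide as sets.
    ...   | inj₂ (B' , B'∈ , img≢ , sub') with all? (λ m → Mem? (lookup B' m) x)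
    ...     | yes B'⊆x = ⊥-elim (img≢ (img-cong B' B
                (λ m → Sub-Mem {x = x} {B} sub (B'⊆x m))
                (λ m → Sub-Mem {x = x} {B'} (Perm⇒Sub (Perm-sym (proj₂ (Sub⇒Perm B' x (nonzero⇒Inj om (bases′ B' B'∈)) B'⊆x)))) (Simplex-Sub om S m))))
    ...     | no ¬all with FinP.¬∀⟶∃¬ _ _ (λ m → Mem? (lookup B' m) x) ¬all
    ...       | m , e∉ = inj₂ (e , S' , ≢zer∧≢pos⇒neg _ (*ₛ-nonzero _ _ nz (proj₁ S')) λ same →
                e∉ (j , sym (no-circuit⇒one-sided om noCircuit′ x j e S S' same)))
      where
      e = lookup B' m
      sub″ : Sub (x [ j ]≔ e) B'
      sub″ k with Mem-update⁻ x j {e} (k , refl)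
      ... | inj₁ eq = m , sym eq
      ... | inj₂ (k' , k'≢j , eq) = subst (λ t → Mem t B') (trans (proj₂ (sub k')) eq)
              (∈img⇒Mem B' (sub' (proj₁ (sub k')) λ eq' →
                k'≢j (nonzero⇒Inj om nz k' j (trans (sym (proj₂ (sub k'))) (trans (cong (lookup B) eq') at)))))
      S' : Simplex Δ ν (x [ j ]≔ e)
      S' = Sub-basis om (Inj-update x (nonzero⇒Inj om nz) e∉ j) sub″ (bases′ B' B'∈) , B' , B'∈ , sub″

  IsTriangulation⇒Triang : Triang ν Δ
  IsTriangulation⇒Triang .bases = bases′
  IsTriangulation⇒Triang .unique = AllPairs.map (λ ne eq → ne (cong img eq)) I.distinct
  IsTriangulation⇒Triang .distinct B B' B∈ B'∈ sub with VecP.≡-dec _≟_ B B'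
  ... | yes eq = eq
  ... | no ne = ⊥-elim (AllPairs-lookup I.distinct (λ ne → ne ∘ sym) B∈ B'∈ ne (img-cong B B' sub
          (Perm⇒Sub (Perm-sym (proj₂ (Sub⇒Perm B B' (nonzero⇒Inj om (bases′ B B∈)) sub))))))
  IsTriangulation⇒Triang .nc = noCircuit′
  IsTriangulation⇒Triang .fac = fac′

-- Existence of a triangulation by pushing: the heights of the elements grow so fast that the sign
-- of a circuit is its sign at the largest element, and the bases below all other elements are kept.

Top : SignVec N → Sign → Set
Top V s = ∃ λ m → V m ≡ s × s ≢ zer × (∀ f → m Fin.< f → V f ≡ zer)

Top? : (V : SignVec N) (s : Sign) → Dec (Top V s)
Top? V s = any? λ m → (V m ≟ₛ s) ×-dec (¬? (s ≟ₛ zer) ×-dec all? λ f → (m FinP.<? f) →-dec (V f ≟ₛ zer))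

top-exists : (V : SignVec N) → (∃ λ e → V e ≢ zer) → ∃ λ s → Top V s
top-exists {N} V (e , nz) = climb e (spo-noetherian FinP.<-isStrictPartialOrder e) nz
  where
  climb : ∀ e → Acc (flip Fin._<_) e → V e ≢ zer → ∃ λ s → Top V s
  climb e (acc rec) nz with any? (λ f → (e FinP.<? f) ×-dec ¬? (V f ≟ₛ zer))
  ... | yes (f , e<f , nzf) = climb f (rec e<f) nzf
  ... | no none = V e , e , refl , nz , λ f e<f → ¬≢zer⇒≡ λ nzf → none (f , e<f , nzf)

Top-unique : (V : SignVec N) → ∀ {s t} → Top V s → Top V t → s ≡ t
Top-unique V (m , vm , s≢ , h) (m' , vm' , t≢ , h') with FinP.<-cmp m m'
... | tri< m<m' _ _ = ⊥-elim (t≢ (trans (sym vm') (h m' m<m')))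
... | tri≈ _ refl _ = trans (sym vm) vm'
... | tri> _ _ m'<m = ⊥-elim (s≢ (trans (sym vm) (h' m m'<m)))

Top-≗ : {V V' : SignVec N} → (∀ f → V f ≡ V' f) → ∀ {s} → Top V s → Top V' s
Top-≗ eq (m , vm , s≢ , h) = m , trans (sym (eq m)) vm , s≢ , λ f m<f → trans (sym (eq f)) (h f m<f)

Top-neg : {V : SignVec N} → ∀ {s} → Top V s → Top (negₛ ∘ V) (negₛ s)
Top-neg (m , vm , s≢ , h) = m , cong negₛ vm , negₛ≢zer _ s≢ , λ f m<f → cong negₛ (h f m<f)

-- c is a possible sign of a sum of terms with signs a and b
Sum3 : Sign → Sign → Sign → Set
Sum3 a b c = (c ≢ zer → a ≡ c ⊎ b ≡ c) × ((a ≢ zer → c ≡ a ⊎ b ≡ negₛ a) × (b ≢ zer → c ≡ b ⊎ a ≡ negₛ b))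

Sum3? : ∀ a b c → Dec (Sum3 a b c)
Sum3? a b c = (¬? (c ≟ₛ zer) →-dec ((a ≟ₛ c) ⊎-dec (b ≟ₛ c)))
  ×-dec ((¬? (a ≟ₛ zer) →-dec ((c ≟ₛ a) ⊎-dec (b ≟ₛ negₛ a))) ×-dec (¬? (b ≟ₛ zer) →-dec ((c ≟ₛ b) ⊎-dec (a ≟ₛ negₛ b))))

Sum3-pos : ∀ a b c → Sum3 a b c → a ≢ neg → b ≢ neg → (a ≡ pos ⊎ b ≡ pos) → c ≡ pos
Sum3-pos = decide (allSigns? λ a → allSigns? λ b → allSigns? λ c → Sum3? a b c →-dec
  (¬? (a ≟ₛ neg) →-dec (¬? (b ≟ₛ neg) →-dec (((a ≟ₛ pos) ⊎-dec (b ≟ₛ pos)) →-dec (c ≟ₛ pos))))) tt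

Sum3-zer : ∀ a b c → Sum3 a b c → a ≡ zer → b ≡ zer → c ≡ zer
Sum3-zer = decide (allSigns? λ a → allSigns? λ b → allSigns? λ c → Sum3? a b c →-dec
  ((a ≟ₛ zer) →-dec ((b ≟ₛ zer) →-dec (c ≟ₛ zer)))) tt

Top-sum : {V₁ V₂ V₃ : SignVec N} → (∀ f → Sum3 (V₁ f) (V₂ f) (V₃ f)) → Top V₁ pos → Top V₂ pos → Top V₃ pos
Top-sum {V₁ = V₁} {V₂} {V₃} sum (m , vm , _ , h) (m' , vm' , _ , h') with FinP.<-cmp m m'
... | tri< m<m' _ _ = m' , Sum3-pos _ _ _ (sum m') (λ eq → ≡neg⇒≢zer eq (h m' m<m')) (pos≢neg vm') (inj₂ vm') , (λ ()) ,
      λ f m'<f → Sum3-zer _ _ _ (sum f) (h f (FinP.<-trans m<m' m'<f)) (h' f m'<f)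
... | tri≈ _ refl _ = m , Sum3-pos _ _ _ (sum m) (pos≢neg vm) (pos≢neg vm') (inj₁ vm) , (λ ()) ,
      λ f m<f → Sum3-zer _ _ _ (sum f) (h f m<f) (h' f m<f)
... | tri> _ _ m'<m = m , Sum3-pos _ _ _ (sum m) (pos≢neg vm) (λ eq → ≡neg⇒≢zer eq (h' m m'<m)) (inj₁ vm) , (λ ()) ,
      λ f m<f → Sum3-zer _ _ _ (sum f) (h f m<f) (h' f (FinP.<-trans m'<m m<f))

Vect-neg : {ν : Chi N r} {V : SignVec N} → Vect ν V → Vect ν (negₛ ∘ V)
Vect-neg {V = V} vect .orthogonal z j e nz with orthogonal vect z j e (λ eq → nz (trans (negₛ-*ˡ (V e) _) (cong negₛ eq)))
... | f , eq = f , trans (negₛ-*ˡ (V f) _) (cong negₛ (trans eq (sym (negₛ-*ˡ (V e) _))))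

Within : ∀ {N r} → Vec (Fin N) r → Fin r → Fin N → Fin N → SignVec N → Set
Within D j p q V = ∀ e → V e ≢ zer → e ≡ p ⊎ e ≡ q ⊎ (∃ λ m → m ≢ j × lookup D m ≡ e)

module Elimination {N r} {ν : Chi N r} (om : OM ν) (D : Vec (Fin N) r) (j : Fin r) where

  two-terms : ∀ V → Vect ν V → ∀ z i u w → u ≢ w → (∀ g → V g *ₛ ν (z [ i ]≔ g) ≢ zer → g ≡ u ⊎ g ≡ w) →
    V u *ₛ ν (z [ i ]≔ u) ≡ negₛ (V w *ₛ ν (z [ i ]≔ w))
  two-terms V vect z i u w u≢w only with (V u *ₛ ν (z [ i ]≔ u)) ≟ₛ zer | (V w *ₛ ν (z [ i ]≔ w)) ≟ₛ zer
  ... | yes zu | yes zw = trans zu (cong negₛ (sym zw))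
  ... | no nzu | _ with orthogonal vect z i u nzu
  ...   | f , eq with only f (λ z' → negₛ≢zer _ nzu (trans (sym eq) z'))
  ...     | inj₁ refl = ⊥-elim (nzu (negₛ-fix _ eq))
  ...     | inj₂ refl = trans (sym (negₛ-invol _)) (cong negₛ (sym eq))
  two-terms V vect z i u w u≢w only | yes zu | no nzw with orthogonal vect z i w nzw
  ...   | f , eq with only f (λ z' → negₛ≢zer _ nzw (trans (sym eq) z'))
  ...     | inj₁ refl = eq
  ...     | inj₂ refl = ⊥-elim (nzw (negₛ-fix _ eq))

  three-terms : ∀ V → Vect ν V → ∀ z i u v w → (∀ g → V g *ₛ ν (z [ i ]≔ g) ≢ zer → g ≡ u ⊎ g ≡ v ⊎ g ≡ w) →
    V u *ₛ ν (z [ i ]≔ u) ≢ zer →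
    V v *ₛ ν (z [ i ]≔ v) ≡ negₛ (V u *ₛ ν (z [ i ]≔ u)) ⊎ V w *ₛ ν (z [ i ]≔ w) ≡ negₛ (V u *ₛ ν (z [ i ]≔ u))
  three-terms V vect z i u v w only nz with orthogonal vect z i u nz
  ... | f , eq with only f (λ z' → negₛ≢zer _ nz (trans (sym eq) z'))
  ...   | inj₁ refl = ⊥-elim (nz (negₛ-fix _ eq))
  ...   | inj₂ (inj₁ refl) = inj₁ eq
  ...   | inj₂ (inj₂ refl) = inj₂ eq

  Fresh : Fin N → Set
  Fresh p = ∀ m → m ≢ j → lookup D m ≢ p

  basis⇒Fresh : ∀ {p} → ν (D [ j ]≔ p) ≢ zer → Fresh p
  basis⇒Fresh nz m m≢j eq = nz (update-other om D m≢j (sym eq))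

  -- The cocircuit spanned by q and the elements of D other than D_j and D_m.
  module Cross {q} (nzq : ν (D [ j ]≔ q) ≢ zer) (m : Fin r) (m≢j : m ≢ j) where
    z : Vec (Fin N) r
    z = D [ j ]≔ q

    at-m : ν (z [ m ]≔ lookup D m) ≢ zer
    at-m eq = nzq (trans (sym (update-same om z m (sym (VecP.lookup∘update′ m≢j D q)))) eq)

    at-q : ν (z [ m ]≔ q) ≡ zer
    at-q = update-other om z (m≢j ∘ sym) (sym (VecP.lookup∘update j D q))

    at-other : ∀ l → l ≢ j → l ≢ m → ν (z [ m ]≔ lookup D l) ≡ zer
    at-other l l≢j l≢m = update-other om z l≢m (sym (VecP.lookup∘update′ l≢j D q))

    only : ∀ {p} V → Within D j p q V → ∀ g → V g *ₛ ν (z [ m ]≔ g) ≢ zer → g ≡ lookup D m ⊎ g ≡ p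
    only {p} V within g nz with within g (*ₛ-nonzeroˡ (V g) _ nz)
    ... | inj₁ g≡p = inj₂ g≡p
    ... | inj₂ (inj₁ refl) = ⊥-elim (nz (*ₛ-zeroʳ′ (V g) at-q))
    ... | inj₂ (inj₂ (l , l≢j , refl)) with l ≟ m
    ...   | yes refl = inj₁ refl
    ...   | no l≢m = ⊥-elim (nz (*ₛ-zeroʳ′ (V (lookup D l)) (at-other l l≢j l≢m)))

  -- The admissible support exceeds the basis obtained from `D` with `q` in place of `D_j` by the
  -- single element `p`. Each cocircuit of that basis meets it in `p` and one more element, so the
  -- entry at `p` determines all others.
  vector-unique : ∀ {V V' p q} → Vect ν V → Vect ν V' → Within D j p q V → Within D j p q V' →
    ν (D [ j ]≔ q) ≢ zer → p ≢ q → Fresh p → V p ≡ V' p → ∀ f → V f ≡ V' f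
  vector-unique {V} {V'} {p} {q} v v' w w' nzq p≢q fresh eq f = both (V f ≟ₛ zer) (V' f ≟ₛ zer)
    where
    cancel : ∀ {a b} c → c ≢ zer → a *ₛ c ≡ b *ₛ c → a ≡ b
    cancel {a} {b} c = decide (allSigns? λ a → allSigns? λ b → allSigns? λ c → ¬? (c ≟ₛ zer) →-dec (((a *ₛ c) ≟ₛ (b *ₛ c)) →-dec (a ≟ₛ b))) tt a b c
    at-q : V q ≡ V' q
    at-q = cancel (ν (D [ j ]≔ q)) nzq (trans (two-terms V v D j q p (p≢q ∘ sym) (only V w))
      (trans (cong (λ s → negₛ (s *ₛ ν (D [ j ]≔ p))) eq) (sym (two-terms V' v' D j q p (p≢q ∘ sym) (only V' w')))))
      where
      only : ∀ V → Within D j p q V → ∀ g → V g *ₛ ν (D [ j ]≔ g) ≢ zer → g ≡ q ⊎ g ≡ p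
      only V w g nz with w g (*ₛ-nonzeroˡ (V g) _ nz)
      ... | inj₁ g≡p = inj₂ g≡p
      ... | inj₂ (inj₁ g≡q) = inj₁ g≡q
      ... | inj₂ (inj₂ (m , m≢j , refl)) = ⊥-elim (nz (*ₛ-zeroʳ′ (V (lookup D m)) (update-other om D m≢j refl)))
    at-f : f ≡ p ⊎ f ≡ q ⊎ (∃ λ m → m ≢ j × lookup D m ≡ f) → V f ≡ V' f
    at-f (inj₁ refl) = eq
    at-f (inj₂ (inj₁ refl)) = at-q
    at-f (inj₂ (inj₂ (m , m≢j , refl))) = cancel (ν (z [ m ]≔ lookup D m)) at-m
      (trans (two-terms V v z m (lookup D m) p (fresh m m≢j) (only V w))
        (trans (cong (λ s → negₛ (s *ₛ ν (z [ m ]≔ p))) eq) (sym (two-terms V' v' z m (lookup D m) p (fresh m m≢j) (only V' w')))))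
      where open Cross nzq m m≢j
    both : Dec (V f ≡ zer) → Dec (V' f ≡ zer) → V f ≡ V' f
    both (yes a) (yes b) = trans a (sym b)
    both (no nz) _ = at-f (w f nz)
    both _ (no nz) = at-f (w' f nz)

  -- `V₃` is what eliminating `q` from `V₁` and `V₂` has to give. The cocircuit through `q` that
  -- separates `D_m` from the rest of `D` vanishes at `q`, so it compares the three entries at `D_m`
  -- by way of the entries at `p` and `t`.
  eliminate : ∀ {V₁ V₂ V₃ p q t} → Vect ν V₁ → Vect ν V₂ → Vect ν V₃ →
    Within D j p q V₁ → Within D j t q V₂ → Within D j p t V₃ →
    ν (D [ j ]≔ q) ≢ zer → p ≢ q → t ≢ q → p ≢ t → Fresh p → Fresh t →
    V₃ p ≡ V₁ p → V₃ t ≡ V₂ t → V₁ q ≡ negₛ (V₂ q) → ∀ f → Sum3 (V₁ f) (V₂ f) (V₃ f)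
  eliminate {V₁} {V₂} {V₃} {p} {q} {t} v₁ v₂ v₃ w₁ w₂ w₃ nzq p≢q t≢q p≢t fp ft e₁ e₂ eq f with f ≟ p
  ... | yes refl = subst₂ (¬≢zer⇒≡ λ nz → absent (w₂ f nz)) e₁
    where
    absent : f ≡ t ⊎ f ≡ q ⊎ (∃ λ m → m ≢ j × lookup D m ≡ f) → ⊥
    absent (inj₁ h) = p≢t h
    absent (inj₂ (inj₁ h)) = p≢q h
    absent (inj₂ (inj₂ (m , m≢j , h))) = fp m m≢j h
    first : ∀ a b c → b ≡ zer → c ≡ a → Sum3 a b c
    first = decide (allSigns? λ a → allSigns? λ b → allSigns? λ c → (b ≟ₛ zer) →-dec ((c ≟ₛ a) →-dec Sum3? a b c)) tt
    subst₂ = first (V₁ f) (V₂ f) (V₃ f)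
  ... | no f≢p with f ≟ t
  ...   | yes refl = second (V₁ f) (V₂ f) (V₃ f) (¬≢zer⇒≡ λ nz → absent (w₁ f nz)) e₂
    where
    absent : f ≡ p ⊎ f ≡ q ⊎ (∃ λ m → m ≢ j × lookup D m ≡ f) → ⊥
    absent (inj₁ h) = f≢p h
    absent (inj₂ (inj₁ h)) = t≢q h
    absent (inj₂ (inj₂ (m , m≢j , h))) = ft m m≢j h
    second : ∀ a b c → a ≡ zer → c ≡ b → Sum3 a b c
    second = decide (allSigns? λ a → allSigns? λ b → allSigns? λ c → (a ≟ₛ zer) →-dec ((c ≟ₛ b) →-dec Sum3? a b c)) tt
  ...   | no f≢t with f ≟ q
  ...     | yes refl = cancels (V₁ f) (V₂ f) (V₃ f) eq (¬≢zer⇒≡ λ nz → absent (w₃ f nz))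
    where
    absent : f ≡ p ⊎ f ≡ t ⊎ (∃ λ m → m ≢ j × lookup D m ≡ f) → ⊥
    absent (inj₁ h) = f≢p h
    absent (inj₂ (inj₁ h)) = f≢t h
    absent (inj₂ (inj₂ (m , m≢j , h))) = basis⇒Fresh nzq m m≢j h
    cancels : ∀ a b c → a ≡ negₛ b → c ≡ zer → Sum3 a b c
    cancels = decide (allSigns? λ a → allSigns? λ b → allSigns? λ c → (a ≟ₛ negₛ b) →-dec ((c ≟ₛ zer) →-dec Sum3? a b c)) tt
  ...     | no f≢q with any? (λ m → ¬? (m ≟ j) ×-dec (lookup D m ≟ f))
  ...       | no none = zeros (V₁ f) (V₂ f) (V₃ f) (¬≢zer⇒≡ λ nz → absent₁ (w₁ f nz)) (¬≢zer⇒≡ λ nz → absent₂ (w₂ f nz)) (¬≢zer⇒≡ λ nz → absent₃ (w₃ f nz))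
    where
    absent₁ : f ≡ p ⊎ f ≡ q ⊎ (∃ λ m → m ≢ j × lookup D m ≡ f) → ⊥
    absent₁ (inj₁ h) = f≢p h
    absent₁ (inj₂ (inj₁ h)) = f≢q h
    absent₁ (inj₂ (inj₂ h)) = none h
    absent₂ : f ≡ t ⊎ f ≡ q ⊎ (∃ λ m → m ≢ j × lookup D m ≡ f) → ⊥
    absent₂ (inj₁ h) = f≢t h
    absent₂ (inj₂ (inj₁ h)) = f≢q h
    absent₂ (inj₂ (inj₂ h)) = none h
    absent₃ : f ≡ p ⊎ f ≡ t ⊎ (∃ λ m → m ≢ j × lookup D m ≡ f) → ⊥
    absent₃ (inj₁ h) = f≢p h
    absent₃ (inj₂ (inj₁ h)) = f≢t h
    absent₃ (inj₂ (inj₂ h)) = none h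
    zeros : ∀ a b c → a ≡ zer → b ≡ zer → c ≡ zer → Sum3 a b c
    zeros = decide (allSigns? λ a → allSigns? λ b → allSigns? λ c → (a ≟ₛ zer) →-dec ((b ≟ₛ zer) →-dec ((c ≟ₛ zer) →-dec Sum3? a b c))) tt
  ...       | yes (m , m≢j , refl) = in-the-middle
    where
    open Cross nzq m m≢j
    Y : Fin N → Sign
    Y e = ν (z [ m ]≔ e)
    y = Y (lookup D m)
    t₁ : V₃ p *ₛ Y p ≡ negₛ (V₁ (lookup D m) *ₛ y)
    t₁ = trans (cong (_*ₛ Y p) e₁) (two-terms V₁ v₁ z m p (lookup D m) (fp m m≢j ∘ sym) λ g nz → flip⊎ (only V₁ w₁ g nz))
      where
      flip⊎ : ∀ {A B : Set} → A ⊎ B → B ⊎ A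
      flip⊎ (inj₁ a) = inj₂ a
      flip⊎ (inj₂ b) = inj₁ b
    t₂ : V₃ t *ₛ Y t ≡ negₛ (V₂ (lookup D m) *ₛ y)
    t₂ = trans (cong (_*ₛ Y t) e₂) (two-terms V₂ v₂ z m t (lookup D m) (ft m m≢j ∘ sym) λ g nz → flip⊎ (only V₂ w₂ g nz))
      where
      flip⊎ : ∀ {A B : Set} → A ⊎ B → B ⊎ A
      flip⊎ (inj₁ a) = inj₂ a
      flip⊎ (inj₂ b) = inj₁ b
    only₃ : ∀ g → V₃ g *ₛ Y g ≢ zer → g ≡ lookup D m ⊎ g ≡ p ⊎ g ≡ t
    only₃ g nz with w₃ g (*ₛ-nonzeroˡ (V₃ g) _ nz)
    ... | inj₁ h = inj₂ (inj₁ h)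
    ... | inj₂ (inj₁ h) = inj₂ (inj₂ h)
    ... | inj₂ (inj₂ (l , l≢j , refl)) with l ≟ m
    ...   | yes refl = inj₁ refl
    ...   | no l≢m = ⊥-elim (nz (*ₛ-zeroʳ′ (V₃ (lookup D l)) (at-other l l≢j l≢m)))
    turn : ∀ {g} → g ≡ lookup D m ⊎ g ≡ p ⊎ g ≡ t → g ≡ p ⊎ g ≡ lookup D m ⊎ g ≡ t
    turn (inj₁ h) = inj₂ (inj₁ h)
    turn (inj₂ (inj₁ h)) = inj₁ h
    turn (inj₂ (inj₂ h)) = inj₂ (inj₂ h)
    turn′ : ∀ {g} → g ≡ lookup D m ⊎ g ≡ p ⊎ g ≡ t → g ≡ t ⊎ g ≡ lookup D m ⊎ g ≡ p
    turn′ (inj₁ h) = inj₂ (inj₁ h)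
    turn′ (inj₂ (inj₁ h)) = inj₂ (inj₂ h)
    turn′ (inj₂ (inj₂ h)) = inj₁ h
    assemble : ∀ a b c y P T → y ≢ zer → P ≡ negₛ (a *ₛ y) → T ≡ negₛ (b *ₛ y) →
      (c *ₛ y ≢ zer → P ≡ negₛ (c *ₛ y) ⊎ T ≡ negₛ (c *ₛ y)) →
      (P ≢ zer → c *ₛ y ≡ negₛ P ⊎ T ≡ negₛ P) → (T ≢ zer → c *ₛ y ≡ negₛ T ⊎ P ≡ negₛ T) → Sum3 a b c
    assemble a b c y P T nzy refl refl h₁ h₂ h₃ = solve a b c y nzy h₁ h₂ h₃
      where
      solve : ∀ a b c y → y ≢ zer →
        (c *ₛ y ≢ zer → negₛ (a *ₛ y) ≡ negₛ (c *ₛ y) ⊎ negₛ (b *ₛ y) ≡ negₛ (c *ₛ y)) →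
        (negₛ (a *ₛ y) ≢ zer → c *ₛ y ≡ negₛ (negₛ (a *ₛ y)) ⊎ negₛ (b *ₛ y) ≡ negₛ (negₛ (a *ₛ y))) →
        (negₛ (b *ₛ y) ≢ zer → c *ₛ y ≡ negₛ (negₛ (b *ₛ y)) ⊎ negₛ (a *ₛ y) ≡ negₛ (negₛ (b *ₛ y))) → Sum3 a b c
      solve = decide (allSigns? λ a → allSigns? λ b → allSigns? λ c → allSigns? λ y → ¬? (y ≟ₛ zer) →-dec
        ((¬? ((c *ₛ y) ≟ₛ zer) →-dec ((negₛ (a *ₛ y) ≟ₛ negₛ (c *ₛ y)) ⊎-dec (negₛ (b *ₛ y) ≟ₛ negₛ (c *ₛ y)))) →-dec
        ((¬? (negₛ (a *ₛ y) ≟ₛ zer) →-dec (((c *ₛ y) ≟ₛ negₛ (negₛ (a *ₛ y))) ⊎-dec (negₛ (b *ₛ y) ≟ₛ negₛ (negₛ (a *ₛ y))))) →-dec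
        ((¬? (negₛ (b *ₛ y) ≟ₛ zer) →-dec (((c *ₛ y) ≟ₛ negₛ (negₛ (b *ₛ y))) ⊎-dec (negₛ (a *ₛ y) ≟ₛ negₛ (negₛ (b *ₛ y))))) →-dec
        Sum3? a b c)))) tt
    in-the-middle : Sum3 (V₁ (lookup D m)) (V₂ (lookup D m)) (V₃ (lookup D m))
    in-the-middle = assemble _ _ _ y (V₃ p *ₛ Y p) (V₃ t *ₛ Y t) at-m t₁ t₂
      (three-terms V₃ v₃ z m (lookup D m) p t only₃)
      (three-terms V₃ v₃ z m p (lookup D m) t λ g nz → turn (only₃ g nz))
      (three-terms V₃ v₃ z m t (lookup D m) p λ g nz → turn′ (only₃ g nz))

module Pushing {N r} {ν : Chi N (suc r)} (om : OM ν) where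

  nC : Vec (Fin N) (suc r) → Fin N → SignVec N
  nC B e f = ν B *ₛ circ ν B e f

  -- In terms of heights: every other element lies above the hyperplane through the lifted `B`,
  -- which the top sign of its fundamental circuit detects.
  Good : Vec (Fin N) (suc r) → Set
  Good B = ν B ≢ zer × (∀ e → ¬ Mem e B → Top (nC B e) pos)

  Good? : ∀ B → Dec (Good B)
  Good? B = ¬? (ν B ≟ₛ zer) ×-dec all? λ e → ¬? (Mem? e B) →-dec Top? (nC B e) pos

  module _ {B : Vec (Fin N) (suc r)} (nz : ν B ≢ zer) {e : Fin N} (e∉ : ¬ Mem e B) where

    nC-self : nC B e e ≡ pos
    nC-self = trans (cong (ν B *ₛ_) (circ-el ν B e (nonzero⇒Inj om nz) e∉ zero)) (*ₛ-square _ nz)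

    nC-at : ∀ k → nC B e (lookup B k) ≡ negₛ (ν B *ₛ ν (B [ k ]≔ e))
    nC-at k = trans (cong (ν B *ₛ_) (circ-el ν B e (nonzero⇒Inj om nz) e∉ (suc k))) (negₛ-*ʳ (ν B) _)

    nC-support : ∀ f → nC B e f ≢ zer → f ≡ e ⊎ (∃ λ k → lookup B k ≡ f)
    nC-support f nzf with circ-support ν B e f (*ₛ-nonzeroʳ (ν B) _ nzf)
    ... | zero , eq = inj₁ (sym eq)
    ... | suc k , eq = inj₂ (k , eq)

    nC-Vect : Vect ν (nC B e)
    nC-Vect = circ-Vect om nz e∉ (ν B)

  sumV : ∀ {n} → Vec (Fin N) n → ℕ
  sumV [] = 0
  sumV (a ∷ x) = toℕ a Nat.+ sumV x

  sumV-update : ∀ {n} (x : Vec (Fin N) n) m {e} → e Fin.< lookup x m → sumV (x [ m ]≔ e) Nat.< sumV x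
  sumV-update (a ∷ x) zero e< = NatP.+-monoˡ-< (sumV x) e<
  sumV-update (a ∷ x) (suc m) e< = NatP.+-monoʳ-< (toℕ a) (sumV-update x m e<)

  -- If no entry of a basis can be replaced by a smaller element, every fundamental circuit peaks at
  -- the new element, where it is positive. Descent on the sum of the entries finds such a basis.
  good-exists : (∃ λ B → ν B ≢ zer) → ∃ Good
  good-exists (B , nz) = descend B (<-wellFounded (sumV B)) nz
    where
    descend : ∀ B → Acc Nat._<_ (sumV B) → ν B ≢ zer → ∃ Good
    descend B (acc rec) nz with any? (λ m → any? λ e → (e FinP.<? lookup B m) ×-dec ¬? (ν (B [ m ]≔ e) ≟ₛ zer))
    ... | yes (m , e , e< , nz') = descend (B [ m ]≔ e) (rec (sumV-update B m e<)) nz'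
    ... | no none = B , nz , λ e e∉ → e , nC-self nz e∉ , (λ ()) , λ f e<f → ¬≢zer⇒≡ λ nzf → above e e∉ f e<f nzf (nC-support nz e∉ f nzf)
      where
      above : ∀ e → ¬ Mem e B → ∀ f → e Fin.< f → nC B e f ≢ zer → f ≡ e ⊎ (∃ λ k → lookup B k ≡ f) → ⊥
      above e e∉ f e<f nzf (inj₁ refl) = FinP.<-irrefl refl e<f
      above e e∉ f e<f nzf (inj₂ (k , refl)) = none (k , e , e<f , λ z →
        nzf (trans (nC-at nz e∉ k) (cong negₛ (*ₛ-zeroʳ′ (ν B) z))))

  -- V is orthogonal to the cocircuits of B; following Good upwards along B never ends.
  module Ascent {B} (good : Good B) {V : SignVec N} (vect : Vect ν V)
    (V⁺⊆B : ∀ e → V e ≡ pos → Mem e B) {m : Fin N} (above : ∀ f → m Fin.< f → V f ≡ zer) where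

    private
      nz = proj₁ good

    next : ∀ {f l} → ¬ Mem f B → f Fin.< lookup B l → ν B *ₛ ν (B [ l ]≔ f) ≡ pos →
      ∃ λ l' → lookup B l Fin.< lookup B l' × ν B *ₛ ν (B [ l' ]≔ f) ≡ neg
    next {f} {l} f∉ f< eq with proj₂ good f f∉
    ... | t , t≡ , _ , t-above with FinP.<-cmp (lookup B l) t
    ...   | tri> _ _ t< = ⊥-elim (≡neg⇒≢zer (trans (nC-at nz f∉ l) (cong negₛ eq)) (t-above _ t<))
    ...   | tri≈ _ refl _ = ⊥-elim (pos≢neg t≡ (trans (nC-at nz f∉ l) (cong negₛ eq)))
    ...   | tri< l<t _ _ with nC-support nz f∉ t (≡pos⇒≢zer t≡)
    ...     | inj₁ refl = ⊥-elim (FinP.<-asym f< l<t)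
    ...     | inj₂ (l' , refl) = l' , l<t , trans (sym (negₛ-invol _)) (cong negₛ (trans (sym (nC-at nz f∉ l')) t≡))

    ascend : ∀ l → Acc (flip Fin._<_) (lookup B l) → m Fin.≤ lookup B l → V (lookup B l) ≢ neg →
      ∀ g → V g *ₛ ν (B [ l ]≔ g) ≡ ν B → ⊥
    ascend l (acc rec) m≤ l≢neg g eq with orthogonal vect B l g (nz ∘ trans (sym eq))
    ... | f , eq' = continue (next f∉ f< prod)
      where
      opp : V f *ₛ ν (B [ l ]≔ f) ≡ negₛ (ν B)
      opp = trans eq' (cong negₛ eq)
      ruled-out : ∀ a b → b ≢ zer → a *ₛ b ≡ negₛ b → a ≡ neg
      ruled-out = decide (allSigns? λ a → allSigns? λ b → ¬? (b ≟ₛ zer) →-dec (((a *ₛ b) ≟ₛ negₛ b) →-dec (a ≟ₛ neg))) tt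
      f∉ : ¬ Mem f B
      f∉ (k , refl) with k ≟ l
      ... | yes refl = l≢neg (ruled-out _ _ nz (trans (cong (V (lookup B k) *ₛ_) (sym (update-same om B k refl))) opp))
      ... | no k≢l = negₛ≢zer _ nz (trans (sym opp) (*ₛ-zeroʳ′ (V (lookup B k)) (update-other om B k≢l refl)))
      V-f : V f ≡ neg
      V-f = ≢zer∧≢pos⇒neg _ (*ₛ-nonzeroˡ _ (ν (B [ l ]≔ f)) (λ z → negₛ≢zer _ nz (trans (sym opp) z))) (f∉ ∘ V⁺⊆B f)
      f≤m : f Fin.≤ m
      f≤m = NatP.≮⇒≥ λ m<f → ≡neg⇒≢zer V-f (above f m<f)
      f< : f Fin.< lookup B l
      f< = NatP.≤∧≢⇒< (NatP.≤-trans f≤m m≤) λ eq″ → f∉ (l , sym (FinP.toℕ-injective eq″))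
      agree : ∀ a b c → a ≡ neg → b ≢ zer → a *ₛ c ≡ negₛ b → b *ₛ c ≡ pos
      agree = decide (allSigns? λ a → allSigns? λ b → allSigns? λ c → (a ≟ₛ neg) →-dec (¬? (b ≟ₛ zer) →-dec
        (((a *ₛ c) ≟ₛ negₛ b) →-dec ((b *ₛ c) ≟ₛ pos)))) tt
      prod : ν B *ₛ ν (B [ l ]≔ f) ≡ pos
      prod = agree _ _ _ V-f nz opp
      turn : ∀ a b c → a ≡ neg → b *ₛ c ≡ neg → a *ₛ c ≡ b
      turn = decide (allSigns? λ a → allSigns? λ b → allSigns? λ c → (a ≟ₛ neg) →-dec (((b *ₛ c) ≟ₛ neg) →-dec ((a *ₛ c) ≟ₛ b))) tt
      continue : (∃ λ l' → lookup B l Fin.< lookup B l' × ν B *ₛ ν (B [ l' ]≔ f) ≡ neg) → ⊥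
      continue (l' , l<l' , neg') = ascend l' (rec l<l') (NatP.<⇒≤ (NatP.≤-<-trans m≤ l<l'))
        (λ h → ≡neg⇒≢zer h (above _ (NatP.≤-<-trans m≤ l<l'))) f (turn _ _ _ V-f neg')

  -- With heights measured from the lifted hyperplane of `B`, the elements of `B` weigh zero and all
  -- others are positive, so a vector with positive part in `B` has no positive total height. The
  -- ascent is the combinatorial form of this estimate.
  vector-top-not-pos : ∀ {B} → Good B → ∀ {V} → Vect ν V → (∀ e → V e ≡ pos → Mem e B) → ¬ Top V pos
  vector-top-not-pos {B} good {V} vect V⁺⊆B (m , vm , _ , above) with V⁺⊆B m vm
  ... | l , refl = Ascent.ascend good vect V⁺⊆B above l (spo-noetherian FinP.<-isStrictPartialOrder _) NatP.≤-refl (pos≢neg vm)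
        (lookup B l) (trans (cong₂ _*ₛ_ vm (update-same om B l refl)) refl)

  good-no-vector : ∀ {B B'} → Good B → Good B' → ∀ {V} → Vect ν V → (∃ λ e → V e ≢ zer) →
    ¬ ((∀ e → V e ≡ pos → Mem e B) × (∀ e → V e ≡ neg → Mem e B'))
  good-no-vector good good' {V} vect some (p , q) with top-exists V some
  ... | pos , top = vector-top-not-pos good vect p top
  ... | zer , (_ , _ , z , _) = z refl
  ... | neg , top = vector-top-not-pos good' (Vect-neg vect) (λ e eq → q e (trans (sym (negₛ-invol _)) (cong negₛ eq))) (Top-neg {V = V} top)

  module Pivot {B} (good : Good B) (j : Fin (suc r)) where

    private
      nz : ν B ≢ zer
      nz = proj₁ good
      b : Fin N
      b = lookup B j

    open Elimination om B j

    Beyond : Fin N → Set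
    Beyond e = ν B *ₛ ν (B [ j ]≔ e) ≡ neg

    x[_] : Fin N → Vec (Fin N) (suc r)
    x[ e ] = B [ j ]≔ e

    module _ {e} (be : Beyond e) where
      x-nz : ν x[ e ] ≢ zer
      x-nz = *ₛ-nonzeroʳ (ν B) _ (≡neg⇒≢zer be)

      beyond-∉ : ¬ Mem e B
      beyond-∉ (k , eq) with k ≟ j
      ... | yes refl = pos≢neg (*ₛ-square _ nz) (trans (cong (ν B *ₛ_) (sym (update-same om B j (sym eq)))) be)
      ... | no k≢j = x-nz (update-other om B k≢j (sym eq))

      x-sign : ν x[ e ] ≡ negₛ (ν B)
      x-sign = *ₛ-neg⇒≡ _ _ (trans (*ₛ-comm (ν x[ e ]) _) be)

      ∉x : ∀ {f} → f ≢ e → (∀ m → m ≢ j → lookup B m ≢ f) → ¬ Mem f x[ e ]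
      ∉x f≢e fresh m with Mem-update⁻ B j m
      ... | inj₁ f≡e = f≢e f≡e
      ... | inj₂ (k , k≢j , eq) = fresh k k≢j eq

      module _ {f} (f∉ : ¬ Mem f x[ e ]) where
        at-e : nC x[ e ] f e ≡ ν B *ₛ ν x[ f ]
        at-e = trans (cong (nC x[ e ] f) (sym (VecP.lookup∘update j B e))) (trans (nC-at x-nz f∉ j)
          (trans (cong₂ (λ s t → negₛ (s *ₛ ν t)) x-sign (VecP.[]≔-idempotent B j))
            (trans (cong negₛ (negₛ-*ˡ (ν B) _)) (negₛ-invol _))))

        within-x : Within B j f e (nC x[ e ] f)
        within-x g nzg with nC-support x-nz f∉ g nzg
        ... | inj₁ g≡f = inj₁ g≡f
        ... | inj₂ m with Mem-update⁻ B j m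
        ...   | inj₁ g≡e = inj₂ (inj₁ g≡e)
        ...   | inj₂ (k , k≢j , eq) = inj₂ (inj₂ (k , k≢j , eq))

    within-B : ∀ {f} → ¬ Mem f B → Within B j f b (nC B f)
    within-B f∉ g nzg with nC-support nz f∉ g nzg
    ... | inj₁ g≡f = inj₁ g≡f
    ... | inj₂ (k , eq) with k ≟ j
    ...   | yes refl = inj₂ (inj₁ (sym eq))
    ...   | no k≢j = inj₂ (inj₂ (k , k≢j , eq))

    swapW : ∀ {p q V} → Within B j p q V → Within B j q p V
    swapW w g nzg with w g nzg
    ... | inj₁ h = inj₂ (inj₁ h)
    ... | inj₂ (inj₁ h) = inj₁ h
    ... | inj₂ (inj₂ h) = inj₂ (inj₂ h)

    negW : ∀ {p q V} → Within B j p q V → Within B j p q (negₛ ∘ V)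
    negW w g nzg = w g (nzg ∘ cong negₛ)

    pair-∉ : ∀ {e f} → Beyond e → Beyond f → e ≢ f → ¬ Mem f x[ e ]
    pair-∉ be bf e≢f = ∉x be (e≢f ∘ sym) λ m m≢j eq → beyond-∉ bf (m , eq)

    beyond-Fresh : ∀ {e} → Beyond e → Fresh e
    beyond-Fresh be m m≢j eq = beyond-∉ be (m , eq)

    -- `f` lies below the lifted hyperplane of the candidate that uses `e`; the pivot goes to a
    -- lowest candidate beyond the facet.
    _⊏_ : Fin N → Fin N → Set
    f ⊏ e = Beyond f × Beyond e × e ≢ f × Top (nC x[ e ] f) neg

    ⊏? : ∀ f e → Dec (f ⊏ e)
    ⊏? f e = (_ ≟ₛ neg) ×-dec ((_ ≟ₛ neg) ×-dec (¬? (e ≟ f) ×-dec Top? (nC x[ e ] f) neg))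

    ⊏-asym : ∀ {f e} → f ⊏ e → ¬ (e ⊏ f)
    ⊏-asym {f} {e} (bf , be , e≢f , top) (_ , _ , _ , top') =
      pos≢neg (Top-unique (nC x[ f ] e) top' (Top-≗ flipped (Top-neg {V = nC x[ e ] f} top))) refl
      where
      flipped : ∀ g → negₛ (nC x[ e ] f g) ≡ nC x[ f ] e g
      flipped = vector-unique (Vect-neg (nC-Vect (x-nz be) (pair-∉ be bf e≢f))) (nC-Vect (x-nz bf) (pair-∉ bf be (e≢f ∘ sym)))
        (negW (within-x be (pair-∉ be bf e≢f))) (swapW (within-x bf (pair-∉ bf be (e≢f ∘ sym))))
        (x-nz be) (e≢f ∘ sym) (beyond-Fresh bf)
        (trans (cong negₛ (nC-self (x-nz be) (pair-∉ be bf e≢f))) (sym (trans (at-e bf (pair-∉ bf be (e≢f ∘ sym))) be)))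

    ⊏-trans : ∀ {h f e} → h ⊏ f → f ⊏ e → h ⊏ e
    ⊏-trans {h} {f} {e} hf@(bh , bf , f≢h , top₂) fe@(_ , be , e≢f , top₁) = bh , be , e≢h ,
      subst (λ s → Top (nC x[ e ] h) s) refl (Top-≗ (λ g → negₛ-invol _) (Top-neg {V = negₛ ∘ nC x[ e ] h} (Top-sum
        (eliminate (Vect-neg (nC-Vect (x-nz be) e∌f)) (Vect-neg (nC-Vect (x-nz bf) f∌h)) (Vect-neg (nC-Vect (x-nz be) e∌h))
          (negW (swapW (within-x be e∌f))) (negW (within-x bf f∌h)) (negW (swapW (within-x be e∌h)))
          (x-nz bf) e≢f (f≢h ∘ sym) e≢h (beyond-Fresh be) (beyond-Fresh bh)
          (cong negₛ (trans (at-e be e∌h) (trans (trans bh (sym bf)) (sym (at-e be e∌f)))))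
          (cong negₛ (trans (nC-self (x-nz be) e∌h) (sym (nC-self (x-nz bf) f∌h))))
          (cong negₛ (trans (nC-self (x-nz be) e∌f) (cong negₛ (sym (trans (at-e bf f∌h) bh))))))
        (Top-neg {V = nC x[ e ] f} top₁) (Top-neg {V = nC x[ f ] h} top₂))))
      where
      e≢h : e ≢ h
      e≢h refl = ⊏-asym hf fe
      e∌f = pair-∉ be bf e≢f
      f∌h = pair-∉ bf bh f≢h
      e∌h = pair-∉ be bh e≢h

    ⊏-isStrictPartialOrder : IsStrictPartialOrder _≡_ _⊏_
    ⊏-isStrictPartialOrder = record { isEquivalence = isEquivalence ; irrefl = λ { refl (_ , _ , ne , _) → ne refl }
      ; trans = ⊏-trans ; <-resp-≈ = (λ { refl h → h }) , (λ { refl h → h }) }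

    minimum : ∀ e → Acc _⊏_ e → Beyond e → ∃ λ e → Beyond e × (∀ f → ¬ (f ⊏ e))
    minimum e (acc rec) be with any? (λ f → ⊏? f e)
    ... | yes (f , f⊏e) = minimum f (rec f⊏e) (proj₁ f⊏e)
    ... | no none = e , be , λ f f⊏e → none (f , f⊏e)

    -- The circuit of a further element `f` over the new basis is compared with circuits over `B`.
    -- Beyond the facet, minimality of `e` gives its top sign; in the hyperplane of the facet it is
    -- the circuit of `f` over `B`; on the side of `B` it is the sum of the circuits of `e` and `f`
    -- with `B_j` eliminated; for `f = B_j` it is the circuit of `e` over `B`.
    minimum-good : ∀ {e} → Beyond e → (∀ f → ¬ (f ⊏ e)) → Good x[ e ]
    minimum-good {e} be min = x-nz be , top
      where
      e∉B : ¬ Mem e B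
      e∉B = beyond-∉ be
      Top-B : Top (nC B e) pos
      Top-B = proj₂ good e e∉B
      at-b : ∀ {f} → ¬ Mem f B → nC B f b ≡ negₛ (ν B *ₛ ν x[ f ])
      at-b f∉ = nC-at nz f∉ j
      b-nz : ν (B [ j ]≔ b) ≢ zer
      b-nz = nz ∘ trans (sym (update-same om B j refl))
      e≢b : e ≢ b
      e≢b eq = e∉B (j , sym eq)
      top : ∀ f → ¬ Mem f x[ e ] → Top (nC x[ e ] f) pos
      top f f∉ with f ≟ b
      ... | yes refl = Top-≗ (vector-unique (nC-Vect nz e∉B) (nC-Vect (x-nz be) f∉) (within-B e∉B) (swapW (within-x be f∉))
              b-nz e≢b (beyond-Fresh be) (trans (nC-self nz e∉B) (sym (trans (at-e be f∉)
                (trans (cong (ν B *ₛ_) (update-same om B j refl)) (*ₛ-square _ nz)))))) Top-B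
      ... | no f≢b = by-side (ν B *ₛ ν x[ f ]) refl
        where
        f-fresh : Fresh f
        f-fresh m m≢j eq = f∉ (subst (λ g → Mem g x[ e ]) eq (Mem-update′ B m≢j))
        f∉B : ¬ Mem f B
        f∉B (k , eq) with k ≟ j
        ... | yes refl = f≢b (sym eq)
        ... | no k≢j = f-fresh k k≢j eq
        e≢f : e ≢ f
        e≢f refl = f∉ (Mem-update B j)
        by-side : ∀ s → ν B *ₛ ν x[ f ] ≡ s → Top (nC x[ e ] f) pos
        by-side neg bf with top-exists (nC x[ e ] f) (f , ≡pos⇒≢zer (nC-self (x-nz be) f∉))
        ... | pos , t = t
        ... | neg , t = ⊥-elim (min f (bf , be , e≢f , t))
        ... | zer , (_ , _ , z , _) = ⊥-elim (z refl)
        by-side zer eq = Top-≗ (vector-unique (nC-Vect nz f∉B) (nC-Vect (x-nz be) f∉) (within-B f∉B) within′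
            b-nz f≢b f-fresh (trans (nC-self nz f∉B) (sym (nC-self (x-nz be) f∉)))) (proj₂ good f f∉B)
          where
          within′ : Within B j f b (nC x[ e ] f)
          within′ g nzg with within-x be f∉ g nzg
          ... | inj₁ h = inj₁ h
          ... | inj₂ (inj₁ refl) = ⊥-elim (nzg (trans (at-e be f∉) eq))
          ... | inj₂ (inj₂ h) = inj₂ (inj₂ h)
        by-side pos eq = Top-sum (eliminate (nC-Vect nz e∉B) (nC-Vect nz f∉B) (nC-Vect (x-nz be) f∉)
            (within-B e∉B) (within-B f∉B) (swapW (within-x be f∉)) b-nz e≢b f≢b e≢f (beyond-Fresh be) f-fresh
            (trans (at-e be f∉) (trans eq (sym (nC-self nz e∉B))))
            (trans (nC-self (x-nz be) f∉) (sym (nC-self nz f∉B)))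
            (trans (at-b e∉B) (trans (cong negₛ be) (cong negₛ (sym (trans (at-b f∉B) (cong negₛ eq)))))))
          Top-B (proj₂ good f f∉B)

    abstract
      pivot-beyond : ∀ e → Beyond e → ∃ λ f → Good x[ f ] × Beyond f
      pivot-beyond e be = let f , bf , min = minimum e (spo-wellFounded ⊏-isStrictPartialOrder e) be in
        f , minimum-good bf min , bf

  pivot : ∀ {B} → Good B → ∀ j → Bd ν (B , j) ⊎ (∃ λ e → Good (B [ j ]≔ e) × ν B *ₛ ν (B [ j ]≔ e) ≡ neg)
  pivot {B} good j with any? (λ e → (ν B *ₛ ν (B [ j ]≔ e)) ≟ₛ neg)
  ... | no none = inj₁ λ e eq → none (e , eq)
  ... | yes (e₀ , b₀) = inj₂ (Pivot.pivot-beyond good j e₀ b₀)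

-- Listing bases up to reordering

allVecs : ∀ {N} r → List (Vec (Fin N) r)
allVecs zero = [] ∷ []
allVecs {N} (suc r) = List.cartesianProductWith _∷_ (allFin N) (allVecs r)

∈-allVecs : (x : Vec (Fin N) r) → x ∈ₗ allVecs r
∈-allVecs [] = here refl
∈-allVecs {N = N} (a ∷ x) = MemP.∈-cartesianProductWith⁺ _∷_ (MemP.∈-allFin a) (∈-allVecs x)

distinctImages : List (Vec (Fin N) r) → List (Vec (Fin N) r)
distinctImages [] = []
distinctImages (x ∷ L) with Any.any? (λ y → img x ≟S img y) (distinctImages L)
... | yes _ = distinctImages L
... | no _ = x ∷ distinctImages L

distinctImages-AllPairs : (L : List (Vec (Fin N) r)) → AllPairs (λ B B' → img B ≢ img B') (distinctImages L)
distinctImages-AllPairs [] = []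
distinctImages-AllPairs (x ∷ L) with Any.any? (λ y → img x ≟S img y) (distinctImages L)
... | yes _ = distinctImages-AllPairs L
... | no none = AllP.¬Any⇒All¬ _ none ∷ distinctImages-AllPairs L

∈-distinctImages⁻ : (L : List (Vec (Fin N) r)) → ∀ {x} → x ∈ₗ distinctImages L → x ∈ₗ L
∈-distinctImages⁻ (x ∷ L) x∈ with Any.any? (λ y → img x ≟S img y) (distinctImages L)
∈-distinctImages⁻ (x ∷ L) x∈ | yes _ = there (∈-distinctImages⁻ L x∈)
∈-distinctImages⁻ (x ∷ L) (here eq) | no _ = here eq
∈-distinctImages⁻ (x ∷ L) (there x∈) | no _ = there (∈-distinctImages⁻ L x∈)

∈-distinctImages : (L : List (Vec (Fin N) r)) → ∀ {x} → x ∈ₗ L → ∃ λ y → y ∈ₗ distinctImages L × img x ≡ img y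
∈-distinctImages (x ∷ L) x∈ with Any.any? (λ y → img x ≟S img y) (distinctImages L)
∈-distinctImages (x ∷ L) (here refl) | yes any = let y , y∈ , eq = find any in y , y∈ , eq
∈-distinctImages (x ∷ L) (here refl) | no _ = x , here refl , refl
∈-distinctImages (x ∷ L) (there x∈) | yes _ = ∈-distinctImages L x∈
∈-distinctImages (x ∷ L) (there x∈) | no _ = let y , y∈ , eq = ∈-distinctImages L x∈ in y , there y∈ , eq

exchange-img≢ : {ν : Chi N r} → OM ν → ∀ {B B' : Vec (Fin N) r} {j e} → ν (B [ j ]≔ e) ≢ zer → ν B *ₛ ν (B [ j ]≔ e) ≡ neg →
  img (B [ j ]≔ e) ≡ img B' → img B' ≢ img B
exchange-img≢ {ν = ν} om {B} {B'} {j} {e} nz opp eq eq' with img≡⇒Sub (B [ j ]≔ e) B (trans eq eq') j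
... | k , eq″ with k ≟ j
...   | yes refl = pos≢neg (*ₛ-square _ (*ₛ-nonzeroˡ (ν B) (ν (B [ j ]≔ e)) (≡neg⇒≢zer opp))) (trans (cong (ν B *ₛ_)
        (sym (update-same om B j (sym (trans eq″ (VecP.lookup∘update j B e)))))) opp)
...   | no k≢j = nz (update-other om B k≢j (sym (trans eq″ (VecP.lookup∘update j B e))))

pushing-IsTriangulation : ∀ {N} {E : Subset N} r {ν : Chi N r} → OM ν → (∃ λ x → ν x ≢ zer) → ∃ (IsTriangulation E r ν)
pushing-IsTriangulation zero {ν} om ([] , nz) = [] ∷ [] , record
  { nonempty = λ () ; bases = nz ∷ [] ; distinct = [] ∷ []
  ; noCircuit = λ { [] [] _ _ C (_ , (e , nze) , _) (p , q) → signed C e nze (SubP.∉⊥ ∘ p e) (SubP.∉⊥ ∘ q e) }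
  ; facets = λ _ _ () }
  where
  signed : ∀ (C : SignVec _) e → C e ≢ zer → C e ≢ pos → C e ≢ neg → ⊥
  signed C e a b c with C e
  ... | pos = b refl
  ... | neg = c refl
  ... | zer = a refl
pushing-IsTriangulation {N} {E} (suc r) {ν} om basis = Δ , record
  { nonempty = nonempty ; bases = All.tabulate (λ B∈ → proj₁ (good B∈)) ; distinct = distinctImages-AllPairs (filter Good? (allVecs (suc r)))
  ; noCircuit = λ B B' B∈ B'∈ C (vec , some , _) (p , q) → good-no-vector (good B∈) (good B'∈) (IsVector⇒Vect {E = E} om {C} vec) some
      ((λ e eq → ∈img⇒Mem B (p e eq)) , (λ e eq → ∈img⇒Mem B' (q e eq)))
  ; facets = facets }
  where
  open Pushing om
  Δ = distinctImages (filter Good? (allVecs (suc r)))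
  good : ∀ {B} → B ∈ₗ Δ → Good B
  good B∈ = proj₂ (MemP.∈-filter⁻ Good? {xs = allVecs (suc r)} (∈-distinctImages⁻ (filter Good? (allVecs (suc r))) B∈))
  represented : ∀ {x} → Good x → ∃ λ y → y ∈ₗ Δ × img x ≡ img y
  represented {x} g = ∈-distinctImages (filter Good? (allVecs (suc r))) (MemP.∈-filter⁺ Good? (∈-allVecs x) g)
  nonempty : Δ ≢ []
  nonempty eq = let x , g = good-exists basis ; y , y∈ , _ = represented {x} g in none (subst (y ∈ₗ_) eq y∈)
    where
    none : ∀ {y : Vec (Fin N) (suc r)} → ¬ (y ∈ₗ [])
    none ()
  Facet : Vec (Fin N) (suc r) → Fin (suc r) → Set
  Facet B j = (∃ λ Y → IsCocircuit (suc r) ν Y × (∀ e → Y e ≢ neg) × (∀ k → k ≢ j → Y (lookup B k) ≡ zer))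
    ⊎ (∃ λ B' → B' ∈ₗ Δ × img B' ≢ img B × (∀ k → k ≢ j → lookup B k ∈ img B'))
  facet-of : ∀ B j → ν B ≢ zer → Bd ν (B , j) ⊎ (∃ λ e → Good (B [ j ]≔ e) × ν B *ₛ ν (B [ j ]≔ e) ≡ neg) → Facet B j
  facet-of B j nz (inj₁ bd) = inj₁ ((λ e → ν B *ₛ ν (B [ j ]≔ e)) ,
    update-cocircuit om B j (ν B) nz (lookup B j , nz ∘ trans (sym (update-same om B j refl))) ,
    bd , λ k k≢j → *ₛ-zeroʳ′ (ν B) (update-other om B k≢j refl))
  facet-of B j nz (inj₂ (e , g , opp)) = let B' , B'∈ , eq = represented {B [ j ]≔ e} g in
    inj₂ (B' , B'∈ , exchange-img≢ om {B} {B'} {j} {e} (proj₁ g) opp eq , λ k k≢j → subst (lookup B k ∈_) eq (Mem⇒∈img (B [ j ]≔ e) (Mem-update′ B k≢j)))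
  facets : ∀ B → B ∈ₗ Δ → ∀ j → Facet B j
  facets B B∈ j = facet-of B j (proj₁ (good B∈)) (pivot (good B∈) j)

-- Atoms

card-insert≤ : (a : Fin n) (p : Subset n) → ∣ ⁅ a ⁆ ∪ p ∣ Nat.≤ suc ∣ p ∣
card-insert≤ zero (true ∷ p) = Nat.s≤s (NatP.≤-trans (NatP.≤-reflexive (cong ∣_∣ (SubP.∪-identityˡ p))) (NatP.n≤1+n _))
card-insert≤ zero (false ∷ p) = Nat.s≤s (NatP.≤-reflexive (cong ∣_∣ (SubP.∪-identityˡ p)))
card-insert≤ (suc a) (true ∷ p) = Nat.s≤s (card-insert≤ a p)
card-insert≤ (suc a) (false ∷ p) = card-insert≤ a p

card-insert : (a : Fin n) (p : Subset n) → a ∉ p → ∣ ⁅ a ⁆ ∪ p ∣ ≡ suc ∣ p ∣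
card-insert zero (true ∷ p) a∉ = ⊥-elim (a∉ Vec.here)
card-insert zero (false ∷ p) a∉ = cong (suc ∘ ∣_∣) (SubP.∪-identityˡ p)
card-insert (suc a) (true ∷ p) a∉ = cong suc (card-insert a p (a∉ ∘ Vec.there))
card-insert (suc a) (false ∷ p) a∉ = card-insert a p (a∉ ∘ Vec.there)

img-card≤ : (x : Vec (Fin N) n) → ∣ img x ∣ Nat.≤ n
img-card≤ {N} [] = NatP.≤-reflexive (SubP.∣⊥∣≡0 N)
img-card≤ (a ∷ x) = NatP.≤-trans (card-insert≤ a (img x)) (Nat.s≤s (img-card≤ x))

img-card : (x : Vec (Fin N) n) → Inj x → ∣ img x ∣ ≡ n
img-card {N} [] _ = SubP.∣⊥∣≡0 N
img-card (a ∷ x) inj = trans (card-insert a (img x) λ a∈ → let k , eq = ∈img⇒Mem x a∈ in FinP.0≢1+n (inj zero (suc k) (sym eq)))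
  (cong suc (img-card x (Inj-∷⁻ {a = a} inj)))

two-elements : (I : Subset N) → ∣ I ∣ ≡ 2 → ∃ λ p → ∃ λ q → p ≢ q × p ∈ I × q ∈ I
two-elements {N} I card with any? (λ p → any? λ q → ¬? (p ≟ q) ×-dec ((p ∈? I) ×-dec (q ∈? I)))
... | yes (p , q , h) = p , q , h
... | no none with any? (λ p → p ∈? I)
...   | yes (p , p∈) = ⊥-elim (NatP.<⇒≱ (NatP.n<1+n 1) (NatP.≤-trans (NatP.≤-reflexive (sym card))
          (NatP.≤-trans (SubP.p⊆q⇒∣p∣≤∣q∣ I⊆) (NatP.≤-reflexive (SubP.∣⁅x⁆∣≡1 p)))))
  where
  I⊆ : I ⊆ ⁅ p ⁆
  I⊆ {q} q∈ with p ≟ q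
  ... | yes refl = SubP.x∈⁅x⁆ p
  ... | no p≢q = ⊥-elim (none (p , q , p≢q , p∈ , q∈))
...   | no empty = ⊥-elim (NatP.<⇒≱ (Nat.s≤s Nat.z≤n) (NatP.≤-trans (NatP.≤-reflexive (sym card))
          (NatP.≤-trans (SubP.p⊆q⇒∣p∣≤∣q∣ {q = Data.Fin.Subset.⊥} (λ {p} p∈ → ⊥-elim (empty (p , p∈)))) (NatP.≤-reflexive (SubP.∣⊥∣≡0 N)))))

-- Ties the explicit ground set, which the Orlik-Solomon algebra refers to, to the implicit one of
-- the chirotope.
Ground : Subset N → Chi N r → Set
Ground E ν = ∀ e → (e ∈ E → NonLoop ν e) × (NonLoop ν e → e ∈ E)

RankGe-mono : (ν : Chi N r) {X X' : Subset N} {k : ℕ} → X ⊆ X' → RankGe ν X k → RankGe ν X' k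
RankGe-mono ν sub (I , ind , I⊆ , card) = I , ind , (λ e∈ → sub (I⊆ e∈)) , card

∈-atomSpan : (E : Subset N) (ν : Chi N r) (S : Subset N) → ∀ {j} → j ∈ E → ¬ RankGe ν (S ∪ ⁅ j ⁆) 2 → j ∈ atomSpan E ν S
∈-atomSpan E ν S {j} j∈ ¬rk = VecP.lookup⇒[]= j _ (trans (VecP.lookup∘tabulate _ j) holds)
  where
  holds : ⌊ j ∈? E ⌋ ∧ not ⌊ RankGe? ν (S ∪ ⁅ j ⁆) 2 ⌋ ≡ true
  holds with j ∈? E | RankGe? ν (S ∪ ⁅ j ⁆) 2
  ... | yes _ | no _ = refl
  ... | no j∉ | _ = ⊥-elim (j∉ j∈)
  ... | yes _ | yes rk = ⊥-elim (¬rk rk)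

∈-atomSpan⁻ : (E : Subset N) (ν : Chi N r) (S : Subset N) → ∀ {j} → j ∈ atomSpan E ν S → j ∈ E × ¬ RankGe ν (S ∪ ⁅ j ⁆) 2
∈-atomSpan⁻ E ν S {j} j∈ = unfold (trans (sym (VecP.lookup∘tabulate _ j)) (VecP.[]=⇒lookup j∈))
  where
  unfold : ⌊ j ∈? E ⌋ ∧ not ⌊ RankGe? ν (S ∪ ⁅ j ⁆) 2 ⌋ ≡ true → j ∈ E × ¬ RankGe ν (S ∪ ⁅ j ⁆) 2
  unfold eq with j ∈? E | RankGe? ν (S ∪ ⁅ j ⁆) 2
  unfold eq | yes j∈E | no ¬rk = j∈E , ¬rk
  unfold () | yes _ | yes _
  unfold () | no _ | _

-- Entries are replaced one at a time; each replaced entry is moved into the contraction, where the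
-- remaining laws still hold.
parallel-basis : ∀ {r} {ν : Chi N r} (y y' : Vec (Fin N) r) →
  (∀ k → ∃ λ σ → σ ≢ zer × (∀ z j → ν (z [ j ]≔ lookup y' k) ≡ σ *ₛ ν (z [ j ]≔ lookup y k))) → ν y ≢ zer → ν y' ≢ zer
parallel-basis [] [] laws nz = nz
parallel-basis {ν = ν} (a ∷ y) (a' ∷ y') laws nz = parallel-basis {ν = con ν a'} y y'
  (λ k → let σ , σ≢ , law = laws (suc k) in σ , σ≢ , λ z j → law (a' ∷ z) (suc j))
  (let σ , σ≢ , law = laws zero in λ eq → *ₛ-nonzero σ _ σ≢ nz (trans (sym (law (a ∷ y) zero)) eq))

module _ {N r} {ν : Chi N (suc r)} (om : OM ν) where

  NonPar : Fin N → Fin N → Set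
  NonPar p q = NonLoop (con ν p) q

  NonPar-sym : ∀ {p q} → NonPar p q → NonPar q p
  NonPar-sym {p} {q} h = decidable-stable (NonLoop? (con ν q) p) λ par → Par-sym om par h

  NonPar⇒≢ : ∀ {p q} → NonPar p q → p ≢ q
  NonPar⇒≢ h refl = Par-refl om _ h

  basis⇒NonPar : ∀ {x} → ν x ≢ zer → ∀ {p q} → p ≢ q → Mem p x → Mem q x → NonPar p q
  basis⇒NonPar {x} nz p≢q (i , refl) (j , refl) = Mem⇒NonLoop (con ν (lookup x i))
    (Perm-basis om (bring x i) nz) (Mem-removeAt x λ { refl → p≢q refl })

  NonPar⇒NonLoop : ∀ {p q} → NonPar p q → NonLoop ν p
  NonPar⇒NonLoop {p} (z , j , nz) = Mem⇒NonLoop ν nz (zero , refl)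

  NonPar⇒RankGe : ∀ {X p q} → p ∈ X → q ∈ X → NonPar p q → RankGe ν X 2
  NonPar⇒RankGe {X} {p} {q} p∈ q∈ h@(z , j , nz) = img (p ∷ q ∷ []) , (p ∷ (z [ j ]≔ q) , nz , sub) , inX ,
    img-card (p ∷ q ∷ []) λ { zero zero _ → refl ; zero (suc zero) eq → ⊥-elim (NonPar⇒≢ h eq)
                             ; (suc zero) zero eq → ⊥-elim (NonPar⇒≢ h (sym eq)) ; (suc zero) (suc zero) _ → refl }
    where
    sub : img (p ∷ q ∷ []) ⊆ img (p ∷ (z [ j ]≔ q))
    sub e∈ with ∈img⇒Mem (p ∷ q ∷ []) e∈
    ... | zero , refl = Mem⇒∈img (p ∷ (z [ j ]≔ q)) (zero , refl)
    ... | suc zero , refl = Mem⇒∈img (p ∷ (z [ j ]≔ q)) (suc j , VecP.lookup∘update j z q)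
    inX : img (p ∷ q ∷ []) ⊆ X
    inX e∈ with ∈img⇒Mem (p ∷ q ∷ []) e∈
    ... | zero , refl = p∈
    ... | suc zero , refl = q∈

  RankGe⇒NonPar : ∀ {X} → RankGe ν X 2 → ∃ λ p → ∃ λ q → p ∈ X × q ∈ X × NonPar p q
  RankGe⇒NonPar (I , (x , nz , I⊆) , I⊆X , card) with two-elements I card
  ... | p , q , p≢q , p∈ , q∈ = p , q , I⊆X p∈ , I⊆X q∈ , basis⇒NonPar nz p≢q (∈img⇒Mem x (I⊆ p∈)) (∈img⇒Mem x (I⊆ q∈))

  RankGe-pair⇒NonPar : ∀ {i j} → RankGe ν (⁅ i ⁆ ∪ ⁅ j ⁆) 2 → NonPar i j
  RankGe-pair⇒NonPar {i} {j} rk with RankGe⇒NonPar rk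
  ... | p , q , p∈ , q∈ , h with SubP.x∈p∪q⁻ ⁅ i ⁆ ⁅ j ⁆ p∈ | SubP.x∈p∪q⁻ ⁅ i ⁆ ⁅ j ⁆ q∈
  ...   | inj₁ a | inj₂ b with SubP.x∈⁅y⁆⇒x≡y i a | SubP.x∈⁅y⁆⇒x≡y j b
  ...     | refl | refl = h
  RankGe-pair⇒NonPar {i} {j} rk | p , q , p∈ , q∈ , h | inj₂ a | inj₁ b with SubP.x∈⁅y⁆⇒x≡y j a | SubP.x∈⁅y⁆⇒x≡y i b
  ...     | refl | refl = NonPar-sym h
  RankGe-pair⇒NonPar {i} {j} rk | p , q , p∈ , q∈ , h | inj₁ a | inj₁ b =
    ⊥-elim (NonPar⇒≢ h (trans (SubP.x∈⁅y⁆⇒x≡y i a) (sym (SubP.x∈⁅y⁆⇒x≡y i b))))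
  RankGe-pair⇒NonPar {i} {j} rk | p , q , p∈ , q∈ , h | inj₂ a | inj₂ b =
    ⊥-elim (NonPar⇒≢ h (trans (SubP.x∈⁅y⁆⇒x≡y j a) (sym (SubP.x∈⁅y⁆⇒x≡y j b))))

  NonPar⇒RankGe-pair : ∀ {i j} → NonPar i j → RankGe ν (⁅ i ⁆ ∪ ⁅ j ⁆) 2
  NonPar⇒RankGe-pair {i} {j} = NonPar⇒RankGe (SubP.x∈p∪q⁺ (inj₁ (SubP.x∈⁅x⁆ i))) (SubP.x∈p∪q⁺ (inj₂ (SubP.x∈⁅x⁆ j)))

  Par-trans : ∀ {i j k} → NonLoop ν i → NonLoop ν j → Par ν i j → Par ν i k → Par ν j k
  Par-trans {i} {j} {k} nli nlj par par' (z , m , nz) with Par-sign om nli nlj par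
  ... | σ , _ , law = par' (z , m , λ eq → nz (trans (law (j ∷ (z [ m ]≔ k)) zero) (*ₛ-zeroʳ′ σ eq)))

  module _ {E : Subset N} (ground : Ground E ν) where

    ∈-atomOf : ∀ {i j} → j ∈ E → Par ν i j → j ∈ atomOf E ν i
    ∈-atomOf {i} j∈ par = ∈-atomSpan E ν ⁅ i ⁆ j∈ (par ∘ RankGe-pair⇒NonPar)

    ∈-atomOf⁻ : ∀ {i j} → j ∈ atomOf E ν i → j ∈ E × Par ν i j
    ∈-atomOf⁻ {i} j∈ = let j∈E , ¬rk = ∈-atomSpan⁻ E ν ⁅ i ⁆ j∈ in j∈E , ¬rk ∘ NonPar⇒RankGe-pair

    self-∈-atomOf : ∀ {i} → i ∈ E → i ∈ atomOf E ν i
    self-∈-atomOf i∈ = ∈-atomOf i∈ (Par-refl om _)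

    atomOf-cong : ∀ {i j} → NonLoop ν i → NonLoop ν j → Par ν i j → atomOf E ν i ≡ atomOf E ν j
    atomOf-cong nli nlj par = SubP.⊆-antisym
      (λ k∈ → let k∈E , par' = ∈-atomOf⁻ k∈ in ∈-atomOf k∈E (Par-trans nli nlj par par'))
      (λ k∈ → let k∈E , par' = ∈-atomOf⁻ k∈ in ∈-atomOf k∈E (Par-trans nlj nli (Par-sym om par) par'))

    atomOf-≡⇒Par : ∀ {i j} → j ∈ E → atomOf E ν i ≡ atomOf E ν j → Par ν i j
    atomOf-≡⇒Par j∈ eq = proj₂ (∈-atomOf⁻ (subst (_ ∈_) (sym eq) (self-∈-atomOf j∈)))

    NonLoop⇒RankGe : ∀ {X i} → i ∈ X → NonLoop ν i → RankGe ν X 1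
    NonLoop⇒RankGe {X} {i} i∈ (z , j , nz) = ⁅ i ⁆ , (z [ j ]≔ i , nz , sub) , inX , SubP.∣⁅x⁆∣≡1 i
      where
      sub : ⁅ i ⁆ ⊆ img (z [ j ]≔ i)
      sub e∈ with SubP.x∈⁅y⁆⇒x≡y i e∈
      ... | refl = Mem⇒∈img (z [ j ]≔ i) (Mem-update z j)
      inX : ⁅ i ⁆ ⊆ X
      inX e∈ with SubP.x∈⁅y⁆⇒x≡y i e∈
      ... | refl = i∈

    atomOf-IsAtom : ∀ {i} → NonLoop ν i → IsAtom E ν (atomOf E ν i)
    atomOf-IsAtom {i} nl = (λ j∈ → proj₁ (∈-atomOf⁻ j∈)) ,
      NonLoop⇒RankGe (self-∈-atomOf (proj₂ (ground i) nl)) nl ,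
      (λ rk → let p , q , p∈ , q∈ , h = RankGe⇒NonPar rk in
        Par-trans nl (NonPar⇒NonLoop h) (proj₂ (∈-atomOf⁻ p∈)) (proj₂ (∈-atomOf⁻ q∈)) h) ,
      λ e e∈ e∉ → NonPar⇒RankGe (SubP.x∈p∪q⁺ (inj₁ (self-∈-atomOf (proj₂ (ground i) nl)))) (SubP.x∈p∪q⁺ (inj₂ (SubP.x∈⁅x⁆ e)))
        (decidable-stable (NonLoop? (con ν i) e) (e∉ ∘ ∈-atomOf e∈))

    IsAtom⇒atomOf : ∀ {a i} → IsAtom E ν a → i ∈ a → a ≡ atomOf E ν i
    IsAtom⇒atomOf {a} {i} (a⊆E , _ , ¬rk2 , maximal) i∈ = SubP.⊆-antisym
      (λ j∈ → ∈-atomOf (a⊆E j∈) (inside j∈)) λ {j} j∈ → go j (∈-atomOf⁻ j∈) (j ∈? a)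
      where
      inside : ∀ {j} → j ∈ a → Par ν i j
      inside j∈ h = ¬rk2 (NonPar⇒RankGe i∈ j∈ h)
      nl : ∀ {j} → j ∈ E → NonLoop ν j
      nl {j} = proj₁ (ground j)
      go : ∀ j → j ∈ E × Par ν i j → Dec (j ∈ a) → j ∈ a
      go j _ (yes j∈) = j∈
      go j (j∈E , par) (no j∉) with RankGe⇒NonPar (maximal j j∈E j∉)
      ... | p , q , p∈ , q∈ , h = ⊥-elim (Par-trans (nl (a⊆E i∈)) (NonPar⇒NonLoop h) (to-par p∈) (to-par q∈) h)
        where
        to-par : ∀ {t} → t ∈ a ∪ ⁅ j ⁆ → Par ν i t
        to-par t∈ with SubP.x∈p∪q⁻ a ⁅ j ⁆ t∈
        ... | inj₁ t∈a = inside t∈a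
        ... | inj₂ t∈j with SubP.x∈⁅y⁆⇒x≡y j t∈j
        ...   | refl = par

    -- An independent set of full size in the union of the atoms is a basis. Replacing each of its
    -- elements by the parallel entry of `x` keeps it a basis, and its entries then exhaust those of
    -- `x`.
    span-basis : (x : Vec (Fin N) (suc r)) → (∀ k → NonLoop ν (lookup x k)) →
      RankGe ν (⋃ (List.map (atomOf E ν) (toList x))) (suc r) → ν x ≢ zer
    span-basis x nl (I , (y , nz , I⊆) , I⊆⋃ , card) = Sub-basis′
      where
      ⋃⁻ : ∀ {n} (x : Vec (Fin N) n) {e} → e ∈ ⋃ (List.map (atomOf E ν) (toList x)) → ∃ λ k → e ∈ atomOf E ν (lookup x k)
      ⋃⁻ [] e∈ = ⊥-elim (SubP.∉⊥ e∈)
      ⋃⁻ (a ∷ x) e∈ with SubP.x∈p∪q⁻ (atomOf E ν a) _ e∈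
      ... | inj₁ p = zero , p
      ... | inj₂ p = let k , q = ⋃⁻ x p in suc k , q
      y⊆I : ∀ k → lookup y k ∈ I
      y⊆I k with lookup y k ∈? I
      ... | yes h = h
      ... | no h = ⊥-elim (NatP.<⇒≱ (SubP.p⊂q⇒∣p∣<∣q∣ (I⊆ , lookup y k , Mem⇒∈img y (k , refl) , h))
                     (NatP.≤-trans (img-card≤ y) (NatP.≤-reflexive (sym card))))
      rep : ∀ k → ∃ λ m → lookup y k ∈ atomOf E ν (lookup x m)
      rep k = ⋃⁻ x (I⊆⋃ (y⊆I k))
      y' : Vec (Fin N) (suc r)
      y' = tabulate λ k → lookup x (proj₁ (rep k))
      at : ∀ k → lookup y' k ≡ lookup x (proj₁ (rep k))
      at k = VecP.lookup∘tabulate (λ k → lookup x (proj₁ (rep k))) k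
      nz' : ν y' ≢ zer
      nz' = parallel-basis {ν = ν} y y' (λ k → subst (λ e → ∃ λ σ → σ ≢ zer × (∀ z j → ν (z [ j ]≔ e) ≡ σ *ₛ ν (z [ j ]≔ lookup y k))) (sym (at k))
        (Par-sign om (Mem⇒NonLoop ν nz (k , refl)) (nl _) (Par-sym om (proj₂ (∈-atomOf⁻ (proj₂ (rep k))))))) nz
      sub : Sub y' x
      sub k = proj₁ (rep k) , sym (at k)
      Sub-basis′ : ν x ≢ zer
      Sub-basis′ = Perm-basis om (proj₂ (Sub⇒Perm y' x (nonzero⇒Inj om nz') sub)) nz'

-- The Orlik–Solomon algebra as an abelian group of formal sums

module OS {c ℓ} (R : CommutativeRing c ℓ) where
  open CommutativeRing R using (Carrier; _≈_; _+_; _*_; -_; 0#; 1#; setoid; +-cong; +-congˡ; +-congʳ; +-assoc; +-comm;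
    +-identityˡ; +-identityʳ; *-congˡ; *-congʳ; *-assoc; *-identityˡ; *-identityʳ; zeroˡ; zeroʳ; distribˡ; -‿inverseʳ; -‿inverseˡ; -‿cong)
    renaming (refl to ≈-refl; sym to ≈-sym; trans to ≈-trans; reflexive to ≈-reflexive)
  open import Algebra.Properties.Ring (CommutativeRing.ring R) using (-1*x≈-x)
  open import Algebra.Properties.AbelianGroup (CommutativeRing.+-abelianGroup R) using () renaming (⁻¹-∙-comm to -‿+-comm)
  open import Algebra.Properties.Group (CommutativeRing.+-group R) using ()
    renaming (⁻¹-involutive to -‿involutive; ε⁻¹≈ε to -0≈0)
  open import Relation.Binary.Reasoning.Setoid setoid

  ⊖_ : FS R N → FS R N
  ⊖ f = scaleFS R (- 1#) f

  consF : Subset N → FS R N → FS R N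
  consF a f = List.map (λ { (d , w) → (d , a ∷ w) }) f

  mono : Word N → FS R N
  mono w = (1# , w) ∷ []

  coeff-++ : ∀ (w : Word N) f g → coeff R w (f ++ g) ≈ coeff R w f + coeff R w g
  coeff-++ w [] g = ≈-sym (+-identityˡ _)
  coeff-++ w ((d , u) ∷ f) g with ListP.≡-dec _≟S_ u w
  ... | yes _ = ≈-trans (+-congˡ (coeff-++ w f g)) (≈-sym (+-assoc _ _ _))
  ... | no _ = coeff-++ w f g

  coeff-scale : ∀ (w : Word N) k f → coeff R w (scaleFS R k f) ≈ k * coeff R w f
  coeff-scale w k [] = ≈-sym (zeroʳ k)
  coeff-scale w k ((d , u) ∷ f) with ListP.≡-dec _≟S_ u w
  ... | yes _ = ≈-trans (+-congˡ (coeff-scale w k f)) (≈-sym (distribˡ k d _))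
  ... | no _ = coeff-scale w k f

  coeff-⊖ : ∀ (w : Word N) f → coeff R w (⊖ f) ≈ - coeff R w f
  coeff-⊖ w f = ≈-trans (coeff-scale w (- 1#) f) (-1*x≈-x _)

  coeff-∷-yes : ∀ (w : Word N) d f → coeff R w ((d , w) ∷ f) ≡ d + coeff R w f
  coeff-∷-yes w d f with ListP.≡-dec _≟S_ w w
  ... | yes _ = refl
  ... | no w≢w = ⊥-elim (w≢w refl)

  coeff-∷-no : ∀ {u w : Word N} d f → u ≢ w → coeff R w ((d , u) ∷ f) ≡ coeff R w f
  coeff-∷-no {u = u} {w} d f u≢w with ListP.≡-dec _≟S_ u w
  ... | yes u≡w = ⊥-elim (u≢w u≡w)
  ... | no _ = refl

  coeff-cons : ∀ (a : Subset N) w f → coeff R (a ∷ w) (consF a f) ≈ coeff R w f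
  coeff-cons a w [] = ≈-refl
  coeff-cons a w ((d , u) ∷ f) = by (ListP.≡-dec _≟S_ u w)
    where
    by : Dec (u ≡ w) → coeff R (a ∷ w) (consF a ((d , u) ∷ f)) ≈ coeff R w ((d , u) ∷ f)
    by (yes refl) = ≈-trans (≈-reflexive (coeff-∷-yes (a ∷ u) d (consF a f)))
      (≈-trans (+-congˡ (coeff-cons a u f)) (≈-reflexive (sym (coeff-∷-yes u d f))))
    by (no u≢w) = ≈-trans (≈-reflexive (coeff-∷-no d (consF a f) (u≢w ∘ ListP.∷-injectiveʳ)))
      (≈-trans (coeff-cons a w f) (≈-reflexive (sym (coeff-∷-no d f u≢w))))

  coeff-cons-other : ∀ (a : Subset N) w f → (∀ u → w ≢ a ∷ u) → coeff R w (consF a f) ≈ 0#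
  coeff-cons-other a w [] h = ≈-refl
  coeff-cons-other a w ((d , u) ∷ f) h =
    ≈-trans (≈-reflexive (coeff-∷-no d (consF a f) (h u ∘ sym))) (coeff-cons-other a w f h)

  ++-≈F : {f f' g g' : FS R N} → _≈F_ R f f' → _≈F_ R g g' → _≈F_ R (f ++ g) (f' ++ g')
  ++-≈F {f = f} {f'} {g} {g'} p q w = ≈-trans (coeff-++ w f g) (≈-trans (+-cong (p w) (q w)) (≈-sym (coeff-++ w f' g')))

  scale-≈F : ∀ k {f g : FS R N} → _≈F_ R f g → _≈F_ R (scaleFS R k f) (scaleFS R k g)
  scale-≈F k {f} {g} p w = ≈-trans (coeff-scale w k f) (≈-trans (*-congˡ (p w)) (≈-sym (coeff-scale w k g)))

  cons-≈F : ∀ a {f g : FS R N} → _≈F_ R f g → _≈F_ R (consF a f) (consF a g)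
  cons-≈F a {f} {g} p [] = ≈-trans (coeff-cons-other a [] f λ _ ()) (≈-sym (coeff-cons-other a [] g λ _ ()))
  cons-≈F a {f} {g} p (b ∷ w) with b ≟S a
  ... | yes refl = ≈-trans (coeff-cons a w f) (≈-trans (p w) (≈-sym (coeff-cons a w g)))
  ... | no b≢a = ≈-trans (coeff-cons-other a (b ∷ w) f λ u eq → b≢a (ListP.∷-injectiveˡ eq))
                   (≈-sym (coeff-cons-other a (b ∷ w) g λ u eq → b≢a (ListP.∷-injectiveˡ eq)))

  ∷-≈F : ∀ {d d'} (w : Word N) (f g : FS R N) → d ≈ d' → _≈F_ R f g → _≈F_ R ((d , w) ∷ f) ((d' , w) ∷ g)
  ∷-≈F w f g p q u with ListP.≡-dec _≟S_ w u
  ... | yes _ = +-cong p (q u)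
  ... | no _ = q u

  module _ {N r} {E : Subset N} {χ : Chi N r} where

    ideal-++ : ∀ {f g} → InIdeal R E χ f → InIdeal R E χ g → InIdeal R E χ (f ++ g)
    ideal-++ nil q = q
    ideal-++ {g = g} (step k u h v f gen p) q = subst (InIdeal R E χ)
      (sym (ListP.++-assoc (scaleFS R k (sandwich R u h v)) f g)) (step k u h v (f ++ g) gen (ideal-++ p q))
    ideal-++ {g = g} (resp f f' eq p) q = resp (f ++ g) (f' ++ g) (++-≈F {f = f} {f'} {g} {g} eq λ _ → ≈-refl) (ideal-++ p q)

    ideal-scale : ∀ l {f} → InIdeal R E χ f → InIdeal R E χ (scaleFS R l f)
    ideal-scale l nil = nil
    ideal-scale l (step k u h v f gen p) = resp (scaleFS R (l * k) (sandwich R u h v) ++ scaleFS R l f) _ eq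
      (step (l * k) u h v _ gen (ideal-scale l p))
      where
      eq : _≈F_ R (scaleFS R (l * k) (sandwich R u h v) ++ scaleFS R l f) (scaleFS R l (scaleFS R k (sandwich R u h v) ++ f))
      eq w = begin
        coeff R w (scaleFS R (l * k) s ++ scaleFS R l f) ≈⟨ coeff-++ w (scaleFS R (l * k) s) _ ⟩
        coeff R w (scaleFS R (l * k) s) + coeff R w (scaleFS R l f) ≈⟨ +-cong (coeff-scale w (l * k) s) (coeff-scale w l f) ⟩
        (l * k) * coeff R w s + l * coeff R w f ≈⟨ +-congʳ (*-assoc l k _) ⟩
        l * (k * coeff R w s) + l * coeff R w f ≈⟨ distribˡ l _ _ ⟨
        l * (k * coeff R w s + coeff R w f) ≈⟨ *-congˡ (+-congʳ (coeff-scale w k s)) ⟨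
        l * (coeff R w (scaleFS R k s) + coeff R w f) ≈⟨ *-congˡ (coeff-++ w (scaleFS R k s) f) ⟨
        l * coeff R w (scaleFS R k s ++ f) ≈⟨ coeff-scale w l (scaleFS R k s ++ f) ⟨
        coeff R w (scaleFS R l (scaleFS R k s ++ f)) ∎
        where s = sandwich R u h v
    ideal-scale l (resp f g eq p) = resp _ _ (scale-≈F l {f} {g} eq) (ideal-scale l p)

    ideal-cons : ∀ a {f} → InIdeal R E χ f → InIdeal R E χ (consF a f)
    ideal-cons a nil = nil
    ideal-cons a (step k u h v f gen p) = subst (InIdeal R E χ) eq (step k (a ∷ u) h v (consF a f) gen (ideal-cons a p))
      where
      shuffle : ∀ (h : FS R N) → scaleFS R k (sandwich R (a ∷ u) h v) ≡ consF a (scaleFS R k (sandwich R u h v))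
      shuffle [] = refl
      shuffle (_ ∷ h) = cong₂ _∷_ refl (shuffle h)
      eq : scaleFS R k (sandwich R (a ∷ u) h v) ++ consF a f ≡ consF a (scaleFS R k (sandwich R u h v) ++ f)
      eq = trans (cong (_++ consF a f) (shuffle h)) (sym (ListP.map-++ _ (scaleFS R k (sandwich R u h v)) f))
    ideal-cons a (resp f g eq p) = resp _ _ (cons-≈F a {f} {g} eq) (ideal-cons a p)

    gen-ideal : ∀ {g} → OSGen R E χ g → InIdeal R E χ g
    gen-ideal {g} gen = resp _ g eq (step 1# [] g [] [] gen nil)
      where
      eq : _≈F_ R (scaleFS R 1# (sandwich R [] g []) ++ []) g
      eq w = ≈-trans (coeff-++ w (scaleFS R 1# (sandwich R [] g [])) []) (≈-trans (+-identityʳ _)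
        (≈-trans (coeff-scale w 1# (sandwich R [] g [])) (≈-trans (*-identityˡ _) (same g))))
        where
        same : ∀ g → coeff R w (sandwich R [] g []) ≈ coeff R w g
        same [] = ≈-refl
        same ((d , u) ∷ g) rewrite ListP.++-identityʳ u with ListP.≡-dec _≟S_ u w
        ... | yes _ = +-congˡ (same g)
        ... | no _ = same g

    tail-ideal : ∀ {g} v → OSGen R E χ g → InIdeal R E χ (List.map (λ { (d , w) → (d , w ++ v) }) g)
    tail-ideal {g} v gen = resp _ _ eq (step 1# [] g v [] gen nil)
      where
      eq : _≈F_ R (scaleFS R 1# (sandwich R [] g v) ++ []) (List.map (λ { (d , w) → (d , w ++ v) }) g)
      eq w = ≈-trans (coeff-++ w (scaleFS R 1# (sandwich R [] g v)) []) (≈-trans (+-identityʳ _)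
        (≈-trans (coeff-scale w 1# (sandwich R [] g v)) (≈-trans (*-identityˡ _) (≈-reflexive (cong (coeff R w) (same g))))))
        where
        same : ∀ g → sandwich R [] g v ≡ List.map (λ { (d , w) → (d , w ++ v) }) g
        same [] = refl
        same (_ ∷ g) = cong₂ _∷_ refl (same g)

  module _ {N r} (E : Subset N) (χ : Chi N r) where

    infix 4 _∼_
    -- A record, since `f` and `g` cannot be recovered from the formal difference to which `OSEq`
    -- unfolds.
    record _∼_ (f g : FS R N) : Set (c ⊔ ℓ) where
      constructor mk∼
      field
        un∼ : OSEq R E χ f g
    open _∼_ public

    coeff-difference : ∀ (w : Word N) (f g : FS R N) → coeff R w (f ++ ⊖ g) ≈ coeff R w f + - coeff R w g
    coeff-difference w f g = ≈-trans (coeff-++ w f (⊖ g)) (+-congˡ (coeff-⊖ w g))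

    ≈F⇒∼ : ∀ {f g} → _≈F_ R f g → f ∼ g
    ≈F⇒∼ {f} {g} eq = mk∼ (resp [] _ (λ w → ≈-sym (≈-trans (coeff-difference w f g)
      (≈-trans (+-congʳ (eq w)) (-‿inverseʳ _)))) nil)

    ≡⇒∼ : ∀ {f g} → f ≡ g → f ∼ g
    ≡⇒∼ refl = ≈F⇒∼ λ _ → ≈-refl

    ideal⇒∼ : ∀ {f} → InIdeal R E χ f → f ∼ []
    ideal⇒∼ {f} p = mk∼ (subst (InIdeal R E χ) (sym (ListP.++-identityʳ f)) p)

    ∼-sym : ∀ {f g} → f ∼ g → g ∼ f
    ∼-sym {f} {g} (mk∼ p) = mk∼ (resp _ _ eq (ideal-scale (- 1#) p))
      where
      eq : _≈F_ R (⊖ (f ++ ⊖ g)) (g ++ ⊖ f)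
      eq w = begin
        coeff R w (⊖ (f ++ ⊖ g)) ≈⟨ coeff-⊖ w (f ++ ⊖ g) ⟩
        - coeff R w (f ++ ⊖ g) ≈⟨ -‿cong (coeff-difference w f g) ⟩
        - (coeff R w f + - coeff R w g) ≈⟨ -‿+-comm _ _ ⟨
        - coeff R w f + - - coeff R w g ≈⟨ +-congˡ (-‿involutive _) ⟩
        - coeff R w f + coeff R w g ≈⟨ +-comm _ _ ⟩
        coeff R w g + - coeff R w f ≈⟨ coeff-difference w g f ⟨
        coeff R w (g ++ ⊖ f) ∎

    ∼-trans : ∀ {f g h} → f ∼ g → g ∼ h → f ∼ h
    ∼-trans {f} {g} {h} (mk∼ p) (mk∼ q) = mk∼ (resp _ _ eq (ideal-++ p q))
      where
      eq : _≈F_ R ((f ++ ⊖ g) ++ (g ++ ⊖ h)) (f ++ ⊖ h)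
      eq w = begin
        coeff R w ((f ++ ⊖ g) ++ (g ++ ⊖ h)) ≈⟨ coeff-++ w (f ++ ⊖ g) _ ⟩
        coeff R w (f ++ ⊖ g) + coeff R w (g ++ ⊖ h) ≈⟨ +-cong (coeff-difference w f g) (coeff-difference w g h) ⟩
        (a + - b) + (b + - d) ≈⟨ +-assoc a (- b) _ ⟩
        a + (- b + (b + - d)) ≈⟨ +-congˡ (+-assoc (- b) b (- d)) ⟨
        a + ((- b + b) + - d) ≈⟨ +-congˡ (+-congʳ (-‿inverseˡ b)) ⟩
        a + (0# + - d) ≈⟨ +-congˡ (+-identityˡ _) ⟩
        a + - d ≈⟨ coeff-difference w f h ⟨
        coeff R w (f ++ ⊖ h) ∎
        where
        a = coeff R w f
        b = coeff R w g
        d = coeff R w h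

    ∼-++ : ∀ {f f' g g'} → f ∼ f' → g ∼ g' → (f ++ g) ∼ (f' ++ g')
    ∼-++ {f} {f'} {g} {g'} (mk∼ p) (mk∼ q) = mk∼ (resp _ _ eq (ideal-++ p q))
      where
      eq : _≈F_ R ((f ++ ⊖ f') ++ (g ++ ⊖ g')) ((f ++ g) ++ ⊖ (f' ++ g'))
      eq w = begin
        coeff R w ((f ++ ⊖ f') ++ (g ++ ⊖ g')) ≈⟨ coeff-++ w (f ++ ⊖ f') _ ⟩
        coeff R w (f ++ ⊖ f') + coeff R w (g ++ ⊖ g') ≈⟨ +-cong (coeff-difference w f f') (coeff-difference w g g') ⟩
        (a + - a') + (b + - b') ≈⟨ +-assoc a (- a') _ ⟩
        a + (- a' + (b + - b')) ≈⟨ +-congˡ (≈-trans (≈-sym (+-assoc _ _ _)) (≈-trans (+-congʳ (+-comm _ _)) (+-assoc _ _ _))) ⟩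
        a + (b + (- a' + - b')) ≈⟨ +-congˡ (+-congˡ (-‿+-comm a' b')) ⟩
        a + (b + - (a' + b')) ≈⟨ +-assoc a b _ ⟨
        (a + b) + - (a' + b') ≈⟨ +-cong (coeff-++ w f g) (-‿cong (coeff-++ w f' g')) ⟨
        coeff R w (f ++ g) + - coeff R w (f' ++ g') ≈⟨ coeff-difference w (f ++ g) (f' ++ g') ⟨
        coeff R w ((f ++ g) ++ ⊖ (f' ++ g')) ∎
        where
        a = coeff R w f
        a' = coeff R w f'
        b = coeff R w g
        b' = coeff R w g'

    ∼-⊖ : ∀ {f g} → f ∼ g → ⊖ f ∼ ⊖ g
    ∼-⊖ {f} {g} (mk∼ p) = mk∼ (resp _ _ (λ w → ≈-reflexive (cong (coeff R w) (ListP.map-++ _ f (⊖ g)))) (ideal-scale (- 1#) p))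

    OSGroup : AbelianGroup c (c ⊔ ℓ)
    OSGroup = record
      { Carrier = FS R N ; _≈_ = _∼_ ; _∙_ = _++_ ; ε = [] ; _⁻¹ = ⊖_
      ; isAbelianGroup = record
        { isGroup = record
          { isMonoid = record
            { isSemigroup = record
              { isMagma = record
                { isEquivalence = record { refl = ≡⇒∼ refl ; sym = ∼-sym ; trans = ∼-trans }
                ; ∙-cong = ∼-++ }
              ; assoc = λ f g h → ≡⇒∼ (ListP.++-assoc f g h) }
            ; identity = (λ f → ≡⇒∼ refl) , λ f → ≡⇒∼ (ListP.++-identityʳ f) }
          ; inverse = (λ f → ≈F⇒∼ (λ w → ≈-trans (coeff-++ w (⊖ f) f) (≈-trans (+-congʳ (coeff-⊖ w f)) (-‿inverseˡ _))))
                    , (λ f → ≈F⇒∼ (λ w → ≈-trans (coeff-difference w f f) (-‿inverseʳ _)))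
          ; ⁻¹-cong = ∼-⊖ }
        ; comm = λ f g → ≈F⇒∼ λ w → ≈-trans (coeff-++ w f g) (≈-trans (+-comm _ _) (≈-sym (coeff-++ w g f))) } }

    open GroupSums OSGroup using (act; act-cong; act-*; act-∙; sumL; sum-cong)

    ∼-cons : ∀ a {f g} → f ∼ g → consF a f ∼ consF a g
    ∼-cons a {f} {g} (mk∼ p) = mk∼ (subst (InIdeal R E χ) (trans (ListP.map-++ _ f (⊖ g)) (cong (consF a f ++_) (commute g))) (ideal-cons a p))
      where
      commute : ∀ g → consF a (⊖ g) ≡ ⊖ (consF a g)
      commute [] = refl
      commute (_ ∷ g) = cong₂ _∷_ refl (commute g)

    cons-act : ∀ a s f → consF a (act s f) ≡ act s (consF a f)
    cons-act a pos f = refl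
    cons-act a zer f = refl
    cons-act a neg [] = refl
    cons-act a neg (_ ∷ f) = cong₂ _∷_ refl (cons-act a neg f)

    cons-sum : ∀ a {I : Set} (f : I → FS R N) L → consF a (sumL f L) ≡ sumL (consF a ∘ f) L
    cons-sum a f [] = refl
    cons-sum a f (p ∷ L) = trans (ListP.map-++ _ (f p) (sumL f L)) (cong (consF a (f p) ++_) (cons-sum a f L))

    term-act : ∀ s w → ((signR R s , w) ∷ []) ∼ act s (mono w)
    term-act pos w = ≡⇒∼ {mono w} refl
    term-act neg w = ≈F⇒∼ (∷-≈F w [] [] (≈-sym (*-identityʳ _)) λ _ → ≈-refl)
    term-act zer w = ≈F⇒∼ zero-term
      where
      zero-term : _≈F_ R ((0# , w) ∷ []) []
      zero-term u with ListP.≡-dec _≟S_ w u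
      ... | yes _ = +-identityˡ 0#
      ... | no _ = ≈-refl

    sum-terms : {I : Set} (s : I → Sign) (w : I → Word N) → ∀ L →
      List.map (λ i → (signR R (s i) , w i)) L ∼ sumL (λ i → act (s i) (mono (w i))) L
    sum-terms s w [] = ≡⇒∼ {[]} refl
    sum-terms s w (i ∷ L) = ∼-++ {g = List.map (λ i → (signR R (s i) , w i)) L} (term-act (s i) (w i)) (sum-terms s w L)

    swap-words : ∀ {a b} → IsAtom E χ a → IsAtom E χ b → ∀ f → consF a (consF b f) ∼ ⊖ (consF b (consF a f))
    swap-words {a} {b} ha hb [] = ≡⇒∼ {[]} refl
    swap-words {a} {b} ha hb ((d , w) ∷ f) = ∼-++ {(d , a ∷ b ∷ w) ∷ []} {⊖ ((d , b ∷ a ∷ w) ∷ [])}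
      {consF a (consF b f)} {⊖ (consF b (consF a f))}
      (mk∼ (resp _ _ eq (ideal-scale d (tail-ideal w (anti a b ha hb))))) (swap-words ha hb f)
      where
      eq : _≈F_ R ((d * 1# , a ∷ b ∷ w) ∷ (d * 1# , b ∷ a ∷ w) ∷ [])
                  ((d , a ∷ b ∷ w) ∷ (- 1# * (- 1# * d) , b ∷ a ∷ w) ∷ [])
      eq = ∷-≈F (a ∷ b ∷ w) ((d * 1# , b ∷ a ∷ w) ∷ []) ((- 1# * (- 1# * d) , b ∷ a ∷ w) ∷ []) (*-identityʳ d) (∷-≈F (b ∷ a ∷ w) [] [] (≈-trans (*-identityʳ d) (≈-sym (≈-trans (-1*x≈-x _) (≈-trans (-‿cong (-1*x≈-x d)) (-‿involutive d)))))
        λ _ → ≈-refl)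

    square-words : ∀ {a} → IsAtom E χ a → ∀ f → consF a (consF a f) ∼ []
    square-words ha [] = ≡⇒∼ {[]} refl
    square-words {a} ha ((d , w) ∷ f) = ∼-++ {(d , a ∷ a ∷ w) ∷ []} {[]} {consF a (consF a f)} {[]}
      (ideal⇒∼ (resp ((d * 1# , a ∷ a ∷ w) ∷ []) _ (∷-≈F (a ∷ a ∷ w) [] [] (*-identityʳ d) λ _ → ≈-refl) (ideal-scale d (tail-ideal w (sq a ha)))))
      (square-words ha f)

-- Monomials attached to tuples of non-loops

module Monomials {c ℓ} (R : CommutativeRing c ℓ) {N r} {E : Subset N} {ν : Chi N (suc r)} (om : OM ν) (ground : Ground E ν) where
  open OS R
  open AbelianGroup (OSGroup E ν) using (_≈_; setoid; ∙-cong; ∙-congˡ; ∙-congʳ; inverseʳ; inverseˡ; identityʳ; assoc)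
    renaming (refl to ∼-refl; sym to ∼-symm; trans to ∼-tran; reflexive to ∼-reflexive)
  open GroupSums (OSGroup E ν)
  open import Relation.Binary.Reasoning.Setoid setoid

  wd : Vec (Fin N) n → Word N
  wd x = List.map (atomOf E ν) (toList x)

  e : Vec (Fin N) n → FS R N
  e x = mono (wd x)

  NonLoops : Vec (Fin N) n → Set
  NonLoops x = ∀ k → NonLoop ν (lookup x k)

  private
    isAtom : ∀ {a} → NonLoop ν a → IsAtom E ν (atomOf E ν a)
    isAtom = atomOf-IsAtom om ground

  cons-cong : ∀ a {f g} → f ≈ g → consF a f ≈ consF a g
  cons-cong = ∼-cons E ν

  e-alt : ∀ {s} {x y : Vec (Fin N) n} → NonLoops x → Perm s x y → e x ≈ act s (e y)
  e-alt nl reflᵖ = ∼-refl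
  e-alt nl (swapᵖ a b x) = swap-words E ν (isAtom (nl zero)) (isAtom (nl (suc zero))) (e x)
  e-alt nl (prepᵖ {s = s} a {x} {y} p) = ∼-tran (cons-cong (atomOf E ν a) (e-alt (nl ∘ suc) p))
    (∼-reflexive (cons-act E ν (atomOf E ν a) s (e y)))
  e-alt {x = x} nl (transᵖ {s = s} {t} {y = y} {z} p q) = ∼-tran (e-alt nl p)
    (∼-tran (act-cong s (e-alt (λ k → let m , eq = Perm-Mem (Perm-sym p) (k , refl) in subst (NonLoop ν) eq (nl m)) q)) (act-* s t (e z)))

  e-repeated : ∀ {x : Vec (Fin N) n} → NonLoops x → ∀ {i j} → i ≢ j → atomOf E ν (lookup x i) ≡ atomOf E ν (lookup x j) → e x ≈ []
  e-repeated {suc zero} {x} nl {zero} {zero} i≢j eq = ⊥-elim (i≢j refl)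
  e-repeated {suc (suc n)} {x} nl {i} {j} i≢j eq = ∼-tran (e-alt nl p) (∼-tran (act-cong s square) (act-ε s))
    where
    k = punchOut i≢j
    F = removeAt x i
    s = parity (toℕ i) *ₛ parity (toℕ k)
    p = transᵖ (bring x i) (prepᵖ (lookup x i) (bring F k))
    G = removeAt F k
    square : e (lookup x i ∷ lookup F k ∷ G) ≈ []
    square = ∼-tran (∼-reflexive (cong (λ a → mono (a ∷ atomOf E ν (lookup F k) ∷ wd G))
        (trans eq (cong (atomOf E ν) (sym (VecP.removeAt-punchOut x i≢j))))))
      (square-words E ν (isAtom (subst (NonLoop ν) (sym (VecP.removeAt-punchOut x i≢j)) (nl j))) (e G))

  wd-length : (x : Vec (Fin N) n) → length (wd x) ≡ n
  wd-length [] = refl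
  wd-length (a ∷ x) = cong suc (wd-length x)

  wd-atoms : (x : Vec (Fin N) n) → NonLoops x → All (IsAtom E ν) (wd x)
  wd-atoms [] nl = []
  wd-atoms (a ∷ x) nl = isAtom (nl zero) ∷ wd-atoms x (nl ∘ suc)

  wd-unique : (x : Vec (Fin N) n) → (∀ i j → i ≢ j → atomOf E ν (lookup x i) ≢ atomOf E ν (lookup x j)) → Unique (wd x)
  wd-unique [] h = []
  wd-unique (a ∷ x) h = fresh x (λ k → h zero (suc k) λ ()) ∷ wd-unique x (λ i j i≢j → h (suc i) (suc j) (i≢j ∘ FinP.suc-injective))
    where
    fresh : ∀ {n} (x : Vec (Fin N) n) → (∀ k → atomOf E ν a ≢ atomOf E ν (lookup x k)) → All (atomOf E ν a ≢_) (wd x)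
    fresh [] h = []
    fresh (b ∷ x) h = h zero ∷ fresh x (h ∘ suc)

  term-sign : ∀ s w (f : FS R N) → ((signR R s , w) ∷ f) ≈ act s (mono w) ++ f
  term-sign s w f = ∙-congʳ {f} (term-act E ν s w)

  -- ∂ (e_a e_x) = ± e_x + e_a ∂ e_x, with e_a ∂ e_x written as a signed sum of replacements.
  replace-sum : ∀ {a} → NonLoop ν a → (x : Vec (Fin N) n) → NonLoops x →
    sumL (λ j → e (x [ j ]≔ a)) (allFin n) ≈ act (negₛ (parity n)) (consF (atomOf E ν a) (∂ R (wd x)))
  replace-sum nla [] nl = ∼-refl
  replace-sum {suc n} {a} nla (s ∷ x) nl = begin
    e (a ∷ x) ++ sumL (λ j → e ((s ∷ x) [ j ]≔ a)) (List.tabulate suc)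
      ≈⟨ ∙-congˡ {e (a ∷ x)} (∼-reflexive (cong (sumL (λ j → e ((s ∷ x) [ j ]≔ a))) (sym (ListP.map-tabulate id suc)))) ⟩
    e (a ∷ x) ++ sumL (λ j → e ((s ∷ x) [ j ]≔ a)) (List.map suc (allFin n))
      ≈⟨ ∙-congˡ {e (a ∷ x)} (sum-map (λ j → e ((s ∷ x) [ j ]≔ a)) suc (allFin n)) ⟩
    e (a ∷ x) ++ sumL (λ j → consF S (e (x [ j ]≔ a))) (allFin n)
      ≈⟨ ∙-congˡ {e (a ∷ x)} (∼-reflexive (sym (cons-sum E ν S (λ j → e (x [ j ]≔ a)) (allFin n)))) ⟩
    e (a ∷ x) ++ consF S (sumL (λ j → e (x [ j ]≔ a)) (allFin n))
      ≈⟨ ∙-congˡ {e (a ∷ x)} (cons-cong S (replace-sum nla x (nl ∘ suc))) ⟩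
    e (a ∷ x) ++ consF S (act (negₛ p) (consF A D))
      ≈⟨ ∙-congˡ {e (a ∷ x)} (∼-reflexive (cons-act E ν S (negₛ p) (consF A D))) ⟩
    e (a ∷ x) ++ act (negₛ p) (consF S (consF A D))
      ≈⟨ ∙-congˡ {e (a ∷ x)} (act-cong (negₛ p) (swap-words E ν (isAtom (nl zero)) (isAtom nla) D)) ⟩
    e (a ∷ x) ++ act (negₛ p) (act neg (consF A (consF S D)))
      ≈⟨ ∙-congˡ {e (a ∷ x)} (∼-tran (act-* (negₛ p) neg (consF A (consF S D))) (∼-reflexive (cong (λ t → act t (consF A (consF S D)))
           (trans (*ₛ-negʳ (negₛ p)) (negₛ-invol p))))) ⟩
    e (a ∷ x) ++ act p (consF A (consF S D))
      ≈⟨ ∙-congʳ {act p (consF A (consF S D))} (∼-tran (∼-reflexive (cong (λ t → act t (e (a ∷ x))) (sym (*ₛ-square p (parity≢zer n))))) (∼-symm (act-* p p (e (a ∷ x))))) ⟩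
    act p (act p (e (a ∷ x))) ++ act p (consF A (consF S D)) ≈⟨ act-∙ p (act p (e (a ∷ x))) (consF A (consF S D)) ⟨
    act p (act p (e (a ∷ x)) ++ consF A (consF S D))
      ≈⟨ act-cong p (∼-symm (∼-tran (∼-reflexive (cong (λ m → (signR R (parity m) , A ∷ wd x) ∷ consF A (consF S D)) (wd-length x)))
           (term-sign p (A ∷ wd x) (consF A (consF S D))))) ⟩
    act p (consF A (∂ R (S ∷ wd x)))
      ≈⟨ ∼-reflexive (cong (λ t → act t (consF A (∂ R (S ∷ wd x)))) (sym (negₛ-invol p))) ⟩
    act (negₛ (negₛ p)) (consF A (∂ R (S ∷ wd x))) ∎
    where
    A = atomOf E ν a
    S = atomOf E ν s
    D = ∂ R (wd x)
    p = parity n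

  act-swap : ∀ s → s ≢ zer → ∀ {f g} → act s f ++ g ≈ [] → f ≈ act (negₛ s) g
  act-swap s s≢ {f} {g} h = begin
    f ≈⟨ ∼-reflexive (cong (λ t → act t f) (*ₛ-square s s≢)) ⟨
    act (s *ₛ s) f ≈⟨ act-* s s f ⟨
    act s (act s f) ≈⟨ act-cong s first ⟩
    act s (act neg g) ≈⟨ act-* s neg g ⟩
    act (s *ₛ neg) g ≈⟨ ∼-reflexive (cong (λ t → act t g) (*ₛ-negʳ s)) ⟩
    act (negₛ s) g ∎
    where
    first : act s f ≈ act neg g
    first = begin
      act s f ≈⟨ identityʳ (act s f) ⟨
      act s f ++ [] ≈⟨ ∙-congˡ {act s f} (inverseʳ g) ⟨
      act s f ++ (g ++ (⊖ g)) ≈⟨ assoc (act s f) g (⊖ g) ⟨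
      (act s f ++ g) ++ (⊖ g) ≈⟨ ∙-congʳ {⊖ g} h ⟩
      ⊖ g ∎

  -- For distinct atoms the boundary relation of the dependent set is multiplied by the first atom:
  -- one term is the monomial up to sign, and the others contain that atom twice. Coinciding atoms
  -- are killed by anticommutation and squares.
  e-nonbasis : ∀ {x} → NonLoops x → ν x ≡ zer → e x ≈ []
  e-nonbasis {x@(s ∷ x′)} nl z with any? (λ i → any? λ j → ¬? (i ≟ j) ×-dec (atomOf E ν (lookup x i) ≟S atomOf E ν (lookup x j)))
  ... | yes (i , j , i≢j , eq) = e-repeated {x = x} nl i≢j eq
  ... | no none = begin
      e x ≈⟨ act-swap p (parity≢zer r) {g = []} (∼-tran (∼-reflexive (ListP.++-identityʳ _)) (∼-symm chain)) ⟩
      act (negₛ p) [] ≈⟨ act-ε (negₛ p) ⟩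
      [] ∎
    where
    S = atomOf E ν s
    p = parity r
    D = ∂ R (wd x′)
    dependent : ¬ RankGe ν (⋃ (wd x)) (length (wd x))
    dependent rk = span-basis om ground x nl (subst (RankGe ν (⋃ (wd x))) (wd-length x) rk) z
    relation : ∂ R (wd x) ≈ []
    relation = ideal⇒∼ E ν (gen-ideal (dep (wd x) (wd-atoms x nl)
      (wd-unique x λ i j i≢j eq → none (i , j , i≢j , eq)) dependent))
    chain : [] ≈ act p (e x)
    chain = begin
      [] ≈⟨ cons-cong S relation ⟨
      consF S (∂ R (wd x)) ≈⟨ ∼-reflexive (cong (λ m → (signR R (parity m) , wd x) ∷ consF S (consF S D)) (wd-length x′)) ⟩
      (signR R p , wd x) ∷ consF S (consF S D) ≈⟨ term-sign p (wd x) (consF S (consF S D)) ⟩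
      act p (e x) ++ consF S (consF S D) ≈⟨ ∙-congˡ {act p (e x)} (square-words E ν (isAtom (nl zero)) D) ⟩
      act p (e x) ++ [] ≈⟨ identityʳ (act p (e x)) ⟩
      act p (e x) ∎

  -- Adding `a` to a basis exceeds the rank, so if the atoms are distinct the boundary relation of
  -- `a ∷ B` holds and expands to the sum. If `a` is parallel to an entry, the term replacing that
  -- entry is `e B` itself and every other term contains two parallel entries.
  e-cone : ∀ {a} → NonLoop ν a → ∀ B → ν B ≢ zer → e B ≈ sumL (λ j → e (B [ j ]≔ a)) (allFin (suc r))
  e-cone {a} nla B nz with any? (λ j → Par? ν (lookup B j) a)
  ... | yes (j₀ , par) = ∼-symm (∼-tran
      (sum-single _ (allFin (suc r)) j₀ (UniqueP.allFin⁺ (suc r)) (MemP.∈-allFin j₀) others) same)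
    where
    nl : NonLoops B
    nl k = Mem⇒NonLoop ν nz (k , refl)
    others : ∀ j → j ∈ₗ allFin (suc r) → j ≢ j₀ → e (B [ j ]≔ a) ≈ []
    others j _ j≢j₀ = e-nonbasis nl′ (Par⇒zer om par (B [ j ]≔ a) j≢j₀ (VecP.lookup∘update j B a) (VecP.lookup∘update′ (j≢j₀ ∘ sym) B a))
      where
      nl′ : NonLoops (B [ j ]≔ a)
      nl′ k with Mem-update⁻ B j {a} (k , refl)
      ... | inj₁ eq = subst (NonLoop ν) (sym eq) nla
      ... | inj₂ (m , _ , eq) = subst (NonLoop ν) eq (nl m)
    same : e (B [ j₀ ]≔ a) ≈ e B
    same = ∼-reflexive (cong mono (wd-update B j₀ (sym (atomOf-cong om ground (nl j₀) nla par))))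
      where
      wd-update : ∀ {n} (x : Vec (Fin N) n) j → atomOf E ν a ≡ atomOf E ν (lookup x j) → wd (x [ j ]≔ a) ≡ wd x
      wd-update (b ∷ x) zero eq = cong (_∷ wd x) eq
      wd-update (b ∷ x) (suc j) eq = cong (atomOf E ν b ∷_) (wd-update x j eq)
  ... | no none = ∼-tran (act-swap p (parity≢zer (suc r)) relation) (∼-symm (replace-sum nla B nl))
    where
    nl : NonLoops B
    nl k = Mem⇒NonLoop ν nz (k , refl)
    A = atomOf E ν a
    p = parity (suc r)
    nl′ : NonLoops (a ∷ B)
    nl′ zero = nla
    nl′ (suc k) = nl k
    distinct-atoms : ∀ i j → i ≢ j → atomOf E ν (lookup (a ∷ B) i) ≢ atomOf E ν (lookup (a ∷ B) j)
    distinct-atoms zero zero i≢j _ = i≢j refl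
    distinct-atoms zero (suc j) _ eq = none (j , Par-sym om (atomOf-≡⇒Par om ground (proj₂ (ground (lookup B j)) (nl j)) eq))
    distinct-atoms (suc i) zero _ eq = none (i , atomOf-≡⇒Par om ground (proj₂ (ground a) nla) eq)
    distinct-atoms (suc i) (suc j) i≢j eq = nz (Par⇒zer om (atomOf-≡⇒Par om ground (proj₂ (ground (lookup B j)) (nl j)) eq) B
      (λ j≡i → i≢j (cong suc (sym j≡i))) refl refl)
    dependent : ¬ RankGe ν (⋃ (wd (a ∷ B))) (length (wd (a ∷ B)))
    dependent (I , (y , _ , I⊆) , _ , card) = NatP.<⇒≱ (NatP.n<1+n (suc r))
      (NatP.≤-trans (NatP.≤-reflexive (trans (sym (wd-length (a ∷ B))) (sym card)))
        (NatP.≤-trans (SubP.p⊆q⇒∣p∣≤∣q∣ I⊆) (img-card≤ y)))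
    relation : act p (e B) ++ consF A (∂ R (wd B)) ≈ []
    relation = ∼-tran (∼-symm (∼-tran (∼-reflexive (cong (λ m → (signR R (parity m) , wd B) ∷ consF A (∂ R (wd B))) (wd-length B)))
        (term-sign p (wd B) (consF A (∂ R (wd B))))))
      (ideal⇒∼ E ν (gen-ideal (dep (wd (a ∷ B)) (wd-atoms (a ∷ B) nl′) (wd-unique (a ∷ B) distinct-atoms) dependent)))

  Om : List (Vec (Fin N) (suc r)) → FS R N
  Om Δ = List.map (λ B → (signR R (ν B) , wd B)) Δ

  Om-sum : ∀ Δ → Om Δ ≈ sumL (λ B → act (ν B) (e B)) Δ
  Om-sum Δ = sum-terms E ν ν wd Δ

  boundary-Om : ∀ {Δ} → Triang ν Δ → ∀ {a} → NonLoop ν a →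
    Om Δ ≈ sumL (λ (B , j) → act (ν B) (e (B [ j ]≔ a))) (filter (Bd? ν) (items Δ))
  boundary-Om {Δ} T {a} nla = ∼-tran (Om-sum Δ) (Boundary.boundary-formula om T (OSGroup E ν) e a nla
    (λ nl p → e-alt nl p) (λ B B∈ → e-cone nla B (bases T B B∈)))

-- Independence of the triangulation, by induction on the rank

module KeySums {c ℓ} (A : AbelianGroup c ℓ) {I K : Set} (_≟K_ : (k l : K) → Dec (k ≡ l)) (key : I → K) where
  open AbelianGroup A renaming (refl to ≈-refl; sym to ≈-sym; trans to ≈-trans)
  open GroupSums A
  open import Relation.Binary.Reasoning.Setoid setoid
  open import Data.List.Relation.Unary.Unique.DecPropositional.Properties _≟K_ using (deduplicate-!)

  fibre : K → List I → List I
  fibre k = filter (λ p → key p ≟K k)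

  sum-∙ : ∀ {J : Set} (f g : J → Carrier) L → sumL (λ k → f k ∙ g k) L ≈ sumL f L ∙ sumL g L
  sum-∙ f g [] = ≈-sym (identityˡ ε)
  sum-∙ f g (k ∷ L) = begin
    (f k ∙ g k) ∙ sumL (λ k → f k ∙ g k) L ≈⟨ ∙-congˡ (sum-∙ f g L) ⟩
    (f k ∙ g k) ∙ (sumL f L ∙ sumL g L) ≈⟨ assoc _ _ _ ⟩
    f k ∙ (g k ∙ (sumL f L ∙ sumL g L)) ≈⟨ ∙-congˡ (≈-trans (≈-sym (assoc _ _ _)) (≈-trans (∙-congʳ (comm _ _)) (assoc _ _ _))) ⟩
    f k ∙ (sumL f L ∙ (g k ∙ sumL g L)) ≈⟨ assoc _ _ _ ⟨
    (f k ∙ sumL f L) ∙ (g k ∙ sumL g L) ∎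

  sum-fibres : (f : I → Carrier) (Ks : List K) → Unique Ks → ∀ L → (∀ p → p ∈ₗ L → key p ∈ₗ Ks) →
    sumL f L ≈ sumL (λ k → sumL f (fibre k L)) Ks
  sum-fibres f Ks uniq [] _ = ≈-sym (sum-ε Ks λ _ _ → ≈-refl)
  sum-fibres f Ks uniq (p ∷ L) h = begin
    f p ∙ sumL f L ≈⟨ ∙-cong (≈-sym (≈-trans (sum-single mark Ks (key p) uniq (h p (here refl)) other) own))
                             (sum-fibres f Ks uniq L λ q q∈ → h q (there q∈)) ⟩
    sumL mark Ks ∙ sumL (λ k → sumL f (fibre k L)) Ks ≈⟨ sum-∙ mark _ Ks ⟨
    sumL (λ k → mark k ∙ sumL f (fibre k L)) Ks ≈⟨ sum-cong Ks (λ k _ → split k) ⟩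
    sumL (λ k → sumL f (fibre k (p ∷ L))) Ks ∎
    where
    mark : K → Carrier
    mark k = if ⌊ key p ≟K k ⌋ then f p else ε
    other : ∀ k → k ∈ₗ Ks → k ≢ key p → mark k ≈ ε
    other k _ k≢ with key p ≟K k
    ... | yes eq = ⊥-elim (k≢ (sym eq))
    ... | no _ = ≈-refl
    own : mark (key p) ≈ f p
    own with key p ≟K key p
    ... | yes _ = ≈-refl
    ... | no ne = ⊥-elim (ne refl)
    split : ∀ k → mark k ∙ sumL f (fibre k L) ≈ sumL f (fibre k (p ∷ L))
    split k with key p ≟K k
    ... | yes _ = ≈-refl
    ... | no _ = identityˡ _

  -- Both lists are split along the keys of their concatenation, so that a key missing on one side
  -- contributes an empty fibre there.
  sums-agree : (f : I → Carrier) → ∀ L M → (∀ k → sumL f (fibre k L) ≈ sumL f (fibre k M)) → sumL f L ≈ sumL f M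
  sums-agree f L M h = begin
    sumL f L ≈⟨ sum-fibres f Ks (deduplicate-! _) L (λ p p∈ → MemP.∈-deduplicate⁺ _≟K_ (MemP.∈-map⁺ key (MemP.∈-++⁺ˡ p∈))) ⟩
    sumL (λ k → sumL f (fibre k L)) Ks ≈⟨ sum-cong Ks (λ k _ → h k) ⟩
    sumL (λ k → sumL f (fibre k M)) Ks
      ≈⟨ sum-fibres f Ks (deduplicate-! _) M (λ p p∈ → MemP.∈-deduplicate⁺ _≟K_ (MemP.∈-map⁺ key (MemP.∈-++⁺ʳ L p∈))) ⟨
    sumL f M ∎
    where
    Ks : List K
    Ks = List.deduplicate _≟K_ (List.map key (L ++ M))

-- The matroid of a facet hyperplane inside the ambient matroid

groundOf : Chi N r → Subset N
groundOf ν = tabulate λ e → ⌊ NonLoop? ν e ⌋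

groundOf-Ground : (ν : Chi N r) → Ground (groundOf ν) ν
groundOf-Ground ν e = from , to
  where
  from : e ∈ groundOf ν → NonLoop ν e
  from e∈ with NonLoop? ν e | trans (sym (VecP.lookup∘tabulate (λ e → ⌊ NonLoop? ν e ⌋) e)) (VecP.[]=⇒lookup e∈)
  ... | yes nl | _ = nl
  ... | no _ | ()
  to : NonLoop ν e → e ∈ groundOf ν
  to nl = VecP.lookup⇒[]= e _ (trans (VecP.lookup∘tabulate (λ e → ⌊ NonLoop? ν e ⌋) e) holds)
    where
    holds : ⌊ NonLoop? ν e ⌋ ≡ true
    holds with NonLoop? ν e
    ... | yes _ = refl
    ... | no loop = ⊥-elim (loop nl)

module HyperplaneMatroid {N r} {ν : Chi N (suc r)} (om : OM ν) (Y : FacetCocircuit ν) where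
  open Restriction om Y
  open FacetCocircuit Y using (tuple; place)

  private
    a : Fin N
    a = apex Y
    D : Vec (Fin N) (suc r)
    D = tuple [ place ]≔ a
    D-basis : ν D ≢ zer
    D-basis = value-basis om Y (≡pos⇒≢zer (value-apex Y))

    D-value : ∀ {e} → Mem e D → e ≡ a ⊎ value Y e ≡ zer
    D-value (k , refl) with Mem-update⁻ tuple place {a} (k , refl)
    ... | inj₁ eq = inj₁ eq
    ... | inj₂ (m , m≢ , eq) = inj₂ (trans (cong (value Y) (sym eq)) (hyperplane-value om Y m m≢))

    -- Exchange the elements outside I one at a time for elements of D.
    exchange-all : ∀ (I : Subset N) ks x → ν x ≢ zer → I ⊆ img x →
      (∀ k → k ∈ₗ ks ⊎ (lookup x k ∈ I ⊎ Mem (lookup x k) D)) →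
      ∃ λ x → ν x ≢ zer × I ⊆ img x × (∀ k → lookup x k ∈ I ⊎ Mem (lookup x k) D)
    exchange-all I [] x nz I⊆ h = x , nz , I⊆ , λ k → settled (h k)
      where
      settled : ∀ {k : Fin (suc r)} {B : Set} → k ∈ₗ [] ⊎ B → B
      settled (inj₂ b) = b
    exchange-all I (k ∷ ks) x nz I⊆ h with lookup x k ∈? I
    ... | yes k∈ = exchange-all I ks x nz I⊆ h'
      where
      h' : ∀ l → l ∈ₗ ks ⊎ (lookup x l ∈ I ⊎ Mem (lookup x l) D)
      h' l with h l
      ... | inj₁ (here refl) = inj₂ (inj₁ k∈)
      ... | inj₁ (there l∈) = inj₁ l∈
      ... | inj₂ s = inj₂ s
    ... | no k∉ with ex om x D k (*ₛ-nonzero _ _ nz D-basis)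
    ...   | i , eq = exchange-all I ks x' nz' I⊆' h'
      where
      x' : Vec (Fin N) (suc r)
      x' = x [ k ]≔ lookup D i
      nz' : ν x' ≢ zer
      nz' z = *ₛ-nonzero _ _ nz D-basis (trans (sym eq) (*ₛ-zeroˡ′ _ z))
      I⊆' : I ⊆ img x'
      I⊆' {e} e∈ with ∈img⇒Mem x (I⊆ e∈)
      ... | l , refl = Mem⇒∈img x' (Mem-update′ x λ { refl → k∉ e∈ })
      h' : ∀ l → l ∈ₗ ks ⊎ (lookup x' l ∈ I ⊎ Mem (lookup x' l) D)
      h' l with l ≟ k
      ... | yes refl = inj₂ (inj₂ (i , sym (VecP.lookup∘update l x _)))
      ... | no l≢k with h l
      ...   | inj₁ (here l≡k) = ⊥-elim (l≢k l≡k)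
      ...   | inj₁ (there l∈) = inj₁ l∈
      ...   | inj₂ s = inj₂ (subst (λ e → e ∈ I ⊎ Mem e D) (sym (VecP.lookup∘update′ l≢k x _)) s)

  -- The extended basis consists of elements of `I` and of `D`, and the only element of `D` off the
  -- hyperplane is the apex. As no basis fits into the hyperplane, the apex occurs; removing it
  -- leaves a basis of the restriction that contains `I`.
  res-Indep : ∀ {I} → (∀ {e} → e ∈ I → value Y e ≡ zer) → Indep ν I → Indep res I
  res-Indep {I} I⊆H (x₀ , nz₀ , I⊆₀) with exchange-all I (allFin (suc r)) x₀ nz₀ I⊆₀ (λ k → inj₁ (MemP.∈-allFin k))
  ... | x , nz , I⊆ , settled = conclude (any? λ k → ¬? (value Y (lookup x k) ≟ₛ zer))
    where
    conclude : Dec (∃ λ k → value Y (lookup x k) ≢ zer) → Indep res I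
    conclude (no none) = ⊥-elim (nz (hyperplane⇒zer om Y x λ k → ¬≢zer⇒≡ λ h → none (k , h)))
    conclude (yes (k , vk)) = y , (λ z → nz′ (trans (sym (res-on on)) z)) , I⊆y
      where
      y : Vec (Fin N) r
      y = removeAt x k
      is-apex : ∀ l → value Y (lookup x l) ≢ zer → lookup x l ≡ a
      is-apex l v with settled l
      ... | inj₁ l∈ = ⊥-elim (v (I⊆H l∈))
      ... | inj₂ m with D-value m
      ...   | inj₁ eq = eq
      ...   | inj₂ z = ⊥-elim (v z)
      on : OnH y
      on l with value Y (lookup y l) ≟ₛ zer
      ... | yes z = z
      ... | no v = ⊥-elim (FinP.punchInᵢ≢i k l (nonzero⇒Inj om nz _ k (trans
            (is-apex (punchIn k l) (subst (λ e → value Y e ≢ zer) (lookup-removeAt x k l) v)) (sym (is-apex k vk)))))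
      nz′ : ν (a ∷ y) ≢ zer
      nz′ = Perm-basis om (subst (λ e → Perm (parity (toℕ k)) x (e ∷ y)) (is-apex k vk) (bring x k)) nz
      I⊆y : I ⊆ img y
      I⊆y e∈ with ∈img⇒Mem x (I⊆ e∈)
      ... | l , refl = Mem⇒∈img y (Mem-removeAt x λ { refl → vk (I⊆H e∈) })

  Indep-res : ∀ {I} → Indep res I → Indep ν I
  Indep-res (y , nz , I⊆) = a ∷ y , res-basis nz , λ e∈ → SubP.x∈p∪q⁺ (inj₂ (I⊆ e∈))

  RankGe-res : ∀ {X k} → (∀ {e} → e ∈ X → value Y e ≡ zer) → RankGe ν X k → RankGe res X k
  RankGe-res X⊆H (I , ind , I⊆ , card) = I , res-Indep (λ e∈ → X⊆H (I⊆ e∈)) ind , I⊆ , card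

  res-RankGe : ∀ {X k} → RankGe res X k → RankGe ν X k
  res-RankGe (I , ind , I⊆ , card) = I , Indep-res ind , I⊆ , card

  NonLoop-res : ∀ {e} → NonLoop ν e → value Y e ≡ zer → NonLoop res e
  NonLoop-res {e} (z , j , nz) v with res-Indep {⁅ e ⁆} (λ f∈ → trans (cong (value Y) (SubP.x∈⁅y⁆⇒x≡y e f∈)) v)
    (z [ j ]≔ e , nz , λ f∈ → subst (_∈ img (z [ j ]≔ e)) (sym (SubP.x∈⁅y⁆⇒x≡y e f∈)) (Mem⇒∈img (z [ j ]≔ e) (Mem-update z j)))
  ... | y , nzy , e⊆ = Mem⇒NonLoop res nzy (∈img⇒Mem y (e⊆ (SubP.x∈⁅x⁆ e)))

  res-NonLoop : ∀ {e} → NonLoop res e → NonLoop ν e × value Y e ≡ zer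
  res-NonLoop {e} (z , j , nz) = (a ∷ z , suc j , res-basis nz) ,
    trans (cong (value Y) (sym (VecP.lookup∘update j z e))) (res-OnH nz j)

  -- With the apex added to its basis, a nonnegative circuit of the restriction is a circuit of `ν`
  -- with entry zero at the apex, contrary to acyclicity.
  res-acyclic : Acyclic ν → Acyclic res
  res-acyclic acyclic w nl with farkas res res-OM (let z , j , nz = nl in z [ j ]≔ w , nz) w (allFin N)
  ... | inj₁ P = P
  ... | inj₂ (y , x , σ , nz , (k₀ , el≡ , sg≡) , h) = ⊥-elim
      (nonneg-orthogonal om (a ∷ y) x σ z j θ signs (proj₁ entry) (proj₂ (proj₂ entry))
        (trans (cong (λ e → θ *ₛ ν (z [ j ]≔ e)) (proj₁ (proj₂ entry))) p))
    where
    P = acyclic w (proj₁ (res-NonLoop nl))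
    z = proj₁ P
    j = proj₁ (proj₂ P)
    θ = proj₁ (proj₂ (proj₂ P))
    p = proj₁ (proj₂ (proj₂ (proj₂ P)))
    q = proj₂ (proj₂ (proj₂ (proj₂ P)))
    value-x : ∀ k → el y x k ≡ w → σ *ₛ sg res y x k ≡ pos → value Y x ≡ zer
    value-x zero refl _ = proj₂ (res-NonLoop nl)
    value-x (suc i) _ eq = trans (cong (value Y) (sym (VecP.lookup∘update i y x))) (res-OnH {y [ i ]≔ x}
      (λ z → ≡pos⇒≢zer eq (*ₛ-zeroʳ′ σ (cong negₛ z))) i)
    vx : value Y x ≡ zer
    vx = value-x k₀ el≡ sg≡
    on : OnH y
    on = res-OnH nz
    sg-shift : ∀ i → sg ν (a ∷ y) x (suc (suc i)) ≡ sg res y x (suc i)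
    sg-shift i = cong negₛ (sym (res-on (OnH-update {x = y} i on vx)))
    entry : ∃ λ k → el (a ∷ y) x k ≡ w × σ *ₛ sg ν (a ∷ y) x k ≡ pos
    entry = find-entry k₀ el≡ sg≡
      where
      find-entry : ∀ k → el y x k ≡ w → σ *ₛ sg res y x k ≡ pos → ∃ λ k → el (a ∷ y) x k ≡ w × σ *ₛ sg ν (a ∷ y) x k ≡ pos
      find-entry zero e s = zero , e , trans (cong (σ *ₛ_) (sym (res-on on))) s
      find-entry (suc i) e s = suc (suc i) , e , trans (cong (σ *ₛ_) (sg-shift i)) (trans refl s)
    keep : ∀ {s t e} → s ≡ t → s ≡ zer ⊎ (s ≡ pos × (e ≡ w ⊎ e ∈ₗ allFin N)) →
      t ≡ zer ⊎ (t ≡ pos × θ *ₛ ν (z [ j ]≔ e) ≢ neg)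
    keep refl (inj₁ s) = inj₁ s
    keep refl (inj₂ (s , _)) = inj₂ (s , q _ (MemP.∈-allFin _))
    signs : ∀ k → σ *ₛ sg ν (a ∷ y) x k ≡ zer ⊎ (σ *ₛ sg ν (a ∷ y) x k ≡ pos × θ *ₛ ν (z [ j ]≔ el (a ∷ y) x k) ≢ neg)
    signs zero = keep {e = x} (cong (σ *ₛ_) (res-on on)) (h zero)
    signs (suc zero) = inj₁ (*ₛ-zeroʳ′ σ (cong negₛ (hyperplane⇒zer om Y (x ∷ y) (OnH-∷ {x = y} vx on))))
    signs (suc (suc i)) = keep {e = lookup y i} (cong (σ *ₛ_) (sym (sg-shift i))) (h (suc i))

  module _ {E : Subset N} (ground : Ground E ν) where

    private
      EH : Subset N
      EH = groundOf res

      ∈EH⁻ : ∀ {e} → e ∈ EH → NonLoop ν e × value Y e ≡ zer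
      ∈EH⁻ {e} e∈ = res-NonLoop (proj₁ (groundOf-Ground res e) e∈)

      pair-value : ∀ {i j e} → value Y i ≡ zer → value Y j ≡ zer → e ∈ ⁅ i ⁆ ∪ ⁅ j ⁆ → value Y e ≡ zer
      pair-value {i} {j} vi vj e∈ with SubP.x∈p∪q⁻ ⁅ i ⁆ ⁅ j ⁆ e∈
      ... | inj₁ p = trans (cong (value Y) (SubP.x∈⁅y⁆⇒x≡y i p)) vi
      ... | inj₂ p = trans (cong (value Y) (SubP.x∈⁅y⁆⇒x≡y j p)) vj

    atomOf-res : ∀ {i} → NonLoop res i → atomOf EH res i ≡ atomOf E ν i
    atomOf-res {i} nl = SubP.⊆-antisym
      (λ {j} j∈ → let j∈H , ¬rk = ∈-atomSpan⁻ EH res ⁅ i ⁆ j∈ in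
        ∈-atomSpan E ν ⁅ i ⁆ (proj₂ (ground j) (proj₁ (∈EH⁻ j∈H)))
          (¬rk ∘ RankGe-res (pair-value (proj₂ (res-NonLoop nl)) (proj₂ (∈EH⁻ j∈H)))))
      (λ {j} j∈ → let j∈E , par = ∈-atomOf⁻ om ground j∈ in
        ∈-atomSpan EH res ⁅ i ⁆ (proj₂ (groundOf-Ground res j) (NonLoop-res (proj₁ (ground j) j∈E) (value-par j∈E par)))
          (proj₂ (∈-atomSpan⁻ E ν ⁅ i ⁆ j∈) ∘ res-RankGe))
      where
      value-par : ∀ {j} → j ∈ E → Par ν i j → value Y j ≡ zer
      value-par {j} j∈ par with Par-sign om (proj₁ (res-NonLoop nl)) (proj₁ (ground j) j∈) par
      ... | σ , _ , law = trans (cong (FacetCocircuit.sign Y *ₛ_) (law tuple place)) (trans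
              (trans (sym (*ₛ-assoc s σ _)) (trans (cong (_*ₛ ν (tuple [ place ]≔ i)) (*ₛ-comm s σ)) (*ₛ-assoc σ s _)))
              (*ₛ-zeroʳ′ σ (proj₂ (res-NonLoop nl))))
        where s = FacetCocircuit.sign Y

    IsAtom-res : ∀ {b} → IsAtom EH res b → IsAtom E ν b
    IsAtom-res {b} (b⊆ , rk1 , ¬rk2 , maximal) =
      (λ {e} e∈ → proj₂ (ground e) (proj₁ (∈EH⁻ (b⊆ e∈)))) , res-RankGe rk1 ,
      (¬rk2 ∘ RankGe-res (λ e∈ → proj₂ (∈EH⁻ (b⊆ e∈)))) , extend
      where
      extend : ∀ e → e ∈ E → e ∉ b → RankGe ν (b ∪ ⁅ e ⁆) 2
      extend e e∈ e∉ with value Y e ≟ₛ zer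
      ... | yes v = res-RankGe (maximal e (proj₂ (groundOf-Ground res e) (NonLoop-res (proj₁ (ground e) e∈) v)) e∉)
      ... | no v = transversal rk1
        where
        transversal : RankGe res b 1 → RankGe ν (b ∪ ⁅ e ⁆) 2
        transversal (I , (y , nz , I⊆) , I⊆b , card) with any? (λ i → i ∈? I)
        ... | no empty = ⊥-elim (NatP.<⇒≱ (Nat.s≤s Nat.z≤n) (NatP.≤-trans (NatP.≤-reflexive (sym card))
              (NatP.≤-trans (SubP.p⊆q⇒∣p∣≤∣q∣ {q = Data.Fin.Subset.⊥} (λ {p} p∈ → ⊥-elim (empty (p , p∈)))) (NatP.≤-reflexive (SubP.∣⊥∣≡0 N)))))
        ... | yes (i , i∈) = NonPar⇒RankGe om (SubP.x∈p∪q⁺ (inj₂ (SubP.x∈⁅x⁆ e))) (SubP.x∈p∪q⁺ (inj₁ (I⊆b i∈)))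
              (basis⇒NonPar om (λ z → res-basis nz (trans (same-side (res-OnH nz) (value-apex Y) (value-pos om Y v)) z)) {e} {i}
                (λ { refl → e∉ (I⊆b i∈) }) (zero , refl) (let k , eq = ∈img⇒Mem y (I⊆ i∈) in suc k , eq))

    module _ {c ℓ} (R : CommutativeRing c ℓ) where
      -- Atoms of the restriction are ambient atoms and ranks inside the hyperplane agree, so each
      -- defining relation of the restriction is one of the whole; this transports the induction
      -- hypothesis.
      InIdeal-res : ∀ {f} → InIdeal R EH res f → InIdeal R E ν f
      InIdeal-res nil = nil
      InIdeal-res (step k u g v f gen p) = step k u g v f (generator gen) (InIdeal-res p)
        where
        generator : ∀ {g} → OSGen R EH res g → OSGen R E ν g
        generator (sq b h) = sq b (IsAtom-res h)
        generator (anti b b' h h') = anti b b' (IsAtom-res h) (IsAtom-res h')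
        generator (dep S h u ¬rk) = dep S (All.map IsAtom-res h) u (¬rk ∘ RankGe-res (⋃-value S h))
          where
          ⋃-value : ∀ S → All (IsAtom EH res) S → ∀ {e} → e ∈ ⋃ S → value Y e ≡ zer
          ⋃-value [] [] e∈ = ⊥-elim (SubP.∉⊥ e∈)
          ⋃-value (b ∷ S) (hb ∷ h) e∈ with SubP.x∈p∪q⁻ b (⋃ S) e∈
          ... | inj₁ q = proj₂ (∈EH⁻ (proj₁ hb q))
          ... | inj₂ q = ⋃-value S h q
      InIdeal-res (resp f g eq p) = resp f g eq (InIdeal-res p)

-- Expansion of the form over facet hyperplanes

filter³ : {A : Set} {P Q S T : A → Set} (P? : ∀ p → Dec (P p)) (Q? : ∀ p → Dec (Q p)) (S? : ∀ p → Dec (S p)) (T? : ∀ p → Dec (T p))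
  (L : List A) → (∀ p → p ∈ₗ L → P p → Q p → S p → T p) → (∀ p → p ∈ₗ L → T p → P p × Q p × S p) →
  filter P? (filter Q? (filter S? L)) ≡ filter T? L
filter³ P? Q? S? T? [] f g = refl
filter³ P? Q? S? T? (p ∷ L) f g with S? p
... | no ¬s = trans (filter³ P? Q? S? T? L (λ q q∈ → f q (there q∈)) (λ q q∈ → g q (there q∈)))
      (sym (ListP.filter-reject T? (¬s ∘ proj₂ ∘ proj₂ ∘ g p (here refl))))
... | yes s with Q? p
...   | no ¬q = trans (filter³ P? Q? S? T? L (λ q q∈ → f q (there q∈)) (λ q q∈ → g q (there q∈)))
        (sym (ListP.filter-reject T? (¬q ∘ proj₁ ∘ proj₂ ∘ g p (here refl))))
...   | yes q with P? p
...     | no ¬p = trans (filter³ P? Q? S? T? L (λ q q∈ → f q (there q∈)) (λ q q∈ → g q (there q∈)))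
          (sym (ListP.filter-reject T? (¬p ∘ proj₁ ∘ g p (here refl))))
...     | yes pp = trans (cong (p ∷_) (filter³ P? Q? S? T? L (λ q q∈ → f q (there q∈)) (λ q q∈ → g q (there q∈))))
          (sym (ListP.filter-accept T? (f p (here refl) pp q s)))

rank0-unique : (Δ : List (Vec (Fin N) 0)) → Unique Δ → (∃ λ B → B ∈ₗ Δ) → Δ ≡ [] ∷ []
rank0-unique [] _ (_ , ())
rank0-unique ([] ∷ []) _ _ = refl
rank0-unique ([] ∷ [] ∷ Δ) ((ne ∷ _) ∷ _) _ = ⊥-elim (ne refl)

module _ {c ℓ} (R : CommutativeRing c ℓ) where

  form : Subset N → Chi N r → List (Vec (Fin N) r) → FS R N
  form E ν Δ = List.map (λ B → (signR R (ν B) , List.map (atomOf E ν) (toList B))) Δ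

  module FacetExpansion {N r} {E : Subset N} {ν : Chi N (suc r)} (om : OM ν) (ground : Ground E ν)
    {a : Fin N} (nla : NonLoop ν a) where

    open Monomials R om ground using (e; e-alt; e-nonbasis; boundary-Om; wd; cons-cong; NonLoops)
    open OS R using (mono; consF; OSGroup; sum-terms)
    open AbelianGroup (OSGroup E ν) using (_≈_; setoid)
      renaming (refl to ∼-refl; sym to ∼-symm; trans to ∼-tran; reflexive to ∼-reflexive)
    open GroupSums (OSGroup E ν)
    open import Relation.Binary.Reasoning.Setoid setoid

    Item : Set
    Item = Vec (Fin N) (suc r) × Fin (suc r)

    T : Item → FS R N
    T (B , j) = act (ν B) (e (B [ j ]≔ a))

    Visible : Item → Set
    Visible (B , j) = ν (B [ j ]≔ a) ≢ zer

    Visible? : ∀ p → Dec (Visible p)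
    Visible? (B , j) = ¬? (ν (B [ j ]≔ a) ≟ₛ zer)

    visible : List (Vec (Fin N) (suc r)) → List Item
    visible Δ = filter Visible? (filter (Bd? ν) (items Δ))

    -- The zero set of the facet cocircuit. For a basis it depends only on the hyperplane spanned by
    -- the facet, so it can label terms coming from different triangulations.
    hyperplane : Item → Subset N
    hyperplane (B , j) = tabulate λ f → ⌊ ν (B [ j ]≔ f) ≟ₛ zer ⌋

    open KeySums (OSGroup E ν) _≟S_ hyperplane

    replaced-NonLoops : ∀ {B} → ν B ≢ zer → ∀ j → NonLoops (B [ j ]≔ a)
    replaced-NonLoops {B} nz j k with Mem-update⁻ B j {a} (k , refl)
    ... | inj₁ eq = subst (NonLoop ν) (sym eq) nla
    ... | inj₂ (m , _ , eq) = Mem⇒NonLoop ν nz (m , eq)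

    visible-sum : ∀ {Δ} → Triang ν Δ → form E ν Δ ≈ sumL T (visible Δ)
    visible-sum {Δ} tri = ∼-tran (boundary-Om tri nla) (sum-filter Visible? T (filter (Bd? ν) (items Δ)) hidden)
      where
      hidden : ∀ p → p ∈ₗ filter (Bd? ν) (items Δ) → ¬ Visible p → T p ≈ []
      hidden (B , j) p∈ ¬v = ∼-tran (act-cong (ν B) (e-nonbasis
          (replaced-NonLoops (bases tri B (∈-items⁻ Δ (proj₁ (MemP.∈-filter⁻ (Bd? ν) {xs = items Δ} p∈)))) j) (¬≢zer⇒≡ ¬v)))
        (act-ε (ν B))

    facetOf : ∀ {B j} → ν B ≢ zer → Bd ν (B , j) → Visible (B , j) → FacetCocircuit ν
    facetOf {B} {j} nz bd v = record { tuple = B ; place = j ; sign = ν B ; value≢neg = bd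
      ; apex = a ; value-apex = ≢zer∧≢neg⇒pos _ (*ₛ-nonzero _ _ nz v) (bd a) }

    module _ {B₀ j₀} (nz₀ : ν B₀ ≢ zer) (bd₀ : Bd ν (B₀ , j₀)) (v₀ : Visible (B₀ , j₀)) where

      Y : FacetCocircuit ν
      Y = facetOf nz₀ bd₀ v₀

      open Restriction om Y
      open HyperplaneMatroid om Y

      private
        A : Subset N
        A = atomOf E ν a

        ∈-hyperplane : ∀ {p f} → ν (proj₁ p [ proj₂ p ]≔ f) ≡ zer → lookup (hyperplane p) f ≡ true
        ∈-hyperplane {B , j} {f} eq = trans (VecP.lookup∘tabulate _ f) holds
          where
          holds : ⌊ ν (B [ j ]≔ f) ≟ₛ zer ⌋ ≡ true
          holds with ν (B [ j ]≔ f) ≟ₛ zer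
          ... | yes _ = refl
          ... | no ne = ⊥-elim (ne eq)

        ∈-hyperplane⁻ : ∀ {p f} → lookup (hyperplane p) f ≡ true → ν (proj₁ p [ proj₂ p ]≔ f) ≡ zer
        ∈-hyperplane⁻ {B , j} {f} h with ν (B [ j ]≔ f) ≟ₛ zer | trans (sym (VecP.lookup∘tabulate (λ f → ⌊ ν (B [ j ]≔ f) ≟ₛ zer ⌋) f)) h
        ... | yes eq | _ = eq
        ... | no _ | ()

      module _ {Δ} (tri : Triang ν Δ) where

        private
          in-facet : ∀ p → p ∈ₗ items Δ → hyperplane p ≡ hyperplane (B₀ , j₀) → Visible p → Bd ν p → InFacet p
          in-facet (B , j) p∈ same _ _ k k≢j = *ₛ-zeroʳ′ (ν B₀) (∈-hyperplane⁻ {B₀ , j₀} (trans (cong (λ H → lookup H (lookup B k)) (sym same))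
            (∈-hyperplane {B , j} (update-other om B k≢j refl))))

          facet-law : ∀ {B j} → B ∈ₗ Δ → InFacet (B , j) → ∀ f → ν (B [ j ]≔ f) ≡ value Y f *ₛ ν B
          facet-law {B} {j} B∈ h f = sym (trans (value-unique om Y (bases tri B B∈) j h f)
            (cong (_*ₛ ν (B [ j ]≔ f)) (facet-side tri B∈ h)))

          of-facet : ∀ p → p ∈ₗ items Δ → InFacet p → hyperplane p ≡ hyperplane (B₀ , j₀) × Visible p × Bd ν p
          of-facet (B , j) p∈ h = VecP.tabulate-cong same-zero ,
            (λ z → *ₛ-nonzero _ _ (≡pos⇒≢zer (value-apex Y)) nzB (trans (sym (facet-law B∈ h a)) z)) ,
            λ f eq → value≢neg Y f (trans (sym (trans (cong (ν B *ₛ_) (trans (facet-law B∈ h f) (*ₛ-comm (value Y f) _))) (*ₛ-cancel _ _ nzB))) eq)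
            where
            B∈ = ∈-items⁻ Δ p∈
            nzB = bases tri B B∈
            same-zero : ∀ f → ⌊ ν (B [ j ]≔ f) ≟ₛ zer ⌋ ≡ ⌊ ν (B₀ [ j₀ ]≔ f) ≟ₛ zer ⌋
            same-zero f with ν (B [ j ]≔ f) ≟ₛ zer | ν (B₀ [ j₀ ]≔ f) ≟ₛ zer
            ... | yes _ | yes _ = refl
            ... | no _ | no _ = refl
            ... | yes z | no nz = ⊥-elim (*ₛ-nonzero _ _ (*ₛ-nonzero _ _ nz₀ nz) nzB (trans (sym (facet-law B∈ h f)) z))
            ... | no nz | yes z = ⊥-elim (nz (trans (facet-law B∈ h f) (*ₛ-zeroˡ′ (ν B) (*ₛ-zeroʳ′ (ν B₀) z))))

        -- The terms with one label are exactly the cones from `a` over the simplices of the induced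
        -- triangulation; moving `a` to the front turns the coefficient into the value of `res`.
        facet-sum : sumL T (fibre (hyperplane (B₀ , j₀)) (visible Δ)) ≈ consF A (form (groundOf res) res (facetΔ Δ))
        facet-sum = begin
          sumL T (fibre (hyperplane (B₀ , j₀)) (visible Δ))
            ≈⟨ ∼-reflexive (cong (sumL T) (filter³ (λ p → hyperplane p ≟S hyperplane (B₀ , j₀)) Visible? (Bd? ν) InFacet? (items Δ) in-facet of-facet)) ⟩
          sumL T (filter InFacet? (items Δ)) ≈⟨ sum-cong (filter InFacet? (items Δ)) same-term ⟩
          sumL (term ∘ face) (filter InFacet? (items Δ)) ≈⟨ sum-map term face (filter InFacet? (items Δ)) ⟨
          sumL term (facetΔ Δ) ≈⟨ sum-terms E ν res (λ F → A ∷ wdH F) (facetΔ Δ) ⟨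
          List.map (λ F → (signR R (res F) , A ∷ wdH F)) (facetΔ Δ) ≈⟨ ∼-reflexive (consed (facetΔ Δ)) ⟩
          consF A (form (groundOf res) res (facetΔ Δ)) ∎
          where
          wdH : Vec (Fin N) r → Word N
          wdH F = List.map (atomOf (groundOf res) res) (toList F)
          term : Vec (Fin N) r → FS R N
          term F = act (res F) (mono (A ∷ wdH F))
          consed : ∀ L → List.map (λ F → (signR R (res F) , A ∷ wdH F)) L ≡ consF A (form (groundOf res) res L)
          consed [] = refl
          consed (F ∷ L) = cong₂ _∷_ refl (consed L)
          wdH≡wd : ∀ {n} (F : Vec (Fin N) n) → (∀ k → NonLoop res (lookup F k)) → List.map (atomOf (groundOf res) res) (toList F) ≡ wd F
          wdH≡wd [] nl = refl
          wdH≡wd (f ∷ F) nl = cong₂ _∷_ (atomOf-res ground (nl zero)) (wdH≡wd F (nl ∘ suc))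
          same-term : ∀ p → p ∈ₗ filter InFacet? (items Δ) → T p ≈ term (face p)
          same-term (B , j) p∈ with MemP.∈-filter⁻ InFacet? {xs = items Δ} p∈
          ... | p∈' , h = begin
              act (ν B) (e (B [ j ]≔ a)) ≈⟨ act-cong (ν B) (e-alt (replaced-NonLoops nzB j) front) ⟩
              act (ν B) (act s (e (a ∷ F))) ≈⟨ act-* (ν B) s (e (a ∷ F)) ⟩
              act (ν B *ₛ s) (e (a ∷ F)) ≈⟨ ∼-reflexive (cong₂ (λ t w → act t (mono (A ∷ w))) sign (sym (wdH≡wd F nlF))) ⟩
              term F ∎
            where
            B∈ = ∈-items⁻ Δ p∈'
            nzB = bases tri B B∈
            F = removeAt B j
            s = parity (toℕ j)
            front : Perm s (B [ j ]≔ a) (a ∷ F)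
            front = subst (λ x → Perm s (B [ j ]≔ a) x) (cong₂ _∷_ (VecP.lookup∘update j B a) (removeAt-update B j a)) (bring (B [ j ]≔ a) j)
            on : OnH F
            on = InFacet-OnH {B} {j} h
            combine : ∀ b s t → s ≢ zer → b ≡ s *ₛ t → b *ₛ s ≡ t
            combine = decide (allSigns? λ b → allSigns? λ s → allSigns? λ t → ¬? (s ≟ₛ zer) →-dec ((b ≟ₛ (s *ₛ t)) →-dec ((b *ₛ s) ≟ₛ t))) tt
            sign : ν B *ₛ s ≡ res F
            sign = trans (combine (ν B) s (ν (a ∷ F)) (parity≢zer (toℕ j)) (trans (sym (trans (facet-law B∈ h a)
              (cong (_*ₛ ν B) (value-apex Y)))) (alt om front))) (sym (res-on on))
            nlF : ∀ k → NonLoop res (lookup F k)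
            nlF k = Mem⇒NonLoop res (bases (facet-Triang tri) F (∈-faces InFacet? Δ B∈ j h)) (k , refl)

  -- Both forms are expanded from a common apex, a vertex of the first triangulation, and compared
  -- hyperplane by hyperplane. A hyperplane occurring on one side is covered by both triangulations,
  -- so the induction hypothesis applies to its two induced triangulations.
  form-independent : ∀ {N} r {E : Subset N} {ν : Chi N r} → OM ν → Ground E ν → Acyclic ν → ∀ {Δ Δ'} →
    Triang ν Δ → Triang ν Δ' → (∃ λ B → B ∈ₗ Δ) → (∃ λ B → B ∈ₗ Δ') → OSEq R E ν (form E ν Δ) (form E ν Δ')
  form-independent zero {E} {ν} om ground acyclic {Δ} {Δ'} tri tri' ne ne' = OS.un∼ (OS.≡⇒∼ R E ν (cong (form E ν)
    (trans (rank0-unique Δ (unique tri) ne) (sym (rank0-unique Δ' (unique tri') ne')))))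
  form-independent {N} (suc r) {E} {ν} om ground acyclic {Δ} {Δ'} tri tri' ne@(B₁ , B₁∈) ne' =
    un∼ (∼-tran (visible-sum tri) (∼-tran (sums-agree T (visible Δ) (visible Δ') agree) (∼-symm (visible-sum tri'))))
    where
    nla : NonLoop ν (lookup B₁ zero)
    nla = Mem⇒NonLoop ν (bases tri B₁ B₁∈) (zero , refl)
    open FacetExpansion om ground nla
    open OS R using (OSGroup; consF; ∼-cons; mk∼; un∼)
    open AbelianGroup (OSGroup E ν) using (_≈_)
      renaming (refl to ∼-refl; sym to ∼-symm; trans to ∼-tran; reflexive to ∼-reflexive)
    open GroupSums (OSGroup E ν)
    open KeySums (OSGroup E ν) _≟S_ hyperplane

    via-facet : ∀ {Δ₀} → Triang ν Δ₀ → ∀ k p → p ∈ₗ fibre k (visible Δ₀) →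
      sumL T (fibre k (visible Δ)) ≈ sumL T (fibre k (visible Δ'))
    via-facet {Δ₀} tri₀ k (B₀ , j₀) p∈ with MemP.∈-filter⁻ (λ p → hyperplane p ≟S k) {xs = visible Δ₀} p∈
    ... | p∈₁ , refl with MemP.∈-filter⁻ Visible? {xs = filter (Bd? ν) (items Δ₀)} p∈₁
    ...   | p∈₂ , v₀ with MemP.∈-filter⁻ (Bd? ν) {xs = items Δ₀} p∈₂
    ...     | p∈₃ , bd₀ = ∼-tran (facet-sum nz₀ bd₀ v₀ tri) (∼-tran
        (∼-cons E ν (atomOf E ν (lookup B₁ zero)) (mk∼ (HyperplaneMatroid.InIdeal-res om Y₀ ground R
          (form-independent r (Restriction.res-OM om Y₀) (groundOf-Ground res) (HyperplaneMatroid.res-acyclic om Y₀ acyclic)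
            (Restriction.facet-Triang om Y₀ tri) (Restriction.facet-Triang om Y₀ tri')
            (nonempty tri ne) (nonempty tri' ne')))))
        (∼-symm (facet-sum nz₀ bd₀ v₀ tri')))
      where
      nz₀ = bases tri₀ B₀ (∈-items⁻ Δ₀ p∈₃)
      Y₀ : FacetCocircuit ν
      Y₀ = facetOf nz₀ bd₀ v₀
      open Restriction om Y₀ using (res; facetΔ; InFacet?)
      nonempty : ∀ {Δ} → Triang ν Δ → (∃ λ B → B ∈ₗ Δ) → ∃ λ F → F ∈ₗ facetΔ Δ
      nonempty {Δ} tri ne = let B , B∈ , j , h = facet-covered r om acyclic tri ne Y₀ in
        removeAt B j , ∈-faces InFacet? Δ B∈ j h

    agree : ∀ k → sumL T (fibre k (visible Δ)) ≈ sumL T (fibre k (visible Δ'))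
    agree k with fibre k (visible Δ) in eq | fibre k (visible Δ') in eq'
    ... | [] | [] = ∼-refl
    ... | p ∷ L | _ = subst₂≈ eq eq' (via-facet tri k p (subst (p ∈ₗ_) (sym eq) (here refl)))
      where
      subst₂≈ : ∀ {L M L' M'} → L ≡ L' → M ≡ M' → sumL T L ≈ sumL T M → sumL T L' ≈ sumL T M'
      subst₂≈ refl refl h = h
    ... | [] | p ∷ L = subst₂≈ eq eq' (via-facet tri' k p (subst (p ∈ₗ_) (sym eq') (here refl)))
      where
      subst₂≈ : ∀ {L M L' M'} → L ≡ L' → M ≡ M' → sumL T L ≈ sumL T M → sumL T L' ≈ sumL T M'
      subst₂≈ refl refl h = h

-- Reorientation, rescaling and change of chirotope

negIf≢zer : ∀ s → negIf s ≢ zer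
negIf≢zer pos ()
negIf≢zer neg ()
negIf≢zer zer ()

flips≢zer : (P : SignVec N) (x : Vec (Fin N) n) → flips P x ≢ zer
flips≢zer P [] ()
flips≢zer P (a ∷ x) = *ₛ-nonzero _ _ (negIf≢zer (P a)) (flips≢zer P x)

flips-Perm : (P : SignVec N) → ∀ {s} {x y : Vec (Fin N) n} → Perm s x y → flips P x ≡ flips P y
flips-Perm P reflᵖ = refl
flips-Perm P (swapᵖ a b x) = *ₛ-exchange (negIf (P a)) (negIf (P b)) (flips P x)
flips-Perm P (prepᵖ a p) = cong (negIf (P a) *ₛ_) (flips-Perm P p)
flips-Perm P (transᵖ p q) = trans (flips-Perm P p) (flips-Perm P q)

-- `negIf` is never zero, so multiplying by the old flip once more removes it.
flips-update : (P : SignVec N) (x : Vec (Fin N) n) (j : Fin n) (e : Fin N) →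
  flips P (x [ j ]≔ e) ≡ (flips P x *ₛ negIf (P (lookup x j))) *ₛ negIf (P e)
flips-update P (a ∷ x) zero e = rearrange (negIf (P a)) (negIf (P e)) (flips P x) (negIf≢zer (P a))
  where
  rearrange : ∀ a e x → a ≢ zer → e *ₛ x ≡ ((a *ₛ x) *ₛ a) *ₛ e
  rearrange = decide (allSigns? λ a → allSigns? λ e → allSigns? λ x → ¬? (a ≟ₛ zer) →-dec (_ ≟ₛ _)) tt
flips-update P (a ∷ x) (suc j) e = trans (cong (negIf (P a) *ₛ_) (flips-update P x j e))
  (rearrange (negIf (P a)) (flips P x) (negIf (P (lookup x j))) (negIf (P e)))
  where
  rearrange : ∀ a f b e → a *ₛ ((f *ₛ b) *ₛ e) ≡ ((a *ₛ f) *ₛ b) *ₛ e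
  rearrange = decide (allSigns? λ a → allSigns? λ f → allSigns? λ b → allSigns? λ e → _ ≟ₛ _) tt

reorient-update : (P : SignVec N) (χ : Chi N r) → ∀ z j e →
  reorient P χ (z [ j ]≔ e) ≡ (flips P z *ₛ negIf (P (lookup z j))) *ₛ (negIf (P e) *ₛ χ (z [ j ]≔ e))
reorient-update P χ z j e = trans (cong (_*ₛ χ (z [ j ]≔ e)) (flips-update P z j e)) (*ₛ-assoc (flips P z *ₛ negIf (P (lookup z j))) _ _)

-- An exchange moves elements between two tuples without changing how often each occurs in total, so
-- the flips on both sides cancel.
reorient-OM : (P : SignVec N) {χ : Chi N r} → OM χ → OM (reorient P χ)
reorient-OM P {χ} om .alt {s} {x} {y} p = trans (cong₂ _*ₛ_ (flips-Perm P p) (alt om p)) (*ₛ-exchange (flips P y) s (χ y))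
reorient-OM P {χ} om .ex x y j nz = i , trans (cong₂ _*ₛ_ (reorient-update P χ x j (lookup y i)) (reorient-update P χ y i (lookup x j)))
    (collect (flips P x) (negIf (P (lookup x j))) (negIf (P (lookup y i))) (χ (x [ j ]≔ lookup y i)) (flips P y) (χ (y [ i ]≔ lookup x j)) (χ x) (χ y)
      (negIf≢zer _) (negIf≢zer _) (proj₂ found))
  where
  found = ex om x y j (*ₛ-nonzero _ _ (*ₛ-nonzeroʳ (flips P x) _ (*ₛ-nonzeroˡ _ (reorient P χ y) nz))
                                      (*ₛ-nonzeroʳ (flips P y) _ (*ₛ-nonzeroʳ (reorient P χ x) _ nz)))
  i = proj₁ found
  collect : ∀ fx a b x' fy y' cx cy → a ≢ zer → b ≢ zer → x' *ₛ y' ≡ cx *ₛ cy →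
    ((fx *ₛ a) *ₛ (b *ₛ x')) *ₛ ((fy *ₛ b) *ₛ (a *ₛ y')) ≡ (fx *ₛ cx) *ₛ (fy *ₛ cy)
  collect fx a b x' fy y' cx cy na nb eq = begin
    ((fx *ₛ a) *ₛ (b *ₛ x')) *ₛ ((fy *ₛ b) *ₛ (a *ₛ y')) ≡⟨ gather fx fy a b x' y' na nb ⟩
    (fx *ₛ fy) *ₛ (x' *ₛ y') ≡⟨ cong ((fx *ₛ fy) *ₛ_) eq ⟩
    (fx *ₛ fy) *ₛ (cx *ₛ cy) ≡⟨ interchange fx fy cx cy ⟩
    (fx *ₛ cx) *ₛ (fy *ₛ cy) ∎
    where
    open ≡-Reasoning
    interchange : ∀ a b c d → (a *ₛ b) *ₛ (c *ₛ d) ≡ (a *ₛ c) *ₛ (b *ₛ d)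
    interchange = decide (allSigns? λ a → allSigns? λ b → allSigns? λ c → allSigns? λ d → _ ≟ₛ _) tt
    gather : ∀ fx fy a b x y → a ≢ zer → b ≢ zer → ((fx *ₛ a) *ₛ (b *ₛ x)) *ₛ ((fy *ₛ b) *ₛ (a *ₛ y)) ≡ (fx *ₛ fy) *ₛ (x *ₛ y)
    gather fx fy a b x y na nb = begin
      ((fx *ₛ a) *ₛ (b *ₛ x)) *ₛ ((fy *ₛ b) *ₛ (a *ₛ y)) ≡⟨ cong₂ _*ₛ_ (*ₛ-assoc (fx) a (b *ₛ x)) (trans (cong (_*ₛ (a *ₛ y)) (*ₛ-comm fy b)) (trans (*ₛ-assoc b fy _) (swap₃ b fy a y))) ⟩
      (fx *ₛ (a *ₛ (b *ₛ x))) *ₛ (fy *ₛ (a *ₛ (b *ₛ y))) ≡⟨ interchange fx _ fy _ ⟩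
      (fx *ₛ fy) *ₛ ((a *ₛ (b *ₛ x)) *ₛ (a *ₛ (b *ₛ y))) ≡⟨ cong ((fx *ₛ fy) *ₛ_) (trans (*ₛ-cancel₂ a (b *ₛ x) (b *ₛ y) na) (*ₛ-cancel₂ b x y nb)) ⟩
      (fx *ₛ fy) *ₛ (x *ₛ y) ∎
      where
      swap₃ : ∀ b f a y → b *ₛ (f *ₛ (a *ₛ y)) ≡ f *ₛ (a *ₛ (b *ₛ y))
      swap₃ = decide (allSigns? λ a → allSigns? λ b → allSigns? λ c → allSigns? λ d → _ ≟ₛ _) tt

-- Agreement of the underlying matroids. The Orlik-Solomon ideal depends on nothing else, so it can
-- be computed with any of the related chirotopes.
record SameZeros {N r} (χ χ' : Chi N r) : Set where
  field
    to   : ∀ x → χ x ≢ zer → χ' x ≢ zer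
    from : ∀ x → χ' x ≢ zer → χ x ≢ zer
open SameZeros public

SameZeros-sym : {χ χ' : Chi N r} → SameZeros χ χ' → SameZeros χ' χ
SameZeros-sym s = record { to = from s ; from = to s }

reorient-SameZeros : (P : SignVec N) (χ : Chi N r) → SameZeros χ (reorient P χ)
reorient-SameZeros P χ = record { to = λ x → *ₛ-nonzero _ _ (flips≢zer P x) ; from = λ x → *ₛ-nonzeroʳ (flips P x) _ }

module _ {N r} {χ χ' : Chi N r} where

  RankGe-same : SameZeros χ χ' → ∀ {X k} → RankGe χ X k → RankGe χ' X k
  RankGe-same s (I , (x , nz , I⊆) , h) = I , (x , to s x nz , I⊆) , h

  NonLoop-same : SameZeros χ χ' → ∀ {e} → NonLoop χ e → NonLoop χ' e
  NonLoop-same s (z , j , nz) = z , j , to s _ nz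

  atomSpan-same : SameZeros χ χ' → (E S : Subset N) → atomSpan E χ S ≡ atomSpan E χ' S
  atomSpan-same s E S = SubP.⊆-antisym
    (λ j∈ → let j∈E , ¬rk = ∈-atomSpan⁻ E χ S j∈ in ∈-atomSpan E χ' S j∈E (¬rk ∘ back))
    (λ j∈ → let j∈E , ¬rk = ∈-atomSpan⁻ E χ' S j∈ in ∈-atomSpan E χ S j∈E (¬rk ∘ RankGe-same s))
    where
    back : ∀ {X k} → RankGe χ' X k → RankGe χ X k
    back (I , (x , nz , I⊆) , h) = I , (x , from s x nz , I⊆) , h

IsAtom-same : {E : Subset N} {χ χ' : Chi N r} → SameZeros χ χ' → ∀ {a} → IsAtom E χ a → IsAtom E χ' a
IsAtom-same s (a⊆ , rk1 , ¬rk2 , maximal) = a⊆ , RankGe-same s rk1 , ¬rk2 ∘ RankGe-same (SameZeros-sym s) ,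
  λ e e∈ e∉ → RankGe-same s (maximal e e∈ e∉)

InIdeal-same : ∀ {c ℓ} (R : CommutativeRing c ℓ) {E : Subset N} {χ χ' : Chi N r} → SameZeros χ χ' →
  ∀ {f} → InIdeal R E χ f → InIdeal R E χ' f
InIdeal-same R s nil = nil
InIdeal-same R {E} {χ} {χ'} s (step k u g v f gen p) = step k u g v f (generator gen) (InIdeal-same R s p)
  where
  generator : ∀ {g} → OSGen R E χ g → OSGen R E χ' g
  generator (sq a h) = sq a (IsAtom-same s h)
  generator (anti a b h h') = anti a b (IsAtom-same s h) (IsAtom-same s h')
  generator (dep S h u ¬rk) = dep S (All.map (IsAtom-same s) h) u (¬rk ∘ RankGe-same (SameZeros-sym s))
InIdeal-same R s (resp f g eq p) = resp f g eq (InIdeal-same R s p)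

-- Chirotopes that differ by a global sign

module Rescale {N r} {ν ν' : Chi N r} (t : Sign) (t≢ : t ≢ zer) (law : ∀ x → ν' x ≡ t *ₛ ν x) where

  private
    square : ∀ x y → ν' x *ₛ ν' y ≡ ν x *ₛ ν y
    square x y = trans (cong₂ _*ₛ_ (law x) (law y)) (*ₛ-cancel₂ t (ν x) (ν y) t≢)

  rescale-SameZeros : SameZeros ν ν'
  rescale-SameZeros = record { to = λ x nz eq → *ₛ-nonzero _ _ t≢ nz (trans (sym (law x)) eq)
                             ; from = λ x nz eq → nz (trans (law x) (*ₛ-zeroʳ′ t eq)) }

  rescale-OM : OM ν → OM ν'
  rescale-OM om .alt {s} {x} {y} p = trans (law x) (trans (cong (t *ₛ_) (alt om p)) (trans (*ₛ-exchange t s (ν y)) (cong (s *ₛ_) (sym (law y)))))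
  rescale-OM om .ex x y j nz with ex om x y j (nz ∘ trans (square x y))
  ... | i , eq = i , trans (square _ _) (trans eq (sym (square x y)))

  rescale-PosCoc : ∀ {w L} → PosCoc ν w L → PosCoc ν' w L
  rescale-PosCoc (z , j , σ , p , q) = z , j , σ *ₛ t , trans (same _) p , λ l l∈ eq → q l l∈ (trans (sym (same _)) eq)
    where
    same : ∀ x → (σ *ₛ t) *ₛ ν' x ≡ σ *ₛ ν x
    same x = trans (*ₛ-assoc σ t _) (cong (σ *ₛ_) (trans (cong (t *ₛ_) (law x)) (*ₛ-cancel t _ t≢)))

  rescale-Acyclic : Acyclic ν → Acyclic ν'
  rescale-Acyclic acyclic e nl = rescale-PosCoc (acyclic e (NonLoop-same (SameZeros-sym rescale-SameZeros) nl))

  rescale-Triang : ∀ {Δ} → Triang ν Δ → Triang ν' Δ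
  rescale-Triang T .bases B B∈ = to rescale-SameZeros B (bases T B B∈)
  rescale-Triang T .unique = unique T
  rescale-Triang T .distinct = distinct T
  rescale-Triang T .nc B B' B∈ B'∈ y x σ nz x∉ nl σ≢ p q = nc T B B' B∈ B'∈ y x (σ *ₛ t) (from rescale-SameZeros y nz) x∉
    (NonLoop-same (SameZeros-sym rescale-SameZeros) nl) (*ₛ-nonzero σ t σ≢ t≢)
    (λ k eq → p k (trans (same k) eq)) (λ k eq → q k (trans (same k) eq))
    where
    same : ∀ k → σ *ₛ sg ν' y x k ≡ (σ *ₛ t) *ₛ sg ν y x k
    same zero = trans (cong (σ *ₛ_) (law y)) (sym (*ₛ-assoc σ t _))
    same (suc i) = trans (cong (λ s → σ *ₛ negₛ s) (law _)) (trans (cong (σ *ₛ_) (sym (negₛ-*ʳ t _))) (sym (*ₛ-assoc σ t _)))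
  rescale-Triang T .fac x (nz , member) j with fac T x (from rescale-SameZeros x nz , member) j
  ... | inj₁ bd = inj₁ λ e eq → bd e (trans (sym (square x _)) eq)
  ... | inj₂ (e , (nz' , member') , opp) = inj₂ (e , (to rescale-SameZeros _ nz' , member') , trans (square x _) opp)

IsTriangulation⇒Triang′ : ∀ {N} r {E : Subset N} {ν : Chi N r} → OM ν → (∀ x → ν x ≢ zer → ∀ k → lookup x k ∈ E) →
  ∀ {Δ} → IsTriangulation E r ν Δ → Triang ν Δ
IsTriangulation⇒Triang′ zero om support I = record
  { bases = λ B B∈ → All.lookup (IsTriangulation.bases I) B∈
  ; unique = AllPairs.map (λ ne eq → ne (cong img eq)) (IsTriangulation.distinct I)
  ; distinct = λ { [] [] _ _ _ → refl }
  ; nc = λ { _ _ _ _ _ _ _ _ _ (_ , () , _) _ _ _ }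
  ; fac = λ _ _ () }
IsTriangulation⇒Triang′ (suc r) om support I = IsTriangulation⇒Triang om support I

IsTriangulation-nonempty : {E : Subset N} {ν : Chi N r} {Δ : List (Vec (Fin N) r)} → IsTriangulation E r ν Δ → ∃ λ B → B ∈ₗ Δ
IsTriangulation-nonempty {Δ = []} I = ⊥-elim (IsTriangulation.nonempty I refl)
IsTriangulation-nonempty {Δ = B ∷ _} I = B , here refl

-- Topes, facets and residues

x∈p─q⇒x∉q : (p q : Subset N) {x : Fin N} → x ∈ p ─ q → x ∉ q
x∈p─q⇒x∉q (_ ∷ p) (_ ∷ q) {suc x} (Vec.there h) (Vec.there h') = x∈p─q⇒x∉q p q h h'
x∈p─q⇒x∉q (true ∷ p) (true ∷ q) {zero} () Vec.here
x∈p─q⇒x∉q (false ∷ p) (true ∷ q) {zero} () Vec.here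

zeroOn-in : (a : Subset N) (P : SignVec N) {e : Fin N} → e ∈ a → zeroOn a P e ≡ zer
zeroOn-in a P {e} e∈ with e ∈? a
... | yes _ = refl
... | no e∉ = ⊥-elim (e∉ e∈)

zeroOn-out : (a : Subset N) (P : SignVec N) {e : Fin N} → e ∉ a → zeroOn a P e ≡ P e
zeroOn-out a P {e} e∉ with e ∈? a
... | yes e∈ = ⊥-elim (e∉ e∈)
... | no _ = refl

composite : List (SignVec N) → SignVec N
composite = List.foldr compose zeroV

composite-snoc : (Ys : List (SignVec N)) (Y : SignVec N) (e : Fin N) →
  (composite Ys e ≢ zer → composite (Ys ++ Y ∷ []) e ≡ composite Ys e) × (composite Ys e ≡ zer → composite (Ys ++ Y ∷ []) e ≡ Y e)
composite-snoc [] Y e = (λ nz → ⊥-elim (nz refl)) , λ _ → alone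
  where
  alone : compose Y zeroV e ≡ Y e
  alone with Y e ≟ₛ zer
  ... | yes eq = trans (compose-zero Y zeroV e eq) (sym eq)
  ... | no nz = compose-nonzero Y zeroV e nz
composite-snoc (Z ∷ Ys) Y e with Z e ≟ₛ zer
... | no nz = (λ _ → trans (compose-nonzero Z _ e nz) (sym (compose-nonzero Z _ e nz))) ,
      λ z → ⊥-elim (nz (trans (sym (compose-nonzero Z (composite Ys) e nz)) z))
... | yes eq = (λ h → trans (drop _) (trans (proj₁ ih (h ∘ trans (drop _))) (sym (drop _)))) ,
      λ h → trans (drop _) (proj₂ ih (trans (sym (drop _)) h))
  where
  drop : ∀ X → compose Z X e ≡ X e
  drop X = compose-zero Z X e eq
  ih = composite-snoc Ys Y e

composite-member : (Ys : List (SignVec N)) (e : Fin N) → composite Ys e ≢ zer → ∃ λ Y → Y ∈ₗ Ys × Y e ≡ composite Ys e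
composite-member [] e nz = ⊥-elim (nz refl)
composite-member (Y ∷ Ys) e nz with Y e ≟ₛ zer
... | no nzY = Y , here refl , sym (compose-nonzero Y _ e nzY)
... | yes eq = let Z , Z∈ , Z≡ = composite-member Ys e (nz ∘ trans (compose-zero Y _ e eq)) in
      Z , there Z∈ , trans Z≡ (sym (compose-zero Y _ e eq))

composite-nonzero : (Ys : List (SignVec N)) {Y : SignVec N} {e : Fin N} → Y ∈ₗ Ys → Y e ≢ zer → composite Ys e ≢ zer
composite-nonzero (Z ∷ Ys) {Y} {e} Y∈ nz with Z e ≟ₛ zer
... | no nzZ = nzZ ∘ trans (sym (compose-nonzero Z _ e nzZ))
composite-nonzero (Z ∷ Ys) {Y} {e} (here refl) nz | yes eq = ⊥-elim (nz eq)
composite-nonzero (Z ∷ Ys) {Y} {e} (there Y∈) nz | yes eq = composite-nonzero Ys Y∈ nz ∘ trans (sym (compose-zero Z _ e eq))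

negIf-self : ∀ s → s ≢ zer → negIf s *ₛ s ≡ pos
negIf-self pos _ = refl
negIf-self neg _ = refl
negIf-self zer h = ⊥-elim (h refl)

negIf-≡ : ∀ s → s ≢ zer → negIf s ≡ s
negIf-≡ pos _ = refl
negIf-≡ neg _ = refl
negIf-≡ zer h = ⊥-elim (h refl)

-- If `x` were an entry of `y`, it would be listed twice, with opposite nonzero signs.
PosCirc-fresh : {ν : Chi N r} → OM ν → ∀ {w L} → ((y , x , _) : PosCirc ν w L) → ¬ Mem x y
PosCirc-fresh {ν = ν} om (y , x , σ , nz , (k₀ , _ , pk) , h) (i , at) = not-both (h zero) (h (suc i))
  where
  opposite : σ *ₛ sg ν y x (suc i) ≡ negₛ (σ *ₛ ν y)
  opposite = trans (negₛ-*ʳ σ _) (cong (λ s → negₛ (σ *ₛ s)) (update-same om y i (sym at)))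
  σν≢zer : σ *ₛ ν y ≢ zer
  σν≢zer = *ₛ-nonzero _ _ (*ₛ-nonzeroˡ σ _ (≡pos⇒≢zer pk)) nz
  not-both : ∀ {A B : Set} → σ *ₛ ν y ≡ zer ⊎ (σ *ₛ ν y ≡ pos × A) → σ *ₛ sg ν y x (suc i) ≡ zer ⊎ (σ *ₛ sg ν y x (suc i) ≡ pos × B) → ⊥
  not-both (inj₁ z) _ = σν≢zer z
  not-both (inj₂ (p , _)) (inj₁ z) = negₛ≢zer _ σν≢zer (trans (sym opposite) z)
  not-both (inj₂ (p , _)) (inj₂ (q , _)) = pos≢neg q (trans opposite (cong negₛ p))

module Tope {N r} {E : Subset N} {χ : Chi N (suc r)} (isχ : IsChirotope E (suc r) χ) (loopless : Loopless E χ)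
  {P : SignVec N} (tope : IsTope χ P) where

  ν : Chi N (suc r)
  ν = reorient P χ

  omχ : OM χ
  omχ = IsChirotope⇒OM isχ

  om : OM ν
  om = reorient-OM P omχ

  same : SameZeros χ ν
  same = reorient-SameZeros P χ

  support : ∀ x → ν x ≢ zer → ∀ k → lookup x k ∈ E
  support x nz = IsChirotope.support isχ x (from same x nz)

  groundχ : Ground E χ
  groundχ e = (λ e∈ → let x , nz , sub = loopless e e∈ in Mem⇒NonLoop χ nz (∈img⇒Mem x (sub (SubP.x∈⁅x⁆ e)))) ,
    λ (z , j , nz) → subst (_∈ E) (VecP.lookup∘update j z e) (IsChirotope.support isχ _ nz j)

  ground : Ground E ν
  ground e = NonLoop-same same ∘ proj₁ (groundχ e) , proj₂ (groundχ e) ∘ NonLoop-same (SameZeros-sym same)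

  atomOf-same : ∀ b → atomOf E χ b ≡ atomOf E ν b
  atomOf-same b = atomSpan-same same E ⁅ b ⁆

  covector-support : ∀ {X} → IsCovector χ X → ∀ e → X e ≢ zer → e ∈ E
  covector-support (Ys , cs , X≡) e nz with composite-member Ys e (nz ∘ trans (X≡ e))
  ... | Y , Y∈ , Y≡ with All.lookup cs Y∈
  ...   | x , s , _ , _ , law = subst (_∈ E) (lookup-snoc-last x e) (IsChirotope.support isχ (x ∷ʳ e)
          (*ₛ-nonzeroʳ s _ (λ z → nz (trans (X≡ e) (trans (sym Y≡) (trans (law e) z))))) (Fin.fromℕ r))

  -- Otherwise composing `P` with a cocircuit that does not vanish at `e` gives a larger covector,
  -- against maximality.
  P-nonzero : ∀ {e} → e ∈ E → P e ≢ zer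
  P-nonzero {e} e∈ Pe = nz (trans (sym (proj₂ (composite-snoc Ys Y e) (trans (sym (P≡ e)) Pe)))
        (trans (proj₂ tope X covector extends e) Pe))
    where
    Ys = proj₁ (proj₁ tope)
    P≡ = proj₂ (proj₂ (proj₁ tope))
    z = proj₁ (proj₁ (groundχ e) e∈)
    j = proj₁ (proj₂ (proj₁ (groundχ e) e∈))
    nz = proj₂ (proj₂ (proj₁ (groundχ e) e∈))
    Y : SignVec N
    Y f = pos *ₛ χ (z [ j ]≔ f)
    X : SignVec N
    X = composite (Ys ++ Y ∷ [])
    covector : IsCovector χ X
    covector = Ys ++ Y ∷ [] , AllP.++⁺ (proj₁ (proj₂ (proj₁ tope))) (update-cocircuit omχ z j pos (λ ()) (e , nz) ∷ []) , λ _ → refl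
    extends : P ≼ X
    extends f nzf = trans (proj₁ (composite-snoc Ys Y f) (nzf ∘ trans (P≡ f))) (sym (P≡ f))

  reoriented-Vect : ∀ {V} → Vect ν V → Vect χ (λ e → negIf (P e) *ₛ V e)
  reoriented-Vect {V} vect .orthogonal z j e nz = f , (begin
      (negIf (P f) *ₛ V f) *ₛ χ (z [ j ]≔ f) ≡⟨ turn f ⟩
      c *ₛ (V f *ₛ ν (z [ j ]≔ f)) ≡⟨ cong (c *ₛ_) (proj₂ found) ⟩
      c *ₛ negₛ (V e *ₛ ν (z [ j ]≔ e)) ≡⟨ negₛ-*ʳ c _ ⟩
      negₛ (c *ₛ (V e *ₛ ν (z [ j ]≔ e))) ≡⟨ cong negₛ (turn e) ⟨
      negₛ ((negIf (P e) *ₛ V e) *ₛ χ (z [ j ]≔ e)) ∎)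
    where
    open ≡-Reasoning
    c : Sign
    c = flips P z *ₛ negIf (P (lookup z j))
    c≢ : c ≢ zer
    c≢ = *ₛ-nonzero _ _ (flips≢zer P z) (negIf≢zer _)
    shuffle : ∀ n v x c → c ≢ zer → (n *ₛ v) *ₛ x ≡ c *ₛ (v *ₛ (c *ₛ (n *ₛ x)))
    shuffle = decide (allSigns? λ n → allSigns? λ v → allSigns? λ x → allSigns? λ c → ¬? (c ≟ₛ zer) →-dec (_ ≟ₛ _)) tt
    turn : ∀ g → (negIf (P g) *ₛ V g) *ₛ χ (z [ j ]≔ g) ≡ c *ₛ (V g *ₛ ν (z [ j ]≔ g))
    turn g = trans (shuffle (negIf (P g)) (V g) _ c c≢) (cong (λ s → c *ₛ (V g *ₛ s)) (sym (reorient-update P χ z j g)))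
    found = orthogonal vect z j e (λ eq → nz (trans (turn e) (*ₛ-zeroʳ′ c eq)))
    f = proj₁ found

  -- After reorientation a covector below `P` is nonnegative, so a vector whose negative part avoids
  -- its support cannot be positive on it. `Z` is `P` itself for acyclicity, and `P` zeroed on an
  -- atom for facets.
  covector-separates : ∀ {Z V} → IsCovector χ Z → (∀ e → Z e ≡ zer ⊎ Z e ≡ P e) → Vect ν V →
    (∀ e → V e ≡ neg → Z e ≡ zer) → ∀ w → V w ≡ pos → Z w ≢ zer → ⊥
  covector-separates {Z} {V} cov Z≤P vect neg⇒zer w Vw Zw
    with covector-Balanced {ν = χ} {λ e → negIf (P e) *ₛ V e} {Z} (reoriented-Vect vect) cov w (λ z → ≡pos⇒≢zer at-w z)
    where
    at-w : (negIf (P w) *ₛ V w) *ₛ Z w ≡ pos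
    at-w with Z≤P w
    ... | inj₁ z = ⊥-elim (Zw z)
    ... | inj₂ eq = trans (cong₂ (λ v z → (negIf (P w) *ₛ v) *ₛ z) Vw eq)
          (trans (cong (_*ₛ P w) (*ₛ-posʳ (negIf (P w)))) (negIf-self (P w) (Zw ∘ trans eq)))
  ... | f , eq = impossible (Z≤P f)
    where
    at-w : (negIf (P w) *ₛ V w) *ₛ Z w ≡ pos
    at-w with Z≤P w
    ... | inj₁ z = ⊥-elim (Zw z)
    ... | inj₂ eq = trans (cong₂ (λ v z → (negIf (P w) *ₛ v) *ₛ z) Vw eq)
          (trans (cong (_*ₛ P w) (*ₛ-posʳ (negIf (P w)))) (negIf-self (P w) (Zw ∘ trans eq)))
    at-f : (negIf (P f) *ₛ V f) *ₛ Z f ≡ neg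
    at-f = trans eq (cong negₛ at-w)
    rearrange : ∀ n v p → n *ₛ p ≡ pos → (n *ₛ v) *ₛ p ≡ v
    rearrange = decide (allSigns? λ n → allSigns? λ v → allSigns? λ p → (_ ≟ₛ _) →-dec (_ ≟ₛ _)) tt
    Zf : Z f ≢ zer
    Zf = *ₛ-nonzeroʳ (negIf (P f) *ₛ V f) _ (≡neg⇒≢zer at-f)
    impossible : Z f ≡ zer ⊎ Z f ≡ P f → ⊥
    impossible (inj₁ z) = Zf z
    impossible (inj₂ Zf≡P) = Zf (neg⇒zer f (trans (sym (rearrange (negIf (P f)) (V f) (P f) (negIf-self (P f) (Zf ∘ trans Zf≡P))))
      (trans (cong ((negIf (P f) *ₛ V f) *ₛ_) (sym Zf≡P)) at-f)))

  circuit-separates : ∀ {Z} → IsCovector χ Z → (∀ e → Z e ≡ zer ⊎ Z e ≡ P e) → ∀ y x σ → ν y ≢ zer → ¬ Mem x y →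
    (∀ k → σ *ₛ sg ν y x k ≡ neg → Z (el y x k) ≡ zer) → ∀ k → σ *ₛ sg ν y x k ≡ pos → Z (el y x k) ≢ zer → ⊥
  circuit-separates {Z} cov Z≤P y x σ nz x∉ h k pk Zk = covector-separates {Z} cov Z≤P (circ-Vect om nz x∉ σ) neg⇒zer (el y x k)
      (trans (cong (σ *ₛ_) (at k)) pk) Zk
    where
    at : ∀ k → circ ν y x (el y x k) ≡ sg ν y x k
    at = circ-el ν y x (nonzero⇒Inj om {y} nz) x∉
    neg⇒zer : ∀ e → σ *ₛ circ ν y x e ≡ neg → Z e ≡ zer
    neg⇒zer e eq with circ-support ν y x e (*ₛ-nonzeroʳ σ _ (≡neg⇒≢zer eq))
    ... | k , refl = h k (trans (cong (σ *ₛ_) (sym (at k))) eq)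

  acyclic : Acyclic ν
  acyclic w nl with farkas ν om (let z , j , nz = nl in z [ j ]≔ w , nz) w (allFin N)
  ... | inj₁ Y = Y
  ... | inj₂ C@(y , x , σ , nz , (k₀ , el≡ , pk) , h) = ⊥-elim (circuit-separates (proj₁ tope) (λ _ → inj₂ refl) y x σ nz
        (PosCirc-fresh om C) (λ k eq → ⊥-elim (not-neg (h k) eq)) k₀ pk (P-nonzero (subst (_∈ E) (sym el≡) (proj₂ (ground w) nl))))
    where
    not-neg : ∀ {s} {A : Set} → s ≡ zer ⊎ (s ≡ pos × A) → s ≢ neg
    not-neg (inj₁ refl) ()
    not-neg (inj₂ (refl , _)) ()

  module Atom {a : Subset N} (atomχ : IsAtom E χ a) {i : Fin N} (i∈a : i ∈ a) where

    i∈E : i ∈ E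
    i∈E = proj₁ atomχ i∈a

    nli : NonLoop ν i
    nli = proj₁ (ground i) i∈E

    a≡atom : a ≡ atomOf E ν i
    a≡atom = IsAtom⇒atomOf om ground (IsAtom-same same atomχ) i∈a

    ∈a⇒Par : ∀ {e} → e ∈ a → Par ν i e
    ∈a⇒Par e∈ = proj₂ (∈-atomOf⁻ om ground (subst (_ ∈_) a≡atom e∈))

    Par⇒∈a : ∀ {e} → e ∈ E → Par ν i e → e ∈ a
    Par⇒∈a e∈ par = subst (_ ∈_) (sym a≡atom) (∈-atomOf om ground e∈ par)

    con-NonLoop⇒∈E : ∀ {e} → NonLoop (con ν i) e → e ∈ E
    con-NonLoop⇒∈E {e} (z , j , nz) = proj₂ (ground e) (i ∷ z , suc j , nz)

    facet⇒Extreme : IsFacet χ P a → Extreme ν i (allFin N)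
    facet⇒Extreme facet w _ with NonLoop? (con ν i) w
    ... | no par = inj₁ par
    ... | yes nl with farkas (con ν i) (con-OM om i) (con-basis om nli) w (allFin N)
    ...   | inj₁ Y = inj₂ Y
    ...   | inj₂ C@(y , x , σ , nz , (k₀ , el≡ , pk) , h) = ⊥-elim
        (circuit-separates facet Z≤P (i ∷ y) x σ nz x∉ at-neg (proj₁ (entry k₀ el≡ pk)) (proj₂ (proj₂ (entry k₀ el≡ pk)))
          (subst (λ e → zeroOn a P e ≢ zer) (sym (proj₁ (proj₂ (entry k₀ el≡ pk))))
            (P-nonzero (con-NonLoop⇒∈E nl) ∘ trans (sym (zeroOn-out a P (λ w∈ → ∈a⇒Par w∈ nl))))))
      where
      Z≤P : ∀ e → zeroOn a P e ≡ zer ⊎ zeroOn a P e ≡ P e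
      Z≤P e with e ∈? a
      ... | yes _ = inj₁ refl
      ... | no _ = inj₂ refl
      x∉ : ¬ Mem x (i ∷ y)
      x∉ (suc k , eq) = PosCirc-fresh (con-OM om i) C (k , eq)
      x∉ (zero , refl) = only-i k₀ el≡ pk
        where
        only-i : ∀ k → el y i k ≡ w → σ *ₛ sg (con ν i) y i k ≡ pos → ⊥
        only-i zero refl _ = Par-refl om i nl
        only-i (suc k) _ eq = ≡pos⇒≢zer eq (*ₛ-zeroʳ′ σ (cong negₛ (con-vanish om i y k)))
      entry : ∀ k → el y x k ≡ w → σ *ₛ sg (con ν i) y x k ≡ pos → ∃ λ k → el (i ∷ y) x k ≡ w × σ *ₛ sg ν (i ∷ y) x k ≡ pos
      entry zero e s = zero , e , s
      entry (suc k) e s = suc (suc k) , e , s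
      not-neg : ∀ {s} {A : Set} → s ≡ zer ⊎ (s ≡ pos × A) → s ≢ neg
      not-neg (inj₁ refl) ()
      not-neg (inj₂ (refl , _)) ()
      at-neg : ∀ k → σ *ₛ sg ν (i ∷ y) x k ≡ neg → zeroOn a P (el (i ∷ y) x k) ≡ zer
      at-neg zero eq = ⊥-elim (not-neg (h zero) eq)
      at-neg (suc zero) _ = zeroOn-in a P i∈a
      at-neg (suc (suc k)) eq = ⊥-elim (not-neg (h (suc k)) eq)

    Nonneg : SignVec N → Set
    Nonneg Y = IsCocircuit (suc r) χ Y × (∀ e → negIf (P e) *ₛ Y e ≢ neg) × (∀ e → Par ν i e → Y e ≡ zer)

    PosCoc⇒cocircuit : ∀ {w} → PosCoc (con ν i) w (allFin N) → ∃ λ Y → Nonneg Y × Y w ≢ zer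
    PosCoc⇒cocircuit {w} (z , j , σ , p , q) = Y ,
      (update-cocircuit omχ (i ∷ z) (suc j) s s≢ (w , from same _ (*ₛ-nonzeroʳ σ _ (≡pos⇒≢zer p))) ,
       (λ e eq → q e (MemP.∈-allFin e) (trans (turn e) eq)) ,
       λ e par → *ₛ-zeroʳ′ s (¬≢zer⇒≡ λ nz → par (z , j , to same _ nz))) ,
      λ eq → ≡pos⇒≢zer p (trans (turn w) (*ₛ-zeroʳ′ (negIf (P w)) eq))
      where
      c = flips P (i ∷ z) *ₛ negIf (P (lookup z j))
      s : Sign
      s = σ *ₛ c
      s≢ : s ≢ zer
      s≢ = *ₛ-nonzero _ _ (*ₛ-nonzeroˡ σ _ (≡pos⇒≢zer p)) (*ₛ-nonzero _ _ (flips≢zer P (i ∷ z)) (negIf≢zer _))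
      Y : SignVec N
      Y e = s *ₛ χ ((i ∷ z) [ suc j ]≔ e)
      shuffle : ∀ σ c n x → σ *ₛ (c *ₛ (n *ₛ x)) ≡ n *ₛ ((σ *ₛ c) *ₛ x)
      shuffle = decide (allSigns? λ n → allSigns? λ v → allSigns? λ x → allSigns? λ c → _ ≟ₛ _) tt
      turn : ∀ e → σ *ₛ con ν i (z [ j ]≔ e) ≡ negIf (P e) *ₛ Y e
      turn e = trans (cong (σ *ₛ_) (reorient-update P χ (i ∷ z) (suc j) e)) (shuffle σ c (negIf (P e)) _)

    -- One cocircuit is taken for each non-loop of the contraction. All of them agree with `P` where
    -- they are nonzero on the ground set and vanish on the atom, so their composition is `P` zeroed
    -- on `a`.
    Extreme⇒facet : (∀ w → NonLoop (con ν i) w → PosCoc (con ν i) w (allFin N)) → IsFacet χ P a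
    Extreme⇒facet coc = Ys , All.tabulate (λ Y∈ → proj₁ (proj₁ all-nonneg Y∈)) , value-at
      where
      collect : ∀ L → ∃ λ Ys → (∀ {Y} → Y ∈ₗ Ys → Nonneg Y) × (∀ w → w ∈ₗ L → NonLoop (con ν i) w → ∃ λ Y → Y ∈ₗ Ys × Y w ≢ zer)
      collect [] = [] , (λ ()) , λ _ ()
      collect (w ∷ L) with collect L | NonLoop? (con ν i) w
      ... | Ys , nn , hit | no par = Ys , nn , λ { v (here refl) nl → ⊥-elim (par nl) ; v (there v∈) nl → hit v v∈ nl }
      ... | Ys , nn , hit | yes nl = let Y , nnY , nzY = PosCoc⇒cocircuit (coc w nl) in
        Y ∷ Ys , (λ { (here refl) → nnY ; (there Y∈) → nn Y∈ }) ,
        λ { v (here refl) _ → Y , here refl , nzY ; v (there v∈) nl' → let Z , Z∈ , nz = hit v v∈ nl' in Z , there Z∈ , nz }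
      Ys = proj₁ (collect (allFin N))
      all-nonneg = proj₂ (collect (allFin N))
      value-at : ∀ e → zeroOn a P e ≡ composite Ys e
      value-at e with NonLoop? (con ν i) e
      ... | yes nl = trans (zeroOn-out a P (λ e∈ → ∈a⇒Par e∈ nl)) (sym agree)
        where
        Y = proj₁ (proj₂ all-nonneg e (MemP.∈-allFin e) nl)
        Y∈ = proj₁ (proj₂ (proj₂ all-nonneg e (MemP.∈-allFin e) nl))
        nzY = proj₂ (proj₂ (proj₂ all-nonneg e (MemP.∈-allFin e) nl))
        nzC : composite Ys e ≢ zer
        nzC = composite-nonzero Ys Y∈ nzY
        Pe = P-nonzero (con-NonLoop⇒∈E nl)
        agree : composite Ys e ≡ P e
        agree with composite-member Ys e nzC
        ... | Z , Z∈ , Z≡ = trans (sym Z≡) (trans (sym (*ₛ-pos⇒≡ _ _ (≢zer∧≢neg⇒pos _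
                (*ₛ-nonzero _ _ (negIf≢zer (P e)) (nzC ∘ trans (sym Z≡))) (proj₁ (proj₂ (proj₁ all-nonneg Z∈)) e)))) (negIf-≡ (P e) Pe))
      ... | no par = trans zeroes (sym (¬≢zer⇒≡ λ nz → let Z , Z∈ , Z≡ = composite-member Ys e nz in
              nz (trans (sym Z≡) (proj₂ (proj₂ (proj₁ all-nonneg Z∈)) e par))))
        where
        zeroes : zeroOn a P e ≡ zer
        zeroes with e ∈? a
        ... | yes _ = refl
        ... | no e∉ = ¬≢zer⇒≡ λ nz → e∉ (Par⇒∈a (covector-support (proj₁ tope) e nz) par)

    -- The Farkas alternative is scanned over all elements instead of deciding facets directly: if
    -- no circuit turns up, the cocircuits make `a` a facet.
    not-facet⇒PosCirc : ¬ IsFacet χ P a → ∃ λ w → NonLoop (con ν i) w × PosCirc (con ν i) w (allFin N)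
    not-facet⇒PosCirc ¬facet = conclude (scan {Q = λ w → NonLoop (con ν i) w → PosCoc (con ν i) w (allFin N)} (allFin N) dichotomy)
      where
      Bad : Fin N → Set
      Bad w = NonLoop (con ν i) w × PosCirc (con ν i) w (allFin N)
      dichotomy : ∀ w → w ∈ₗ allFin N → Bad w ⊎ (NonLoop (con ν i) w → PosCoc (con ν i) w (allFin N))
      dichotomy w _ with NonLoop? (con ν i) w
      ... | no par = inj₂ λ nl → ⊥-elim (par nl)
      ... | yes nl with farkas (con ν i) (con-OM om i) (con-basis om nli) w (allFin N)
      ...   | inj₁ Y = inj₂ λ _ → Y
      ...   | inj₂ C = inj₁ (nl , C)
      conclude : (∃ λ w → w ∈ₗ allFin N × Bad w) ⊎ (∀ w → w ∈ₗ allFin N → NonLoop (con ν i) w → PosCoc (con ν i) w (allFin N)) →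
        ∃ Bad
      conclude (inj₁ (w , _ , bad)) = w , bad
      conclude (inj₂ coc) = ⊥-elim (¬facet (Extreme⇒facet λ w → coc w (MemP.∈-allFin w)))

-- Residues of monomials and links

module _ {c ℓ} (R : CommutativeRing c ℓ) where

  resWord-none : (a : Subset N) (w : Word N) → All (_≢ a) w → resWord R a w ≡ nothing
  resWord-none a [] [] = refl
  resWord-none a (b ∷ w) (b≢a ∷ h) with b ≟S a
  ... | yes b≡a = ⊥-elim (b≢a b≡a)
  ... | no _ rewrite resWord-none a w h = refl

  -- The residue sign is that of the permutation carrying entry `j` to the last place, which lets
  -- alternation of `ν` absorb it.
  resWord-at : (a : Subset N) (f : Fin N → Subset N) (x : Vec (Fin N) (suc n)) (j : Fin (suc n)) → f (lookup x j) ≡ a →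
    (∀ k → k ≢ j → f (lookup x k) ≢ a) →
    ∃ λ s → Perm s x (removeAt x j ∷ʳ lookup x j) × resWord R a (List.map f (toList x)) ≡ just (s , List.map f (toList (removeAt x j)))
  resWord-at {n = n} a f (b ∷ x) zero eq h = parity n , rotate b x , word
    where
    len : ∀ {n} (x : Vec (Fin _) n) → length (List.map f (toList x)) ≡ n
    len [] = refl
    len (_ ∷ x) = cong suc (len x)
    absent : ∀ {n} (x : Vec (Fin _) n) → (∀ k → f (lookup x k) ≢ a) → ¬ Any.Any (_≡ a) (List.map f (toList x))
    absent (c ∷ x) h (here eq) = h zero eq
    absent (c ∷ x) h (there p) = absent x (h ∘ suc) p
    word : resWord R a (f b ∷ List.map f (toList x)) ≡ just (parity n , List.map f (toList x))
    word with f b ≟S a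
    ... | no ne = ⊥-elim (ne eq)
    ... | yes _ with Any.any? (_≟S a) (List.map f (toList x))
    ...   | yes p = ⊥-elim (absent x (λ k → h (suc k) λ ()) p)
    ...   | no _ = cong (λ m → just (parity m , List.map f (toList x))) (len x)
  resWord-at a f (b ∷ x@(_ ∷ _)) (suc j) eq h with resWord-at a f x j eq (λ k k≢j → h (suc k) (k≢j ∘ FinP.suc-injective))
  ... | s , p , ih = s , prepᵖ b p , word
    where
    word : resWord R a (f b ∷ List.map f (toList x)) ≡ just (s , f b ∷ List.map f (toList (removeAt x j)))
    word with f b ≟S a
    ... | yes eq' = ⊥-elim (h zero (λ ()) eq')
    ... | no _ rewrite ih = refl

  Res-∷ : ∀ {r'} (E' : Subset N) (χ' : Chi N r') a t f → Res R E' χ' a (t ∷ f) ≡ Res R E' χ' a (t ∷ []) ++ Res R E' χ' a f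
  Res-∷ E' χ' a t f = ListP.concatMap-++ _ (t ∷ []) f

  Res-nothing : ∀ {r'} (E' : Subset N) (χ' : Chi N r') a d w → resWord R a w ≡ nothing → Res R E' χ' a ((d , w) ∷ []) ≡ []
  Res-nothing E' χ' a d w eq with resWord R a w | eq
  ... | nothing | refl = refl

  Res-just : ∀ {r'} (E' : Subset N) (χ' : Chi N r') a d w {s w'} → resWord R a w ≡ just (s , w') →
    Res R E' χ' a ((d , w) ∷ []) ≡ (CommutativeRing._*_ R (signR R s) d , List.map (atomSpan E' χ') w') ∷ []
  Res-just E' χ' a d w eq with resWord R a w | eq
  ... | just _ | refl = refl

  signR-* : ∀ s t → CommutativeRing._≈_ R (CommutativeRing._*_ R (signR R s) (signR R t)) (signR R (s *ₛ t))
  signR-* pos t = CommutativeRing.*-identityˡ R _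
  signR-* zer t = CommutativeRing.zeroˡ R _
  signR-* neg pos = CommutativeRing.*-identityʳ R _
  signR-* neg zer = CommutativeRing.zeroʳ R _
  signR-* neg neg = CommutativeRing.trans R (-1*x≈-x _) (-‿involutive _)
    where
    open CommutativeRing R using (ring; +-group)
    open import Algebra.Properties.Ring ring using (-1*x≈-x)
    open import Algebra.Properties.Group +-group using () renaming (⁻¹-involutive to -‿involutive)

img-pair⊆ : ∀ {b j : Fin N} {X} → b ∈ X → j ∈ X → img (b ∷ j ∷ []) ⊆ X
img-pair⊆ {b = b} {j} b∈ j∈ e∈ with ∈img⇒Mem (b ∷ j ∷ []) e∈
... | zero , refl = b∈
... | suc zero , refl = j∈

-- Two distinct parallel elements of equal sign form a circuit with one positive and one negative
-- element, each a vertex of a simplex of `Δ`.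
parallel-used : {ν : Chi N (suc r)} → OM ν → ∀ {Δ} → Triang ν Δ → ∀ {B B'} → B ∈ₗ Δ → B' ∈ₗ Δ → ∀ {k l} →
  Par ν (lookup B k) (lookup B' l) → (∀ z j → ν (z [ j ]≔ lookup B' l) ≡ ν (z [ j ]≔ lookup B k)) → lookup B' l ≡ lookup B k
parallel-used {ν = ν} om T {B} {B'} B∈ B'∈ {k} {l} par law = decidable-stable (lookup B' l ≟ lookup B k) λ ne →
  nc T B' B B'∈ B∈ B q (ν B) nz (q∉ ne) (Mem⇒NonLoop ν (bases T B' B'∈) (l , refl)) nz positive′ negative
  where
  q = lookup B' l
  nz = bases T B B∈
  q∉ : q ≢ lookup B k → ¬ Mem q B
  q∉ ne (m , eq) with m ≟ k
  ... | yes refl = ne (sym eq)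
  ... | no m≢k = nz (Par⇒zer om par B m≢k eq refl)
  entry : ∀ m → m ≢ k → ν (B [ m ]≔ q) ≡ zer
  entry m m≢k = Par⇒zer om par (B [ m ]≔ q) m≢k (VecP.lookup∘update m B q) (VecP.lookup∘update′ (m≢k ∘ sym) B q)
  at-k : ν B *ₛ sg ν B q (suc k) ≡ neg
  at-k = trans (cong (λ s → ν B *ₛ negₛ s) (trans (law B k) (update-same om B k refl)))
    (trans (negₛ-*ʳ (ν B) _) (cong negₛ (*ₛ-square _ nz)))
  positive′ : ∀ m → ν B *ₛ sg ν B q m ≡ pos → Mem (el B q m) B'
  positive′ zero _ = l , refl
  positive′ (suc m) eq with m ≟ k
  ... | yes refl = ⊥-elim (pos≢neg eq at-k)
  ... | no m≢k = ⊥-elim (≡pos⇒≢zer eq (*ₛ-zeroʳ′ (ν B) (cong negₛ (entry m m≢k))))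
  negative : ∀ m → ν B *ₛ sg ν B q m ≡ neg → Mem (el B q m) B
  negative zero eq = ⊥-elim (pos≢neg (*ₛ-square _ nz) eq)
  negative (suc m) _ = m , refl

module Residue {c ℓ} (R : CommutativeRing c ℓ) {N r} {E : Subset N} {ν : Chi N (suc r)} (om : OM ν) (ground : Ground E ν)
  (acyclic : Acyclic ν) {a : Subset N} {i : Fin N} (nli : NonLoop ν i) (a≡atom : a ≡ atomOf E ν i)
  {Δ : List (Vec (Fin N) (suc r))} (T : Triang ν Δ) where

  private
    ∈a⇒Par : ∀ {e} → e ∈ a → Par ν i e
    ∈a⇒Par e∈ = proj₂ (∈-atomOf⁻ om ground (subst (_ ∈_) a≡atom e∈))

    Par⇒∈a : ∀ {e} → e ∈ E → Par ν i e → e ∈ a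
    Par⇒∈a e∈ par = subst (_ ∈_) (sym a≡atom) (∈-atomOf om ground e∈ par)

    con-NonLoop⇒∈E : ∀ {e} → NonLoop (con ν i) e → e ∈ E
    con-NonLoop⇒∈E {e} (z , j , nz) = proj₂ (ground e) (i ∷ z , suc j , nz)

  -- The contraction with `i` in the last place, as in the residue; it differs from `con` by the
  -- parity of `r`.
  μ : Chi N r
  μ x = ν (x ∷ʳ i)

  E′ : Subset N
  E′ = E ─ a

  law-μ : ∀ x → μ x ≡ parity r *ₛ con ν i x
  law-μ x = trans (sym (*ₛ-cancel (parity r) (μ x) (parity≢zer r))) (cong (parity r *ₛ_) (sym (alt om (rotate i x))))

  module Re = Rescale {ν = con ν i} {μ} (parity r) (parity≢zer r) law-μ

  om-μ : OM μ
  om-μ = Re.rescale-OM (con-OM om i)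

  μ-NonLoop : ∀ {e} → NonLoop μ e → NonLoop (con ν i) e
  μ-NonLoop = NonLoop-same (SameZeros-sym Re.rescale-SameZeros)

  ground-μ : Ground E′ μ
  ground-μ e = (λ e∈ → NonLoop-same Re.rescale-SameZeros (decidable-stable (NonLoop? (con ν i) e)
      λ par → x∈p─q⇒x∉q E a e∈ (Par⇒∈a (SubP.p─q⊆p E a e∈) par))) ,
    λ nl → SubP.x∈p∧x∉q⇒x∈p─q (con-NonLoop⇒∈E (μ-NonLoop nl)) (λ e∈ → ∈a⇒Par e∈ (μ-NonLoop nl))

  support : ∀ B → ν B ≢ zer → ∀ k → lookup B k ∈ E
  support B nz k = proj₂ (ground _) (Mem⇒NonLoop ν {B} nz (k , refl))

  Parallel : Fin N → Set
  Parallel i' = Par ν i i' × (∀ x → ν (i' ∷ x) ≡ ν (i ∷ x)) × (∀ B → B ∈ₗ Δ → ∀ k → Par ν i (lookup B k) → lookup B k ≡ i')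

  parallel-law : ∀ {B} → B ∈ₗ Δ → ∀ k → Par ν i (lookup B k) → ∀ z j → ν (z [ j ]≔ lookup B k) ≡ ν (z [ j ]≔ i)
  parallel-law {B} B∈ k = Par-pos om (acyclic i nli) (MemP.∈-allFin _) (Mem⇒NonLoop ν {B} (bases T B B∈) (k , refl))

  -- `i` is an arbitrary element of the atom, while the simplices of `Δ` use at most one element of
  -- it. The link is taken at that element, or at `i` when there is none and the link is empty.
  representative : ∃ Parallel
  representative = conclude (scan {P = λ B → ∃ λ k → Par ν i (lookup B k)} {Q = λ B → ∀ k → ¬ Par ν i (lookup B k)} Δ dichotomy)
    where
    dichotomy : ∀ B → B ∈ₗ Δ → (∃ λ k → Par ν i (lookup B k)) ⊎ (∀ k → ¬ Par ν i (lookup B k))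
    dichotomy B _ with any? (λ k → Par? ν i (lookup B k))
    ... | yes p = inj₁ p
    ... | no none = inj₂ λ k par → none (k , par)
    conclude : _ ⊎ _ → ∃ Parallel
    conclude (inj₂ none) = i , Par-refl om i , (λ _ → refl) , λ B B∈ k par → ⊥-elim (none B B∈ k par)
    conclude (inj₁ (B , B∈ , k , par)) = lookup B k , par , (λ x → parallel-law B∈ k par (i ∷ x) zero) ,
      λ B' B'∈ l par' → parallel-used om T B∈ B'∈ (Par-trans om nli (Mem⇒NonLoop ν {B} (bases T B B∈) (k , refl)) par par')
        λ z j → trans (parallel-law B'∈ l par' z j) (sym (parallel-law B∈ k par z j))

  module Represented {i' : Fin N} (i'-par : Parallel i') where

    link-μ : Triang μ (link Δ i')
    link-μ = Rescale.rescale-Triang {ν = con ν i'} {μ} (parity r) (parity≢zer r)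
      (λ x → trans (law-μ x) (cong (parity r *ₛ_) (sym (proj₁ (proj₂ i'-par) x)))) (link-Triang om T i')

    module _ (χ′ : Chi N r) (same′ : SameZeros χ′ μ) where

      open OS R using (OSGroup; mono; consF; term-act; sum-terms; ∷-≈F; ≈F⇒∼; un∼)
      open AbelianGroup (OSGroup E′ χ′) using (_≈_; setoid; ∙-cong; identityʳ)
        renaming (refl to ∼-refl; sym to ∼-symm; trans to ∼-tran; reflexive to ∼-reflexive)
      open GroupSums (OSGroup E′ χ′)

      wd′ : ∀ {n} → Vec (Fin N) n → Word N
      wd′ F = List.map (atomOf E′ χ′) (toList F)

      private
        -- Two elements of the atom of `b` are never independent in the contraction. An independent
        -- pair in the enlarged set therefore consists of `j` and an element of the atom, and the
        -- latter may be replaced by the parallel `b`.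
        span-atom : ∀ {b} → NonLoop ν b → atomSpan E′ χ′ (atomOf E ν b) ≡ atomOf E′ χ′ b
        span-atom {b} nlb = SubP.⊆-antisym
          (λ {j} j∈ → let j∈E , ¬rk = ∈-atomSpan⁻ E′ χ′ _ j∈ in ∈-atomSpan E′ χ′ ⁅ b ⁆ j∈E (¬rk ∘ RankGe-mono χ′ (widen j)))
          (λ {j} j∈ → let j∈E , ¬rk = ∈-atomSpan⁻ E′ χ′ ⁅ b ⁆ j∈ in ∈-atomSpan E′ χ′ _ j∈E (¬rk ∘ narrow j))
          where
          widen : ∀ j → ⁅ b ⁆ ∪ ⁅ j ⁆ ⊆ atomOf E ν b ∪ ⁅ j ⁆
          widen j e∈ with SubP.x∈p∪q⁻ ⁅ b ⁆ ⁅ j ⁆ e∈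
          ... | inj₁ p = SubP.x∈p∪q⁺ (inj₁ (subst (_∈ atomOf E ν b) (sym (SubP.x∈⁅y⁆⇒x≡y b p)) (self-∈-atomOf om ground (proj₂ (ground b) nlb))))
          ... | inj₂ q = SubP.x∈p∪q⁺ (inj₂ q)
          narrow : ∀ j → RankGe χ′ (atomOf E ν b ∪ ⁅ j ⁆) 2 → RankGe χ′ (⁅ b ⁆ ∪ ⁅ j ⁆) 2
          narrow j (I , (x , nz , I⊆) , I⊆X , card) with two-elements I card
          ... | p , q , p≢q , p∈ , q∈ = by (SubP.x∈p∪q⁻ (atomOf E ν b) ⁅ j ⁆ (I⊆X p∈)) (SubP.x∈p∪q⁻ (atomOf E ν b) ⁅ j ⁆ (I⊆X q∈))
            where
            nz′ : con ν i x ≢ zer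
            nz′ = from Re.rescale-SameZeros x (to same′ x nz)
            nonpar : ∀ {p q} → p ≢ q → Mem p x → Mem q x → NonLoop (con ν p) q
            nonpar p≢q (k , eq) (l , eq') = basis⇒NonPar om {x = i ∷ x} nz′ p≢q (suc k , eq) (suc l , eq')
            mp = ∈img⇒Mem x (I⊆ p∈)
            mq = ∈img⇒Mem x (I⊆ q∈)
            replace : ∀ {p} → p ∈ atomOf E ν b → Mem p x → p ≢ j → Mem j x → RankGe χ′ (⁅ b ⁆ ∪ ⁅ j ⁆) 2
            replace {p} p∈b (k , eq) p≢j (l , eq') = img (b ∷ j ∷ []) , (x [ k ]≔ b , from same′ _ (to Re.rescale-SameZeros _ nzb) , sub) , inX ,
                img-card (b ∷ j ∷ []) λ { zero zero _ → refl ; zero (suc zero) h → ⊥-elim (b≢j h)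
                                         ; (suc zero) zero h → ⊥-elim (b≢j (sym h)) ; (suc zero) (suc zero) _ → refl }
              where
              nzb : con ν i (x [ k ]≔ b) ≢ zer
              nzb z = let σ , _ , law = Par-sign om nlb (Mem⇒NonLoop ν {i ∷ x} nz′ (suc k , eq)) (proj₂ (∈-atomOf⁻ om ground p∈b)) in
                nz′ (trans (sym (update-same om (i ∷ x) (suc k) (sym eq))) (trans (law (i ∷ x) (suc k)) (*ₛ-zeroʳ′ σ z)))
              l≢k : l ≢ k
              l≢k refl = p≢j (trans (sym eq) eq')
              b≢j : b ≢ j
              b≢j refl = nzb (repeated⇒zer om (i ∷ (x [ k ]≔ b)) {suc k} {suc l} (l≢k ∘ sym ∘ FinP.suc-injective)
                (trans (VecP.lookup∘update k x b) (sym (trans (VecP.lookup∘update′ l≢k x b) eq'))))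
              sub : img (b ∷ j ∷ []) ⊆ img (x [ k ]≔ b)
              sub = img-pair⊆ (Mem⇒∈img (x [ k ]≔ b) (Mem-update x k))
                (Mem⇒∈img (x [ k ]≔ b) (subst (λ e → Mem e (x [ k ]≔ b)) eq' (Mem-update′ x l≢k)))
              inX : img (b ∷ j ∷ []) ⊆ ⁅ b ⁆ ∪ ⁅ j ⁆
              inX = img-pair⊆ (SubP.x∈p∪q⁺ (inj₁ (SubP.x∈⁅x⁆ b))) (SubP.x∈p∪q⁺ (inj₂ (SubP.x∈⁅x⁆ j)))
            by : p ∈ atomOf E ν b ⊎ p ∈ ⁅ j ⁆ → q ∈ atomOf E ν b ⊎ q ∈ ⁅ j ⁆ → RankGe χ′ (⁅ b ⁆ ∪ ⁅ j ⁆) 2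
            by (inj₁ a₁) (inj₁ a₂) = ⊥-elim (Par-trans om nlb (NonPar⇒NonLoop om (nonpar p≢q mp mq)) (proj₂ (∈-atomOf⁻ om ground a₁))
              (proj₂ (∈-atomOf⁻ om ground a₂)) (nonpar p≢q mp mq))
            by (inj₁ a₁) (inj₂ b₂) with SubP.x∈⁅y⁆⇒x≡y j b₂
            ... | refl = replace a₁ mp p≢q mq
            by (inj₂ b₁) (inj₁ a₂) with SubP.x∈⁅y⁆⇒x≡y j b₁
            ... | refl = replace a₂ mq (p≢q ∘ sym) mp
            by (inj₂ b₁) (inj₂ b₂) = ⊥-elim (p≢q (trans (SubP.x∈⁅y⁆⇒x≡y j b₁) (sym (SubP.x∈⁅y⁆⇒x≡y j b₂))))

        spanned : ∀ {n} (F : Vec (Fin N) n) → (∀ k → NonLoop ν (lookup F k)) →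
          List.map (atomSpan E′ χ′) (List.map (atomOf E ν) (toList F)) ≡ wd′ F
        spanned [] nl = refl
        spanned (b ∷ F) nl = cong₂ _∷_ (span-atom (nl zero)) (spanned F (nl ∘ suc))

        word-at : ∀ b → atomOf E ν b ≡ a → b ∈ E → Par ν i b
        word-at b eq b∈ = ∈a⇒Par (subst (b ∈_) eq (self-∈-atomOf om ground b∈))

        term : Vec (Fin N) r → FS R N
        term F = act (μ F) (mono (wd′ F))

        marked : Vec (Fin N) (suc r) × Fin (suc r) → FS R N
        marked p = if ⌊ At? i' p ⌋ then term (face p) else []

        marked-on : ∀ p → At i' p → marked p ≡ term (face p)
        marked-on p at with At? i' p
        ... | yes _ = refl
        ... | no ¬at = ⊥-elim (¬at at)

        marked-off : ∀ p → ¬ At i' p → marked p ≡ []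
        marked-off p ¬at with At? i' p
        ... | yes at = ⊥-elim (¬at at)
        ... | no _ = refl

        one : Vec (Fin N) (suc r) → FS R N
        one B = Res R E′ χ′ a ((signR R (ν B) , List.map (atomOf E ν) (toList B)) ∷ [])

        atom-i' : atomOf E ν i' ≡ a
        atom-i' = trans (sym (atomOf-cong om ground nli nli' (proj₁ i'-par))) (sym a≡atom)
          where
          nli' : NonLoop ν i'
          nli' = let z , j , nz = nli in Mem⇒NonLoop ν {i' ∷ removeAt (z [ j ]≔ i) j} (λ eq → Perm-basis om (front z j) nz (trans (sym (proj₁ (proj₂ i'-par) _)) eq)) {i'} (zero , refl)
            where
            front : ∀ z j → Perm (parity (toℕ j)) (z [ j ]≔ i) (i ∷ removeAt (z [ j ]≔ i) j)
            front z j = subst (λ e → Perm (parity (toℕ j)) (z [ j ]≔ i) (e ∷ removeAt (z [ j ]≔ i) j)) (VecP.lookup∘update j z i) (bring (z [ j ]≔ i) j)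

        one-term : ∀ B → B ∈ₗ Δ → one B ≈ sumL (λ j → marked (B , j)) (allFin (suc r))
        one-term B B∈ with any? (λ j → lookup B j ≟ i')
        ... | no none = ∼-tran (∼-reflexive (Res-nothing R E′ χ′ a (signR R (ν B)) (List.map (atomOf E ν) (toList B)) (resWord-none R a (List.map (atomOf E ν) (toList B)) (avoid B all-avoid))))
              (∼-symm (sum-ε (allFin (suc r)) λ j _ → ∼-reflexive (marked-off (B , j) λ at → none (j , at))))
          where
          all-avoid : ∀ k → atomOf E ν (lookup B k) ≢ a
          all-avoid k eq = none (k , proj₂ (proj₂ i'-par) B B∈ k (word-at _ eq (support B (bases T B B∈) k)))
          avoid : ∀ {n} (x : Vec (Fin N) n) → (∀ k → atomOf E ν (lookup x k) ≢ a) → All (_≢ a) (List.map (atomOf E ν) (toList x))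
          avoid [] h = []
          avoid (b ∷ x) h = h zero ∷ avoid x (h ∘ suc)
        ... | yes (j , at) = ∼-tran reduced (∼-symm (∼-tran
              (sum-single (λ j → marked (B , j)) (allFin (suc r)) j (UniqueP.allFin⁺ (suc r)) (MemP.∈-allFin j)
                λ k _ k≢j → ∼-reflexive (marked-off (B , k) λ at' → k≢j (inj k j (trans at' (sym at)))))
              (∼-reflexive (marked-on (B , j) at))))
          where
          nzB = bases T B B∈
          inj = nonzero⇒Inj om {B} nzB
          F = removeAt B j
          found = resWord-at R a (atomOf E ν) B j (trans (cong (atomOf E ν) at) atom-i')
            (λ k k≢j eq → k≢j (inj k j (trans (proj₂ (proj₂ i'-par) B B∈ k (word-at _ eq (support B nzB k))) (sym at))))
          s = proj₁ found
          last-law : ν (F ∷ʳ lookup B j) ≡ μ F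
          last-law = begin
            ν (F ∷ʳ lookup B j) ≡⟨ *ₛ-cancel (parity r) _ (parity≢zer r) ⟨
            parity r *ₛ (parity r *ₛ ν (F ∷ʳ lookup B j)) ≡⟨ cong (parity r *ₛ_) (alt om (rotate (lookup B j) F)) ⟨
            parity r *ₛ ν (lookup B j ∷ F) ≡⟨ cong (λ e → parity r *ₛ ν (e ∷ F)) at ⟩
            parity r *ₛ ν (i' ∷ F) ≡⟨ cong (parity r *ₛ_) (proj₁ (proj₂ i'-par) F) ⟩
            parity r *ₛ ν (i ∷ F) ≡⟨ law-μ F ⟨
            μ F ∎
            where open ≡-Reasoning
          sign : s *ₛ ν B ≡ μ F
          sign = trans (cong (s *ₛ_) (alt om (proj₁ (proj₂ found)))) (trans (*ₛ-cancel s _ (Perm-nonzero (proj₁ (proj₂ found)))) last-law)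
          nlF : ∀ k → NonLoop ν (lookup F k)
          nlF k = Mem⇒NonLoop ν {B} nzB (Mem-removeAt⁻ B (k , refl))
          reduced : one B ≈ term F
          reduced = ∼-tran (∼-reflexive (trans (Res-just R E′ χ′ a (signR R (ν B)) (List.map (atomOf E ν) (toList B)) {s} {List.map (atomOf E ν) (toList F)} (proj₂ (proj₂ found)))
              (cong (λ w → (CommutativeRing._*_ R (signR R s) (signR R (ν B)) , w) ∷ []) (spanned F nlF))))
            (∼-tran (≈F⇒∼ E′ χ′ (∷-≈F (wd′ F) [] [] (CommutativeRing.trans R (signR-* R s (ν B)) (CommutativeRing.reflexive R (cong (signR R) sign)))
                λ _ → CommutativeRing.refl R))
              (term-act E′ χ′ (μ F) (wd′ F)))

      Res-form : List (Vec (Fin N) r) → FS R N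
      Res-form L = List.map (λ F → (signR R (μ F) , wd′ F)) L

      -- A simplex contains at most one element of the atom and so contributes at most one term; the
      -- sign of moving that element to the end converts `ν` into `μ`.
      Res-link : Res R E′ χ′ a (form R E ν Δ) ≈ Res-form (link Δ i')
      Res-link = begin
        Res R E′ χ′ a (form R E ν Δ) ≈⟨ ∼-reflexive (spread Δ) ⟩
        sumL one Δ ≈⟨ sum-cong Δ one-term ⟩
        sumL (λ B → sumL (λ j → marked (B , j)) (allFin (suc r))) Δ ≈⟨ sum-product marked Δ (allFin (suc r)) ⟨
        sumL marked (items Δ) ≈⟨ sum-filter (At? i') marked (items Δ) (λ p _ ¬at → ∼-reflexive (marked-off p ¬at)) ⟩
        sumL marked (filter (At? i') (items Δ))
          ≈⟨ sum-cong (filter (At? i') (items Δ)) (λ p p∈ → ∼-reflexive (marked-on p (proj₂ (MemP.∈-filter⁻ (At? i') {xs = items Δ} p∈)))) ⟩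
        sumL (term ∘ face) (filter (At? i') (items Δ)) ≈⟨ sum-map term face (filter (At? i') (items Δ)) ⟨
        sumL term (link Δ i') ≈⟨ sum-terms E′ χ′ μ wd′ (link Δ i') ⟨
        Res-form (link Δ i') ∎
        where
        open import Relation.Binary.Reasoning.Setoid setoid
        spread : ∀ L → Res R E′ χ′ a (form R E ν L) ≡ sumL one L
        spread [] = refl
        spread (B ∷ L) = trans (Res-∷ R E′ χ′ a (signR R (ν B) , List.map (atomOf E ν) (toList B)) (form R E ν L)) (cong (one B ++_) (spread L))

      form-μ : ∀ L → form R E′ μ L ≡ Res-form L
      form-μ L = ListP.map-cong (λ F → cong (λ w → signR R (μ F) , w)
        (ListP.map-cong (λ b → sym (atomSpan-same same′ E′ ⁅ b ⁆)) (toList F))) L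

-- Vanishing off facets and the recursion

rank0-IsTriangulation : {E : Subset N} {ψ : Chi N 0} {Δ : List (Vec (Fin N) 0)} → IsTriangulation E 0 ψ Δ → Δ ≡ [] ∷ []
rank0-IsTriangulation {Δ = Δ} I = rank0-unique Δ
  (AllPairs.map (λ ne eq → ne (cong img eq)) (IsTriangulation.distinct I)) (IsTriangulation-nonempty I)

PosCirc⇒¬PosCoc : {ν : Chi N r} → OM ν → ∀ {w} → PosCirc ν w (allFin N) → ¬ PosCoc ν w (allFin N)
PosCirc⇒¬PosCoc {N} {ν = ν} om (y , x , σ , _ , (k , el≡ , p) , h) (z , j , τ , q , nonneg) =
  nonneg-orthogonal om y x σ z j τ (λ l → bounded (h l)) k p (trans (cong (λ e → τ *ₛ ν (z [ j ]≔ e)) el≡) q)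
  where
  bounded : ∀ {s e} {A : Set} → s ≡ zer ⊎ (s ≡ pos × A) → s ≡ zer ⊎ (s ≡ pos × τ *ₛ ν (z [ j ]≔ e) ≢ neg)
  bounded (inj₁ eq) = inj₁ eq
  bounded (inj₂ (eq , _)) = inj₂ (eq , nonneg _ (MemP.∈-allFin _))

flips-snoc : (P : SignVec N) (x : Vec (Fin N) n) (e : Fin N) → flips P (x ∷ʳ e) ≡ flips P x *ₛ negIf (P e)
flips-snoc P [] e = *ₛ-posʳ (negIf (P e))
flips-snoc P (b ∷ x) e = trans (cong (negIf (P b) *ₛ_) (flips-snoc P x e)) (sym (*ₛ-assoc (negIf (P b)) _ _))

flips-zeroOn : (P : SignVec N) (a : Subset N) (x : Vec (Fin N) n) → (∀ k → lookup x k ∉ a) → flips (zeroOn a P) x ≡ flips P x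
flips-zeroOn P a [] h = refl
flips-zeroOn P a (b ∷ x) h = cong₂ _*ₛ_ (cong negIf (zeroOn-out a P (h zero))) (flips-zeroOn P a x (h ∘ suc))

module _ {c ℓ} (R : CommutativeRing c ℓ) where

  -- All terms of the boundary formula with apex w vanish.
  form-vanishes : ∀ r {E : Subset N} {ν : Chi N r} → OM ν → Ground E ν → ∀ {w} → NonLoop ν w → ¬ PosCoc ν w (allFin N) →
    ∀ {Δ} → Triang ν Δ → OSEq R E ν (form R E ν Δ) []
  form-vanishes zero om ground (_ , () , _)
  form-vanishes (suc r) {E} {ν} om ground {w} nlw none {Δ} T = un∼ (∼-tran (boundary-Om T nlw)
      (sum-ε (filter (Bd? ν) (items Δ)) λ p p∈ → vanish p (MemP.∈-filter⁻ (Bd? ν) {xs = items Δ} p∈)))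
    where
    open Monomials R om ground using (e; e-nonbasis; boundary-Om)
    open OS R using (OSGroup; un∼)
    open AbelianGroup (OSGroup E ν) using (_≈_) renaming (trans to ∼-tran)
    open GroupSums (OSGroup E ν)
    vanish : ∀ ((B , j) : _ × _) → (B , j) ∈ₗ items Δ × Bd ν (B , j) → act (ν B) (e (B [ j ]≔ w)) ≈ []
    vanish (B , j) (p∈ , bd) = ∼-tran (act-cong (ν B) (e-nonbasis nonloops zero-at-w)) (act-ε (ν B))
      where
      nzB : ν B ≢ zer
      nzB = bases T B (∈-items⁻ Δ p∈)
      zero-at-w : ν (B [ j ]≔ w) ≡ zer
      -- Otherwise the nonnegative cocircuit of the boundary facet would be positive at `w`.
      zero-at-w = ¬≢zer⇒≡ λ nz → none (B , j , ν B , ≢zer∧≢neg⇒pos _ (*ₛ-nonzero _ _ nzB nz) (bd w) , λ l _ → bd l)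
      nonloops : ∀ k → NonLoop ν (lookup (B [ j ]≔ w) k)
      nonloops k with Mem-update⁻ B j {w} (k , refl)
      ... | inj₁ eq = subst (NonLoop ν) (sym eq) nlw
      ... | inj₂ (m , _ , eq) = Mem⇒NonLoop ν nzB (m , eq)

  module _ {N r} {E : Subset N} {χ : Chi N (suc r)} (isχ : IsChirotope E (suc r) χ) (loopless : Loopless E χ)
    {P : SignVec N} (tope : IsTope χ P) where

    open Tope isχ loopless tope

    Omega-form : ∀ Δ → Omega R E χ P Δ ≡ form R E ν Δ
    Omega-form Δ = ListP.map-cong (λ B → cong (λ w → signR R (ν B) , w) (ListP.map-cong atomOf-same (toList B))) Δ

    Omega-independent : ∀ Δ Δ' → IsTriangulation E (suc r) ν Δ → IsTriangulation E (suc r) ν Δ' →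
      OSEq R E χ (Omega R E χ P Δ) (Omega R E χ P Δ')
    Omega-independent Δ Δ' I I' = subst (λ f → OSEq R E χ f (Omega R E χ P Δ')) (sym (Omega-form Δ))
      (subst (OSEq R E χ (form R E ν Δ)) (sym (Omega-form Δ')) (InIdeal-same R (SameZeros-sym same)
        (form-independent R (suc r) om ground acyclic (IsTriangulation⇒Triang′ (suc r) om support I) (IsTriangulation⇒Triang′ (suc r) om support I')
          (IsTriangulation-nonempty I) (IsTriangulation-nonempty I'))))

    Omega-residues : Recursion R E (suc r) χ P
    Omega-residues a atomχ Δ I i i∈a = on-facet , off-facet
      where
      open Atom atomχ i∈a
      T : Triang ν Δ
      T = IsTriangulation⇒Triang′ (suc r) om support I
      open Residue R om ground acyclic nli a≡atom T using (μ; E′; law-μ; om-μ; ground-μ; representative; module Re; module Represented)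
      i' : Fin N
      i' = proj₁ representative
      open Represented (proj₂ representative)
      open OS R using (OSGroup; mk∼; un∼; ≡⇒∼)

      Pi : P i ≢ zer
      Pi = P-nonzero i∈E

      -- The link need not be empty here. The obstruction to being a facet is a nonnegative circuit
      -- of the contraction, so one of its elements has no positive cocircuit and can serve as an
      -- apex that sees no boundary facet.
      off-facet : ¬ IsFacet χ P a → OSEq R E′ (contr χ i) (Res R E′ (contr χ i) a (Omega R E χ P Δ)) []
      off-facet ¬facet = un∼ (∼-tran (≡⇒∼ E′ (contr χ i) (cong (Res R E′ (contr χ i) a) (Omega-form Δ)))
          (∼-tran (Res-link (contr χ i) same′) (mk∼ (InIdeal-same R (SameZeros-sym same′)
            (subst (λ f → OSEq R E′ μ f []) (form-μ (contr χ i) same′ (link Δ i')) (form-vanishes r om-μ ground-μ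
              (NonLoop-same Re.rescale-SameZeros nlw) (PosCirc⇒¬PosCoc (con-OM om i) circuit ∘ Back.rescale-PosCoc) link-μ))))))
        where
        open AbelianGroup (OSGroup E′ (contr χ i)) using () renaming (trans to ∼-tran)
        same′ : SameZeros (contr χ i) μ
        same′ = record { to = λ x → to same (x ∷ʳ i) ; from = λ x → from same (x ∷ʳ i) }
        found = not-facet⇒PosCirc ¬facet
        nlw = proj₁ (proj₂ found)
        circuit = proj₂ (proj₂ found)
        module Back = Rescale {ν = μ} {con ν i} (parity r) (parity≢zer r) (λ x → alt om (rotate i x))

      on-facet : IsFacet χ P a → ∀ Δ' → IsTriangulation E′ r (reorient (zeroOn a P) (contrP P χ i)) Δ' →
        OSEq R E′ (contrP P χ i) (Res R E′ (contrP P χ i) a (Omega R E χ P Δ)) (Omega R E′ (contrP P χ i) (zeroOn a P) Δ')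
      on-facet facet Δ' I' = un∼ (∼-tran (≡⇒∼ E′ χ′ (cong (Res R E′ χ′ a) (Omega-form Δ)))
          (∼-tran (Res-link χ′ same′) (∼-tran (mk∼ (InIdeal-same R (SameZeros-sym same′) links-agree)) (≡⇒∼ E′ χ′ (sym Omega-Δ')))))
        where
        χ′ : Chi N r
        χ′ = contrP P χ i
        open AbelianGroup (OSGroup E′ χ′) using () renaming (trans to ∼-tran)
        same′ : SameZeros χ′ μ
        same′ = record { to = λ x nz → to same (x ∷ʳ i) (*ₛ-nonzeroʳ (P i) _ nz) ; from = λ x nz → *ₛ-nonzero (P i) _ Pi (from same (x ∷ʳ i) nz) }
        ψ : Chi N r
        ψ = reorient (zeroOn a P) χ′
        -- A nonzero value forces `x` to avoid the atom, where zeroing changes nothing; the factor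
        -- `P i` of the contracted chirotope is the flip of the last entry `i`.
        agree : ∀ x → ψ x ≡ μ x
        agree x with χ (x ∷ʳ i) ≟ₛ zer
        ... | yes eq = trans (*ₛ-zeroʳ′ (flips (zeroOn a P) x) (*ₛ-zeroʳ′ (P i) eq)) (sym (*ₛ-zeroʳ′ (flips P (x ∷ʳ i)) eq))
        ... | no nz = begin
            flips (zeroOn a P) x *ₛ (P i *ₛ χ (x ∷ʳ i)) ≡⟨ *ₛ-assoc (flips (zeroOn a P) x) (P i) _ ⟨
            (flips (zeroOn a P) x *ₛ P i) *ₛ χ (x ∷ʳ i) ≡⟨ cong₂ (λ s t → (s *ₛ t) *ₛ χ (x ∷ʳ i)) (flips-zeroOn P a x away) (sym (negIf-≡ (P i) Pi)) ⟩
            (flips P x *ₛ negIf (P i)) *ₛ χ (x ∷ʳ i) ≡⟨ cong (_*ₛ χ (x ∷ʳ i)) (flips-snoc P x i) ⟨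
            μ x ∎
          where
          open ≡-Reasoning
          away : ∀ k → lookup x k ∉ a
          away k x∈ = from Re.rescale-SameZeros x (to same (x ∷ʳ i) nz) (Par⇒zer om (∈a⇒Par x∈) (i ∷ x) {suc k} {zero} (λ ()) refl refl)
        support-μ : ∀ x → ψ x ≢ zer → ∀ k → lookup x k ∈ E′
        support-μ x nz k = proj₂ (ground-μ (lookup x k)) (Mem⇒NonLoop μ {x} (nz ∘ trans (agree x)) (k , refl))
        T' : Triang μ Δ'
        T' = Rescale.rescale-Triang {ν = ψ} {μ} pos (λ ()) (λ x → sym (agree x))
          (IsTriangulation⇒Triang′ r (Rescale.rescale-OM {ν = μ} {ψ} pos (λ ()) agree om-μ) support-μ I')
        extreme : Extreme ν i (allFin N)
        extreme = facet⇒Extreme facet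
        -- A facet makes `i` extreme, and every triangulation uses an element parallel to it;
        -- independence can be applied to the link only because of this covering.
        link-nonempty : ∃ λ F → F ∈ₗ link Δ i'
        link-nonempty = let B , B∈ , j , par = Covering.extreme-used om acyclic T (IsTriangulation-nonempty I) i nli extreme in
          removeAt B j , ∈-faces (At? i') Δ B∈ j (proj₂ (proj₂ (proj₂ representative)) B B∈ j par)
        Omega-Δ' : Omega R E′ χ′ (zeroOn a P) Δ' ≡ Res-form χ′ same′ Δ'
        Omega-Δ' = ListP.map-cong (λ F → cong (λ s → signR R s , List.map (atomOf E′ χ′) (toList F)) (agree F)) Δ'
        links-agree : OSEq R E′ μ (Res-form χ′ same′ (link Δ i')) (Res-form χ′ same′ Δ')
        links-agree = subst (λ f → OSEq R E′ μ f (Res-form χ′ same′ Δ')) (form-μ χ′ same′ (link Δ i'))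
          (subst (OSEq R E′ μ (form R E′ μ (link Δ i'))) (form-μ χ′ same′ Δ')
            (form-independent R r om-μ ground-μ (Re.rescale-Acyclic (extreme⇒Acyclic-con {ν = ν} {i} extreme)) link-μ T'
              link-nonempty (IsTriangulation-nonempty I')))

  Omega-independent₀ : {E : Subset N} {χ : Chi N 0} {P : SignVec N} → ∀ {Δ Δ'} → IsTriangulation E 0 (reorient P χ) Δ →
    IsTriangulation E 0 (reorient P χ) Δ' → OSEq R E χ (Omega R E χ P Δ) (Omega R E χ P Δ')
  Omega-independent₀ {E = E} {χ} {P} I I' = OS.un∼ (OS.≡⇒∼ R E χ (cong (Omega R E χ P)
    (trans (rank0-IsTriangulation I) (sym (rank0-IsTriangulation I')))))

  Omega₀ : {E : Subset N} {χ : Chi N 0} {P : SignVec N} → Recursion R E 0 χ P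
  Omega₀ {E = E} {χ} {P} Δ I = OS.un∼ (OS.≡⇒∼ R E χ (cong (Omega R E χ P) (rank0-IsTriangulation I)))

theorem2p11 : ∀ {c ℓ} (R : CommutativeRing c ℓ) {N : ℕ} (E : Subset N) (r : ℕ) (χ : Chi N r)
  → IsChirotope E r χ → Loopless E χ
  → (P : SignVec N) → IsTope χ P
  → (∃ λ Δ → IsTriangulation E r (reorient P χ) Δ)
    × (∀ Δ Δ' → IsTriangulation E r (reorient P χ) Δ → IsTriangulation E r (reorient P χ) Δ'
         → OSEq R E χ (Omega R E χ P Δ) (Omega R E χ P Δ'))
    × Recursion R E r χ P
theorem2p11 R E r χ isχ loopless P tope = triangulated , rest r isχ loopless tope
  where
  triangulated : ∃ λ Δ → IsTriangulation E r (reorient P χ) Δ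
  triangulated = pushing-IsTriangulation r (reorient-OM P (IsChirotope⇒OM isχ))
    (let B , nz = IsChirotope.nonzero isχ in B , to (reorient-SameZeros P χ) B nz)
  rest : ∀ r {χ : Chi _ r} → IsChirotope E r χ → Loopless E χ → IsTope χ P →
    (∀ Δ Δ' → IsTriangulation E r (reorient P χ) Δ → IsTriangulation E r (reorient P χ) Δ'
         → OSEq R E χ (Omega R E χ P Δ) (Omega R E χ P Δ')) × Recursion R E r χ P
  rest zero _ _ _ = (λ Δ Δ' I I' → Omega-independent₀ R I I') , Omega₀ R
  rest (suc r) isχ loopless tope = Omega-independent R isχ loopless tope , Omega-residues R isχ loopless tope
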